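{- The following are equivalent: (1) There exists a strong cardinal. (2) $\Sigma_2$-$\mathrm{PRP}$. (3) $\Pi_1$-$\mathrm{PRP}$. (4) $\Sigma_2$-$\mathrm{SWVP}$. (5) $\Pi_1$-$\mathrm{SWVP}$. (6) $\Sigma_2$-$\mathrm{WVP}$. (7) $\Pi_1$-$\mathrm{WVP}$.
   Context: We work in ZFC; $\Sigma_n,\Pi_n$ refer to the Levy hierarchy, and "class" means definable class. Graphs. A graph is a structure $\langle G,E_G\rangle$ with $G$ a non-empty set and $E_G$ a binary relation on $G$. A homomorphism $h:G\to H$ is a map such that $xE_Gy$ implies $h(x)E_Hh(y)$. For a set $S$ of graphs, $\prod S$ is the structure whose universe is the set of all functions $f$ with domain $S$ such that $f(\mathcal{A})$ belongs to the universe of $\mathcal{A}$ for every $\mathcal{A}\in S$, with the relation defined pointwise. Principles. Let $\Gamma$ be one of $\Sigma_m,\Pi_m$, $m>0$. All definitions below are without parameters. - $\Gamma$-$\mathrm{PRP}$ (Product Reflection Principle): for every $\Gamma$-definable proper class $\mathcal{C}$ of graphs there is a subset $S$ of $\mathcal{C}$ such that for every $G$ in $\mathcal{C}$ there is a homomorphism $\prod S\to G$. - $\Gamma$-$\mathrm{WVP}$ (Weak Vopěnka Principle): there is no $\Gamma$-definable sequence $\langle G_\alpha:\alpha\in\mathrm{OR}\rangle$ of graphs such that for every $\alpha\leq\beta$ there exists exactly one homomorphism $G_\beta\to G_\alpha$, and there is no homomorphism $G_\alpha\to G_\beta$ whenever $\alpha<\beta$. - $\Gamma$-$\mathrm{SWVP}$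 (Semi-Weak Vopěnka Principle): the same as $\Gamma$-$\mathrm{WVP}$, with "exactly one homomorphism $G_\beta\to G_\alpha$" replaced by "at least one homomorphism $G_\beta\to G_\alpha$". A cardinal $\kappa$ is $\lambda$-strong, where $\lambda>\kappa$ is a cardinal, if there is an elementary embedding $j:V\to M$ with $M$ transitive, critical point $\kappa$, and $V_\lambda\subseteq M$; $\kappa$ is strong if it is $\lambda$-strong for every cardinal $\lambda>\kappa$. -}

module Defs where

open import Level using (Level) renaming (suc to lsuc)
open import Data.Nat using (ℕ; zero; suc; NonZero)
open import Data.Fin using (Fin; zero; suc)
open import Data.Vec using (Vec; []; _∷_; lookup)
open import Data.Vec.Relation.Binary.Pointwise.Inductive using (Pointwise)
open import Data.Product using (_×_; ∃; ∃₂; ∃!; ∃-syntax)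
open import Data.Sum using (_⊎_)
open import Data.Empty.Polymorphic using (⊥)
open import Data.Unit.Polymorphic using (⊤)
open import Function.Bundles using (_⇔_)
open import Relation.Binary.Core using (Rel)
open import Relation.Binary.PropositionalEquality using (_≡_; _≢_)
open import Relation.Nullary using (¬_)
open import Relation.Unary using (Pred)

-- First-order formulas of the language {∈, =}, with de Bruijn variables:
-- in the body of a quantifier, variable zero is the bound one.

infix  8 _ˢ∈_ _ˢ≡_
infixr 7 _∧ˢ_
infixr 6 _∨ˢ_
infixr 5 _⇒ˢ_

data Formula (n : ℕ) : Set where
  _ˢ∈_ _ˢ≡_           : Fin n → Fin n → Formula n
  ⊥ˢ                  : Formula n
  _∧ˢ_ _∨ˢ_ _⇒ˢ_      : Formula n → Formula n → Formula n
  ∀ˢ ∃ˢ               : Formula (suc n) → Formula n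

∀∈ˢ ∃∈ˢ : ∀ {n} → Fin n → Formula (suc n) → Formula n
∀∈ˢ y φ = ∀ˢ (zero ˢ∈ suc y ⇒ˢ φ)
∃∈ˢ y φ = ∃ˢ (zero ˢ∈ suc y ∧ˢ φ)

data IsΔ₀ {n : ℕ} : Formula n → Set where
  mem : ∀ {x y} → IsΔ₀ (x ˢ∈ y)
  eq  : ∀ {x y} → IsΔ₀ (x ˢ≡ y)
  bot : IsΔ₀ ⊥ˢ
  and : ∀ {φ ψ} → IsΔ₀ φ → IsΔ₀ ψ → IsΔ₀ (φ ∧ˢ ψ)
  or  : ∀ {φ ψ} → IsΔ₀ φ → IsΔ₀ ψ → IsΔ₀ (φ ∨ˢ ψ)
  imp : ∀ {φ ψ} → IsΔ₀ φ → IsΔ₀ ψ → IsΔ₀ (φ ⇒ˢ ψ)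
  all : ∀ {y φ} → IsΔ₀ φ → IsΔ₀ (∀∈ˢ y φ)
  ex  : ∀ {y φ} → IsΔ₀ φ → IsΔ₀ (∃∈ˢ y φ)

-- A Σₘ₊₁ formula is a (possibly empty) block of existential quantifiers in
-- front of a Πₘ formula, and dually for Πₘ₊₁.
mutual
  data IsΣ {n : ℕ} : ℕ → Formula n → Set where
    Δ₀⇒Σ₀ : ∀ {φ} → IsΔ₀ φ → IsΣ 0 φ
    Π⇒Σ   : ∀ {m φ} → IsΠ m φ → IsΣ (suc m) φ
    ex    : ∀ {m φ} → IsΣ (suc m) φ → IsΣ (suc m) (∃ˢ φ)

  data IsΠ {n : ℕ} : ℕ → Formula n → Set where
    Δ₀⇒Π₀ : ∀ {φ} → IsΔ₀ φ → IsΠ 0 φ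
    Σ⇒Π   : ∀ {m φ} → IsΣ m φ → IsΠ (suc m) φ
    all   : ∀ {m φ} → IsΠ (suc m) φ → IsΠ (suc m) (∀ˢ φ)

data LevyClass : Set where
  𝚺 𝚷 : (m : ℕ) → .{{NonZero m}} → LevyClass

_∈ᴸ_ : ∀ {n} → Formula n → LevyClass → Set
φ ∈ᴸ 𝚺 m = IsΣ m φ
φ ∈ᴸ 𝚷 m = IsΠ m φ

TFAE : ∀ {ℓ n} → Vec (Set ℓ) n → Set ℓ
TFAE Ps = ∀ i j → lookup Ps i → lookup Ps j

module SetTheory {ℓ : Level} (V : Set ℓ) (_∈_ : Rel V ℓ) where

  infix 4 _⊆_ _≐⟨_⨾_⟩ _∋⟨_⨾_⟩ _≼_

  -- Satisfaction in the substructure ⟨M, ∈⟩.  The quantifiers are relativised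
  -- to M, instead of ranging over a Σ-type, so that equality stays equality
  -- in V and does not depend on proofs of membership in M.
  _⊨_[_] : Pred V ℓ → ∀ {n} → Formula n → Vec V n → Set ℓ
  M ⊨ x ˢ∈ y [ ρ ] = lookup ρ x ∈ lookup ρ y
  M ⊨ x ˢ≡ y [ ρ ] = lookup ρ x ≡ lookup ρ y
  M ⊨ ⊥ˢ     [ ρ ] = ⊥
  M ⊨ φ ∧ˢ ψ [ ρ ] = (M ⊨ φ [ ρ ]) × (M ⊨ ψ [ ρ ])
  M ⊨ φ ∨ˢ ψ [ ρ ] = (M ⊨ φ [ ρ ]) ⊎ (M ⊨ ψ [ ρ ])
  M ⊨ φ ⇒ˢ ψ [ ρ ] = M ⊨ φ [ ρ ] → M ⊨ ψ [ ρ ]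
  M ⊨ ∀ˢ φ   [ ρ ] = ∀ x → M x → M ⊨ φ [ x ∷ ρ ]
  M ⊨ ∃ˢ φ   [ ρ ] = ∃[ x ] M x × (M ⊨ φ [ x ∷ ρ ])

  𝕍 : Pred V ℓ
  𝕍 _ = ⊤

  _⊆_ : V → V → Set ℓ
  x ⊆ y = ∀ z → z ∈ x → z ∈ y

  NonEmpty : V → Set ℓ
  NonEmpty x = ∃[ y ] y ∈ x

  IsEmpty : V → Set ℓ
  IsEmpty x = ∀ y → ¬ y ∈ x

  IsSucc : V → V → Set ℓ
  IsSucc s x = ∀ z → z ∈ s ⇔ (z ∈ x ⊎ z ≡ x)

  record IsZFC : Set ℓ where
    field
      extensionality : ∀ x y → (∀ z → z ∈ x ⇔ z ∈ y) → x ≡ y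
      foundation     : ∀ x → NonEmpty x →
                       ∃[ y ] y ∈ x × (∀ z → z ∈ y → ¬ z ∈ x)
      pairing        : ∀ x y → ∃[ p ] ∀ z → z ∈ p ⇔ (z ≡ x ⊎ z ≡ y)
      union          : ∀ x → ∃[ u ] ∀ z → z ∈ u ⇔ (∃[ y ] y ∈ x × z ∈ y)
      powerset       : ∀ x → ∃[ p ] ∀ z → z ∈ p ⇔ z ⊆ x
      infinity       : ∃[ x ] (∃[ e ] IsEmpty e × e ∈ x)
                            × (∀ y → y ∈ x → ∃[ s ] IsSucc s y × s ∈ x)
      separation     : ∀ {n} (φ : Formula (suc n)) (ps : Vec V n) a →
                       ∃[ b ] ∀ x → x ∈ b ⇔ (x ∈ a × (𝕍 ⊨ φ [ x ∷ ps ]))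
      replacement    : ∀ {n} (φ : Formula (suc (suc n))) (ps : Vec V n) a →
                       (∀ x → x ∈ a → ∃! _≡_ λ y → 𝕍 ⊨ φ [ x ∷ y ∷ ps ]) →
                       ∃[ b ] ∀ y → y ∈ b ⇔
                                    (∃[ x ] x ∈ a × (𝕍 ⊨ φ [ x ∷ y ∷ ps ]))
      choice         : ∀ a → (∀ x → x ∈ a → NonEmpty x) →
                       (∀ x y z → x ∈ a → y ∈ a → z ∈ x → z ∈ y → x ≡ y) →
                       ∃[ c ] ∀ x → x ∈ a → ∃! _≡_ λ z → z ∈ x × z ∈ c

  -- p is the Kuratowski pair {{x}, {x, y}}.
  _≐⟨_⨾_⟩ : V → V → V → Set ℓ
  p ≐⟨ x ⨾ y ⟩ = ∃₂ λ a b → (∀ z → z ∈ a ⇔ z ≡ x)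
                          × (∀ z → z ∈ b ⇔ (z ≡ x ⊎ z ≡ y))
                          × (∀ z → z ∈ p ⇔ (z ≡ a ⊎ z ≡ b))

  -- ⟨x, y⟩ ∈ r; when r is a function, this says r(x) = y.
  _∋⟨_⨾_⟩ : V → V → V → Set ℓ
  r ∋⟨ x ⨾ y ⟩ = ∃[ p ] (p ≐⟨ x ⨾ y ⟩) × p ∈ r

  IsFunctionOn : V → V → Set ℓ
  IsFunctionOn f a = (∀ p → p ∈ f → ∃₂ λ x y → x ∈ a × (p ≐⟨ x ⨾ y ⟩))
                   × (∀ x → x ∈ a → ∃! _≡_ λ y → f ∋⟨ x ⨾ y ⟩)

  IsMap : V → V → V → Set ℓ
  IsMap f a b = IsFunctionOn f a × (∀ x y → f ∋⟨ x ⨾ y ⟩ → y ∈ b)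

  IsBijection : V → V → V → Set ℓ
  IsBijection f a b = IsMap f a b × (∀ y → y ∈ b → ∃! _≡_ λ x → f ∋⟨ x ⨾ y ⟩)

  -- A transitive set that is strictly well-ordered by ∈.
  record IsOrdinal (α : V) : Set ℓ where
    field
      transitive : ∀ x → x ∈ α → x ⊆ α
      ∈-irrefl   : ∀ x → x ∈ α → ¬ x ∈ x
      ∈-trans    : ∀ x y z → x ∈ α → y ∈ α → z ∈ α → x ∈ y → y ∈ z → x ∈ z
      ∈-total    : ∀ x y → x ∈ α → y ∈ α → x ∈ y ⊎ x ≡ y ⊎ y ∈ x
      least      : ∀ a → a ⊆ α → NonEmpty a →
                   ∃[ x ] x ∈ a × (∀ y → y ∈ a → x ≡ y ⊎ x ∈ y)

  _≼_ : V → V → Set ℓ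
  α ≼ β = α ∈ β ⊎ α ≡ β

  IsCardinal : V → Set ℓ
  IsCardinal κ = IsOrdinal κ × (∀ α → α ∈ κ → ¬ (∃[ f ] IsBijection f α κ))

  -- x = V_α, where V_β = ⋃_{γ<β} 𝒫(V_γ); f is the sequence ⟨V_β : β ≤ α⟩.
  IsRankInitialSegment : V → V → Set ℓ
  IsRankInitialSegment α x =
    ∃₂ λ f s → IsSucc s α × IsFunctionOn f s × (f ∋⟨ α ⨾ x ⟩)
      × (∀ β v → f ∋⟨ β ⨾ v ⟩ → ∀ z →
           z ∈ v ⇔ (∃₂ λ γ w → γ ∈ β × (f ∋⟨ γ ⨾ w ⟩) × z ⊆ w))

  -- Classes are definable with parameters.
  record Class : Set ℓ where
    field
      {arity}    : ℕ
      formula    : Formula (suc arity)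
      parameters : Vec V arity

  ⟦_⟧ : Class → Pred V ℓ
  ⟦ C ⟧ x = 𝕍 ⊨ Class.formula C [ x ∷ Class.parameters C ]

  class₀ : Formula 1 → Class
  class₀ φ = record { formula = φ ; parameters = [] }

  _∋ᶜ⟨_⨾_⟩ : Class → V → V → Set ℓ
  F ∋ᶜ⟨ x ⨾ y ⟩ = ∃[ p ] (p ≐⟨ x ⨾ y ⟩) × ⟦ F ⟧ p

  IsProper : Class → Set ℓ
  IsProper C = ¬ (∃[ x ] ∀ y → y ∈ x ⇔ ⟦ C ⟧ y)

  IsClassFunctionOn : Class → Pred V ℓ → Set ℓ
  IsClassFunctionOn F A =
      (∀ p → ⟦ F ⟧ p → ∃₂ λ x y → A x × (p ≐⟨ x ⨾ y ⟩))
    × (∀ x → A x → ∃! _≡_ λ y → F ∋ᶜ⟨ x ⨾ y ⟩)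

  IsGraph : V → Set ℓ
  IsGraph A = ∃₂ λ G E → (A ≐⟨ G ⨾ E ⟩) × NonEmpty G
    × (∀ p → p ∈ E → ∃₂ λ x y → x ∈ G × y ∈ G × (p ≐⟨ x ⨾ y ⟩))

  IsHom : V → V → V → Set ℓ
  IsHom h A B = ∃₂ λ G E → ∃₂ λ H F → (A ≐⟨ G ⨾ E ⟩) × (B ≐⟨ H ⨾ F ⟩)
    × IsMap h G H
    × (∀ x y x′ y′ → E ∋⟨ x ⨾ y ⟩ → h ∋⟨ x ⨾ x′ ⟩ → h ∋⟨ y ⨾ y′ ⟩ →
         F ∋⟨ x′ ⨾ y′ ⟩)

  IsProduct : V → V → Set ℓ
  IsProduct P S = ∃₂ λ U R → (P ≐⟨ U ⨾ R ⟩)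
    × (∀ f → f ∈ U ⇔
         (IsFunctionOn f S
          × (∀ A G E x → A ∈ S → A ≐⟨ G ⨾ E ⟩ → f ∋⟨ A ⨾ x ⟩ → x ∈ G)))
    × (∀ p → p ∈ R ⇔
         (∃₂ λ f g → (p ≐⟨ f ⨾ g ⟩) × f ∈ U × g ∈ U
          × (∀ A G E x y → A ∈ S → A ≐⟨ G ⨾ E ⟩ →
               f ∋⟨ A ⨾ x ⟩ → g ∋⟨ A ⨾ y ⟩ → E ∋⟨ x ⨾ y ⟩)))

  PRP : LevyClass → Set ℓ
  PRP Γ = (φ : Formula 1) → φ ∈ᴸ Γ → let C = class₀ φ in
    IsProper C → (∀ G → ⟦ C ⟧ G → IsGraph G) →
    ∃[ S ] (∀ A → A ∈ S → ⟦ C ⟧ A)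
         × (∃[ P ] IsProduct P S × (∀ G → ⟦ C ⟧ G → ∃[ h ] IsHom h P G))

  IsGraphSequence : Class → Set ℓ
  IsGraphSequence F =
    IsClassFunctionOn F IsOrdinal × (∀ α G → F ∋ᶜ⟨ α ⨾ G ⟩ → IsGraph G)

  WVP : LevyClass → Set ℓ
  WVP Γ = ¬ (∃[ φ ] φ ∈ᴸ Γ × let F = class₀ φ in
      IsGraphSequence F
    × (∀ α β A B → F ∋ᶜ⟨ α ⨾ A ⟩ → F ∋ᶜ⟨ β ⨾ B ⟩ → α ≼ β →
         ∃! _≡_ λ h → IsHom h B A)
    × (∀ α β A B → F ∋ᶜ⟨ α ⨾ A ⟩ → F ∋ᶜ⟨ β ⨾ B ⟩ → α ∈ β →
         ¬ (∃[ h ] IsHom h A B)))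

  SWVP : LevyClass → Set ℓ
  SWVP Γ = ¬ (∃[ φ ] φ ∈ᴸ Γ × let F = class₀ φ in
      IsGraphSequence F
    × (∀ α β A B → F ∋ᶜ⟨ α ⨾ A ⟩ → F ∋ᶜ⟨ β ⨾ B ⟩ → α ≼ β →
         ∃[ h ] IsHom h B A)
    × (∀ α β A B → F ∋ᶜ⟨ α ⨾ A ⟩ → F ∋ᶜ⟨ β ⨾ B ⟩ → α ∈ β →
         ¬ (∃[ h ] IsHom h A B)))

  record IsElementaryEmbedding (j M : Class) : Set ℓ where
    field
      function   : IsClassFunctionOn j 𝕍
      into       : ∀ x y → j ∋ᶜ⟨ x ⨾ y ⟩ → ⟦ M ⟧ y
      elementary : ∀ {n} (φ : Formula n) (xs ys : Vec V n) →
                   Pointwise (λ x y → j ∋ᶜ⟨ x ⨾ y ⟩) xs ys →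
                   (𝕍 ⊨ φ [ xs ]) ⇔ (⟦ M ⟧ ⊨ φ [ ys ])

  IsTransitiveClass : Class → Set ℓ
  IsTransitiveClass M = ∀ x y → ⟦ M ⟧ y → x ∈ y → ⟦ M ⟧ x

  IsCriticalPoint : V → Class → Set ℓ
  IsCriticalPoint κ j = IsOrdinal κ × (∀ α → α ∈ κ → j ∋ᶜ⟨ α ⨾ α ⟩)
                                    × ¬ (j ∋ᶜ⟨ κ ⨾ κ ⟩)

  IsStrongUpTo : V → V → Set ℓ
  IsStrongUpTo μ κ = ∃₂ λ j M →
      IsElementaryEmbedding j M × IsTransitiveClass M × IsCriticalPoint κ j
    × (∃[ v ] IsRankInitialSegment μ v × (∀ x → x ∈ v → ⟦ M ⟧ x))

  IsStrong : V → Set ℓ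
  IsStrong κ = IsCardinal κ × (∀ μ → IsCardinal μ → κ ∈ μ → IsStrongUpTo μ κ)

  ExistsStrong : Set ℓ
  ExistsStrong = ∃[ κ ] IsStrong κ

module Submission where

-- A strong cardinal reflects homomorphisms: if a graph P maps to every member of rank below κ of a
-- Σ₂ class, take the least level containing a member to which P does not map and apply j : V → M
-- with a large V_μ ⊆ M.  Composing with j ↾ P shows that j fixes this level although it lies above
-- κ, contradicting Kunen's theorem.  Products, or members of a descending sequence, serve as P.
--
-- Conversely, let W = V_λ with λ > ω a limit.  The graph Γ W consists of copies of 𝒫 W joined so
-- that a homomorphism Γ W → Γ W′ is a map h : 𝒫 W → 𝒫 W′ commuting with complementation and with
-- the modalities of some local relations, and preserving well-foundedness.  Then {X | a ∈ h X} is an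
-- ultrafilter for each a ∈ W′, and these cohere to an extender.  A non-identity endomorphism of
-- Γ W yields a transitive ultrapower M ⊇ W, and its embedding has a critical point in W.  If no
-- cardinal is strong, it follows that there are unboundedly many rigid W.  For rigid W ∈ W′ the
-- restriction X ↦ X ∩ W is the only homomorphism Γ W′ → Γ W, and there is none in the other
-- direction, so the graphs of rigid universes refute the product reflection principle and, listed
-- in increasing order, the weak Vopěnka principle.  Apart from one quantifier over all subsets and
-- all endomorphisms, the description of such a graph is absolute, hence the class and the sequence
-- are Π₁.

open import Defs
open import Data.Nat using (nonZero)
open import Data.Vec using ([]; _∷_)
open import Level using (Level) renaming (suc to lsuc)
open import Data.Nat using (ℕ; zero; suc; _+_; pred; _<_; s≤s; z≤n)
open import Data.Nat.Properties using (m≤n⇒m<n∨m≡n)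
open import Data.Fin using (Fin; zero; suc; _↑ˡ_; toℕ)
open import Data.Fin.Properties using (toℕ-injective; toℕ<n)
open import Data.Vec using (Vec; lookup)
open import Data.Product using (Σ; _×_; ∃₂; ∃!; ∃-syntax; _,_; proj₁; proj₂)
open import Data.Sum using (_⊎_; inj₁; inj₂)
open import Data.Empty using (⊥-elim) renaming (⊥ to ⊥₀)
open import Data.Empty.Polymorphic using (⊥)
open import Data.Unit.Polymorphic using (⊤; tt)
open import Function.Base using (id)
open import Function.Bundles using (_⇔_; mk⇔; Equivalence)
open import Relation.Binary.PropositionalEquality using (_≡_; _≢_; refl; sym; trans; cong; cong₂; subst; subst₂)
open import Relation.Nullary using (¬_)
open import Relation.Unary using (Pred)
import Data.Vec.Relation.Binary.Pointwise.Inductive as PW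

-- The ambient logic is constructive and the axiom schemes speak of first-order formulas, so
-- separation, replacement and even excluded middle are available for definable notions alone. Hence
-- every predicate and operation carries a defining formula. The same bookkeeping in the mode `abs`
-- yields absoluteness, which serves to move statements along j, to evaluate them in M, and to bring
-- the final definitions into Π₁ form. Embeddings and inner models are classes, over which no
-- formula can quantify. For this reason an extender is handled through the set h alone: `Crit`
-- speaks of principal ultrafilters only, so that "κ is critical for unboundedly many W" is one
-- decidable sentence about sets. Afterwards j and M are written down as formulas with the
-- parameters W and h. Since V_α is not absolute, ranks are carried along j as explicit ranking
-- functions on transitive sets.

module ZFC {ℓ : Level} (V : Set ℓ) (_∈_ : V → V → Set ℓ) (zfc : SetTheory.IsZFC V _∈_) where
  open SetTheory V _∈_ public
  open IsZFC zfc public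

  -- First-order definability, absoluteness and excluded middle.

  module Logic where
    to : ∀ {a b} {A : Set a} {B : Set b} → A ⇔ B → A → B
    to e = Equivalence.to e
    from : ∀ {a b} {A : Set a} {B : Set b} → A ⇔ B → B → A
    from e = Equivalence.from e

    infixr 20 _∙⇔_
    _∙⇔_ : ∀ {a b c} {A : Set a} {B : Set b} {C : Set c} → A ⇔ B → B ⇔ C → A ⇔ C
    e ∙⇔ f = mk⇔ (λ x → to f (to e x)) (λ x → from e (from f x))
    sym⇔ : ∀ {a b} {A : Set a} {B : Set b} → A ⇔ B → B ⇔ A
    sym⇔ e = mk⇔ (from e) (to e)
    id⇔ : ∀ {a} {A : Set a} → A ⇔ A
    id⇔ = mk⇔ id id
    ×⇔ : ∀ {a b c d} {A : Set a} {B : Set b} {C : Set c} {D : Set d} → A ⇔ C → B ⇔ D → (A × B) ⇔ (C × D)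
    ×⇔ e f = mk⇔ (λ (x , y) → to e x , to f y) (λ (x , y) → from e x , from f y)
    ⊎⇔ : ∀ {a b c d} {A : Set a} {B : Set b} {C : Set c} {D : Set d} → A ⇔ C → B ⇔ D → (A ⊎ B) ⇔ (C ⊎ D)
    ⊎⇔ e f = mk⇔ (λ { (inj₁ x) → inj₁ (to e x) ; (inj₂ y) → inj₂ (to f y) })
                  (λ { (inj₁ x) → inj₁ (from e x) ; (inj₂ y) → inj₂ (from f y) })
    →⇔ : ∀ {a b c d} {A : Set a} {B : Set b} {C : Set c} {D : Set d} → A ⇔ C → B ⇔ D → (A → B) ⇔ (C → D)
    →⇔ e f = mk⇔ (λ g x → to f (g (from e x))) (λ g x → from f (g (to e x)))
    Π⇔ : ∀ {a b c} {A : Set a} {B : A → Set b} {C : A → Set c} → (∀ x → B x ⇔ C x) → (∀ x → B x) ⇔ (∀ x → C x)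
    Π⇔ e = mk⇔ (λ g x → to (e x) (g x)) (λ g x → from (e x) (g x))
    Σ⇔ : ∀ {a b c} {A : Set a} {B : A → Set b} {C : A → Set c} → (∀ x → B x ⇔ C x) → Σ A B ⇔ Σ A C
    Σ⇔ e = mk⇔ (λ (x , b) → x , to (e x) b) (λ (x , b) → x , from (e x) b)

    ren : ∀ {m n} → (Fin m → Fin n) → Formula m → Formula n
    lift : ∀ {m n} → (Fin m → Fin n) → Fin (suc m) → Fin (suc n)
    lift r zero = zero
    lift r (suc i) = suc (r i)
    ren r (x ˢ∈ y) = r x ˢ∈ r y
    ren r (x ˢ≡ y) = r x ˢ≡ r y
    ren r ⊥ˢ = ⊥ˢ
    ren r (φ ∧ˢ ψ) = ren r φ ∧ˢ ren r ψ
    ren r (φ ∨ˢ ψ) = ren r φ ∨ˢ ren r ψ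
    ren r (φ ⇒ˢ ψ) = ren r φ ⇒ˢ ren r ψ
    ren r (∀ˢ φ) = ∀ˢ (ren (lift r) φ)
    ren r (∃ˢ φ) = ∃ˢ (ren (lift r) φ)

    ren-⊨ : ∀ M {m n} (r : Fin m → Fin n) φ (ρ : Vec V m) (σ : Vec V n) →
            (∀ i → lookup ρ i ≡ lookup σ (r i)) → (M ⊨ φ [ ρ ]) ⇔ (M ⊨ ren r φ [ σ ])
    ren-⊨-lift : ∀ {m n} (r : Fin m → Fin n) (ρ : Vec V m) (σ : Vec V n) →
                 (∀ i → lookup ρ i ≡ lookup σ (r i)) → ∀ x i → lookup (x ∷ ρ) i ≡ lookup (x ∷ σ) (lift r i)
    ren-⊨-lift r ρ σ e x zero = refl
    ren-⊨-lift r ρ σ e x (suc i) = e i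
    ren-⊨ M r (x ˢ∈ y) ρ σ e rewrite e x | e y = id⇔
    ren-⊨ M r (x ˢ≡ y) ρ σ e rewrite e x | e y = id⇔
    ren-⊨ M r ⊥ˢ ρ σ e = id⇔
    ren-⊨ M r (φ ∧ˢ ψ) ρ σ e = ×⇔ (ren-⊨ M r φ ρ σ e) (ren-⊨ M r ψ ρ σ e)
    ren-⊨ M r (φ ∨ˢ ψ) ρ σ e = ⊎⇔ (ren-⊨ M r φ ρ σ e) (ren-⊨ M r ψ ρ σ e)
    ren-⊨ M r (φ ⇒ˢ ψ) ρ σ e = →⇔ (ren-⊨ M r φ ρ σ e) (ren-⊨ M r ψ ρ σ e)
    ren-⊨ M r (∀ˢ φ) ρ σ e =
      Π⇔ λ x → Π⇔ λ _ → ren-⊨ M (lift r) φ (x ∷ ρ) (x ∷ σ) (ren-⊨-lift r ρ σ e x)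
    ren-⊨ M r (∃ˢ φ) ρ σ e =
      Σ⇔ λ x → ×⇔ id⇔ (ren-⊨ M (lift r) φ (x ∷ ρ) (x ∷ σ) (ren-⊨-lift r ρ σ e x))

    opaque
      infix 26 _,,_
      -- The axioms are stated with Σ-types, so their witnesses serve directly as operations.
      _,,_ : V → V → V
      x ,, y = proj₁ (pairing x y)
      ∈,, : ∀ {x y z} → z ∈ (x ,, y) ⇔ (z ≡ x ⊎ z ≡ y)
      ∈,, {x} {y} {z} = proj₂ (pairing x y) z
      ⋃ : V → V
      ⋃ x = proj₁ (union x)
      ∈⋃ : ∀ {x z} → z ∈ ⋃ x ⇔ (∃[ y ] (y ∈ x × z ∈ y))
      ∈⋃ {x} {z} = proj₂ (union x) z
      ∅ : V
      ∅ = proj₁ (proj₁ (proj₂ infinity))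
      ∉∅ : ∀ {x} → ¬ x ∈ ∅
      ∉∅ {x} = proj₁ (proj₂ (proj₁ (proj₂ infinity))) x
      𝒫 : V → V
      𝒫 x = proj₁ (powerset x)
      ∈𝒫 : ∀ {x z} → z ∈ 𝒫 x ⇔ z ⊆ x
      ∈𝒫 {x} {z} = proj₂ (powerset x) z

    ext : ∀ {x y} → (∀ z → z ∈ x → z ∈ y) → (∀ z → z ∈ y → z ∈ x) → x ≡ y
    ext p q = extensionality _ _ λ z → mk⇔ (p z) (q z)

    -- The mode 'full' only asks for a definition over 𝕍; 'abs' asks that one formula defines the
    -- predicate over every good class (absoluteness).

    infixl 5 _▹_
    record ε : Set ℓ where
      constructor ∙
    record Snoc (A B : Set ℓ) : Set ℓ where
      constructor _▹_
      field
        init : A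
        last : B
    open Snoc public

    -- Environments are nested records growing at the right, so that a pattern such as `∙ ▹ W ▹ h`
    -- always matches and a predicate on environments can be written as a function of named
    -- variables.
    Env : ℕ → Set ℓ
    Env zero = ε
    Env (suc n) = Snoc (Env n) V

    vec : ∀ {n} → Env n → Vec V n
    vec {zero} _ = []
    vec {suc n} (γ ▹ x) = x ∷ vec γ

    env : ∀ {n} → Vec V n → Env n
    env [] = ∙
    env (x ∷ ρ) = env ρ ▹ x

    vec-env : ∀ {n} (ρ : Vec V n) → vec (env ρ) ≡ ρ
    vec-env [] = refl
    vec-env (x ∷ ρ) = cong (x ∷_) (vec-env ρ)

    In : Pred V ℓ → ∀ {n} → Env n → Set ℓ
    In M {zero} _ = ⊤
    In M {suc n} (γ ▹ x) = In M γ × M x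

    -- Transitivity and these closures suffice for ordered pairs, coordinates, values of functions
    -- and successors to mean the same inside M. Limit levels V_λ and the target of an elementary
    -- embedding both qualify.
    record Good (M : Pred V ℓ) : Set ℓ where
      field
        tr : ∀ {x y} → x ∈ y → M y → M x
        cl-,, : ∀ {x y} → M x → M y → M (x ,, y)
        cl-⋃ : ∀ {x} → M x → M (⋃ x)
        cl-∅ : M ∅
    open Good public

    data Mode : Set where full abs : Mode

    OK : Mode → Pred V ℓ → Set ℓ
    OK full M = ∀ x → M x
    OK abs M = Good M

    OK⇒Good : ∀ {m M} → OK m M → Good M
    OK⇒Good {full} a = record { tr = λ _ _ → a _ ; cl-,, = λ _ _ → a _ ; cl-⋃ = λ _ → a _ ; cl-∅ = a _ }
    OK⇒Good {abs} g = g

    record Def (m : Mode) {n : ℕ} (P : Env n → Set ℓ) : Set (lsuc ℓ) where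
      no-eta-equality
      field
        form : Formula n
        ok : ∀ M → OK m M → ∀ γ → In M γ → P γ ⇔ (M ⊨ form [ vec γ ])
    open Def public

    record DefT (m : Mode) {n : ℕ} (t : Env n → V) : Set (lsuc ℓ) where
      no-eta-equality
      field
        graph : Def m {suc n} (λ γ → last γ ≡ t (init γ))
        closed : ∀ M → OK m M → ∀ γ → In M γ → M (t γ)
    open DefT public

    inV : ∀ {n} (γ : Env n) → In 𝕍 γ
    inV {zero} γ = tt
    inV {suc n} γ = inV (init γ) , tt

    allV : OK full 𝕍
    allV _ = tt

    module _ {n} (P : Env n → Set ℓ) ⦃ d : Def full P ⦄ (γ : Env n) where
      ok𝕍 : P γ ⇔ (𝕍 ⊨ form d [ vec γ ])
      ok𝕍 = ok d 𝕍 allV γ (inV γ)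

    wkD : ∀ {m n} {P : Env n → Set ℓ} → Def m P → Def m {suc n} (λ γ → P (init γ))
    wkD d = record { form = ren suc (form d)
      ; ok = λ M o γ i → ok d M o (init γ) (proj₁ i) ∙⇔ ren-⊨ M suc (form d) _ _ (λ _ → refl) }

    iso : ∀ {m n} {P Q : Env n → Set ℓ} → (∀ γ → P γ ⇔ Q γ) → Def m P → Def m Q
    iso e d = record { form = form d ; ok = λ M o γ i → sym⇔ (e γ) ∙⇔ ok d M o γ i }

    any : ∀ {m n} {P : Env n → Set ℓ} → Def abs P → Def m P
    any d = record { form = form d ; ok = λ M o γ i → ok d M (OK⇒Good o) γ i }

    anyT : ∀ {m n} {t : Env n → V} → DefT abs t → DefT m t
    anyT d = record { graph = any (graph d) ; closed = λ M o γ i → closed d M (OK⇒Good o) γ i }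

    private
      swap01 : ∀ {n} → Fin (suc n) → Fin (suc (suc n))
      swap01 zero = zero
      swap01 (suc i) = suc (suc i)

    wkT : ∀ {m n} {t : Env n → V} → DefT m t → DefT m {suc n} (λ γ → t (init γ))
    wkT {n = n} d = record
      { graph = record { form = ren swap01 (form (graph d))
          ; ok = λ M o γ i → ok (graph d) M o (init (init γ) ▹ last γ) (proj₁ (proj₁ i) , proj₂ i)
                   ∙⇔ ren-⊨ M swap01 (form (graph d)) _ _ λ { zero → refl ; (suc _) → refl } }
      ; closed = λ M o γ i → closed d M o (init γ) (proj₁ i) }

    -- A term is substituted by saying that some y equals its value and satisfies P. The field
    -- `closed` places this y in M.
    inst : ∀ {m n} {P : Env n → V → Set ℓ} {t : Env n → V} →
           Def m {suc n} (λ γ → P (init γ) (last γ)) → DefT m t → Def m (λ γ → P γ (t γ))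
    inst {P = P} {t} d s = record
      { form = ∃ˢ (form (graph s) ∧ˢ form d)
      ; ok = λ M o γ i → mk⇔
          (λ p → t γ , closed s M o γ i , to (ok (graph s) M o (γ ▹ t γ) (i , closed s M o γ i)) refl
                , to (ok d M o (γ ▹ t γ) (i , closed s M o γ i)) p)
          (λ (x , mx , g , p) → subst (P γ) (from (ok (graph s) M o (γ ▹ x) (i , mx)) g)
                (from (ok d M o (γ ▹ x) (i , mx)) p)) }

    top : ∀ k {n} → Env (k + n) → Env k
    top zero _ = ∙
    top (suc k) (γ ▹ x) = top k γ ▹ x

    private
      vec-top : ∀ k {n} (γ : Env (k + n)) i → lookup (vec (top k γ)) i ≡ lookup (vec γ) (i ↑ˡ n)
      vec-top (suc k) γ zero = refl
      vec-top (suc k) γ (suc i) = vec-top k (init γ) i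
      In-top : ∀ {M} k {n} (γ : Env (k + n)) → In M γ → In M (top k γ)
      In-top zero γ i = tt
      In-top (suc k) γ (i , x) = In-top k (init γ) i , x

    topD : ∀ {m} k {n} {Q : Env k → Set ℓ} → Def m Q → Def m {k + n} (λ γ → Q (top k γ))
    topD k {n} d = record { form = ren (_↑ˡ n) (form d)
      ; ok = λ M o γ i → ok d M o (top k γ) (In-top k γ i)
               ∙⇔ ren-⊨ M (_↑ˡ n) (form d) _ _ (vec-top k γ) }

    module _ {m : Mode} {n : ℕ} where
      sub1 : {s : Env n → V} (Q : Env 1 → Set ℓ) → Def m Q → DefT m s → Def m (λ γ → Q (∙ ▹ s γ))
      sub1 {s} Q d a = inst {P = λ γ x → Q (∙ ▹ x)} (topD 1 d) a
      sub2 : {s t : Env n → V} (Q : Env 2 → Set ℓ) → Def m Q → DefT m s → DefT m t → Def m (λ γ → Q (∙ ▹ s γ ▹ t γ))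
      sub2 {s} {t} Q d a b = inst {P = λ γ x → Q (∙ ▹ x ▹ t γ)} (inst {P = λ γ y → Q (∙ ▹ last γ ▹ y)} (topD 2 d) (wkT b)) a
      sub3 : {s t u : Env n → V} (Q : Env 3 → Set ℓ) → Def m Q → DefT m s → DefT m t → DefT m u → Def m (λ γ → Q (∙ ▹ s γ ▹ t γ ▹ u γ))
      sub3 {s} {t} {u} Q d a b c = inst {P = λ γ x → Q (∙ ▹ x ▹ t γ ▹ u γ)}
        (inst {P = λ γ y → Q (∙ ▹ last γ ▹ y ▹ u (init γ))}
          (inst {P = λ γ z → Q (∙ ▹ last (init γ) ▹ last γ ▹ z)} (topD 3 d) (wkT (wkT c))) (wkT b)) a
      sub4 : {s t u w : Env n → V} (Q : Env 4 → Set ℓ) → Def m Q → DefT m s → DefT m t → DefT m u → DefT m w →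
             Def m (λ γ → Q (∙ ▹ s γ ▹ t γ ▹ u γ ▹ w γ))
      sub4 {s} {t} {u} {w} Q d a b c e = inst {P = λ γ x → Q (∙ ▹ x ▹ t γ ▹ u γ ▹ w γ)}
        (inst {P = λ γ y → Q (∙ ▹ last γ ▹ y ▹ u (init γ) ▹ w (init γ))}
          (inst {P = λ γ z → Q (∙ ▹ last (init γ) ▹ last γ ▹ z ▹ w (init (init γ)))}
            (inst {P = λ γ z → Q (∙ ▹ last (init (init γ)) ▹ last (init γ) ▹ last γ ▹ z)}
              (topD 4 d) (wkT (wkT (wkT e)))) (wkT (wkT c))) (wkT b)) a

    module _ {m : Mode} {n : ℕ} where
      subT1 : {s : Env n → V} (f : V → V) → DefT m {1} (λ γ → f (last γ)) → DefT m s → DefT m (λ γ → f (s γ))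
      subT1 {s} f d a = record
        { graph = sub2 (λ γ → last γ ≡ f (last (init γ))) (graph d) (wkT a) var₀
        ; closed = λ M o γ i → closed d M o (∙ ▹ s γ) (tt , closed a M o γ i) }
        where
        var₀ : DefT m {suc n} (λ γ → last γ)
        var₀ = record { graph = record { form = zero ˢ≡ suc zero ; ok = λ M o γ i → id⇔ } ; closed = λ M o γ i → proj₂ i }
      subT2 : {s t : Env n → V} (f : V → V → V) → DefT m {2} (λ γ → f (last (init γ)) (last γ)) → DefT m s → DefT m t → DefT m (λ γ → f (s γ) (t γ))
      subT2 {s} {t} f d a b = record
        { graph = sub3 (λ γ → last γ ≡ f (last (init (init γ))) (last (init γ))) (graph d) (wkT a) (wkT b) var₀
        ; closed = λ M o γ i → closed d M o (∙ ▹ s γ ▹ t γ) ((tt , closed a M o γ i) , closed b M o γ i) }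
        where
        var₀ : DefT m {suc n} (λ γ → last γ)
        var₀ = record { graph = record { form = zero ˢ≡ suc zero ; ok = λ M o γ i → id⇔ } ; closed = λ M o γ i → proj₂ i }
      subT3 : {s t u : Env n → V} (f : V → V → V → V) → DefT m {3} (λ γ → f (last (init (init γ))) (last (init γ)) (last γ)) →
              DefT m s → DefT m t → DefT m u → DefT m (λ γ → f (s γ) (t γ) (u γ))
      subT3 {s} {t} {u} f d a b c = record
        { graph = sub4 (λ γ → last γ ≡ f (last (init (init (init γ)))) (last (init (init γ))) (last (init γ))) (graph d)
                    (wkT a) (wkT b) (wkT c) var₀
        ; closed = λ M o γ i → closed d M o (∙ ▹ s γ ▹ t γ ▹ u γ)
                     (((tt , closed a M o γ i) , closed b M o γ i) , closed c M o γ i) }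
        where
        var₀ : DefT m {suc n} (λ γ → last γ)
        var₀ = record { graph = record { form = zero ˢ≡ suc zero ; ok = λ M o γ i → id⇔ } ; closed = λ M o γ i → proj₂ i }

    infixl 5 _⧺_
    _⧺_ : ∀ {k n} → Env k → Env n → Env (k + n)
    _⧺_ {zero} _ γ = γ
    _⧺_ {suc k} (δ ▹ x) γ = (δ ⧺ γ) ▹ x

    low : ∀ k {n} → Env (k + n) → Env n
    low zero γ = γ
    low (suc k) γ = low k (init γ)

    low-⧺ : ∀ k {n} (δ : Env k) (γ : Env n) → low k (δ ⧺ γ) ≡ γ
    low-⧺ zero δ γ = refl
    low-⧺ (suc k) δ γ = low-⧺ k (init δ) γ

    top-⧺ : ∀ k {n} (δ : Env k) (γ : Env n) → top k (δ ⧺ γ) ≡ δ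
    top-⧺ zero δ γ = refl
    top-⧺ (suc k) δ γ = cong (_▹ last δ) (top-⧺ k (init δ) γ)

    wkT* : ∀ {m} k {n} {t : Env n → V} → DefT m t → DefT m {k + n} (λ γ → t (low k γ))
    wkT* zero d = d
    wkT* (suc k) d = wkT (wkT* k d)

    data Ts (m : Mode) (n : ℕ) : (k : ℕ) → (Env n → Env k) → Set (lsuc ℓ) where
      [] : Ts m n 0 (λ _ → ∙)
      _▸_ : ∀ {k f} {t : Env n → V} → Ts m n k f → DefT m t → Ts m n (suc k) (λ γ → f γ ▹ t γ)
    infixl 5 _▸_

    wkTs : ∀ {m n k} {f : Env n → Env k} → Ts m n k f → Ts m (suc n) k (λ γ → f (init γ))
    wkTs [] = []
    wkTs (ts ▸ a) = wkTs ts ▸ wkT a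

    -- The last variable is instantiated first, while the environment still contains the k others;
    -- hence its term is evaluated below them, through `low k`.
    elimTs : ∀ {m n k f} → Ts m n k f → {R : Env (k + n) → Set ℓ} → Def m R → Def m (λ γ → R (f γ ⧺ γ))
    elimTs [] d = d
    elimTs {k = suc k} {f} (_▸_ {f = g} {t = t} ts a) {R} d =
      iso (λ γ → substIff (cong (λ δ → R ((g γ ⧺ γ) ▹ t δ)) (low-⧺ k (g γ) γ)))
          (elimTs ts {R = λ δ → R (δ ▹ t (low k δ))} (inst {P = λ δ x → R (δ ▹ x)} d (wkT* k a)))
      where
      substIff : ∀ {A B : Set ℓ} → A ≡ B → A ⇔ B
      substIff refl = id⇔

    subs : ∀ {m n k f} (Q : Env k → Set ℓ) → Def m Q → Ts m n k f → Def m (λ γ → Q (f γ))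
    subs {k = k} {f} Q d ts = iso (λ γ → substIff (cong Q (top-⧺ k (f γ) γ))) (elimTs ts (topD k d))
      where
      substIff : ∀ {A B : Set ℓ} → A ≡ B → A ⇔ B
      substIff refl = id⇔

    opaque
     instance
      v0 : ∀ {m n} → DefT m {1 + n} (λ γ → last γ)
      v0 = record { graph = record { form = zero ˢ≡ suc zero ; ok = λ M o γ i → id⇔ } ; closed = λ M o γ i → proj₂ i }
      v1 : ∀ {m n} → DefT m {2 + n} (λ γ → last (init γ))
      v1 = wkT v0
      v2 : ∀ {m n} → DefT m {3 + n} (λ γ → last (init (init γ)))
      v2 = wkT v1
      v3 : ∀ {m n} → DefT m {4 + n} (λ γ → last (init (init (init γ))))
      v3 = wkT v2
      v4 : ∀ {m n} → DefT m {5 + n} (λ γ → last (init (init (init (init γ)))))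
      v4 = wkT v3
      v5 : ∀ {m n} → DefT m {6 + n} (λ γ → last (init (init (init (init (init γ))))))
      v5 = wkT v4
      v6 : ∀ {m n} → DefT m {7 + n} (λ γ → last (init (init (init (init (init (init γ)))))))
      v6 = wkT v5
      v7 : ∀ {m n} → DefT m {8 + n} (λ γ → last (init (init (init (init (init (init (init γ))))))))
      v7 = wkT v6
      v8 : ∀ {m n} → DefT m {9 + n} (λ γ → last (init (init (init (init (init (init (init (init γ)))))))))
      v8 = wkT v7
      v9 : ∀ {m n} → DefT m {10 + n} (λ γ → last (init (init (init (init (init (init (init (init (init γ))))))))))
      v9 = wkT v8
      v10 : ∀ {m n} → DefT m {11 + n} (λ γ → last (init (init (init (init (init (init (init (init (init (init γ)))))))))))
      v10 = wkT v9
      v11 : ∀ {m n} → DefT m {12 + n} (λ γ → last (init (init (init (init (init (init (init (init (init (init (init γ))))))))))))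
      v11 = wkT v10

      dMem : ∀ {m n} {s t : Env n → V} ⦃ _ : DefT m s ⦄ ⦃ _ : DefT m t ⦄ → Def m (λ γ → s γ ∈ t γ)
      dMem ⦃ a ⦄ ⦃ b ⦄ = sub2 (λ γ → last (init γ) ∈ last γ) (record { form = suc zero ˢ∈ zero ; ok = λ M o γ i → id⇔ }) a b
      dEq : ∀ {m n} {s t : Env n → V} ⦃ _ : DefT m s ⦄ ⦃ _ : DefT m t ⦄ → Def m (λ γ → s γ ≡ t γ)
      dEq ⦃ a ⦄ ⦃ b ⦄ = sub2 (λ γ → last (init γ) ≡ last γ) (record { form = suc zero ˢ≡ zero ; ok = λ M o γ i → id⇔ }) a b
      dAnd : ∀ {m n} {P Q : Env n → Set ℓ} ⦃ _ : Def m P ⦄ ⦃ _ : Def m Q ⦄ → Def m (λ γ → P γ × Q γ)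
      dAnd ⦃ a ⦄ ⦃ b ⦄ = record { form = form a ∧ˢ form b ; ok = λ M o γ i → ×⇔ (ok a M o γ i) (ok b M o γ i) }
      dOr : ∀ {m n} {P Q : Env n → Set ℓ} ⦃ _ : Def m P ⦄ ⦃ _ : Def m Q ⦄ → Def m (λ γ → P γ ⊎ Q γ)
      dOr ⦃ a ⦄ ⦃ b ⦄ = record { form = form a ∨ˢ form b ; ok = λ M o γ i → ⊎⇔ (ok a M o γ i) (ok b M o γ i) }
      dImp : ∀ {m n} {P Q : Env n → Set ℓ} ⦃ _ : Def m P ⦄ ⦃ _ : Def m Q ⦄ → Def m (λ γ → P γ → Q γ)
      dImp ⦃ a ⦄ ⦃ b ⦄ = record { form = form a ⇒ˢ form b ; ok = λ M o γ i → →⇔ (ok a M o γ i) (ok b M o γ i) }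
      dNot : ∀ {m n} {P : Env n → Set ℓ} ⦃ _ : Def m P ⦄ → Def m (λ γ → ¬ P γ)
      dNot ⦃ a ⦄ = record { form = form a ⇒ˢ ⊥ˢ
        ; ok = λ M o γ i → →⇔ (ok a M o γ i) (mk⇔ ⊥-elim λ ()) }
      dIff : ∀ {m n} {P Q : Env n → Set ℓ} ⦃ _ : Def m P ⦄ ⦃ _ : Def m Q ⦄ → Def m (λ γ → P γ ⇔ Q γ)
      dIff ⦃ a ⦄ ⦃ b ⦄ = record { form = (form a ⇒ˢ form b) ∧ˢ (form b ⇒ˢ form a)
        ; ok = λ M o γ i → mk⇔ (λ e → to (→⇔ (ok a M o γ i) (ok b M o γ i)) (to e) , to (→⇔ (ok b M o γ i) (ok a M o γ i)) (from e))
                  (λ (p , q) → mk⇔ (from (→⇔ (ok a M o γ i) (ok b M o γ i)) p) (from (→⇔ (ok b M o γ i) (ok a M o γ i)) q)) }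
      dAll : ∀ {n} {P : Env n → V → Set ℓ} ⦃ _ : Def full {suc n} (λ γ → P (init γ) (last γ)) ⦄ → Def full (λ γ → ∀ x → P γ x)
      dAll ⦃ a ⦄ = record { form = ∀ˢ (form a)
        ; ok = λ M o γ i → Π⇔ λ x → mk⇔ (λ p _ → to (ok a M o (γ ▹ x) (i , o x)) p) (λ f → from (ok a M o (γ ▹ x) (i , o x)) (f (o x))) }
      dEx : ∀ {n} {P : Env n → V → Set ℓ} ⦃ _ : Def full {suc n} (λ γ → P (init γ) (last γ)) ⦄ → Def full (λ γ → Σ V (λ x → P γ x))
      dEx ⦃ a ⦄ = record { form = ∃ˢ (form a)
        ; ok = λ M o γ i → Σ⇔ λ x → mk⇔ (λ p → o x , to (ok a M o (γ ▹ x) (i , o x)) p) (λ f → from (ok a M o (γ ▹ x) (i , o x)) (proj₂ f)) }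
      -- Mode `abs` admits quantifiers bounded by a term only: transitivity puts members of members
      -- of M back into M, so relativisation to M changes nothing.
      dBAll : ∀ {n} {t : Env n → V} {P : Env n → V → Set ℓ} ⦃ _ : DefT abs t ⦄ ⦃ _ : Def abs {suc n} (λ γ → P (init γ) (last γ)) ⦄ →
              Def abs (λ γ → ∀ x → x ∈ t γ → P γ x)
      dBAll {t = t} {P} ⦃ b ⦄ ⦃ a ⦄ = inst {P = λ γ y → ∀ x → x ∈ y → P γ x} bounded b
        where
        bounded : Def abs (λ γ → ∀ x → x ∈ last γ → P (init γ) x)
        bounded = record { form = ∀ˢ (zero ˢ∈ suc zero ⇒ˢ ren (λ { zero → zero ; (suc i) → suc (suc i) }) (form a))
          ; ok = λ M o γ i → mk⇔
             (λ f x mx e → to (ren-⊨ M _ (form a) _ _ λ { zero → refl ; (suc _) → refl }) (to (ok a M o (init γ ▹ x) (proj₁ i , mx)) (f x e)))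
             (λ f x e → from (ok a M o (init γ ▹ x) (proj₁ i , tr o e (proj₂ i)))
                (from (ren-⊨ M _ (form a) _ _ λ { zero → refl ; (suc _) → refl }) (f x (tr o e (proj₂ i)) e))) }
      dBEx : ∀ {n} {t : Env n → V} {P : Env n → V → Set ℓ} ⦃ _ : DefT abs t ⦄ ⦃ _ : Def abs {suc n} (λ γ → P (init γ) (last γ)) ⦄ →
             Def abs (λ γ → Σ V (λ x → x ∈ t γ × P γ x))
      dBEx {t = t} {P} ⦃ b ⦄ ⦃ a ⦄ = inst {P = λ γ y → Σ V (λ x → x ∈ y × P γ x)} bounded b
        where
        bounded : Def abs (λ γ → Σ V (λ x → x ∈ last γ × P (init γ) x))
        bounded = record { form = ∃ˢ (zero ˢ∈ suc zero ∧ˢ ren (λ { zero → zero ; (suc i) → suc (suc i) }) (form a))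
          ; ok = λ M o γ i → mk⇔
             (λ (x , e , p) → x , tr o e (proj₂ i) , e , to (ren-⊨ M _ (form a) _ _ λ { zero → refl ; (suc _) → refl })
                  (to (ok a M o (init γ ▹ x) (proj₁ i , tr o e (proj₂ i))) p))
             (λ (x , mx , e , p) → x , e , from (ok a M o (init γ ▹ x) (proj₁ i , mx))
                (from (ren-⊨ M _ (form a) _ _ λ { zero → refl ; (suc _) → refl }) p)) }

    find : ∀ {m n} (P : Env n → Set ℓ) ⦃ d : Def m P ⦄ → Def m P
    find P ⦃ d ⦄ = d
    findT : ∀ {m n} (t : Env n → V) ⦃ d : DefT m t ⦄ → DefT m t
    findT t ⦃ d ⦄ = d

    mkT : ∀ {m n} {t : Env n → V} → (∀ M → OK m M → ∀ γ → In M γ → M (t γ)) →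
          (P : Env n → V → Set ℓ) ⦃ _ : Def m {suc n} (λ γ → P (init γ) (last γ)) ⦄ →
          (∀ γ y → P γ y ⇔ (y ≡ t γ)) → DefT m t
    mkT c P ⦃ d ⦄ e = record { graph = iso (λ γ → e (init γ) (last γ)) d ; closed = c }

    -- By extensionality, a formula for the members of a set yields one for the set itself.
    byMem : ∀ {n} {t : Env n → V} (P : Env n → V → Set ℓ) ⦃ _ : Def full {suc n} (λ γ → P (init γ) (last γ)) ⦄ →
            (∀ γ z → z ∈ t γ ⇔ P γ z) → DefT full t
    byMem {t = t} P ⦃ d ⦄ e = mkT (λ M o _ _ → o _) (λ γ y → ∀ z → z ∈ y ⇔ P γ z)
      ⦃ dAll {P = λ γ z → z ∈ last γ ⇔ P (init γ) z} ⦃ dIff ⦃ find _ ⦄ ⦃ swp ⦄ ⦄ ⦄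
      λ γ y → mk⇔ (λ f → ext (λ z h → from (e γ z) (to (f z) h)) (λ z h → from (f z) (to (e γ z) h)))
                  (λ { refl → e γ })
      where
      swp : Def full (λ γ → P (init (init γ)) (last γ))
      swp = record { form = ren (λ { zero → zero ; (suc i) → suc (suc i) }) (form d)
          ; ok = λ M o γ i → ok d M o (init (init γ) ▹ last γ) (proj₁ (proj₁ i) , proj₂ i)
                   ∙⇔ ren-⊨ M _ (form d) _ _ λ { zero → refl ; (suc _) → refl } }

    opaque
     private
      d,, : DefT abs {2} (λ γ → last (init γ) ,, last γ)
      d,, = mkT (λ M o γ i → cl-,, o (proj₂ (proj₁ i)) (proj₂ i))
        (λ γ y → (∀ z → z ∈ y → (z ≡ last (init γ) ⊎ z ≡ last γ)) × (last (init γ) ∈ y × last γ ∈ y))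
        λ γ y → mk⇔ (λ (f , a , b) → ext (λ z h → from ∈,, (f z h)) λ z h → g y a b (to ∈,, h))
                    (λ { refl → (λ z h → to ∈,, h) , from ∈,, (inj₁ refl) , from ∈,, (inj₂ refl) })
        where
        g : ∀ {a b z} y → a ∈ y → b ∈ y → z ≡ a ⊎ z ≡ b → z ∈ y
        g y a b (inj₁ refl) = a
        g y a b (inj₂ refl) = b
      d⋃ : DefT abs {1} (λ γ → ⋃ (last γ))
      d⋃ = mkT (λ M o γ i → cl-⋃ o (proj₂ i))
        (λ γ y → (∀ z → z ∈ y → ∃[ w ] (w ∈ last γ × z ∈ w)) × (∀ w → w ∈ last γ → ∀ z → z ∈ w → z ∈ y))
        λ γ y → mk⇔ (λ (f , g) → ext (λ z h → from ∈⋃ (f z h)) λ z h → let (w , a , b) = to ∈⋃ h in g w a z b)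
                    (λ { refl → (λ z h → to ∈⋃ h) , λ w a z b → from ∈⋃ (w , a , b) })
      d∅ : ∀ {n} → DefT abs {n} (λ γ → ∅)
      d∅ = mkT (λ M o γ i → cl-∅ o) (λ γ y → ∀ z → z ∈ y → ¬ (z ≡ z))
        λ γ y → mk⇔ (λ f → ext (λ z h → ⊥-elim (f z h refl)) λ z h → ⊥-elim (∉∅ h)) λ { refl z h → ⊥-elim (∉∅ h) }
      d𝒫 : DefT full {1} (λ γ → 𝒫 (last γ))
      d𝒫 = byMem (λ γ z → ∀ x → x ∈ z → x ∈ last γ) λ γ z → ∈𝒫

     instance
      i,, : ∀ {m n} {s t : Env n → V} ⦃ _ : DefT m s ⦄ ⦃ _ : DefT m t ⦄ → DefT m (λ γ → s γ ,, t γ)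
      i,, ⦃ a ⦄ ⦃ b ⦄ = subT2 _,,_ (anyT d,,) a b
      i⋃ : ∀ {m n} {s : Env n → V} ⦃ _ : DefT m s ⦄ → DefT m (λ γ → ⋃ (s γ))
      i⋃ ⦃ a ⦄ = subT1 ⋃ (anyT d⋃) a
      i∅ : ∀ {m n} → DefT m {n} (λ γ → ∅)
      i∅ = anyT d∅
      i𝒫 : ∀ {n} {s : Env n → V} ⦃ _ : DefT full s ⦄ → DefT full (λ γ → 𝒫 (s γ))
      i𝒫 ⦃ a ⦄ = subT1 𝒫 d𝒫 a

    module Sep {n} (P : Env n → V → Set ℓ) ⦃ d : Def full {suc n} (λ γ → P (init γ) (last γ)) ⦄ (γ : Env n) (a : V) where
      opaque
        sep : V
        sep = proj₁ (separation (form d) (vec γ) a)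
        ∈sep : ∀ {x} → x ∈ sep ⇔ (x ∈ a × P γ x)
        ∈sep {x} = proj₂ (separation (form d) (vec γ) a) x ∙⇔
          mk⇔ (λ (e , p) → e , from (ok𝕍 (λ γ → P (init γ) (last γ)) (γ ▹ x)) p)
              (λ (e , p) → e , to (ok𝕍 (λ γ → P (init γ) (last γ)) (γ ▹ x)) p)
    open Sep public

    opaque
     isep : ∀ {n k} {f : Env n → Env k} (P : Env k → V → Set ℓ) ⦃ d : Def full {suc k} (λ γ → P (init γ) (last γ)) ⦄ {a : Env n → V} →
            Ts full n k f → DefT full a → DefT full (λ γ → sep P (f γ) (a γ))
     isep {f = f} P ⦃ d ⦄ {a} ts e = byMem (λ γ x → x ∈ a γ × P (f γ) x)
       ⦃ dAnd ⦃ dMem ⦃ v0 ⦄ ⦃ wkT e ⦄ ⦄ ⦃ subs (λ γ → P (init γ) (last γ)) d (wkTs ts ▸ v0) ⦄ ⦄ λ γ z → ∈sep P (f γ) (a γ)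

    -- Excluded middle for definable statements: foundation decides φ by producing a minimal element
    -- of {x ∈ {0,1} : x = 1 or φ}.
    module _ {n} (P : Env n → Set ℓ) ⦃ d : Def full P ⦄ (γ : Env n) where
      private
        one : V
        one = ∅ ,, ∅
        Q : Env (suc n) → V → Set ℓ
        Q γ x = x ≡ last γ ⊎ P (init γ)
        dQ : Def full {suc (suc n)} (λ γ → Q (init γ) (last γ))
        dQ = dOr ⦃ find _ ⦄ ⦃ wkD (wkD d) ⦄
        b : V
        b = sep Q ⦃ dQ ⦄ (γ ▹ one) (∅ ,, one)
        ∈b : ∀ {x} → x ∈ b ⇔ (x ∈ (∅ ,, one) × (x ≡ one ⊎ P γ))
        ∈b = ∈sep Q ⦃ dQ ⦄ (γ ▹ one) (∅ ,, one)
        decide : (∃[ y ] (y ∈ b × (∀ z → z ∈ y → ¬ z ∈ b))) → P γ ⊎ ¬ P γ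
        decide (y , y∈b , min) with to ∈b y∈b
        ... | _ , inj₂ p = inj₁ p
        ... | _ , inj₁ refl = inj₂ λ p → min ∅ (from ∈,, (inj₁ refl)) (from ∈b (from ∈,, (inj₁ refl) , inj₂ p))
      opaque
        lem : P γ ⊎ ¬ P γ
        lem = decide (foundation b (one , from ∈b (from ∈,, (inj₂ refl) , inj₁ refl)))

    opaque
     by-contra : ∀ {n} (P : Env n → Set ℓ) ⦃ d : Def full P ⦄ (γ : Env n) → ¬ ¬ P γ → P γ
     by-contra P γ nn with lem P γ
     ... | inj₁ p = p
     ... | inj₂ np = ⊥-elim (nn np)
  open Logic public

  -- Pairs, functions, products and definite descriptions.

  module Sets where
    exch : ∀ {m n} {P : Env n → V → V → Set ℓ} → Def m {2 + n} (λ γ → P (init (init γ)) (last (init γ)) (last γ)) →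
           Def m {2 + n} (λ γ → P (init (init γ)) (last γ) (last (init γ)))
    exch d = record { form = ren (λ { zero → suc zero ; (suc zero) → zero ; (suc (suc i)) → suc (suc i) }) (form d)
      ; ok = λ M o γ i → ok d M o (init (init γ) ▹ last γ ▹ last (init γ)) ((proj₁ (proj₁ i) , proj₂ i) , proj₂ (proj₁ i))
               ∙⇔ ren-⊨ M _ (form d) _ _ λ { zero → refl ; (suc zero) → refl ; (suc (suc _)) → refl } }

    sing : V → V
    sing x = x ,, x
    ∈sing : ∀ {x z} → z ∈ sing x ⇔ z ≡ x
    ∈sing = mk⇔ (λ h → Data.Sum.[ id , id ] (to ∈,, h)) (λ h → from ∈,, (inj₁ h))
      where import Data.Sum

    ∈l : ∀ {x y} → x ∈ (x ,, y)
    ∈l = from ∈,, (inj₁ refl)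
    ∈r : ∀ {x y} → y ∈ (x ,, y)
    ∈r = from ∈,, (inj₂ refl)

    ∈-irrefl : ∀ {x} → ¬ x ∈ x
    ∈-irrefl {x} h with foundation (sing x) (x , ∈l)
    ... | y , e , f with to ∈sing e
    ... | refl = f x h ∈l

    ∈-asym : ∀ {x y} → x ∈ y → ¬ y ∈ x
    ∈-asym {x} {y} h k with foundation (x ,, y) (x , ∈l)
    ... | z , e , f with to ∈,, e
    ... | inj₁ refl = f y k ∈r
    ... | inj₂ refl = f x h ∈l

    ,,-inj : ∀ {x y z} → (x ,, y) ≡ (x ,, z) → y ≡ z
    ,,-inj {x} {y} {z} e with to (∈,, {x} {z}) (subst (y ∈_) e ∈r)
    ... | inj₂ p = p
    ... | inj₁ refl with to (∈,, {x} {x}) (subst (z ∈_) (sym e) ∈r)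
    ... | inj₁ q = sym q
    ... | inj₂ q = sym q

    opaque

      ⟪_،_⟫ : V → V → V
      ⟪ x ، y ⟫ = (x ,, x) ,, (x ,, y)
      instance
       i⟪⟫ : ∀ {m n} {s t : Env n → V} ⦃ _ : DefT m s ⦄ ⦃ _ : DefT m t ⦄ → DefT m (λ γ → ⟪ s γ ، t γ ⟫)
       i⟪⟫ {s = s} {t} = i,, {s = λ γ → s γ ,, s γ} {λ γ → s γ ,, t γ}
      ⟪⟫-inj₁ : ∀ {x y x′ y′} → ⟪ x ، y ⟫ ≡ ⟪ x′ ، y′ ⟫ → x ≡ x′
      ⟪⟫-inj₁ {x} {y} {x′} {y′} e with to ∈,, (subst ((x ,, x) ∈_) e ∈l)
      ... | inj₁ p = to ∈sing (subst (x ∈_) p ∈l)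
      ... | inj₂ p = sym (to ∈sing (subst (x′ ∈_) (sym p) ∈l))
      ⟪⟫-inj₂ : ∀ {x y x′ y′} → ⟪ x ، y ⟫ ≡ ⟪ x′ ، y′ ⟫ → y ≡ y′
      ⟪⟫-inj₂ {x} {y} {x′} {y′} e with ⟪⟫-inj₁ e
      ... | refl = ,,-inj (,,-inj e)
      ≐⇔ : ∀ {p x y} → (p ≐⟨ x ⨾ y ⟩) ⇔ (p ≡ ⟪ x ، y ⟫)
      ≐⇔ {p} {x} {y} = mk⇔
        (λ (a , b , f , g , h) → let ea = ext {a} {x ,, x} (λ z k → from ∈sing (to (f z) k)) (λ z k → from (f z) (to ∈sing k))
                                     eb = ext {b} {x ,, y} (λ z k → from ∈,, (to (g z) k)) (λ z k → from (g z) (to ∈,, k))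
           in trans (ext (λ z k → from ∈,, (to (h z) k)) (λ z k → from (h z) (to ∈,, k))) (cong₂ _,,_ ea eb))
        (λ { refl → x ,, x , x ,, y , (λ z → ∈sing) , (λ z → ∈,,) , (λ z → ∈,,) })
      ⟪⟫-⋃⋃ : ∀ {x y r} → ⟪ x ، y ⟫ ∈ r → (x ∈ ⋃ (⋃ r)) × (y ∈ ⋃ (⋃ r))
      ⟪⟫-⋃⋃ {x} {y} h = from ∈⋃ (x ,, y , from ∈⋃ (_ , h , ∈r) , ∈l) , from ∈⋃ (x ,, y , from ∈⋃ (_ , h , ∈r) , ∈r)
      Good-⟪⟫ : ∀ {M x y} → Good M → M x → M y → M ⟪ x ، y ⟫
      Good-⟪⟫ g a b = cl-,, g (cl-,, g a a) (cl-,, g a b)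
      ⟪⟫-𝒫𝒫 : ∀ {x y a b} → x ∈ a → y ∈ b → ⟪ x ، y ⟫ ∈ 𝒫 (𝒫 (⋃ (a ,, b)))
      ⟪⟫-𝒫𝒫 {x} {y} {a} {b} h k = from ∈𝒫 λ z e → from ∈𝒫 λ w l → f e l
        where
        f : ∀ {z w} → z ∈ ((x ,, x) ,, (x ,, y)) → w ∈ z → w ∈ ⋃ (a ,, b)
        f e l with to ∈,, e
        f e l | inj₁ refl with to ∈sing l
        ... | refl = from ∈⋃ (a , ∈l , h)
        f e l | inj₂ refl with to ∈,, l
        ... | inj₁ refl = from ∈⋃ (a , ∈l , h)
        ... | inj₂ refl = from ∈⋃ (b , ∈r , k)
      ∈⟪⟫-comps : ∀ {x y} → ∃[ z ] (z ∈ ⟪ x ، y ⟫ × x ∈ z × y ∈ z)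
      ∈⟪⟫-comps {x} {y} = x ,, y , ∈r , ∈l , ∈r

    ∋⇔ : ∀ {r x y} → (r ∋⟨ x ⨾ y ⟩) ⇔ (⟪ x ، y ⟫ ∈ r)
    ∋⇔ {r} = mk⇔ (λ (p , e , h) → subst (_∈ r) (to ≐⇔ e) h) (λ h → _ , from ≐⇔ refl , h)

    opaque
      infixl 26 _∪_
      _∪_ : V → V → V
      x ∪ y = ⋃ (x ,, y)
      ∈∪ : ∀ {x y z} → z ∈ (x ∪ y) ⇔ (z ∈ x ⊎ z ∈ y)
      ∈∪ {x} {y} {z} = mk⇔ (λ h → f (to ∈⋃ h)) (λ { (inj₁ h) → from ∈⋃ (x , ∈l , h) ; (inj₂ h) → from ∈⋃ (y , ∈r , h) })
        where
        f : (∃[ w ] (w ∈ (x ,, y) × z ∈ w)) → z ∈ x ⊎ z ∈ y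
        f (w , e , h) with to ∈,, e
        ... | inj₁ refl = inj₁ h
        ... | inj₂ refl = inj₂ h
      instance
       i∪ : ∀ {m n} {s t : Env n → V} ⦃ _ : DefT m s ⦄ ⦃ _ : DefT m t ⦄ → DefT m (λ γ → s γ ∪ t γ)
       i∪ {s = s} {t} ⦃ a ⦄ ⦃ b ⦄ = i⋃ {s = λ γ → s γ ,, t γ} ⦃ i,, ⦃ a ⦄ ⦃ b ⦄ ⦄
      sucV : V → V
      sucV x = x ∪ sing x
      ∈suc : ∀ {x z} → z ∈ sucV x ⇔ (z ∈ x ⊎ z ≡ x)
      ∈suc = ∈∪ ∙⇔ ⊎⇔ id⇔ ∈sing
      instance
       isuc : ∀ {m n} {s : Env n → V} ⦃ _ : DefT m s ⦄ → DefT m (λ γ → sucV (s γ))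
       isuc {s = s} ⦃ a ⦄ = i∪ {t = λ γ → sing (s γ)} ⦃ a ⦄ ⦃ i,, ⦃ a ⦄ ⦃ a ⦄ ⦄
    ∈suc-refl : ∀ {x} → x ∈ sucV x
    ∈suc-refl = from ∈suc (inj₂ refl)

    -- Definite description as a total operation: `lem` decides whether there is exactly one
    -- witness, and `∅` is the default. Totality lets the result occur in terms without side
    -- conditions.
    module Iota {n} (P : Env n → V → Set ℓ) ⦃ d : Def full {suc n} (λ γ → P (init γ) (last γ)) ⦄ where
      private
        U : Env n → V → Set ℓ
        U γ y = P γ y × (∀ z → P γ z → z ≡ y)
        dU : Def full {suc n} (λ γ → U (init γ) (last γ))
        dU = dAnd ⦃ d ⦄ ⦃ dAll {P = λ γ z → P (init γ) z → z ≡ last γ} ⦃ dImp ⦃ exch {P = λ γ x _ → P γ x} (wkD d) ⦄ ⦃ find _ ⦄ ⦄ ⦄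
        dE : Def full (λ γ → Σ V (U γ))
        dE = dEx ⦃ dU ⦄
        ι′ : ∀ γ → Σ V (U γ) ⊎ ¬ Σ V (U γ) → V
        ι′ γ (inj₁ (y , _)) = y
        ι′ γ (inj₂ _) = ∅
      opaque
        ι : Env n → V
        ι γ = ι′ γ (lem (λ γ → Σ V (U γ)) ⦃ dE ⦄ γ)
        ι-eq : ∀ {γ y} → P γ y → (∀ z → P γ z → z ≡ y) → ι γ ≡ y
        ι-eq {γ} {y} p u with lem (λ γ → Σ V (U γ)) ⦃ dE ⦄ γ
        ... | inj₁ (z , q , _) = u z q
        ... | inj₂ no = ⊥-elim (no (y , p , u))
        ι-else : ∀ {γ} → ¬ (∃[ y ] (P γ y × (∀ z → P γ z → z ≡ y))) → ι γ ≡ ∅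
        ι-else {γ} no with lem (λ γ → Σ V (U γ)) ⦃ dE ⦄ γ
        ... | inj₁ p = ⊥-elim (no p)
        ... | inj₂ _ = refl
        iι : DefT full ι
        iι = mkT (λ M o _ _ → o _) (λ γ y → U γ y ⊎ (¬ Σ V (U γ) × y ≡ ∅))
          ⦃ dOr ⦃ dU ⦄ ⦃ dAnd ⦃ dNot ⦃ wkD dE ⦄ ⦄ ⦃ find _ ⦄ ⦄ ⦄
          λ γ y → mk⇔ (λ { (inj₁ (p , u)) → sym (ι-eq p u) ; (inj₂ (no , e)) → trans e (sym (ι-else no)) })
                      (λ e → g γ y e (lem (λ γ → Σ V (U γ)) ⦃ dE ⦄ γ))
          where
          g : ∀ γ y → y ≡ ι γ → Σ V (U γ) ⊎ ¬ Σ V (U γ) → U γ y ⊎ (¬ Σ V (U γ) × y ≡ ∅)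
          g γ y e (inj₁ (z , p , u)) with trans e (ι-eq p u)
          ... | refl = inj₁ (p , u)
          g γ y e (inj₂ no) = inj₂ (no , trans e (ι-else no))
    open Iota public

    module Img {n} (t : Env n → V → V) ⦃ d : DefT full {suc n} (λ γ → t (init γ) (last γ)) ⦄ where
      private
        D : Def full {2 + n} (λ γ → last (init γ) ≡ t (init (init γ)) (last γ))
        D = exch {P = λ γ x y → y ≡ t γ x} (graph d)
      opaque
        img : Env n → V → V
        img γ a = proj₁ (replacement (form D) (vec γ) a λ x _ → t γ x ,
          to (ok𝕍 _ ⦃ D ⦄ (γ ▹ t γ x ▹ x)) refl , λ {y} q → sym (from (ok𝕍 _ ⦃ D ⦄ (γ ▹ y ▹ x)) q))
        ∈img : ∀ {γ a y} → y ∈ img γ a ⇔ (∃[ x ] (x ∈ a × y ≡ t γ x))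
        ∈img {γ} {a} {y} = proj₂ (replacement (form D) (vec γ) a λ x _ → t γ x ,
            to (ok𝕍 _ ⦃ D ⦄ (γ ▹ t γ x ▹ x)) refl , λ {y} q → sym (from (ok𝕍 _ ⦃ D ⦄ (γ ▹ y ▹ x)) q)) y
          ∙⇔ Σ⇔ λ x → ×⇔ id⇔ (sym⇔ (ok𝕍 _ ⦃ D ⦄ (γ ▹ y ▹ x)))
      opaque
       iimg : {a : Env n → V} → DefT full a → DefT full (λ γ → img γ (a γ))
       iimg {a} e = byMem (λ γ y → ∃[ x ] (x ∈ a γ × y ≡ t γ x))
         ⦃ dEx ⦃ dAnd ⦃ dMem ⦃ v0 ⦄ ⦃ wkT (wkT e) ⦄ ⦄ ⦃ D ⦄ ⦄ ⦄ λ γ z → ∈img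
    open Img public

    record Fn (f a : V) : Set ℓ where
      field
        fn-rel : ∀ p → p ∈ f → ∃[ x ] (x ∈ a × ∃[ y ] (p ≡ ⟪ x ، y ⟫))
        fn-tot : ∀ x → x ∈ a → ∃[ y ] (⟪ x ، y ⟫ ∈ f)
        fn-uni : ∀ x → x ∈ a → ∀ y z → ⟪ x ، y ⟫ ∈ f → ⟪ x ، z ⟫ ∈ f → y ≡ z
    open Fn public

    opaque
     private
      dFn : Def abs {2} (λ γ → Fn (last (init γ)) (last γ))
      -- Values of f lie in ⋃ ⋃ f because pairs are Kuratowski pairs. This bounds the quantifiers
      -- over values and makes being a function absolute.
      dFn = iso {P = λ (∙ ▹ f ▹ a) → (∀ p → p ∈ f → ∃[ x ] (x ∈ a × ∃[ y ] (y ∈ ⋃ (⋃ f) × p ≡ ⟪ x ، y ⟫)))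
               × (∀ x → x ∈ a → ∃[ y ] (y ∈ ⋃ (⋃ f) × ⟪ x ، y ⟫ ∈ f))
               × (∀ x → x ∈ a → ∀ y → y ∈ ⋃ (⋃ f) → ∀ z → z ∈ ⋃ (⋃ f) → ⟪ x ، y ⟫ ∈ f → ⟪ x ، z ⟫ ∈ f → y ≡ z)}
        (λ (∙ ▹ f ▹ a) → mk⇔
          (λ (r , t , u) → record { fn-rel = λ p h → let (x , e , y , _ , q) = r p h in x , e , y , q
                                  ; fn-tot = λ x e → let (y , _ , h) = t x e in y , h
                                  ; fn-uni = λ x e y z h k → u x e y (proj₂ (⟪⟫-⋃⋃ h)) z (proj₂ (⟪⟫-⋃⋃ k)) h k })
          (λ F → (λ p h → let (x , e , y , q) = fn-rel F p h in x , e , y , proj₂ (⟪⟫-⋃⋃ (subst (_∈ f) q h)) , q)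
               , (λ x e → let (y , h) = fn-tot F x e in y , proj₂ (⟪⟫-⋃⋃ h) , h)
               , (λ x e y _ z _ → fn-uni F x e y z)))
        (find _)
     instance
      iFn : ∀ {m n} {s t : Env n → V} ⦃ _ : DefT m s ⦄ ⦃ _ : DefT m t ⦄ → Def m (λ γ → Fn (s γ) (t γ))
      iFn ⦃ a ⦄ ⦃ b ⦄ = sub2 (λ γ → Fn (last (init γ)) (last γ)) (any dFn) a b

    Fn⇔ : ∀ {f a} → Fn f a ⇔ IsFunctionOn f a
    Fn⇔ {f} {a} = mk⇔ fw bw
      where
      fw : Fn f a → IsFunctionOn f a
      fw F = (λ p h → let (x , e , y , q) = fn-rel F p h in x , y , e , from ≐⇔ q)
           , (λ x e → let (y , h) = fn-tot F x e in y , from ∋⇔ h , λ k → fn-uni F x e _ _ h (to ∋⇔ k))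
      bw : IsFunctionOn f a → Fn f a
      bw (r , t) = record
        { fn-rel = λ p h → let (x , y , e , q) = r p h in x , e , y , to ≐⇔ q
        ; fn-tot = λ x e → let (y , h , _) = t x e in y , to ∋⇔ h
        ; fn-uni = λ x e y z h k → let (_ , _ , u) = t x e in trans (sym (u (from ∋⇔ h))) (u (from ∋⇔ k)) }

    -- Junk value: app f x = ∅ unless f has exactly one value at x.
    private
      Val : Env 2 → V → Set ℓ
      Val (∙ ▹ f ▹ x) y = ⟪ x ، y ⟫ ∈ f
    private
     opaque
      defVal : Def full {3} (λ γ → Val (init γ) (last γ))
      defVal = find _
    opaque
      app : V → V → V
      app f x = ι Val ⦃ defVal ⦄ (∙ ▹ f ▹ x)
      app-eq : ∀ {f a x y} → Fn f a → ⟪ x ، y ⟫ ∈ f → app f x ≡ y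
      app-eq {f} {a} {x} {y} F h = ι-eq Val ⦃ defVal ⦄ h λ z k → fn-uni F x x∈a z y k h
        where
        x∈a : x ∈ a
        x∈a with fn-rel F _ h
        ... | x′ , e , y′ , q with ⟪⟫-inj₁ q
        ... | refl = e
      private
        HasV : Env 2 → Set ℓ
        HasV γ = ∃[ y ] (Val γ y × (∀ z → Val γ z → z ≡ y))
        -- The graph of application with all quantifiers bounded, in the default case too, so that
        -- `app` is absolute together with its junk values.
        B : Env 2 → V → Set ℓ
        B (∙ ▹ f ▹ x) y = (⟪ x ، y ⟫ ∈ f × (∀ z → z ∈ ⋃ (⋃ f) → ⟪ x ، z ⟫ ∈ f → z ≡ y))
              ⊎ (¬ (∃[ z ] (z ∈ ⋃ (⋃ f) × ⟪ x ، z ⟫ ∈ f × (∀ w → w ∈ ⋃ (⋃ f) → ⟪ x ، w ⟫ ∈ f → w ≡ z))) × y ≡ ∅)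
        clo : ∀ M → Good M → ∀ f x → M f → HasV (∙ ▹ f ▹ x) ⊎ ¬ HasV (∙ ▹ f ▹ x) → M (app f x)
        clo M o f x mf (inj₁ (y , h , u)) =
          subst M (sym (ι-eq Val ⦃ defVal ⦄ h u)) (tr o (proj₂ (⟪⟫-⋃⋃ h)) (cl-⋃ o (cl-⋃ o mf)))
        clo M o f x _ (inj₂ no) = subst M (sym (ι-else Val ⦃ defVal ⦄ no)) (cl-∅ o)
        B⇒ : ∀ f x y → B (∙ ▹ f ▹ x) y → y ≡ app f x
        B⇒ f x y (inj₁ (h , u)) = sym (ι-eq Val ⦃ defVal ⦄ h λ z k → u z (proj₂ (⟪⟫-⋃⋃ k)) k)
        B⇒ f x y (inj₂ (no , e)) =
          trans e (sym (ι-else Val ⦃ defVal ⦄ λ (z , h , u) → no (z , proj₂ (⟪⟫-⋃⋃ h) , h , λ w _ → u w)))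
        ⇒B : ∀ f x y → y ≡ app f x → HasV (∙ ▹ f ▹ x) ⊎ ¬ HasV (∙ ▹ f ▹ x) → B (∙ ▹ f ▹ x) y
        ⇒B f x y e (inj₁ (z , h , u)) with trans e (ι-eq Val ⦃ defVal ⦄ h u)
        ... | refl = inj₁ (h , λ w _ → u w)
        ⇒B f x y e (inj₂ no) =
          inj₂ ((λ (z , _ , h , u) → no (z , h , λ w k → u w (proj₂ (⟪⟫-⋃⋃ k)) k)) , trans e (ι-else Val ⦃ defVal ⦄ no))
        defHasV : Def full HasV
        defHasV = find _
        dapp : DefT abs {2} (λ γ → app (last (init γ)) (last γ))
        dapp = mkT (λ M o (∙ ▹ f ▹ x) i → clo M o f x (proj₂ (proj₁ i)) (lem HasV ⦃ defHasV ⦄ (∙ ▹ f ▹ x))) B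
          (λ (∙ ▹ f ▹ x) y → mk⇔ (B⇒ f x y) (λ e → ⇒B f x y e (lem HasV ⦃ defHasV ⦄ (∙ ▹ f ▹ x))))
      instance
       iapp : ∀ {m n} {s t : Env n → V} ⦃ _ : DefT m s ⦄ ⦃ _ : DefT m t ⦄ → DefT m (λ γ → app (s γ) (t γ))
       iapp ⦃ a ⦄ ⦃ b ⦄ = subT2 app (anyT dapp) a b

    app-∈ : ∀ {f a x} → Fn f a → x ∈ a → ⟪ x ، app f x ⟫ ∈ f
    app-∈ F h with fn-tot F _ h
    ... | y , k = subst (λ z → ⟪ _ ، z ⟫ ∈ _) (sym (app-eq F k)) k

    fn-dom : ∀ {f a x y} → Fn f a → ⟪ x ، y ⟫ ∈ f → x ∈ a
    fn-dom F h with fn-rel F _ h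
    ... | x′ , e , y′ , q with ⟪⟫-inj₁ q
    ... | refl = e

    fn-ext : ∀ {f g a} → Fn f a → Fn g a → (∀ x → x ∈ a → app f x ≡ app g x) → f ≡ g
    fn-ext F G e = ext (λ p h → half F G e p h) (λ p h → half G F (λ x k → sym (e x k)) p h)
      where
      half : ∀ {f g a} → Fn f a → Fn g a → (∀ x → x ∈ a → app f x ≡ app g x) → ∀ p → p ∈ f → p ∈ g
      half F G e p h with fn-rel F p h
      ... | x , k , y , refl with trans (sym (e x k)) (app-eq F h)
      ... | q = subst (λ z → ⟪ x ، z ⟫ ∈ _) q (app-∈ G k)

    module Lam {n} (t : Env n → V → V) ⦃ d : DefT full {suc n} (λ γ → t (init γ) (last γ)) ⦄ where
      private
        d′ : DefT full {suc n} (λ γ → ⟪ last γ ، t (init γ) (last γ) ⟫)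
        d′ = i⟪⟫ ⦃ v0 ⦄ ⦃ d ⦄
      opaque
        lam : Env n → V → V
        lam γ a = img (λ γ x → ⟪ x ، t γ x ⟫) ⦃ d′ ⦄ γ a
        ∈lam : ∀ {γ a p} → p ∈ lam γ a ⇔ (∃[ x ] (x ∈ a × p ≡ ⟪ x ، t γ x ⟫))
        ∈lam = ∈img (λ γ x → ⟪ x ، t γ x ⟫) ⦃ d′ ⦄
        ilam : {a : Env n → V} → DefT full a → DefT full (λ γ → lam γ (a γ))
        ilam e = iimg (λ γ x → ⟪ x ، t γ x ⟫) ⦃ d′ ⦄ e
      lam-Fn : ∀ {γ a} → Fn (lam γ a) a
      lam-Fn = record
        { fn-rel = λ p h → let (x , e , q) = to ∈lam h in x , e , _ , q
        ; fn-tot = λ x e → _ , from ∈lam (x , e , refl)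
        ; fn-uni = λ x e y z h k → trans (val h) (sym (val k)) }
        where
        val : ∀ {γ a x y} → ⟪ x ، y ⟫ ∈ lam γ a → y ≡ t γ x
        val h with to ∈lam h
        ... | x′ , _ , q with ⟪⟫-inj₁ q
        ... | refl = ⟪⟫-inj₂ q
      lam-app : ∀ {γ a x} → x ∈ a → app (lam γ a) x ≡ t γ x
      lam-app h = app-eq lam-Fn (from ∈lam (_ , h , refl))
    open Lam public

    private
      ProdP : Env 2 → V → Set ℓ
      ProdP (∙ ▹ a ▹ b) z = ∃[ x ] (x ∈ a × ∃[ y ] (y ∈ b × z ≡ ⟪ x ، y ⟫))
      FnP : Env 1 → V → Set ℓ
      FnP (∙ ▹ a) f = Fn f a
    private
     opaque
      defProdP : Def full {3} (λ γ → ProdP (init γ) (last γ))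
      defProdP = find _
    opaque
      infixr 27 _⊗_
      _⊗_ : V → V → V
      a ⊗ b = sep ProdP ⦃ defProdP ⦄ (∙ ▹ a ▹ b) (𝒫 (𝒫 (⋃ (a ,, b))))
      ∈⊗ : ∀ {a b z} → z ∈ a ⊗ b ⇔ ProdP (∙ ▹ a ▹ b) z
      ∈⊗ {a} {b} = ∈sep ProdP ⦃ defProdP ⦄ (∙ ▹ a ▹ b) (𝒫 (𝒫 (⋃ (a ,, b)))) ∙⇔ mk⇔ proj₂ bound
        where
        bound : ∀ {a b z} → ProdP (∙ ▹ a ▹ b) z → z ∈ 𝒫 (𝒫 (⋃ (a ,, b))) × ProdP (∙ ▹ a ▹ b) z
        bound p@(x , h , y , k , refl) = ⟪⟫-𝒫𝒫 h k , p
    opaque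
     unfolding _⊗_
     instance
      i⊗ : ∀ {n} {s t : Env n → V} ⦃ _ : DefT full s ⦄ ⦃ _ : DefT full t ⦄ → DefT full (λ γ → s γ ⊗ t γ)
      i⊗ ⦃ a ⦄ ⦃ b ⦄ = isep ProdP ⦃ defProdP ⦄ ([] ▸ a ▸ b) (i𝒫 ⦃ i𝒫 ⦃ i⋃ ⦃ i,, ⦃ a ⦄ ⦃ b ⦄ ⦄ ⦄ ⦄)

    pair∈⊗ : ∀ {a b x y} → ⟪ x ، y ⟫ ∈ a ⊗ b ⇔ (x ∈ a × y ∈ b)
    pair∈⊗ {a} {b} {x} {y} = mk⇔ (λ h → f (to ∈⊗ h)) (λ (h , k) → from ∈⊗ (_ , h , _ , k , refl))
      where
      f : ProdP (∙ ▹ a ▹ b) ⟪ x ، y ⟫ → x ∈ a × y ∈ b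
      f (x′ , h , y′ , k , e) with ⟪⟫-inj₁ e | ⟪⟫-inj₂ e
      ... | refl | refl = h , k

    private
     opaque
      defFnP : Def full {2} (λ γ → FnP (init γ) (last γ))
      defFnP = find _
    opaque
      infixr 26 _⇛_
      _⇛_ : V → V → V
      a ⇛ b = sep FnP ⦃ defFnP ⦄ (∙ ▹ a) (𝒫 (a ⊗ b))
      ∈⇛ : ∀ {a b f} → f ∈ a ⇛ b ⇔ (Fn f a × (∀ x → x ∈ a → app f x ∈ b))
      ∈⇛ {a} {b} {f} = ∈sep FnP ⦃ defFnP ⦄ (∙ ▹ a) (𝒫 (a ⊗ b)) ∙⇔ mk⇔
        (λ (s , F) → F , λ x h → proj₂ (to pair∈⊗ (to ∈𝒫 s _ (app-∈ F h))))
        (λ (F , v) → from ∈𝒫 (λ p h → g F v p h (fn-rel F p h)) , F)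
        where
        g : ∀ {a b f} → Fn f a → (∀ x → x ∈ a → app f x ∈ b) → ∀ p → p ∈ f → ∃[ x ] (x ∈ a × ∃[ y ] (p ≡ ⟪ x ، y ⟫)) → p ∈ a ⊗ b
        g {b = b} F v p h (x , e , y , refl) = from pair∈⊗ (e , subst (_∈ b) (app-eq F h) (v x e))
    opaque
     unfolding _⇛_
     instance
      i⇛ : ∀ {n} {s t : Env n → V} ⦃ _ : DefT full s ⦄ ⦃ _ : DefT full t ⦄ → DefT full (λ γ → s γ ⇛ t γ)
      i⇛ ⦃ a ⦄ ⦃ b ⦄ = isep FnP ⦃ defFnP ⦄ ([] ▸ a) (i𝒫 ⦃ i⊗ ⦃ a ⦄ ⦃ b ⦄ ⦄)
  open Sets public

  -- Ordinals and natural numbers.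

  module Ordinals where
    record Tr (x : V) : Set ℓ where
      field
        trn : ∀ y → y ∈ x → ∀ z → z ∈ y → z ∈ x
    open Tr public
    -- Foundation reduces `IsOrdinal`, whose least-element clause ranges over all subsets, to this
    -- form with bounded quantifiers.
    record Ord (x : V) : Set ℓ where
      field
        ordTr : Tr x
        ordTr′ : ∀ y → y ∈ x → Tr y
    open Ord public

    opaque
     instance
      iTr : ∀ {m n} {s : Env n → V} ⦃ _ : DefT m s ⦄ → Def m (λ γ → Tr (s γ))
      iTr ⦃ a ⦄ = sub1 (λ γ → Tr (last γ)) (any (iso {P = λ (∙ ▹ x) → ∀ y → y ∈ x → ∀ z → z ∈ y → z ∈ x}
        (λ γ → mk⇔ (λ t → record { trn = t }) trn) (find _))) a
      iOrd : ∀ {m n} {s : Env n → V} ⦃ _ : DefT m s ⦄ → Def m (λ γ → Ord (s γ))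
      iOrd ⦃ a ⦄ = sub1 (λ γ → Ord (last γ)) (any (iso {P = λ (∙ ▹ x) → Tr x × (∀ y → y ∈ x → Tr y)}
        (λ γ → mk⇔ (λ (t , u) → record { ordTr = t ; ordTr′ = u }) (λ o → ordTr o , ordTr′ o)) (find _))) a

    Ord-∈ : ∀ {α β} → Ord α → β ∈ α → Ord β
    Ord-∈ o h = record { ordTr = ordTr′ o _ h ; ordTr′ = λ y k → ordTr′ o y (trn (ordTr o) _ h y k) }

    Ord-tr : ∀ {α β γ} → Ord γ → α ∈ β → β ∈ γ → α ∈ γ
    Ord-tr o h k = trn (ordTr o) _ k _ h

    Tr-suc : ∀ {x} → Tr x → Tr (sucV x)
    Tr-suc t = record { trn = λ y h z k → from ∈suc (inj₁ (f h k)) }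
      where
      f : ∀ {y z} → y ∈ sucV _ → z ∈ y → z ∈ _
      f h k with to ∈suc h
      ... | inj₁ h = trn t _ h _ k
      ... | inj₂ refl = k

    Ord-suc : ∀ {α} → Ord α → Ord (sucV α)
    Ord-suc o = record { ordTr = Tr-suc (ordTr o) ; ordTr′ = λ y h → f h }
      where
      f : ∀ {y} → y ∈ sucV _ → Tr y
      f h with to ∈suc h
      ... | inj₁ h = ordTr′ o _ h
      ... | inj₂ refl = ordTr o

    Ord-⋃ : ∀ {s} → (∀ x → x ∈ s → Ord x) → Ord (⋃ s)
    Ord-⋃ f = record
      { ordTr = record { trn = λ y h z k → let (w , e , l) = to ∈⋃ h in from ∈⋃ (w , e , trn (ordTr (f w e)) y l z k) }
      ; ordTr′ = λ y h → let (w , e , l) = to ∈⋃ h in ordTr′ (f w e) y l }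

    Ord-∅ : Ord ∅
    Ord-∅ = record { ordTr = record { trn = λ y h → ⊥-elim (∉∅ h) } ; ordTr′ = λ y h → ⊥-elim (∉∅ h) }

    module _ {n} (P : Env n → V → Set ℓ) ⦃ d : Def full {suc n} (λ γ → P (init γ) (last γ)) ⦄ where
      private
        S : Env n → V → V
        S γ a = sep (λ γ x → ¬ P γ x) ⦃ dNot ⦃ d ⦄ ⦄ γ a
        ∈S : ∀ {γ a x} → x ∈ S γ a ⇔ (x ∈ a × ¬ P γ x)
        ∈S {γ} {a} = ∈sep (λ γ x → ¬ P γ x) ⦃ dNot ⦃ d ⦄ ⦄ γ a
      opaque
       -- Foundation is applied to the set of counterexamples in α + 1, and P is recovered from its
       -- double negation; both need P to be definable.
       Ord-ind : ∀ γ → (∀ α → Ord α → (∀ β → β ∈ α → P γ β) → P γ α) → ∀ α → Ord α → P γ α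
       Ord-ind γ step α o = by-contra (λ γ → P (init γ) (last γ)) (γ ▹ α) bad
         where
         bad : ¬ ¬ P γ α
         bad np with foundation (S γ (sucV α)) (α , from ∈S (∈suc-refl , np))
         ... | m , h , min with to ∈S h
         ... | m∈ , nq = nq (step m (Ord-∈ (Ord-suc o) m∈) λ β k →
                 by-contra (λ γ → P (init γ) (last γ)) (γ ▹ β) λ nr →
                   min β k (from ∈S (Ord-tr (Ord-suc o) k m∈ , nr)))

      opaque
       Ord-least : ∀ γ → (∃[ α ] (Ord α × P γ α)) → ∃[ α ] (Ord α × P γ α × (∀ β → β ∈ α → ¬ P γ β))
       Ord-least γ (α , o , p) with foundation T (α , from ∈T (∈suc-refl , p))
         where
         T : V
         T = sep P γ (sucV α)
         ∈T : ∀ {x} → x ∈ T ⇔ (x ∈ sucV α × P γ x)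
         ∈T = ∈sep P γ (sucV α)
       ... | m , h , min with to (∈sep P γ (sucV α)) h
       ... | m∈ , q = m , Ord-∈ (Ord-suc o) m∈ , q , λ β k r → min β k (from (∈sep P γ (sucV α)) (Ord-tr (Ord-suc o) k m∈ , r))

    opaque
     -- Induction on α and, inside it, on β: if the two were incomparable, the induction hypotheses
     -- would give both inclusions, hence equality.
     Ord-cmp : ∀ {α β} → Ord α → Ord β → α ∈ β ⊎ α ≡ β ⊎ β ∈ α
     Ord-cmp {α} {β} oα oβ = Ord-ind (λ _ x → ∀ y → Ord y → Cmp x y) ∙ outer α oα β oβ
       where
       Cmp : V → V → Set ℓ
       Cmp x y = x ∈ y ⊎ x ≡ y ⊎ y ∈ x
       outer : ∀ a → Ord a → (∀ b → b ∈ a → ∀ y → Ord y → Cmp b y) → ∀ y → Ord y → Cmp a y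
       outer a oa iha = Ord-ind (λ (∙ ▹ a) y → Cmp a y) (∙ ▹ a) inner
         where
         inner : ∀ b → Ord b → (∀ y → y ∈ b → Cmp a y) → Cmp a b
         inner b ob ihb = by-contra (λ (∙ ▹ a ▹ b) → Cmp a b) (∙ ▹ a ▹ b) λ no →
           no (inj₂ (inj₁ (ext (λ x h → f no h (iha x h b ob)) (λ x h → g no h (ihb x h)))))
           where
           f : ¬ Cmp a b → ∀ {x} → x ∈ a → Cmp x b → x ∈ b
           f no h (inj₁ k) = k
           f no h (inj₂ (inj₁ refl)) = ⊥-elim (no (inj₂ (inj₂ h)))
           f no h (inj₂ (inj₂ k)) = ⊥-elim (no (inj₂ (inj₂ (Ord-tr oa k h))))
           g : ¬ Cmp a b → ∀ {x} → x ∈ b → Cmp a x → x ∈ a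
           g no h (inj₁ k) = ⊥-elim (no (inj₁ (Ord-tr ob k h)))
           g no h (inj₂ (inj₁ refl)) = ⊥-elim (no (inj₁ h))
           g no h (inj₂ (inj₂ k)) = k

    Ord-⊆ : ∀ {α β} → Ord α → Ord β → α ⊆ β → α ∈ β ⊎ α ≡ β
    Ord-⊆ a b s with Ord-cmp a b
    ... | inj₁ h = inj₁ h
    ... | inj₂ (inj₁ e) = inj₂ e
    ... | inj₂ (inj₂ h) = ⊥-elim (∈-irrefl (s _ h))

    Ord-suc-⊆ : ∀ {α β} → Ord β → α ∈ β → sucV α ⊆ β
    Ord-suc-⊆ o h z k with to ∈suc k
    ... | inj₁ l = Ord-tr o l h
    ... | inj₂ refl = h

    Ord⇔ : ∀ {α} → Ord α ⇔ IsOrdinal α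
    Ord⇔ {α} = mk⇔
      (λ o → record
        { transitive = trn (ordTr o) ; ∈-irrefl = λ _ _ → ∈-irrefl
        ; ∈-trans = λ x y z _ _ h k l → Ord-tr (Ord-∈ o h) k l
        ; ∈-total = λ x y h k → Ord-cmp (Ord-∈ o h) (Ord-∈ o k)
        ; least = λ a s ne → let (m , h , min) = foundation a ne in
            m , h , λ y k → f min k (Ord-cmp (Ord-∈ o (s m h)) (Ord-∈ o (s y k))) })
      (λ o → record { ordTr = record { trn = IsOrdinal.transitive o }
        ; ordTr′ = λ y h → record { trn = λ z k w l →
            let z∈ = IsOrdinal.transitive o y h z k ; w∈ = IsOrdinal.transitive o z z∈ w l
            in IsOrdinal.∈-trans o w z y w∈ z∈ h l k } })
      where
      f : ∀ {m y a} → (∀ z → z ∈ m → ¬ z ∈ a) → y ∈ a → m ∈ y ⊎ m ≡ y ⊎ y ∈ m → m ≡ y ⊎ m ∈ y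
      f min k (inj₁ h) = inj₂ h
      f min k (inj₂ (inj₁ h)) = inj₁ h
      f min k (inj₂ (inj₂ h)) = ⊥-elim (min _ h k)

    -- Burali-Forti: the ordinals in s would form an ordinal, which would then belong to itself.
    ¬Ord-set : ∀ s → ¬ (∀ α → Ord α → α ∈ s)
    ¬Ord-set s f = ∈-irrefl (from ∈T (f T oT , oT))
      where
      T : V
      T = sep (λ _ x → Ord x) ∙ s
      ∈T : ∀ {x} → x ∈ T ⇔ (x ∈ s × Ord x)
      ∈T = ∈sep (λ _ x → Ord x) ∙ s
      oT : Ord T
      oT = record { ordTr = record { trn = λ y h z k → let o = Ord-∈ (proj₂ (to ∈T h)) k in from ∈T (f z o , o) }
                  ; ordTr′ = λ y h → ordTr (proj₂ (to ∈T h)) }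

    -- A definition of the finite ordinals with bounded quantifiers, which makes ω recognisable
    -- inside transitive models.
    record Nat (x : V) : Set ℓ where
      field
        natOrd : Ord x
        natPred : ∀ m → m ∈ sucV x → m ≡ ∅ ⊎ ∃[ k ] (k ∈ m × m ≡ sucV k)
    open Nat public
    opaque
     instance
      iNat : ∀ {m n} {s : Env n → V} ⦃ _ : DefT m s ⦄ → Def m (λ γ → Nat (s γ))
      iNat ⦃ a ⦄ = sub1 (λ γ → Nat (last γ)) (any (iso
        {P = λ (∙ ▹ x) → Ord x × (∀ m → m ∈ sucV x → m ≡ ∅ ⊎ ∃[ k ] (k ∈ m × m ≡ sucV k))}
        (λ γ → mk⇔ (λ (t , u) → record { natOrd = t ; natPred = u }) (λ o → natOrd o , natPred o)) (find _))) a

    Nat-∅ : Nat ∅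
    Nat-∅ = record { natOrd = Ord-∅ ; natPred = λ m h → f (to ∈suc h) }
      where
      f : ∀ {m} → m ∈ ∅ ⊎ m ≡ ∅ → m ≡ ∅ ⊎ ∃[ k ] (k ∈ m × m ≡ sucV k)
      f (inj₁ h) = ⊥-elim (∉∅ h)
      f (inj₂ h) = inj₁ h

    Nat-suc : ∀ {x} → Nat x → Nat (sucV x)
    Nat-suc {x} N = record { natOrd = Ord-suc (natOrd N) ; natPred = λ m h → f (to ∈suc h) }
      where
      f : ∀ {m} → m ∈ sucV x ⊎ m ≡ sucV x → m ≡ ∅ ⊎ ∃[ k ] (k ∈ m × m ≡ sucV k)
      f (inj₁ h) = natPred N _ h
      f (inj₂ refl) = inj₂ (x , ∈suc-refl , refl)

    Nat-∈ : ∀ {x y} → Nat x → y ∈ x → Nat y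
    Nat-∈ {x} {y} N h = record { natOrd = Ord-∈ (natOrd N) h
      ; natPred = λ m k → natPred N m (from ∈suc (inj₁ (f (to ∈suc k)))) }
      where
      f : ∀ {m} → m ∈ y ⊎ m ≡ y → m ∈ x
      f (inj₁ k) = Ord-tr (natOrd N) k h
      f (inj₂ refl) = h

    opaque
      ω : V
      ω = sep (λ _ x → Nat x) ∙ (proj₁ infinity)
      ∈ω : ∀ {x} → x ∈ ω ⇔ Nat x
      ∈ω {x} = ∈sep (λ _ x → Nat x) ∙ (proj₁ infinity) ∙⇔ mk⇔ proj₂ (λ N → allI x (natOrd N) N , N)
        where
        I : V
        I = proj₁ infinity
        step : ∀ x → Ord x → (∀ y → y ∈ x → Nat y → y ∈ I) → Nat x → x ∈ I
        step x o ih N with natPred N x ∈suc-refl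
        step x o ih N | inj₁ refl with proj₁ (proj₂ infinity)
        ... | e , emp , h = subst (_∈ I) (ext (λ z k → ⊥-elim (emp z k)) (λ z k → ⊥-elim (∉∅ k))) h
        step x o ih N | inj₂ (k , h , refl) with proj₂ (proj₂ infinity) k (ih k h (Nat-∈ N h))
        ... | s , iss , l = subst (_∈ I) (ext (λ z e → from ∈suc (to (iss z) e)) (λ z e → from (iss z) (to ∈suc e))) l
        allI : ∀ x → Ord x → Nat x → x ∈ I
        allI x o = Ord-ind (λ (∙ ▹ I) x → Nat x → x ∈ I) (∙ ▹ I) (λ x o ih → step x o ih) x o
      instance
       iω : ∀ {n} → DefT full {n} (λ γ → ω)
       iω = byMem (λ γ z → Nat z) λ γ z → ∈ω

    ∅∈ω : ∅ ∈ ω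
    ∅∈ω = from ∈ω Nat-∅
    suc∈ω : ∀ {n} → n ∈ ω → sucV n ∈ ω
    suc∈ω h = from ∈ω (Nat-suc (to ∈ω h))
    Ord-ω : Ord ω
    Ord-ω = record { ordTr = record { trn = λ y h z k → from ∈ω (Nat-∈ (to ∈ω h) k) }
                   ; ordTr′ = λ y h → ordTr (natOrd (to ∈ω h)) }

    module _ {n} (P : Env n → V → Set ℓ) ⦃ d : Def full {suc n} (λ γ → P (init γ) (last γ)) ⦄ where
      opaque
       ω-ind : ∀ γ → P γ ∅ → (∀ m → m ∈ ω → P γ m → P γ (sucV m)) → ∀ m → m ∈ ω → P γ m
       ω-ind γ z s m h = Ord-ind (λ γ m → Nat m → P γ m) ⦃ dImp ⦃ find _ ⦄ ⦃ d ⦄ ⦄ γ step m (natOrd (to ∈ω h)) (to ∈ω h)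
         where
         step : ∀ x → Ord x → (∀ y → y ∈ x → Nat y → P γ y) → Nat x → P γ x
         step x o ih N with natPred N x ∈suc-refl
         ... | inj₁ refl = z
         ... | inj₂ (k , h , refl) = s k (from ∈ω (Nat-∈ N h)) (ih k h (Nat-∈ N h))

    suc-inj : ∀ {x y} → sucV x ≡ sucV y → x ≡ y
    suc-inj {x} {y} e with to (∈suc {y} {x}) (subst (x ∈_) e ∈suc-refl) | to (∈suc {x} {y}) (subst (y ∈_) (sym e) ∈suc-refl)
    ... | inj₂ p | _ = p
    ... | inj₁ h | inj₂ p = sym p
    ... | inj₁ h | inj₁ k = ⊥-elim (∈-asym h k)

    suc≢∅ : ∀ {x} → sucV x ≢ ∅
    suc≢∅ e = ∉∅ (subst (_ ∈_) e ∈suc-refl)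
  open Ordinals public

  -- Projections and well-founded recursion.

  module Recursion where
    private
      FstP SndP : Env 1 → V → Set ℓ
      FstP (∙ ▹ p) x = ∃[ y ] (p ≡ ⟪ x ، y ⟫)
      SndP (∙ ▹ p) y = ∃[ x ] (p ≡ ⟪ x ، y ⟫)
    private
     opaque
      defFstP : Def full {2} (λ γ → FstP (init γ) (last γ))
      defFstP = find _
      defSndP : Def full {2} (λ γ → SndP (init γ) (last γ))
      defSndP = find _
    opaque
      fst snd : V → V
      fst p = ι FstP ⦃ defFstP ⦄ (∙ ▹ p)
      snd p = ι SndP ⦃ defSndP ⦄ (∙ ▹ p)
      fst-⟪⟫ : ∀ {x y} → fst ⟪ x ، y ⟫ ≡ x
      fst-⟪⟫ {x} {y} = ι-eq FstP ⦃ defFstP ⦄ (y , refl) λ z (w , e) → sym (⟪⟫-inj₁ e)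
      snd-⟪⟫ : ∀ {x y} → snd ⟪ x ، y ⟫ ≡ y
      snd-⟪⟫ {x} {y} = ι-eq SndP ⦃ defSndP ⦄ (x , refl) λ z (w , e) → sym (⟪⟫-inj₂ e)
      private
        IsP : Env 1 → Set ℓ
        IsP (∙ ▹ p) = ∃[ x ] (x ∈ ⋃ p × ∃[ y ] (y ∈ ⋃ p × p ≡ ⟪ x ، y ⟫))
        isP : ∀ {x y} → IsP (∙ ▹ ⟪ x ، y ⟫)
        isP {x} {y} = let (z , h , k , l) = ∈⟪⟫-comps in x , from ∈⋃ (z , h , k) , y , from ∈⋃ (z , h , l) , refl
        BP : (V → V → V) → Env 1 → V → Set ℓ
        BP f (∙ ▹ p) z = (∃[ x ] (x ∈ ⋃ p × ∃[ y ] (y ∈ ⋃ p × p ≡ ⟪ x ، y ⟫ × z ≡ f x y))) ⊎ (¬ IsP (∙ ▹ p) × z ≡ ∅)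
        defIsP : Def full IsP
        defIsP = find _
        comp : ∀ (f : V → V → V) (t : V → V) → (∀ {x y} → t ⟪ x ، y ⟫ ≡ f x y) → (∀ {p} → ¬ IsP (∙ ▹ p) → t p ≡ ∅) →
               Def abs {2} (λ γ → BP f (init γ) (last γ)) → (∀ x y → f x y ≡ x ⊎ f x y ≡ y) → DefT abs {1} (λ γ → t (last γ))
        comp f t e no d c = mkT (λ M o (∙ ▹ p) i → clo M o p (proj₂ i) (lem IsP ⦃ defIsP ⦄ (∙ ▹ p))) (BP f) ⦃ d ⦄
          (λ (∙ ▹ p) z → mk⇔ (λ { (inj₁ (x , _ , y , _ , refl , q)) → trans q (sym e) ; (inj₂ (n , q)) → trans q (sym (no n)) })
                              (λ q → g p z q (lem IsP ⦃ defIsP ⦄ (∙ ▹ p))))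
          where
          clo : ∀ M → Good M → ∀ p → M p → IsP (∙ ▹ p) ⊎ ¬ IsP (∙ ▹ p) → M (t p)
          clo M o p m (inj₁ (x , h , y , k , refl)) with c x y
          ... | inj₁ q = subst M (sym (trans e q)) (tr o h (cl-⋃ o m))
          ... | inj₂ q = subst M (sym (trans e q)) (tr o k (cl-⋃ o m))
          clo M o p m (inj₂ n) = subst M (sym (no n)) (cl-∅ o)
          g : ∀ p z → z ≡ t p → IsP (∙ ▹ p) ⊎ ¬ IsP (∙ ▹ p) → BP f (∙ ▹ p) z
          g p z q (inj₁ (x , h , y , k , refl)) = inj₁ (x , h , y , k , refl , trans q e)
          g p z q (inj₂ n) = inj₂ (n , trans q (no n))
      fst-else : ∀ {p} → ¬ IsP (∙ ▹ p) → fst p ≡ ∅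
      fst-else n = ι-else FstP ⦃ defFstP ⦄ λ { (x , (y , refl) , _) → n isP }
      snd-else : ∀ {p} → ¬ IsP (∙ ▹ p) → snd p ≡ ∅
      snd-else n = ι-else SndP ⦃ defSndP ⦄ λ { (y , (x , refl) , _) → n isP }
      instance
       ifst : ∀ {m n} {s : Env n → V} ⦃ _ : DefT m s ⦄ → DefT m (λ γ → fst (s γ))
       ifst ⦃ a ⦄ = subT1 fst (anyT (comp (λ x y → x) fst fst-⟪⟫ fst-else (find _) λ x y → inj₁ refl)) a
       isnd : ∀ {m n} {s : Env n → V} ⦃ _ : DefT m s ⦄ → DefT m (λ γ → snd (s γ))
       isnd ⦃ a ⦄ = subT1 snd (anyT (comp (λ x y → y) snd snd-⟪⟫ snd-else (find _) λ x y → inj₂ refl)) a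

    private
      AppT : Env 1 → V → V
      AppT (∙ ▹ g) x = app g x
      PreP : Env 2 → V → Set ℓ
      PreP (∙ ▹ E ▹ c) d = ⟪ d ، c ⟫ ∈ E
    private
     opaque
      defAppT : DefT full {2} (λ γ → AppT (init γ) (last γ))
      defAppT = findT _
      defPreP : Def full {3} (λ γ → PreP (init γ) (last γ))
      defPreP = find _
    opaque
      infix 26 _″_
      _″_ : V → V → V
      g ″ s = img AppT ⦃ defAppT ⦄ (∙ ▹ g) s
      ∈″ : ∀ {g s y} → y ∈ g ″ s ⇔ (∃[ x ] (x ∈ s × y ≡ app g x))
      ∈″ = ∈img AppT ⦃ defAppT ⦄
      instance
       i″ : ∀ {n} {s t : Env n → V} ⦃ _ : DefT full s ⦄ ⦃ _ : DefT full t ⦄ → DefT full (λ γ → s γ ″ t γ)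
       i″ ⦃ a ⦄ ⦃ b ⦄ = subT2 _″_ (byMem {t = λ γ → last (init γ) ″ last γ}
         (λ (∙ ▹ g ▹ s) y → ∃[ x ] (x ∈ s × y ≡ app g x)) λ γ z → ∈″) a b
      pre : V → V → V → V
      pre D E c = sep PreP ⦃ defPreP ⦄ (∙ ▹ E ▹ c) D
      ∈pre : ∀ {D E c d} → d ∈ pre D E c ⇔ (d ∈ D × ⟪ d ، c ⟫ ∈ E)
      ∈pre {D} {E} {c} = ∈sep PreP ⦃ defPreP ⦄ (∙ ▹ E ▹ c) D
      instance
       ipre : ∀ {n} {s t u : Env n → V} ⦃ _ : DefT full s ⦄ ⦃ _ : DefT full t ⦄ ⦃ _ : DefT full u ⦄ →
              DefT full (λ γ → pre (s γ) (t γ) (u γ))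
       ipre ⦃ a ⦄ ⦃ b ⦄ ⦃ c ⦄ = isep PreP ⦃ defPreP ⦄ ([] ▸ b ▸ c) a

    ″-cong : ∀ {g h s} → (∀ x → x ∈ s → app g x ≡ app h x) → g ″ s ≡ h ″ s
    ″-cong f = ext (λ y k → let (x , e , q) = to ∈″ k in from ∈″ (x , e , trans q (f x e)))
                   (λ y k → let (x , e , q) = to ∈″ k in from ∈″ (x , e , trans q (sym (f x e))))

    WF : V → V → Set ℓ
    WF D E = ∀ S → S ⊆ D → NonEmpty S → ∃[ m ] (m ∈ S × (∀ x → x ∈ S → ¬ ⟪ x ، m ⟫ ∈ E))

    -- Recursion along a well-founded relation E on a set D: the attempts are
    -- the solutions on downward closed subsets, and they agree.

    module WfRec (G : V → V → V → V) ⦃ dG : DefT full {3} (λ γ → G (last (init (init γ))) (last (init γ)) (last γ)) ⦄ where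
      record Att (p D E g A : V) : Set ℓ where
        field
          att-⊆ : ∀ c → c ∈ A → c ∈ D
          att-↓ : ∀ c → c ∈ A → ∀ d → d ∈ pre D E c → d ∈ A
          att-Fn : Fn g A
          att-eq : ∀ c → c ∈ A → app g c ≡ G p c (g ″ pre D E c)
      open Att
      opaque
       private instance
        iG : ∀ {n} {s t u : Env n → V} ⦃ _ : DefT full s ⦄ ⦃ _ : DefT full t ⦄ ⦃ _ : DefT full u ⦄ →
              DefT full (λ γ → G (s γ) (t γ) (u γ))
        iG ⦃ a ⦄ ⦃ b ⦄ ⦃ c ⦄ = subT3 G dG a b c
      record Val (p D E c y : V) : Set ℓ where
        constructor val
        field
          {val-g val-A} : V
          val-att : Att p D E val-g val-A
          val-∈ : c ∈ val-A
          val-eq : y ≡ app val-g c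
      opaque
       private instance
        iAtt : ∀ {n} {s t u v w : Env n → V} ⦃ _ : DefT full s ⦄ ⦃ _ : DefT full t ⦄ ⦃ _ : DefT full u ⦄
               ⦃ _ : DefT full v ⦄ ⦃ _ : DefT full w ⦄ → Def full (λ γ → Att (s γ) (t γ) (u γ) (v γ) (w γ))
        iAtt ⦃ a ⦄ ⦃ b ⦄ ⦃ c ⦄ ⦃ d ⦄ ⦃ e ⦄ = subs (λ (∙ ▹ p ▹ D ▹ E ▹ g ▹ A) → Att p D E g A)
          (iso {P = λ (∙ ▹ p ▹ D ▹ E ▹ g ▹ A) → (∀ c → c ∈ A → c ∈ D)
                 × (∀ c → c ∈ A → ∀ d → d ∈ pre D E c → d ∈ A) × Fn g A × (∀ c → c ∈ A → app g c ≡ G p c (g ″ pre D E c))}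
          (λ γ → mk⇔ (λ (a , b , c , d) → record { att-⊆ = a ; att-↓ = b ; att-Fn = c ; att-eq = d })
                      (λ a → att-⊆ a , att-↓ a , att-Fn a , att-eq a)) (find _)) ([] ▸ a ▸ b ▸ c ▸ d ▸ e)
        iVal : ∀ {n} {s t u v w : Env n → V} ⦃ _ : DefT full s ⦄ ⦃ _ : DefT full t ⦄ ⦃ _ : DefT full u ⦄
               ⦃ _ : DefT full v ⦄ ⦃ _ : DefT full w ⦄ → Def full (λ γ → Val (s γ) (t γ) (u γ) (v γ) (w γ))
        iVal ⦃ a ⦄ ⦃ b ⦄ ⦃ c ⦄ ⦃ d ⦄ ⦃ e ⦄ = subs (λ (∙ ▹ p ▹ D ▹ E ▹ c ▹ y) → Val p D E c y)
          (iso {P = λ (∙ ▹ p ▹ D ▹ E ▹ c ▹ y) → ∃[ g ] ∃[ A ] (Att p D E g A × c ∈ A × y ≡ app g c)}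
          (λ γ → mk⇔ (λ (_ , _ , a , b , c) → val a b c) (λ (val a b c) → _ , _ , a , b , c)) (find _)) ([] ▸ a ▸ b ▸ c ▸ d ▸ e)
      private
        VP : Env 4 → V → Set ℓ
        VP (∙ ▹ p ▹ D ▹ E ▹ c) y = Val p D E c y
        HP : Env 3 → V → Set ℓ
        HP (∙ ▹ p ▹ D ▹ E) c = ∃[ y ] Val p D E c y
      private
       opaque
        defVP : Def full {5} (λ γ → VP (init γ) (last γ))
        defVP = find _
      opaque
        theVal : V → V → V → V → V
        theVal p D E c = ι VP ⦃ defVP ⦄ (∙ ▹ p ▹ D ▹ E ▹ c)
        theVal-eq : ∀ {p D E c y} → Val p D E c y → (∀ z → Val p D E c z → z ≡ y) → theVal p D E c ≡ y
        theVal-eq = ι-eq VP ⦃ defVP ⦄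
      private
        VT : Env 3 → V → V
        VT (∙ ▹ p ▹ D ▹ E) c = theVal p D E c
        instance
         opaque
          unfolding theVal
          iVT : DefT full {4} (λ γ → VT (init γ) (last γ))
          iVT = iι VP ⦃ defVP ⦄

      private
       opaque
        defHP : Def full {4} (λ γ → HP (init γ) (last γ))
        defHP = find _
        defVT : DefT full {4} (λ γ → VT (init γ) (last γ))
        defVT = findT _
      module _ (p D E : V) (w : WF D E) where
        private
          γ : Env 3
          γ = ∙ ▹ p ▹ D ▹ E
          agree : ∀ {g A h B} → Att p D E g A → Att p D E h B → ∀ c → c ∈ A → c ∈ B → app g c ≡ app h c
          agree {g} {A} {h} {B} a b c c∈A c∈B = by-contra (λ (∙ ▹ g ▹ c ▹ h) → app g c ≡ app h c) (∙ ▹ g ▹ c ▹ h) λ ne →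
            let (m , m∈ , min) = w S (λ z k → att-⊆ a z (proj₁ (to ∈S k))) (c , from ∈S (c∈A , c∈B , ne))
                (mA , mB , neq) = to ∈S m∈
            in neq (trans (att-eq a m mA) (trans (cong (G p m) (″-cong λ x k →
                 by-contra (λ (∙ ▹ g ▹ c ▹ h) → app g c ≡ app h c) (∙ ▹ g ▹ x ▹ h) λ nx →
                   min x (from ∈S (att-↓ a m mA x k , att-↓ b m mB x k , nx)) (proj₂ (to ∈pre k)))) (sym (att-eq b m mB))))
            where
            Q : Env 3 → V → Set ℓ
            Q (∙ ▹ B ▹ g ▹ h) c = c ∈ B × ¬ (app g c ≡ app h c)
            opaque
              defQ : Def full {4} (λ γ → Q (init γ) (last γ))
              defQ = find _
            S : V
            S = sep Q ⦃ defQ ⦄ (∙ ▹ B ▹ g ▹ h) A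
            ∈S : ∀ {x} → x ∈ S ⇔ (x ∈ A × Q (∙ ▹ B ▹ g ▹ h) x)
            ∈S = ∈sep Q ⦃ defQ ⦄ (∙ ▹ B ▹ g ▹ h) A
          D′ : V
          D′ = sep HP ⦃ defHP ⦄ γ D
          ∈D′ : ∀ {x} → x ∈ D′ ⇔ (x ∈ D × ∃[ y ] Val p D E x y)
          ∈D′ = ∈sep HP ⦃ defHP ⦄ γ D
          F : V
          F = lam VT ⦃ defVT ⦄ γ D′
          F-Fn : Fn F D′
          F-Fn = lam-Fn VT ⦃ defVT ⦄
          att∈ : ∀ {g A c} → Att p D E g A → c ∈ A → c ∈ D′
          att∈ {g} {A} {c} a h = from ∈D′ (att-⊆ a c h , _ , val a h refl)
          F-val : ∀ {g A c} → Att p D E g A → c ∈ A → app F c ≡ app g c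
          F-val {g} {A} {c} a h = trans (lam-app VT ⦃ defVT ⦄ (att∈ a h))
            (theVal-eq (val a h refl) λ { z (val a′ h′ refl) → agree a′ a c h′ h })
          F-Att : Att p D E F D′
          F-Att = record
            { att-⊆ = λ c h → proj₁ (to ∈D′ h)
            ; att-↓ = λ c h d k → let (_ , _ , val a h′ _) = to ∈D′ h in att∈ a (att-↓ a c h′ d k)
            ; att-Fn = F-Fn
            ; att-eq = λ c h → let (_ , _ , val a h′ _) = to ∈D′ h in
                trans (F-val a h′) (trans (att-eq a c h′) (cong (G p c) (″-cong λ x k → sym (F-val a (att-↓ a c h′ x k))))) }
          -- The union F of all attempts is itself an attempt. A minimal point outside its domain
          -- could be adjoined, which would be one attempt more.
          total : ∀ c → c ∈ D → c ∈ D′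
          total c h = by-contra (λ (∙ ▹ c ▹ a) → c ∈ a) (∙ ▹ c ▹ D′) λ no →
            let (m , m∈ , min) = w S (λ z k → proj₁ (to ∈S k)) (c , from ∈S (h , no))
                (mD , m∉) = to ∈S m∈
                below : ∀ d → d ∈ pre D E m → d ∈ D′
                below d k = by-contra (λ (∙ ▹ c ▹ a) → c ∈ a) (∙ ▹ d ▹ D′) λ nd →
                  min d (from ∈S (proj₁ (to ∈pre k) , nd)) (proj₂ (to ∈pre k))
            in m∉ (att∈ (ext-att m mD below) (from ∈∪ (inj₂ (from ∈sing refl))))
            where
            S : V
            S = sep (λ (∙ ▹ a) c → ¬ c ∈ a) (∙ ▹ D′) D
            ∈S : ∀ {x} → x ∈ S ⇔ (x ∈ D × ¬ x ∈ D′)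
            ∈S = ∈sep (λ (∙ ▹ a) c → ¬ c ∈ a) (∙ ▹ D′) D
            T : Env 4 → V → V
            T (∙ ▹ p ▹ D ▹ E ▹ F) c = G p c (F ″ pre D E c)
            opaque
              defT : DefT full {5} (λ γ → T (init γ) (last γ))
              defT = findT _
            module _ (m : V) (mD : m ∈ D) (below : ∀ d → d ∈ pre D E m → d ∈ D′) where
              A″ F″ : V
              A″ = D′ ∪ sing m
              F″ = lam T ⦃ defT ⦄ (γ ▹ F) A″
              F″-app : ∀ {c} → c ∈ A″ → app F″ c ≡ G p c (F ″ pre D E c)
              F″-app = lam-app T ⦃ defT ⦄
              down : ∀ c → c ∈ A″ → ∀ d → d ∈ pre D E c → d ∈ D′
              down c h d k with to ∈∪ h
              ... | inj₁ h = att-↓ F-Att c h d k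
              ... | inj₂ h with to ∈sing h
              ... | refl = below d k
              ext-att : Att p D E F″ A″
              ext-att = record
                { att-⊆ = λ c h → sub c (to ∈∪ h)
                ; att-↓ = λ c h d k → from ∈∪ (inj₁ (down c h d k))
                ; att-Fn = lam-Fn T ⦃ defT ⦄
                ; att-eq = λ c h → trans (F″-app h) (cong (G p c) (″-cong λ x k →
                    trans (att-eq F-Att x (down c h x k)) (sym (F″-app (from ∈∪ (inj₁ (down c h x k))))))) }
                where
                sub : ∀ c → c ∈ D′ ⊎ c ∈ sing m → c ∈ D
                sub c (inj₁ h) = proj₁ (to ∈D′ h)
                sub c (inj₂ h) with to ∈sing h
                ... | refl = mD
          D≡ : D′ ≡ D
          D≡ = ext (λ z h → proj₁ (to ∈D′ h)) total

        opaque
         wf-rec : ∃[ f ] (Fn f D × (∀ c → c ∈ D → app f c ≡ G p c (f ″ pre D E c)))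
         wf-rec = F , subst (Fn F) D≡ F-Fn , λ c h → att-eq F-Att c (total c h)
  open Recursion public

  -- Recursion on ω, ∈-induction and the cumulative hierarchy.

  module Hierarchy where
    private
      SucT : Env 0 → V → V
      SucT _ k = sucV k
      opaque
        defSucT : DefT full {1} (λ γ → SucT (init γ) (last γ))
        defSucT = findT _
      sucE : V
      sucE = lam SucT ⦃ defSucT ⦄ ∙ ω
      ∈sucE : ∀ {x y} → ⟪ x ، y ⟫ ∈ sucE ⇔ (x ∈ ω × y ≡ sucV x)
      ∈sucE {x} {y} = ∈lam SucT ⦃ defSucT ⦄ ∙⇔ mk⇔ f (λ (h , e) → x , h , cong ⟪ x ،_⟫ e)
        where
        f : (∃[ z ] (z ∈ ω × ⟪ x ، y ⟫ ≡ ⟪ z ، sucV z ⟫)) → x ∈ ω × y ≡ sucV x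
        f (z , h , e) with ⟪⟫-inj₁ e
        ... | refl = h , ⟪⟫-inj₂ e
      sucE-WF : WF ω sucE
      sucE-WF S s ne = let (m , h , min) = foundation S ne in
        m , h , λ x k l → min x (subst (x ∈_) (sym (proj₂ (to ∈sucE l))) ∈suc-refl) k

    ⋃-sing : ∀ {x} → ⋃ (sing x) ≡ x
    ⋃-sing {x} = ext (λ z h → let (y , e , k) = to ∈⋃ h in subst (z ∈_) (to ∈sing e) k)
                     (λ z h → from ∈⋃ (x , from ∈sing refl , h))

    module _ (t : V → V → V) ⦃ dt : DefT full {2} (λ γ → t (last (init γ)) (last γ)) ⦄ where
      private
        instance
         opaque
          it : ∀ {n} {s u : Env n → V} ⦃ _ : DefT full s ⦄ ⦃ _ : DefT full u ⦄ → DefT full (λ γ → t (s γ) (u γ))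
          it ⦃ a ⦄ ⦃ b ⦄ = subT2 t dt a b
        GP : Env 3 → V → Set ℓ
        -- q packs the parameter of `t` with the initial value. A successor has a single
        -- `sucE`-predecessor, so S is the singleton of the previous value and ⋃ S recovers that
        -- value.
        GP (∙ ▹ q ▹ c ▹ S) y = (c ≡ ∅ × y ≡ snd q) ⊎ (¬ c ≡ ∅ × y ≡ t (fst q) (⋃ S))
        opaque
          defGP : Def full {4} (λ γ → GP (init γ) (last γ))
          defGP = find _
        G : V → V → V → V
        G q c S = ι GP ⦃ defGP ⦄ (∙ ▹ q ▹ c ▹ S)
        instance
         opaque
          iG : DefT full {3} (λ γ → G (last (init (init γ))) (last (init γ)) (last γ))
          iG = iι GP ⦃ defGP ⦄
        GE : ∀ p x₀ → ∃[ f ] (Fn f ω × (∀ c → c ∈ ω → app f c ≡ G ⟪ p ، x₀ ⟫ c (f ″ pre ω sucE c)))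
        GE p x₀ = WfRec.wf-rec G ⟪ p ، x₀ ⟫ ω sucE sucE-WF
        im : ∀ {n s} → n ∈ ω → s ″ pre ω sucE (sucV n) ≡ sing (app s n)
        im {n} {s} h = ext (λ y k → let (x , e , q) = to ∈″ k ; (_ , l) = to ∈pre e in
            from ∈sing (trans q (cong (app s) (sym (suc-inj (proj₂ (to ∈sucE l)))))))
          (λ y k → from ∈″ (n , from ∈pre (h , from ∈sucE (h , refl)) , to ∈sing k))
        g0 : ∀ {p x S} → G ⟪ p ، x ⟫ ∅ S ≡ x
        g0 {p} {x} {S} = ι-eq GP ⦃ defGP ⦄ (inj₁ (refl , sym snd-⟪⟫)) u
          where
          u : ∀ z → GP (∙ ▹ ⟪ p ، x ⟫ ▹ ∅ ▹ S) z → z ≡ x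
          u z (inj₁ (_ , e)) = trans e snd-⟪⟫
          u z (inj₂ (ne , _)) = ⊥-elim (ne refl)
        g1 : ∀ {p x n y} → G ⟪ p ، x ⟫ (sucV n) (sing y) ≡ t p y
        g1 {p} {x} {n} {y} = ι-eq GP ⦃ defGP ⦄ (inj₂ (suc≢∅ , sym e)) w
          where
          e : t (fst ⟪ p ، x ⟫) (⋃ (sing y)) ≡ t p y
          e = cong₂ t fst-⟪⟫ ⋃-sing
          w : ∀ z → GP (∙ ▹ ⟪ p ، x ⟫ ▹ sucV n ▹ sing y) z → z ≡ t p y
          w z (inj₁ (b , _)) = ⊥-elim (suc≢∅ b)
          w z (inj₂ (_ , q)) = trans q e
      opaque
       ω-rec : ∀ p x₀ → ∃[ s ] (Fn s ω × app s ∅ ≡ x₀ × (∀ n → n ∈ ω → app s (sucV n) ≡ t p (app s n)))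
       ω-rec p x₀ = let (s , F , q) = GE p x₀ in s , F , trans (q ∅ ∅∈ω) g0 ,
         λ n h → trans (q (sucV n) (suc∈ω h)) (trans (cong (G ⟪ p ، x₀ ⟫ (sucV n)) (im h)) g1)

    private
      ⋃T : V → V → V
      ⋃T _ y = ⋃ y
    opaque
     tc-exists : ∀ x → ∃[ T ] (Tr T × x ∈ T)
     tc-exists x = let (s , F , s0 , s1) = ω-rec ⋃T ∅ (sing x)
                       T = ⋃ (s ″ ω)
                       trT : ∀ y → y ∈ T → ∀ z → z ∈ y → z ∈ T
                       trT y h z k = let (w , e , l) = to ∈⋃ h ; (n , n∈ , q) = to ∈″ e in
                         from ∈⋃ (app s (sucV n) , from ∈″ (_ , suc∈ω n∈ , refl) ,
                           subst (z ∈_) (sym (s1 n n∈)) (from ∈⋃ (y , subst (y ∈_) q l , k)))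
       in T , record { trn = trT } , from ∈⋃ (_ , from ∈″ (∅ , ∅∈ω , refl) , subst (x ∈_) (sym s0) (from ∈sing refl))

    module _ {n} (P : Env n → V → Set ℓ) ⦃ d : Def full {suc n} (λ γ → P (init γ) (last γ)) ⦄ where
      opaque
       ∈-ind : ∀ γ → (∀ x → (∀ y → y ∈ x → P γ y) → P γ x) → ∀ x → P γ x
       ∈-ind γ step x = by-contra (λ γ → P (init γ) (last γ)) (γ ▹ x) λ np →
         let (T , trT , x∈) = tc-exists x
             S = sep (λ γ x → ¬ P γ x) ⦃ dNot ⦃ d ⦄ ⦄ γ T
             ∈S : ∀ {z} → z ∈ S ⇔ (z ∈ T × ¬ P γ z)
             ∈S = ∈sep (λ γ x → ¬ P γ x) ⦃ dNot ⦃ d ⦄ ⦄ γ T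
             (m , m∈ , min) = foundation S (x , from ∈S (x∈ , np))
             (mT , nq) = to ∈S m∈
         in nq (step m λ β k → by-contra (λ γ → P (init γ) (last γ)) (γ ▹ β) λ nr →
              min β k (from ∈S (trn trT m mT β k , nr)))

    -- The cumulative hierarchy: R x = ⋃ {𝒫 (R y) | y ∈ x}, which is V_α at an ordinal α.

    private
      𝒫T : Env 0 → V → V
      𝒫T _ y = 𝒫 y
    private
     opaque
      def𝒫T : DefT full {1} (λ γ → 𝒫T (init γ) (last γ))
      def𝒫T = findT _
    opaque
      Pow : V → V
      Pow s = ⋃ (img 𝒫T ⦃ def𝒫T ⦄ ∙ s)
      ∈Pow : ∀ {s z} → z ∈ Pow s ⇔ (∃[ y ] (y ∈ s × z ⊆ y))
      ∈Pow {s} {z} = mk⇔ fw (λ (y , h , k) → from ∈⋃ (𝒫 y , from (∈img 𝒫T ⦃ def𝒫T ⦄) (y , h , refl) , from ∈𝒫 k))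
        where
        fw : z ∈ ⋃ (img 𝒫T ⦃ def𝒫T ⦄ ∙ s) → ∃[ y ] (y ∈ s × z ⊆ y)
        fw h with to ∈⋃ h
        ... | w , e , k with to (∈img 𝒫T ⦃ def𝒫T ⦄) e
        ... | y , l , refl = y , l , to ∈𝒫 k
      private instance
       iPow : ∀ {n} {s : Env n → V} ⦃ _ : DefT full s ⦄ → DefT full (λ γ → Pow (s γ))
       iPow ⦃ a ⦄ = subT1 Pow (byMem {t = λ γ → Pow (last γ)} (λ (∙ ▹ s) z → ∃[ y ] (y ∈ s × (∀ x → x ∈ z → x ∈ y))) λ γ z → ∈Pow) a

    private
      ∈P : Env 0 → V → Set ℓ
      ∈P _ p = fst p ∈ snd p
    private
     opaque
      def∈P : Def full {1} (λ γ → ∈P (init γ) (last γ))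
      def∈P = find _
    opaque
      ∈On : V → V
      ∈On T = sep ∈P ⦃ def∈P ⦄ ∙ (T ⊗ T)
      ⟪⟫∈On : ∀ {T x y} → ⟪ x ، y ⟫ ∈ ∈On T ⇔ (x ∈ T × y ∈ T × x ∈ y)
      ⟪⟫∈On {T} = mk⇔
        (λ k → let (a , b) = to (∈sep ∈P ⦃ def∈P ⦄ ∙ (T ⊗ T)) k ; (x∈ , y∈) = to pair∈⊗ a in x∈ , y∈ , subst₂ _∈_ fst-⟪⟫ snd-⟪⟫ b)
        (λ (x∈ , y∈ , k) → from (∈sep ∈P ⦃ def∈P ⦄ ∙ (T ⊗ T)) (from pair∈⊗ (x∈ , y∈) , subst₂ _∈_ (sym fst-⟪⟫) (sym snd-⟪⟫) k))
    ∈On-WF : ∀ T → WF T (∈On T)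
    ∈On-WF T S s ne = let (m , h , min) = foundation S ne in m , h , λ x k l → min x (proj₂ (proj₂ (to ⟪⟫∈On l))) k
    private
      GR : V → V → V → V
      GR _ _ S = Pow S
      pre-∈ : ∀ {T c} → Tr T → c ∈ T → pre T (∈On T) c ≡ c
      pre-∈ {T} {c} tr h = ext (λ z k → proj₂ (proj₂ (to ⟪⟫∈On (proj₂ (to ∈pre k)))))
        λ z k → from ∈pre (trn tr c h z k , from ⟪⟫∈On (trn tr c h z k , h , k))
      -- Recursion is available on sets only, so the value at x is read off from a solution on some
      -- transitive set containing x. By ∈-induction the choice of that set does not matter.
      record RVal (x y : V) : Set ℓ where
        field
          {rT rf} : V
          r-tr : Tr rT
          r-∈ : x ∈ rT
          r-eq : ∀ c → c ∈ rT → app rf c ≡ Pow (rf ″ c)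
          r-val : y ≡ app rf x
      open RVal
      RP : Env 1 → V → Set ℓ
      RP (∙ ▹ x) y = RVal x y
      opaque
        dRP : Def full {2} (λ γ → RP (init γ) (last γ))
        dRP = iso {P = λ (∙ ▹ x ▹ y) → ∃[ T ] ∃[ f ] (Tr T × x ∈ T × (∀ c → c ∈ T → app f c ≡ Pow (f ″ c)) × y ≡ app f x)}
          (λ γ → mk⇔ (λ (T , f , a , b , c , d) → record { r-tr = a ; r-∈ = b ; r-eq = c ; r-val = d })
                      (λ r → rT r , rf r , r-tr r , r-∈ r , r-eq r , r-val r)) (find _)
        RAll : Def full {1} (λ γ → ∀ y z → RVal (last γ) y → RVal (last γ) z → y ≡ z)
        RAll = dAll ⦃ dAll ⦃ dImp ⦃ sub2 (λ γ → RP (init γ) (last γ)) dRP v2 v1 ⦄ ⦃ dImp ⦃ sub2 (λ γ → RP (init γ) (last γ)) dRP v2 v0 ⦄ ⦃ find _ ⦄ ⦄ ⦄ ⦄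
      opaque
       R-uniq : ∀ x y z → RVal x y → RVal x z → y ≡ z
       R-uniq = ∈-ind (λ _ x → ∀ y z → RVal x y → RVal x z → y ≡ z) ⦃ RAll ⦄ ∙ λ x ih y z a b →
         trans (r-val a) (trans (r-eq a x (r-∈ a)) (trans (cong Pow (″-cong λ w h →
           ih w h _ _ (record { r-tr = r-tr a ; r-∈ = trn (r-tr a) x (r-∈ a) w h ; r-eq = r-eq a ; r-val = refl })
                      (record { r-tr = r-tr b ; r-∈ = trn (r-tr b) x (r-∈ b) w h ; r-eq = r-eq b ; r-val = refl })))
           (trans (sym (r-eq b x (r-∈ b))) (sym (r-val b)))))
      opaque
       R-ex : ∀ x → ∃[ y ] RVal x y
       R-ex x = let (T , tr , h) = tc-exists x
                    (f , F , q) = WfRec.wf-rec GR ∅ T (∈On T) (∈On-WF T)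
                in app f x , record { r-tr = tr ; r-∈ = h ; r-val = refl
                     ; r-eq = λ c k → trans (q c k) (cong (λ s → Pow (f ″ s)) (pre-∈ tr k)) }
    opaque
      R : V → V
      R x = ι RP ⦃ dRP ⦄ (∙ ▹ x)
      private
        R-val : ∀ {x} → RVal x (R x)
        R-val {x} = let (y , r) = R-ex x in subst (RVal x) (sym (ι-eq RP ⦃ dRP ⦄ r λ z s → R-uniq x z y s r)) r
      ∈R : ∀ {x z} → z ∈ R x ⇔ (∃[ y ] (y ∈ x × z ⊆ R y))
      ∈R {x} {z} = mk⇔ fw bw
        where
        r : RVal x (R x)
        r = R-val {x}
        eqR : R x ≡ Pow (rf r ″ x)
        eqR = trans (r-val r) (r-eq r x (r-∈ r))
        sub : ∀ {y} → y ∈ x → app (rf r) y ≡ R y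
        sub h = R-uniq _ _ _ (record { r-tr = r-tr r ; r-∈ = trn (r-tr r) x (r-∈ r) _ h ; r-eq = r-eq r ; r-val = refl }) R-val
        fw : z ∈ R x → ∃[ y ] (y ∈ x × z ⊆ R y)
        fw h = let (w , e , k) = to ∈Pow (subst (z ∈_) eqR h) ; (y , l , q) = to ∈″ e in
          y , l , subst (z ⊆_) (trans q (sub l)) k
        bw : (∃[ y ] (y ∈ x × z ⊆ R y)) → z ∈ R x
        bw (y , l , k) = subst (z ∈_) (sym eqR) (from ∈Pow (R y , from ∈″ (y , l , sym (sub l)) , k))
      instance
       iR : ∀ {n} {s : Env n → V} ⦃ _ : DefT full s ⦄ → DefT full (λ γ → R (s γ))
       iR ⦃ a ⦄ = subT1 R (iι RP ⦃ dRP ⦄) a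

    R-Tr : ∀ x → Tr (R x)
    R-Tr = ∈-ind (λ _ x → Tr (R x)) ∙ λ x ih → record { trn = λ z h y k →
      let (w , l , s) = to ∈R h in from ∈R (w , l , trn (ih w l) y (s y k)) }

    R-∈ : ∀ {x y} → x ∈ y → R x ∈ R y
    R-∈ h = from ∈R (_ , h , λ _ k → k)

    R-super : ∀ {x y z} → y ∈ R x → z ⊆ y → z ∈ R x
    R-super h s = let (w , l , t) = to ∈R h in from ∈R (w , l , λ u k → t u (s u k))

    R-mono : ∀ {x y} → x ⊆ y → R x ⊆ R y
    R-mono s z h = let (w , l , t) = to ∈R h in from ∈R (w , s w l , t)

    R-⊆ : ∀ x → x ⊆ R x
    R-⊆ = ∈-ind (λ _ x → x ⊆ R x) ∙ λ x ih y h → from ∈R (y , h , ih y h)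

    private
      RkP : Env 1 → V → Set ℓ
      RkP (∙ ▹ x) α = Ord α × x ⊆ R α × (∀ β → β ∈ α → ¬ x ⊆ R β)
      least-uniq : ∀ {α β y} → Ord α → Ord β → (∀ γ → γ ∈ α → ¬ y ⊆ R γ) → (∀ γ → γ ∈ β → ¬ y ⊆ R γ) →
                   y ⊆ R α → y ⊆ R β → α ≡ β
      least-uniq a b m n s t with Ord-cmp a b
      ... | inj₁ h = ⊥-elim (n _ h s)
      ... | inj₂ (inj₁ e) = e
      ... | inj₂ (inj₂ h) = ⊥-elim (m _ h t)
    private
     opaque
      defRkP : Def full {2} (λ γ → RkP (init γ) (last γ))
      defRkP = find _
    opaque
      rk : V → V
      rk x = ι RkP ⦃ defRkP ⦄ (∙ ▹ x)
      rk-spec : ∀ {y} → ∃[ α ] (Ord α × y ⊆ R α) → Ord (rk y) × y ⊆ R (rk y) × (∀ β → β ∈ rk y → ¬ y ⊆ R β)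
      rk-spec {y} e = let (α , o , s , m) = Ord-least (λ (∙ ▹ y) α → y ⊆ R α) (∙ ▹ y) e
                          q = ι-eq RkP ⦃ defRkP ⦄ {∙ ▹ y} (o , s , m) λ β (p , t , n) → least-uniq p o n m t s
                      in subst (λ a → Ord a × y ⊆ R a × (∀ β → β ∈ a → ¬ y ⊆ R β)) (sym q) (o , s , m)
      instance
       irk : ∀ {n} {s : Env n → V} ⦃ _ : DefT full s ⦄ → DefT full (λ γ → rk (s γ))
       irk ⦃ a ⦄ = subT1 rk (iι RkP ⦃ defRkP ⦄) a
    private
      SrkT : Env 0 → V → V
      SrkT _ y = sucV (rk y)
      opaque
        defSrkT : DefT full {1} (λ γ → SrkT (init γ) (last γ))
        defSrkT = findT _
      opaque
       rk-ex : ∀ x → ∃[ α ] (Ord α × x ⊆ R α)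
       rk-ex = ∈-ind (λ _ x → ∃[ α ] (Ord α × x ⊆ R α)) ∙ λ x ih →
         ⋃ (img SrkT ⦃ defSrkT ⦄ ∙ x) ,
         Ord-⋃ (λ α h → let (y , k , q) = to (∈img SrkT ⦃ defSrkT ⦄) h in subst Ord (sym q) (Ord-suc (proj₁ (rk-spec (ih y k))))) ,
         λ y h → from ∈R (rk y , from ∈⋃ (_ , from (∈img SrkT ⦃ defSrkT ⦄) (y , h , refl) , ∈suc-refl) , proj₁ (proj₂ (rk-spec (ih y h))))
    rk-Ord : ∀ {x} → Ord (rk x)
    rk-Ord {x} = proj₁ (rk-spec (rk-ex x))
    rk-⊆ : ∀ {x} → x ⊆ R (rk x)
    rk-⊆ {x} = proj₁ (proj₂ (rk-spec (rk-ex x)))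
    rk-≤ : ∀ {x α} → Ord α → x ⊆ R α → rk x ∈ sucV α
    rk-≤ {x} {α} o s with Ord-cmp (rk-Ord {x}) (Ord-suc o)
    ... | inj₁ h = h
    ... | inj₂ (inj₁ e) = ⊥-elim (proj₂ (proj₂ (rk-spec (rk-ex x))) α (subst (α ∈_) (sym e) ∈suc-refl) s)
    ... | inj₂ (inj₂ h) = ⊥-elim (proj₂ (proj₂ (rk-spec (rk-ex x))) α (Ord-tr rk-Ord ∈suc-refl h) s)
    rk-∈ : ∀ {x y} → x ∈ y → rk x ∈ rk y
    rk-∈ {x} {y} h = let (β , k , s) = to ∈R (rk-⊆ x h) in f (rk-≤ (Ord-∈ rk-Ord k) s) k
      where
      f : ∀ {β} → rk x ∈ sucV β → β ∈ rk y → rk x ∈ rk y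
      f h k with to ∈suc h
      ... | inj₁ h = Ord-tr rk-Ord h k
      ... | inj₂ refl = k

    Ord-R : ∀ {α β} → Ord α → Ord β → β ∈ R α → β ∈ α
    Ord-R {α} {β} a b h = Ord-ind (λ _ α → ∀ β → Ord β → β ∈ R α → β ∈ α) ∙ step α a β b h
      where
      step : ∀ α → Ord α → (∀ δ → δ ∈ α → ∀ β → Ord β → β ∈ R δ → β ∈ δ) → ∀ β → Ord β → β ∈ R α → β ∈ α
      step α a ih β b h = let (γ , k , s) = to ∈R h in
        f k (Ord-⊆ b (Ord-∈ a k) λ δ l → ih γ k δ (Ord-∈ b l) (s δ l))
        where
        f : ∀ {γ} → γ ∈ α → β ∈ γ ⊎ β ≡ γ → β ∈ α
        f k (inj₁ l) = Ord-tr a l k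
        f k (inj₂ refl) = k
  open Hierarchy public

  -- Least ordinals, collection, choice and closure points.

  module Collection where
    module Mu {n} (P : Env n → V → Set ℓ) ⦃ d : Def full {suc n} (λ γ → P (init γ) (last γ)) ⦄ where
      private
        Q : Env n → V → Set ℓ
        Q γ α = Ord α × P γ α × (∀ β → β ∈ α → ¬ P γ β)
        opaque
          dQ : Def full {suc n} (λ γ → Q (init γ) (last γ))
          dQ = dAnd ⦃ find _ ⦄ ⦃ dAnd ⦃ d ⦄ ⦃ dAll ⦃ dImp ⦃ find _ ⦄ ⦃ dNot ⦃ exch {P = λ γ x _ → P γ x} (wkD d) ⦄ ⦄ ⦄ ⦄ ⦄
      opaque
        μ : Env n → V
        μ γ = ι Q ⦃ dQ ⦄ γ
        iμ : DefT full μ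
        iμ = iι Q ⦃ dQ ⦄
        μ-spec : ∀ {γ} → ∃[ α ] (Ord α × P γ α) → Ord (μ γ) × P γ (μ γ) × (∀ β → β ∈ μ γ → ¬ P γ β)
        μ-spec {γ} e = let (α , o , p , m) = Ord-least P γ e
                           q = ι-eq Q ⦃ dQ ⦄ {γ} (o , p , m) λ β (b , p′ , m′) → u b o m′ m p′ p
                       in subst (Q γ) (sym q) (o , p , m)
          where
          u : ∀ {α β} → Ord α → Ord β → (∀ δ → δ ∈ α → ¬ P γ δ) → (∀ δ → δ ∈ β → ¬ P γ δ) → P γ α → P γ β → α ≡ β
          u a b m n s t with Ord-cmp a b
          ... | inj₁ h = ⊥-elim (n _ h s)
          ... | inj₂ (inj₁ e) = e
          ... | inj₂ (inj₂ h) = ⊥-elim (m _ h t)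

    ∪-Ord : ∀ {α β} → Ord α → Ord β → Ord (⋃ (α ,, β))
    ∪-Ord {α} {β} a b = Ord-⋃ λ x h → f (to ∈,, h)
      where
      f : ∀ {x} → x ≡ α ⊎ x ≡ β → Ord x
      f (inj₁ refl) = a
      f (inj₂ refl) = b
    ⊆∪l : ∀ {α β} → α ⊆ ⋃ (α ,, β)
    ⊆∪l z h = from ∈⋃ (_ , ∈l , h)
    ⊆∪r : ∀ {α β} → β ⊆ ⋃ (α ,, β)
    ⊆∪r z h = from ∈⋃ (_ , ∈r , h)

    -- Limits above ω: then V_x contains ω, and ω-sequences of its elements are subsets of it, as
    -- the well-foundedness of the ultrapower requires.
    record Lim (x : V) : Set ℓ where
      field
        lim-Ord : Ord x
        lim-ω : ω ∈ x
        lim-suc : ∀ y → y ∈ x → sucV y ∈ x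
    open Lim public

    module Choice (T : V → V → V → Set ℓ) (dT : Def full {3} (λ γ → T (last (init (init γ))) (last (init γ)) (last γ))) where
      opaque
       instance
        iT : ∀ {n} {s t u : Env n → V} ⦃ _ : DefT full s ⦄ ⦃ _ : DefT full t ⦄ ⦃ _ : DefT full u ⦄ →
             Def full (λ γ → T (s γ) (t γ) (u γ))
        iT ⦃ a ⦄ ⦃ b ⦄ ⦃ c ⦄ = sub3 (λ (∙ ▹ p ▹ x ▹ y) → T p x y) dT a b c
      private
        HP : Env 2 → V → Set ℓ
        HP (∙ ▹ p ▹ x) α = ∃[ y ] (y ∈ R α × T p x y)
        open Mu HP
        MT : Env 1 → V → V
        MT (∙ ▹ p) x = μ (∙ ▹ p ▹ x)
        opaque
         private
          iMT : DefT full {2} (λ γ → MT (init γ) (last γ))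
          iMT = iμ
         instance
          iμT : ∀ {n} {s t : Env n → V} ⦃ _ : DefT full s ⦄ ⦃ _ : DefT full t ⦄ → DefT full (λ γ → μ (∙ ▹ s γ ▹ t γ))
          iμT ⦃ a ⦄ ⦃ b ⦄ = subT2 (λ p x → μ (∙ ▹ p ▹ x)) iμ a b
        lev : ∀ {p x} → ∃[ y ] T p x y → ∃[ α ] (Ord α × HP (∙ ▹ p ▹ x) α)
        lev (y , t) = sucV (rk y) , Ord-suc rk-Ord , y , from ∈R (rk y , ∈suc-refl , rk-⊆) , t
      opaque
        -- Collection: each x has a least level at which a partner occurs, and this is the supremum
        -- of these levels over D.
        bnd : V → V → V
        bnd p D = ⋃ (img MT ⦃ iMT ⦄ (∙ ▹ p) D)
        bnd-Ord : ∀ {p D} → (∀ x → x ∈ D → ∃[ y ] T p x y) → Ord (bnd p D)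
        bnd-Ord {p} {D} f = Ord-⋃ λ α h → let (x , e , q) = to (∈img MT ⦃ iMT ⦄) h in subst Ord (sym q) (proj₁ (μ-spec (lev (f x e))))
        bnd-∈ : ∀ {p D} → (∀ x → x ∈ D → ∃[ y ] T p x y) → ∀ x → x ∈ D → ∃[ y ] (y ∈ R (bnd p D) × T p x y)
        bnd-∈ {p} {D} f x h = let (o , (y , k , t) , _) = μ-spec (lev (f x h)) in
            y , R-mono (λ z l → from ∈⋃ (_ , from (∈img MT ⦃ iMT ⦄) (x , h , refl) , l)) y k , t
        private instance
         ibnd : ∀ {n} {s t : Env n → V} ⦃ _ : DefT full s ⦄ ⦃ _ : DefT full t ⦄ → DefT full (λ γ → bnd (s γ) (t γ))
         ibnd ⦃ a ⦄ ⦃ b ⦄ = subT2 bnd (byMem {t = λ γ → bnd (last (init γ)) (last γ)}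
           (λ (∙ ▹ p ▹ D) z → ∃[ x ] (x ∈ D × z ∈ μ (∙ ▹ p ▹ x)))
           λ (∙ ▹ p ▹ D) z → mk⇔ (λ h → let (w , i , j) = to ∈⋃ h ; (x , k , e) = to (∈img MT ⦃ iMT ⦄) i in x , k , subst (z ∈_) e j)
             (λ (x , k , j) → from ∈⋃ (_ , from (∈img MT ⦃ iMT ⦄) (x , k , refl) , j))) a b

      private
        AP : Env 2 → V → Set ℓ
        AP (∙ ▹ p ▹ x) z = fst z ≡ x × T p x (snd z)
        opaque
          defAP : Def full {3} (λ γ → AP (init γ) (last γ))
          defAP = find _
        AT : Env 2 → V → V
        AT (∙ ▹ p ▹ B) x = sep AP ⦃ defAP ⦄ (∙ ▹ p ▹ x) (sing x ⊗ B)
        opaque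
         instance
          iAT : DefT full {3} (λ γ → AT (init γ) (last γ))
          iAT = byMem (λ (∙ ▹ p ▹ B ▹ x) z → z ∈ (sing x ⊗ B) × (fst z ≡ x × T p x (snd z)))
                  λ (∙ ▹ p ▹ B ▹ x) z → ∈sep AP ⦃ defAP ⦄ (∙ ▹ p ▹ x) (sing x ⊗ B)
        ∈AT : ∀ {p B x z} → z ∈ AT (∙ ▹ p ▹ B) x → ∃[ y ] (z ≡ ⟪ x ، y ⟫ × y ∈ B × T p x y)
        ∈AT {p} {B} {x} {z} h with to (∈sep AP ⦃ defAP ⦄ (∙ ▹ p ▹ x) (sing x ⊗ B)) h
        ... | k , e , t with to ∈⊗ k
        ... | x′ , l , y , m , refl with to ∈sing l
        ... | refl = y , refl , m , subst (T p x) snd-⟪⟫ t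
        AT∈ : ∀ {p B x y} → y ∈ B → T p x y → ⟪ x ، y ⟫ ∈ AT (∙ ▹ p ▹ B) x
        AT∈ {p} {B} {x} {y} h t = from (∈sep AP ⦃ defAP ⦄ (∙ ▹ p ▹ x) (sing x ⊗ B))
          (from pair∈⊗ (from ∈sing refl , h) , fst-⟪⟫ , subst (T p x) (sym snd-⟪⟫) t)
      private
       opaque
        defAT : DefT full {3} (λ γ → AT (init γ) (last γ))
        defAT = findT _
      -- The axiom of choice selects from disjoint families. The partners of x below the bound `bnd`
      -- are therefore tagged with x, which also turns the selector into a function.
      uniformize : ∀ p D → (∀ x → x ∈ D → ∃[ y ] T p x y) → ∃[ f ] (Fn f D × (∀ x → x ∈ D → T p x (app f x)))
      uniformize p D tot = f , F , λ x h → proj₂ (Fval h)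
        where
        B = R (bnd p D)
        γ : Env 2
        γ = ∙ ▹ p ▹ B
        A = img AT ⦃ defAT ⦄ γ D
        ne : ∀ x → x ∈ A → NonEmpty x
        ne a h with to (∈img AT ⦃ defAT ⦄) h
        ... | x , e , refl = let (y , k , t) = bnd-∈ tot x e in _ , AT∈ k t
        disj : ∀ x y z → x ∈ A → y ∈ A → z ∈ x → z ∈ y → x ≡ y
        disj a b z h k l m with to (∈img AT ⦃ defAT ⦄) h | to (∈img AT ⦃ defAT ⦄) k
        ... | x , _ , refl | y , _ , refl with ∈AT l | ∈AT m
        ... | _ , e , _ | _ , e′ , _ with ⟪⟫-inj₁ (trans (sym e) e′)
        ... | refl = refl
        C = proj₁ (choice A ne disj)
        CP : Env 1 → V → Set ℓ
        CP (∙ ▹ C) z = z ∈ C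
        opaque
          defCP : Def full {2} (λ γ → CP (init γ) (last γ))
          defCP = find _
        f : V
        f = sep CP ⦃ defCP ⦄ (∙ ▹ C) (⋃ A)
        pick : ∀ x → x ∈ D → ∃[ y ] (T p x y × ⟪ x ، y ⟫ ∈ f × (∀ z → ⟪ x ، z ⟫ ∈ f → z ≡ y))
        pick x h with proj₂ (choice A ne disj) (AT γ x) (from (∈img AT ⦃ defAT ⦄) (x , h , refl))
        ... | z , (k , c) , u with ∈AT k
        ... | y , refl , yB , t = y , t , from (∈sep CP ⦃ defCP ⦄ (∙ ▹ C) (⋃ A)) (from ∈⋃ (_ , from (∈img AT ⦃ defAT ⦄) (x , h , refl) , k) , c) ,
          λ w l → let (q , c′) = to (∈sep CP ⦃ defCP ⦄ (∙ ▹ C) (⋃ A)) l ; (a , i , j) = to ∈⋃ q in ⟪⟫-inj₂ (sym (u (inA i j , c′)))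
          where
          inA : ∀ {a w} → a ∈ A → ⟪ x ، w ⟫ ∈ a → ⟪ x ، w ⟫ ∈ AT γ x
          inA i j with to (∈img AT ⦃ defAT ⦄) i
          ... | x′ , _ , refl with ∈AT j
          ... | _ , e , _ with ⟪⟫-inj₁ e
          ... | refl = j
        F : Fn f D
        F = record { fn-rel = rel ; fn-tot = λ x h → let (y , _ , k , _) = pick x h in y , k
          ; fn-uni = λ x h y z k l → let (_ , _ , _ , u) = pick x h in trans (u y k) (sym (u z l)) }
          where
          rel : ∀ q → q ∈ f → ∃[ x ] (x ∈ D × ∃[ y ] (q ≡ ⟪ x ، y ⟫))
          rel q h with to ∈⋃ (proj₁ (to (∈sep CP ⦃ defCP ⦄ (∙ ▹ C) (⋃ A)) h))
          ... | a , i , j with to (∈img AT ⦃ defAT ⦄) i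
          ... | x , e , refl = let (y , q , _) = ∈AT j in x , e , y , q
        Fval : ∀ {x} → x ∈ D → ⟪ x ، app f x ⟫ ∈ f × T p x (app f x)
        Fval {x} h = let (y , t , k , _) = pick x h in
          app-∈ F h , subst (T p x) (sym (app-eq F k)) t

      private
        NxT : V → V → V
        NxT p α = sucV (⋃ (α ,, bnd p (R α)))
      opaque
       -- Starting above z and ω, the level is raised ω times, each time beyond the bound for
       -- partners of everything present. The successor in `NxT` makes the stages strictly
       -- increasing, so their supremum is a limit.
       closure : ∀ p → (∀ x → ∃[ y ] T p x y) → ∀ z →
                 ∃[ λ′ ] (Lim λ′ × z ∈ R λ′ × (∀ x → x ∈ R λ′ → ∃[ y ] (y ∈ R λ′ × T p x y)))
       closure p tot z = L , lim , R-mono (λ δ h → from ∈⋃ (_ , in-s ∅∈ω , subst (δ ∈_) (sym s0) h)) z z∈ , cl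
         where
         α₀ β₀ : V
         α₀ = ⋃ (rk z ,, ω)
         β₀ = sucV α₀
         z∈ : z ∈ R β₀
         z∈ = from ∈R (α₀ , ∈suc-refl , λ w h → R-mono ⊆∪l w (rk-⊆ w h))
         S : ∃[ s ] (Fn s ω × app s ∅ ≡ β₀ × (∀ n → n ∈ ω → app s (sucV n) ≡ NxT p (app s n)))
         S = ω-rec NxT p β₀
         s L : V
         s = proj₁ S
         s0 : app s ∅ ≡ β₀
         s0 = proj₁ (proj₂ (proj₂ S))
         s1 : ∀ n → n ∈ ω → app s (sucV n) ≡ NxT p (app s n)
         s1 = proj₂ (proj₂ (proj₂ S))
         L = ⋃ (s ″ ω)
         in-s : ∀ {n} → n ∈ ω → app s n ∈ s ″ ω
         in-s h = from ∈″ (_ , h , refl)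
         sOrd : ∀ n → n ∈ ω → Ord (app s n)
         sOrd = ω-ind (λ (∙ ▹ s) n → Ord (app s n)) (∙ ▹ s) (subst Ord (sym s0) (Ord-suc (∪-Ord rk-Ord Ord-ω)))
           λ m h o → subst Ord (sym (s1 m h)) (Ord-suc (∪-Ord o (bnd-Ord λ x _ → tot x)))
         up : ∀ {n} → n ∈ ω → app s n ∈ app s (sucV n)
         up {n} h = subst (app s n ∈_) (sym (s1 n h)) (from ∈suc (Ord-⊆ (sOrd n h) (∪-Ord (sOrd n h) (bnd-Ord λ x _ → tot x)) ⊆∪l))
         oL : Ord L
         oL = Ord-⋃ λ x h → let (n , k , e) = to ∈″ h in subst Ord (sym e) (sOrd n k)
         lim : Lim L
         lim = record { lim-Ord = oL
           ; lim-ω = from ∈⋃ (_ , in-s ∅∈ω , subst (ω ∈_) (sym s0) (from ∈suc (Ord-⊆ Ord-ω (∪-Ord rk-Ord Ord-ω) ⊆∪r)))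
           ; lim-suc = λ y h → let (w , k , l) = to ∈⋃ h ; (n , n∈ , e) = to ∈″ k in
               from ∈⋃ (_ , in-s (suc∈ω n∈) , f (Ord-suc (Ord-∈ oL h)) (sOrd _ (suc∈ω n∈))
                 (Ord-suc-⊆ (sOrd n n∈) (subst (y ∈_) e l)) (up n∈) (sOrd n n∈)) }
           where
           f : ∀ {a b c} → Ord a → Ord b → a ⊆ c → c ∈ b → Ord c → a ∈ b
           f a b s h c with Ord-⊆ a c s
           ... | inj₁ k = Ord-tr b k h
           ... | inj₂ refl = h
         cl : ∀ x → x ∈ R L → ∃[ y ] (y ∈ R L × T p x y)
         cl x h = let (α , k , t) = to ∈R h ; (w , i , j) = to ∈⋃ k ; (n , n∈ , e) = to ∈″ i
                      (y , y∈ , r) = bnd-∈ {p} {R (app s n)} (λ x _ → tot x) x (from ∈R (α , subst (α ∈_) e j , t))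
                  in y , R-mono (λ δ l → from ∈⋃ (_ , in-s (suc∈ω n∈) , subst (δ ∈_) (sym (s1 n n∈)) (from ∈suc (inj₁ (⊆∪r δ l))))) y y∈ , r
  open Collection public

  module StrongCardinals where
   private

    -- Dependent choice, cardinals and Hartogs' theorem.

    module Cardinals where
      module DC (T : V → V → V → Set ℓ) (dT : Def full {3} (λ γ → T (last (init (init γ))) (last (init γ)) (last γ))) where
        open Choice T dT using (iT)
        private
          T′ : V → V → V → Set ℓ
          T′ q x y = y ∈ snd q × T (fst q) x y
          ApT : V → V → V
          ApT f x = app f x
        opaque
         dc : ∀ p D x₀ → x₀ ∈ D → (∀ x → x ∈ D → ∃[ y ] (y ∈ D × T p x y)) →
              ∃[ s ] (Fn s ω × app s ∅ ≡ x₀ × (∀ n → n ∈ ω → app s n ∈ D × T p (app s n) (app s (sucV n))))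
         dc p D x₀ h₀ tot =
           let q = ⟪ p ، D ⟫
               (f , F , u) = Choice.uniformize T′ (find _) q D λ x h → let (y , k , t) = tot x h in
                 y , subst (y ∈_) (sym snd-⟪⟫) k , subst (λ p → T p x y) (sym fst-⟪⟫) t
               v : ∀ x → x ∈ D → app f x ∈ D × T p x (app f x)
               v x h = let (k , t) = u x h in subst (app f x ∈_) snd-⟪⟫ k , subst (λ p → T p x (app f x)) fst-⟪⟫ t
               (s , S , s0 , s1) = ω-rec ApT f x₀
               inD : ∀ n → n ∈ ω → app s n ∈ D
               inD = ω-ind (λ (∙ ▹ s ▹ D) n → app s n ∈ D) (∙ ▹ s ▹ D) (subst (_∈ D) (sym s0) h₀)
                       λ m h k → subst (_∈ D) (sym (s1 m h)) (proj₁ (v _ k))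
           in s , S , s0 , λ n h → inD n h , subst (T p (app s n)) (sym (s1 n h)) (proj₂ (v _ (inD n h)))

      Lim-𝒫 : ∀ {x y} → Lim x → y ∈ R x → 𝒫 y ∈ R x
      Lim-𝒫 {x} {y} l h = let (α , k , s) = to ∈R h in from ∈R (sucV α , lim-suc l α k , λ z z∈ → from ∈R (α , ∈suc-refl , λ w w∈ → s w (to ∈𝒫 z∈ w w∈)))

      Lim-join : ∀ {x a b} → Lim x → a ∈ x → b ∈ x → ∃[ c ] (c ∈ x × a ⊆ c × b ⊆ c)
      Lim-join {x} {a} {b} l h k with Ord-cmp (Ord-∈ (lim-Ord l) h) (Ord-∈ (lim-Ord l) k)
      ... | inj₁ e = b , k , (λ z m → Ord-tr (Ord-∈ (lim-Ord l) k) m e) , λ _ m → m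
      ... | inj₂ (inj₁ refl) = a , h , (λ _ m → m) , λ _ m → m
      ... | inj₂ (inj₂ e) = a , h , (λ _ m → m) , λ z m → Ord-tr (Ord-∈ (lim-Ord l) h) m e

      Lim-Good : ∀ {x} → Lim x → Good (_∈ R x)
      Lim-Good {x} l = record
        { tr = λ h k → trn (R-Tr x) _ k _ h
        ; cl-,, = pairs
        ; cl-⋃ = λ h → let (α , k , s) = to ∈R h in from ∈R (α , k , λ z m → let (w , i , j) = to ∈⋃ m in trn (R-Tr α) w (s w i) z j)
        ; cl-∅ = from ∈R (ω , lim-ω l , λ z h → ⊥-elim (∉∅ h)) }
        where
        pairs : ∀ {y z} → y ∈ R x → z ∈ R x → (y ,, z) ∈ R x
        pairs {y} {z} h k = let (a , a∈ , s) = to ∈R h ; (b , b∈ , t) = to ∈R k ; (c , c∈ , p , q) = Lim-join l a∈ b∈ in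
          from ∈R (sucV c , lim-suc l c c∈ , λ w m → f c (λ w n → R-mono p w (s w n)) (λ w n → R-mono q w (t w n)) (to ∈,, m))
          where
          f : ∀ c {w} → y ⊆ R c → z ⊆ R c → w ≡ y ⊎ w ≡ z → w ∈ R (sucV c)
          f c s t (inj₁ refl) = from ∈R (c , ∈suc-refl , s)
          f c s t (inj₂ refl) = from ∈R (c , ∈suc-refl , t)

      private
        RT : Env 0 → V → V
        RT _ x = R x
      private
       opaque
        defRT : DefT full {1} (λ γ → RT (init γ) (last γ))
        defRT = findT _
      RankInit : ∀ {α} → Ord α → IsRankInitialSegment α (R α)
      RankInit {α} o = lam RT ⦃ defRT ⦄ ∙ (sucV α) , sucV α , (λ z → ∈suc) , to Fn⇔ (lam-Fn RT ⦃ defRT ⦄) ,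
        from ∋⇔ (from (∈lam RT ⦃ defRT ⦄) (α , ∈suc-refl , refl)) , λ β v h z → lvl (to ∋⇔ h)
        where
        rv : ∀ {β v} → ⟪ β ، v ⟫ ∈ lam RT ⦃ defRT ⦄ ∙ (sucV α) → β ∈ sucV α × v ≡ R β
        rv h with to (∈lam RT ⦃ defRT ⦄) h
        ... | x , e , q with ⟪⟫-inj₁ q
        ... | refl = e , ⟪⟫-inj₂ q
        lvl : ∀ {β v z} → ⟪ β ، v ⟫ ∈ lam RT ⦃ defRT ⦄ ∙ (sucV α) →
              z ∈ v ⇔ (∃₂ λ γ w → γ ∈ β × (lam RT ⦃ defRT ⦄ ∙ (sucV α) ∋⟨ γ ⨾ w ⟩) × z ⊆ w)
        lvl h with rv h
        ... | b , refl = mk⇔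
          (λ k → let (γ , e , s) = to ∈R k in γ , R γ , e , from ∋⇔ (from (∈lam RT ⦃ defRT ⦄) (γ , Ord-tr (Ord-suc o) e b , refl)) , s)
          (λ (γ , w , e , k , s) → from ∈R (γ , e , subst (_ ⊆_) (proj₂ (rv (to ∋⇔ k))) s))

      RankInit-uniq : ∀ {α v} → Ord α → IsRankInitialSegment α v → v ≡ R α
      RankInit-uniq {α} {v} o (f , s , iss , F , fα , lv) = trans (sym (app-eq F′ (to ∋⇔ fα))) (all-eq α o (from (iss α) (inj₂ refl)))
        where
        F′ : Fn f s
        F′ = from Fn⇔ F
        all-eq : ∀ β → Ord β → β ∈ s → app f β ≡ R β
        all-eq = Ord-ind (λ (∙ ▹ f ▹ s) β → β ∈ s → app f β ≡ R β) (∙ ▹ f ▹ s) λ β b ih h →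
          let at : ∀ {γ} → γ ∈ β → γ ∈ s
              at k = from (iss _) (inj₁ (below k (to (iss β) h)))
              lev = lv β (app f β) (from ∋⇔ (app-∈ F′ h))
          in ext (λ z k → let (γ , w , e , l , t) = to (lev z) k in
                     from ∈R (γ , e , subst (z ⊆_) (trans (sym (app-eq F′ (to ∋⇔ l))) (ih γ e (at e))) t))
                 (λ z k → let (γ , e , t) = to ∈R k in
                     from (lev z) (γ , app f γ , e , from ∋⇔ (app-∈ F′ (at e)) , subst (z ⊆_) (sym (ih γ e (at e))) t))
          where
          below : ∀ {β γ} → γ ∈ β → β ∈ α ⊎ β ≡ α → γ ∈ α
          below k (inj₁ h) = Ord-tr o k h
          below k (inj₂ refl) = k

      record Inj (g a b : V) : Set ℓ where
        field
          inj-Fn : Fn g a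
          inj-into : ∀ x → x ∈ a → app g x ∈ b
          inj-inj : ∀ x → x ∈ a → ∀ y → y ∈ a → app g x ≡ app g y → x ≡ y
      open Inj public
      opaque
       private instance
        iInj : ∀ {m n} {s t u : Env n → V} ⦃ _ : DefT m s ⦄ ⦃ _ : DefT m t ⦄ ⦃ _ : DefT m u ⦄ → Def m (λ γ → Inj (s γ) (t γ) (u γ))
        iInj ⦃ a ⦄ ⦃ b ⦄ ⦃ c ⦄ = sub3 (λ (∙ ▹ g ▹ a ▹ b) → Inj g a b) (any (iso
          {P = λ (∙ ▹ g ▹ a ▹ b) → Fn g a × (∀ x → x ∈ a → app g x ∈ b) × (∀ x → x ∈ a → ∀ y → y ∈ a → app g x ≡ app g y → x ≡ y)}
          (λ γ → mk⇔ (λ (f , i , j) → record { inj-Fn = f ; inj-into = i ; inj-inj = j }) (λ i → inj-Fn i , inj-into i , inj-inj i))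
          (find _))) a b c
      record Bij (g a b : V) : Set ℓ where
        field
          bij-Inj : Inj g a b
          bij-onto : ∀ y → y ∈ b → ∃[ x ] (x ∈ a × app g x ≡ y)
      open Bij public
      opaque
       instance
        iBij : ∀ {m n} {s t u : Env n → V} ⦃ _ : DefT m s ⦄ ⦃ _ : DefT m t ⦄ ⦃ _ : DefT m u ⦄ → Def m (λ γ → Bij (s γ) (t γ) (u γ))
        iBij ⦃ a ⦄ ⦃ b ⦄ ⦃ c ⦄ = sub3 (λ (∙ ▹ g ▹ a ▹ b) → Bij g a b) (any (iso
          {P = λ (∙ ▹ g ▹ a ▹ b) → Inj g a b × (∀ y → y ∈ b → ∃[ x ] (x ∈ a × app g x ≡ y))}
          (λ γ → mk⇔ (λ (i , j) → record { bij-Inj = i ; bij-onto = j }) (λ i → bij-Inj i , bij-onto i))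
          (find _))) a b c

      Bij⇒ : ∀ {g a b} → Bij g a b → IsBijection g a b
      Bij⇒ {g} {a} {b} B = (to Fn⇔ F , λ x y h → let k = to ∋⇔ h in subst (_∈ b) (app-eq F k) (inj-into I x (fn-dom F k))) ,
        λ y h → let (x , k , e) = bij-onto B y h in x , from ∋⇔ (subst (λ z → ⟪ x ، z ⟫ ∈ g) e (app-∈ F k)) ,
          λ {z} l → let m = to ∋⇔ l in inj-inj I x k z (fn-dom F m) (trans e (sym (app-eq F m)))
        where
        I : Inj g a b
        I = bij-Inj B
        F : Fn g a
        F = inj-Fn I

      ⇒Bij : ∀ {g a b} → IsBijection g a b → Bij g a b
      ⇒Bij {g} {a} {b} ((f , into) , onto) = record
        { bij-Inj = record { inj-Fn = F ; inj-into = λ x h → into x (app g x) (at h)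
            ; inj-inj = λ x h y k e → let (_ , _ , u) = onto (app g x) (into x _ (at h)) in
                trans (sym (u (at h))) (u (subst (λ z → g ∋⟨ y ⨾ z ⟩) (sym e) (at k))) }
        ; bij-onto = λ y h → let (x , k , _) = onto y h in x , fn-dom F (to ∋⇔ k) , app-eq F (to ∋⇔ k) }
        where
        F : Fn g a
        F = from Fn⇔ f
        at : ∀ {x} → x ∈ a → g ∋⟨ x ⨾ app g x ⟩
        at h = from ∋⇔ (app-∈ F h)

      record Card (μ : V) : Set ℓ where
        field
          card-Ord : Ord μ
          card-min : ∀ α → α ∈ μ → ¬ (∃[ f ] Bij f α μ)
      open Card public
      opaque
       private instance
        iCard : ∀ {n} {s : Env n → V} ⦃ _ : DefT full s ⦄ → Def full (λ γ → Card (s γ))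
        iCard ⦃ a ⦄ = sub1 (λ (∙ ▹ x) → Card x) (iso {P = λ (∙ ▹ x) → Ord x × (∀ α → α ∈ x → ¬ (∃[ f ] Bij f α x))}
          (λ γ → mk⇔ (λ (o , m) → record { card-Ord = o ; card-min = m }) (λ c → card-Ord c , card-min c)) (find _)) a

      Card⇔ : ∀ {μ} → Card μ ⇔ IsCardinal μ
      Card⇔ = mk⇔ (λ c → to Ord⇔ (card-Ord c) , λ α h (f , b) → card-min c α h (f , ⇒Bij b))
                   (λ (o , m) → record { card-Ord = from Ord⇔ o ; card-min = λ α h (f , b) → m α h (f , Bij⇒ b) })

      private
        IdT : Env 0 → V → V
        IdT _ x = x
      private
       opaque
        defIdT : DefT full {1} (λ γ → IdT (init γ) (last γ))
        defIdT = findT _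
      id-Inj : ∀ {a b} → a ⊆ b → Inj (lam IdT ⦃ defIdT ⦄ ∙ a) a b
      id-Inj {a} {b} s = record { inj-Fn = lam-Fn IdT ⦃ defIdT ⦄ ; inj-into = λ x h → subst (_∈ b) (sym (lam-app IdT ⦃ defIdT ⦄ h)) (s x h)
        ; inj-inj = λ x h y k e → trans (sym (lam-app IdT ⦃ defIdT ⦄ h)) (trans e (lam-app IdT ⦃ defIdT ⦄ k)) }

      private
        InvP : Env 3 → V → Set ℓ
        InvP (∙ ▹ f ▹ c ▹ y) x = x ∈ c × app f x ≡ y
        opaque
          defInvP : Def full {4} (λ γ → InvP (init γ) (last γ))
          defInvP = find _
        opaque
          invAt : V → V → V → V
          invAt f c y = ι InvP ⦃ defInvP ⦄ (∙ ▹ f ▹ c ▹ y)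
          invAt-eq : ∀ {f c y x} → InvP (∙ ▹ f ▹ c ▹ y) x → (∀ z → InvP (∙ ▹ f ▹ c ▹ y) z → z ≡ x) → invAt f c y ≡ x
          invAt-eq = ι-eq InvP ⦃ defInvP ⦄
          instance
           iinvAt : ∀ {n} {s t u : Env n → V} ⦃ _ : DefT full s ⦄ ⦃ _ : DefT full t ⦄ ⦃ _ : DefT full u ⦄ →
                    DefT full (λ γ → invAt (s γ) (t γ) (u γ))
           iinvAt ⦃ a ⦄ ⦃ b ⦄ ⦃ c ⦄ = subT3 invAt (iι InvP ⦃ defInvP ⦄) a b c
        GInvT : Env 3 → V → V
        GInvT (∙ ▹ f ▹ c ▹ g) y = app g (invAt f c y)
      private
       opaque
        defGInvT : DefT full {4} (λ γ → GInvT (init γ) (last γ))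
        defGInvT = findT _
      inv-Inj : ∀ {f c b g a} → Bij f c b → Inj g c a → ∃[ h ] Inj h b a
      inv-Inj {f} {c} {b} {g} {a} B I = h , record { inj-Fn = lam-Fn GInvT ⦃ defGInvT ⦄
          ; inj-into = λ y k → let (x , x∈ , e) = bij-onto B y k in subst (_∈ a) (sym (h-app k x∈ e)) (inj-into I x x∈)
          ; inj-inj = λ y k y′ k′ q → let (x , x∈ , e) = bij-onto B y k ; (x′ , x′∈ , e′) = bij-onto B y′ k′ in
              trans (sym e) (trans (cong (app f) (inj-inj I x x∈ x′ x′∈ (trans (sym (h-app k x∈ e)) (trans q (h-app k′ x′∈ e′))))) e′) }
        where
        h = lam GInvT ⦃ defGInvT ⦄ (∙ ▹ f ▹ c ▹ g) b
        h-app : ∀ {y x} → y ∈ b → x ∈ c → app f x ≡ y → app h y ≡ app g x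
        h-app {y} {x} k x∈ e = trans (lam-app GInvT ⦃ defGInvT ⦄ k) (cong (app g) (invAt-eq (x∈ , e) λ z (z∈ , e′) →
          inj-inj (bij-Inj B) z z∈ x x∈ (trans e′ (sym e))))

      private
        -- c is a set with a relation, and g is an isomorphism from β with its order. An ordinal is
        -- determined by its order type, so β can be recovered from c alone.
        record Codes (c g β : V) : Set ℓ where
          field
            cd-Ord : Ord β
            cd-inj : ∀ x → x ∈ β → ∀ y → y ∈ β → app g x ≡ app g y → x ≡ y
            cd-ran : fst c ≡ g ″ β
            cd-ord : ∀ x → x ∈ β → ∀ y → y ∈ β → x ∈ y ⇔ ⟪ app g x ، app g y ⟫ ∈ snd c
        open Codes
        CodeP : Env 1 → V → Set ℓ
        CodeP (∙ ▹ c) β = ∃[ g ] Codes c g β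
        opaque
         instance
          iCodes : ∀ {n} {s t u : Env n → V} ⦃ _ : DefT full s ⦄ ⦃ _ : DefT full t ⦄ ⦃ _ : DefT full u ⦄ →
                   Def full (λ γ → Codes (s γ) (t γ) (u γ))
          iCodes ⦃ a ⦄ ⦃ b ⦄ ⦃ c ⦄ = sub3 (λ (∙ ▹ c ▹ g ▹ β) → Codes c g β)
            (iso {P = λ (∙ ▹ c ▹ g ▹ β) → Ord β × (∀ x → x ∈ β → ∀ y → y ∈ β → app g x ≡ app g y → x ≡ y) × fst c ≡ g ″ β
                     × (∀ x → x ∈ β → ∀ y → y ∈ β → x ∈ y ⇔ ⟪ app g x ، app g y ⟫ ∈ snd c)}
            (λ γ → mk⇔ (λ (a , b , c , d) → record { cd-Ord = a ; cd-inj = b ; cd-ran = c ; cd-ord = d })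
                        (λ k → cd-Ord k , cd-inj k , cd-ran k , cd-ord k)) (find _)) a b c
        opaque
          defCodeP : Def full {2} (λ γ → CodeP (init γ) (last γ))
          defCodeP = find _
        opaque
          decode : V → V
          decode c = ι CodeP ⦃ defCodeP ⦄ (∙ ▹ c)
          instance
           idecode : ∀ {n} {s : Env n → V} ⦃ _ : DefT full s ⦄ → DefT full (λ γ → decode (s γ))
           idecode ⦃ a ⦄ = subT1 decode (iι CodeP ⦃ defCodeP ⦄) a
          decode-eq : ∀ {c β} → CodeP (∙ ▹ c) β → (∀ z → CodeP (∙ ▹ c) z → z ≡ β) → decode c ≡ β
          decode-eq = ι-eq CodeP ⦃ defCodeP ⦄
        -- Two isomorphisms from ordinals onto the same relation coincide by induction: x and its
        -- counterpart have the same predecessors.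
        code-agree : ∀ {c g β g′ β′} → Codes c g β → Codes c g′ β′ → ∀ x → Ord x → x ∈ β → x ∈ β′ × app g x ≡ app g′ x
        code-agree {c} {g} {β} {g′} {β′} k k′ = Ord-ind (λ (∙ ▹ g ▹ β ▹ g′ ▹ β′) x → x ∈ β → x ∈ β′ × app g x ≡ app g′ x)
          (∙ ▹ g ▹ β ▹ g′ ▹ β′) λ x o ih x∈ →
            let (x′ , x′∈ , e) = to ∈″ (subst (app g x ∈_) (trans (sym (cd-ran k)) (cd-ran k′)) (from ∈″ (x , x∈ , refl)))
                eq₁ : x ≡ x′
                eq₁ = ext
                  (λ y h → let y∈ = Ord-tr (cd-Ord k) h x∈ ; (y∈′ , q) = ih y h y∈ in
                    from (cd-ord k′ y y∈′ x′ x′∈) (subst₂ (λ a b → ⟪ a ، b ⟫ ∈ snd c) q e (to (cd-ord k y y∈ x x∈) h)))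
                  (λ y h → let y∈′ = Ord-tr (cd-Ord k′) h x′∈
                               (u , u∈ , q) = to ∈″ (subst (app g′ y ∈_) (trans (sym (cd-ran k′)) (cd-ran k)) (from ∈″ (y , y∈′ , refl)))
                               ux = from (cd-ord k u u∈ x x∈) (subst₂ (λ a b → ⟪ a ، b ⟫ ∈ snd c) q (sym e) (to (cd-ord k′ y y∈′ x′ x′∈) h))
                               (u∈′ , r) = ih u ux u∈
                           in subst (_∈ x) (cd-inj k′ u u∈′ y y∈′ (trans (sym r) (sym q))) ux)
            in subst (_∈ β′) (sym eq₁) x′∈ , trans e (cong (app g′) (sym eq₁))
        code-uniq : ∀ {c β β′} → CodeP (∙ ▹ c) β → CodeP (∙ ▹ c) β′ → β ≡ β′
        code-uniq (g , k) (g′ , k′) = ext (λ x h → proj₁ (code-agree k k′ x (Ord-∈ (cd-Ord k) h) h))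
                                          (λ x h → proj₁ (code-agree k′ k x (Ord-∈ (cd-Ord k′) h) h))
        DecT : Env 0 → V → V
        DecT _ c = decode c
        OrdRelP : Env 2 → V → Set ℓ
        OrdRelP (∙ ▹ g ▹ β) q = ∃[ x ] (x ∈ β × ∃[ y ] (y ∈ β × q ≡ ⟪ app g x ، app g y ⟫ × x ∈ y))

      private
       opaque
        defDecT : DefT full {1} (λ γ → DecT (init γ) (last γ))
        defDecT = findT _
        defOrdRelP : Def full {3} (λ γ → OrdRelP (init γ) (last γ))
        defOrdRelP = find _
      -- Hartogs: an ordinal that injects into a is decoded from a relation on a subset of a, so by
      -- replacement all ordinals would belong to one set.
      not-all-inject : ∀ a → ¬ (∀ β → Ord β → ∃[ g ] Inj g β a)
      not-all-inject a f = ¬Ord-set (img DecT ⦃ defDecT ⦄ ∙ (𝒫 a ⊗ 𝒫 (a ⊗ a))) λ β o →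
        let (g , I) = f β o
            W = sep OrdRelP ⦃ defOrdRelP ⦄ (∙ ▹ g ▹ β) (a ⊗ a)
            c = ⟪ g ″ β ، W ⟫
            ∈W : ∀ {q} → q ∈ W ⇔ (q ∈ (a ⊗ a) × OrdRelP (∙ ▹ g ▹ β) q)
            ∈W = ∈sep OrdRelP ⦃ defOrdRelP ⦄ (∙ ▹ g ▹ β) (a ⊗ a)
            K : Codes c g β
            K = record { cd-Ord = o ; cd-inj = inj-inj I ; cd-ran = fst-⟪⟫
              ; cd-ord = λ x x∈ y y∈ → mk⇔
                  (λ h → subst (⟪ app g x ، app g y ⟫ ∈_) (sym snd-⟪⟫) (from ∈W (from pair∈⊗ (inj-into I x x∈ , inj-into I y y∈) , x , x∈ , y , y∈ , refl , h)))
                  (λ h → let (_ , x′ , x′∈ , y′ , y′∈ , e , l) = to ∈W (subst (⟪ app g x ، app g y ⟫ ∈_) snd-⟪⟫ h) in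
                    subst₂ _∈_ (inj-inj I x′ x′∈ x x∈ (sym (⟪⟫-inj₁ e))) (inj-inj I y′ y′∈ y y∈ (sym (⟪⟫-inj₂ e))) l) }
        in from (∈img DecT ⦃ defDecT ⦄) (c , from pair∈⊗ (from ∈𝒫 (λ z h → let (x , x∈ , e) = to ∈″ h in subst (_∈ a) (sym e) (inj-into I x x∈))
                                            , from ∈𝒫 (λ q h → proj₁ (to ∈W h)))
                              , sym (decode-eq (g , K) λ z k → code-uniq k (g , K)))

      opaque
       -- Otherwise every ordinal beyond α would be equinumerous with a smaller one, and induction
       -- would inject all ordinals into α + 1, against Hartogs.
       card-above : ∀ α → Ord α → ∃[ μ ] (Card μ × α ∈ μ)
       card-above α o = by-contra (λ (∙ ▹ α) → ∃[ μ ] (Card μ × α ∈ μ)) (∙ ▹ α) λ no → not-all-inject (sucV α)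
         (Ord-ind (λ (∙ ▹ a) β → ∃[ g ] Inj g β a) (∙ ▹ sucV α) λ β b ih → step no β b ih (Ord-cmp b (Ord-suc o)))
         where
         step : ¬ (∃[ μ ] (Card μ × α ∈ μ)) → ∀ β → Ord β → (∀ γ → γ ∈ β → ∃[ g ] Inj g γ (sucV α)) →
                β ∈ sucV α ⊎ β ≡ sucV α ⊎ sucV α ∈ β → ∃[ g ] Inj g β (sucV α)
         step no β b ih (inj₁ h) = _ , id-Inj λ z k → Ord-tr (Ord-suc o) k h
         step no β b ih (inj₂ (inj₁ refl)) = _ , id-Inj λ z k → k
         step no β b ih (inj₂ (inj₂ h)) =
           let (γ , γ∈ , f , B) = by-contra (λ (∙ ▹ β) → ∃[ γ ] (γ ∈ β × ∃[ f ] Bij f γ β)) (∙ ▹ β) λ nb →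
                 no (β , record { card-Ord = b ; card-min = λ γ k e → nb (γ , k , e) } , Ord-tr b ∈suc-refl h)
           in inv-Inj B (proj₂ (ih γ γ∈))
    open Cardinals

    -- Upward persistence, homomorphisms and elementary embeddings.

    module Embeddings where
      full-⊨ : ∀ {M} → (∀ x → M x) → ∀ {n} (φ : Formula n) ρ → (M ⊨ φ [ ρ ]) ⇔ (𝕍 ⊨ φ [ ρ ])
      full-⊨ o (x ˢ∈ y) ρ = id⇔
      full-⊨ o (x ˢ≡ y) ρ = id⇔
      full-⊨ o ⊥ˢ ρ = id⇔
      full-⊨ o (φ ∧ˢ ψ) ρ = ×⇔ (full-⊨ o φ ρ) (full-⊨ o ψ ρ)
      full-⊨ o (φ ∨ˢ ψ) ρ = ⊎⇔ (full-⊨ o φ ρ) (full-⊨ o ψ ρ)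
      full-⊨ o (φ ⇒ˢ ψ) ρ = →⇔ (full-⊨ o φ ρ) (full-⊨ o ψ ρ)
      full-⊨ o (∀ˢ φ) ρ = Π⇔ λ x → →⇔ (mk⇔ (λ _ → tt) (λ _ → o x)) (full-⊨ o φ (x ∷ ρ))
      full-⊨ o (∃ˢ φ) ρ = Σ⇔ λ x → ×⇔ (mk⇔ (λ _ → tt) (λ _ → o x)) (full-⊨ o φ (x ∷ ρ))

      formD : ∀ {n} (φ : Formula n) → Def full (λ γ → 𝕍 ⊨ φ [ vec γ ])
      formD φ = record { form = φ ; ok = λ M o γ i → sym⇔ (full-⊨ o φ (vec γ)) }

      AllIn : Pred V ℓ → ∀ {n} → Vec V n → Set ℓ
      AllIn M [] = ⊤
      AllIn M (x ∷ ρ) = AllIn M ρ × M x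

      AllIn-lookup : ∀ {M n} (ρ : Vec V n) → AllIn M ρ → ∀ i → M (lookup ρ i)
      AllIn-lookup (x ∷ ρ) (a , m) zero = m
      AllIn-lookup (x ∷ ρ) (a , m) (suc i) = AllIn-lookup ρ a i

      AllIn-vec : ∀ {M n} (γ : Env n) → In M γ → AllIn M (vec γ)
      AllIn-vec {n = zero} γ i = tt
      AllIn-vec {n = suc n} γ (i , m) = AllIn-vec (init γ) i , m

      IsΔ₀-abs : ∀ {M} → Good M → ∀ {n} {φ : Formula n} → IsΔ₀ φ → ∀ ρ → AllIn M ρ → (𝕍 ⊨ φ [ ρ ]) ⇔ (M ⊨ φ [ ρ ])
      IsΔ₀-abs g mem ρ a = id⇔
      IsΔ₀-abs g eq ρ a = id⇔
      IsΔ₀-abs g bot ρ a = id⇔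
      IsΔ₀-abs g (and d e) ρ a = ×⇔ (IsΔ₀-abs g d ρ a) (IsΔ₀-abs g e ρ a)
      IsΔ₀-abs g (or d e) ρ a = ⊎⇔ (IsΔ₀-abs g d ρ a) (IsΔ₀-abs g e ρ a)
      IsΔ₀-abs g (imp d e) ρ a = →⇔ (IsΔ₀-abs g d ρ a) (IsΔ₀-abs g e ρ a)
      IsΔ₀-abs g (all {y = y} d) ρ a = mk⇔
        (λ f x m h → to (IsΔ₀-abs g d (x ∷ ρ) (a , m)) (f x tt h))
        (λ f x _ h → let m = tr g h (AllIn-lookup ρ a y) in from (IsΔ₀-abs g d (x ∷ ρ) (a , m)) (f x m h))
      IsΔ₀-abs g (ex {y = y} d) ρ a = mk⇔
        (λ (x , _ , h , p) → let m = tr g h (AllIn-lookup ρ a y) in x , m , h , to (IsΔ₀-abs g d (x ∷ ρ) (a , m)) p)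
        (λ (x , m , h , p) → x , tt , h , from (IsΔ₀-abs g d (x ∷ ρ) (a , m)) p)

      Π₁-down : ∀ {M} → Good M → ∀ {n} {φ : Formula n} → IsΠ 1 φ → ∀ ρ → AllIn M ρ → 𝕍 ⊨ φ [ ρ ] → M ⊨ φ [ ρ ]
      Π₁-down g (Σ⇒Π (Δ₀⇒Σ₀ d)) ρ a p = to (IsΔ₀-abs g d ρ a) p
      Π₁-down g (all π) ρ a p x m = Π₁-down g π (x ∷ ρ) (a , m) (p x tt)

      -- A true instance is secured by one set w: it holds in each good class that contains w. The
      -- notion is semantic so that it also covers the range of a Σ₂ sequence, whose formula is not
      -- literally of the form Σ₂.
      Upward : ∀ {n} → Formula n → Set (lsuc ℓ)
      Upward {n} φ = ∀ ρ → 𝕍 ⊨ φ [ ρ ] → ∃[ w ] (∀ M → Good M → M w → AllIn M ρ → M ⊨ φ [ ρ ])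

      -- Π₁ statements pass down to good classes; for the outer existential block, w collects the
      -- witnesses.
      Σ₂-upward : ∀ {n} {φ : Formula n} → IsΣ 2 φ → Upward φ
      Σ₂-upward (Π⇒Σ π) ρ p = ∅ , λ M g _ a → Π₁-down g π ρ a p
      Σ₂-upward (ex σ) ρ (x , _ , p) = let (w , f) = Σ₂-upward σ (x ∷ ρ) p in
        x ,, w , λ M g m a → x , tr g ∈l m , f M g (tr g ∈r m) (a , tr g ∈l m)

      record HomGE (h G E H F : V) : Set ℓ where
        field
          hom-Fn : Fn h G
          hom-into : ∀ x → x ∈ G → app h x ∈ H
          hom-edge : ∀ x → x ∈ G → ∀ y → y ∈ G → ⟪ x ، y ⟫ ∈ E → ⟪ app h x ، app h y ⟫ ∈ F
      open HomGE public
      record Hom (h A B : V) : Set ℓ where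
        constructor mkHom
        field
          {hG hE hH hF} : V
          hom-dom : A ≡ ⟪ hG ، hE ⟫
          hom-cod : B ≡ ⟪ hH ، hF ⟫
          hom-ge : HomGE h hG hE hH hF
      open Hom public
      opaque
       instance
        iHomGE : ∀ {m n} {s t u v w : Env n → V} ⦃ _ : DefT m s ⦄ ⦃ _ : DefT m t ⦄ ⦃ _ : DefT m u ⦄ ⦃ _ : DefT m v ⦄ ⦃ _ : DefT m w ⦄ →
                 Def m (λ γ → HomGE (s γ) (t γ) (u γ) (v γ) (w γ))
        iHomGE ⦃ a ⦄ ⦃ b ⦄ ⦃ c ⦄ ⦃ d ⦄ ⦃ e ⦄ = subs (λ (∙ ▹ h ▹ G ▹ E ▹ H ▹ F) → HomGE h G E H F) (any (iso
          {P = λ (∙ ▹ h ▹ G ▹ E ▹ H ▹ F) → Fn h G × (∀ x → x ∈ G → app h x ∈ H)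
               × (∀ x → x ∈ G → ∀ y → y ∈ G → ⟪ x ، y ⟫ ∈ E → ⟪ app h x ، app h y ⟫ ∈ F)}
          (λ γ → mk⇔ (λ (f , i , j) → record { hom-Fn = f ; hom-into = i ; hom-edge = j }) (λ i → hom-Fn i , hom-into i , hom-edge i))
          (find _))) ([] ▸ a ▸ b ▸ c ▸ d ▸ e)
        iHom : ∀ {m n} {s t u : Env n → V} ⦃ _ : DefT m s ⦄ ⦃ _ : DefT m t ⦄ ⦃ _ : DefT m u ⦄ → Def m (λ γ → Hom (s γ) (t γ) (u γ))
        iHom ⦃ a ⦄ ⦃ b ⦄ ⦃ c ⦄ = sub3 (λ (∙ ▹ h ▹ A ▹ B) → Hom h A B) (any (iso
          {P = λ (∙ ▹ h ▹ A ▹ B) → ∃[ G ] (G ∈ ⋃ A × ∃[ E ] (E ∈ ⋃ A × ∃[ H ] (H ∈ ⋃ B × ∃[ F ] (F ∈ ⋃ B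
               × A ≡ ⟪ G ، E ⟫ × B ≡ ⟪ H ، F ⟫ × HomGE h G E H F))))}
          (λ γ → mk⇔ (λ (_ , _ , _ , _ , _ , _ , _ , _ , e , f , k) → mkHom e f k)
                      (λ { (mkHom refl refl k) → _ , cm₁ , _ , cm₂ , _ , cm₁ , _ , cm₂ , refl , refl , k }))
          (find _))) a b c
          where
          cm₁ : ∀ {x y} → x ∈ ⋃ ⟪ x ، y ⟫
          cm₁ = let (z , h , k , l) = ∈⟪⟫-comps in from ∈⋃ (z , h , k)
          cm₂ : ∀ {x y} → y ∈ ⋃ ⟪ x ، y ⟫
          cm₂ = let (z , h , k , l) = ∈⟪⟫-comps in from ∈⋃ (z , h , l)

      Hom⇔ : ∀ {h A B} → Hom h A B ⇔ IsHom h A B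
      Hom⇔ {h} {A} {B} = mk⇔ fw bw
        where
        fw : Hom h A B → IsHom h A B
        fw (mkHom {G} {E} {H} {F} e f k) = G , E , H , F , from ≐⇔ e , from ≐⇔ f ,
          (to Fn⇔ (hom-Fn k) , λ x y l → let l = to ∋⇔ l in subst (_∈ H) (app-eq (hom-Fn k) l) (hom-into k x (fn-dom (hom-Fn k) l))) ,
          λ x y x′ y′ a b c → let b = to ∋⇔ b ; c = to ∋⇔ c in from ∋⇔ (subst₂ (λ u v → ⟪ u ، v ⟫ ∈ F) (app-eq (hom-Fn k) b) (app-eq (hom-Fn k) c)
            (hom-edge k x (fn-dom (hom-Fn k) b) y (fn-dom (hom-Fn k) c) (to ∋⇔ a)))
        bw : IsHom h A B → Hom h A B
        bw (G , E , H , F , e , f , (k , into) , edge) = let K = from Fn⇔ k in mkHom (to ≐⇔ e) (to ≐⇔ f) record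
          { hom-Fn = K ; hom-into = λ x h → into x _ (from ∋⇔ (app-∈ K h))
          ; hom-edge = λ x h y l m → to ∋⇔ (edge x y _ _ (from ∋⇔ m) (from ∋⇔ (app-∈ K h)) (from ∋⇔ (app-∈ K l))) }

      private
        CompT : Env 2 → V → V
        CompT (∙ ▹ g ▹ f) x = app g (app f x)
      infix 26 _⊙_
      private
       opaque
        defCompT : DefT full {3} (λ γ → CompT (init γ) (last γ))
        defCompT = findT _
      opaque
        _⊙_ : V → V → V → V
        (g ⊙ f) a = lam CompT ⦃ defCompT ⦄ (∙ ▹ g ▹ f) a
        ⊙-app : ∀ {g f a x} → x ∈ a → app ((g ⊙ f) a) x ≡ app g (app f x)
        ⊙-app = lam-app CompT ⦃ defCompT ⦄
        ⊙-Fn : ∀ {g f a} → Fn ((g ⊙ f) a) a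
        ⊙-Fn = lam-Fn CompT ⦃ defCompT ⦄
      ⊙-HomGE : ∀ {g f G E H F K D} → HomGE g H F K D → HomGE f G E H F → HomGE ((g ⊙ f) G) G E K D
      ⊙-HomGE {D = D} q p = record { hom-Fn = ⊙-Fn
        ; hom-into = λ x h → subst (_∈ _) (sym (⊙-app h)) (hom-into q _ (hom-into p x h))
        ; hom-edge = λ x h y k e → subst₂ (λ u v → ⟪ u ، v ⟫ ∈ D) (sym (⊙-app h)) (sym (⊙-app k))
            (hom-edge q _ (hom-into p x h) _ (hom-into p y k) (hom-edge p x h y k e)) }
      ⊙-Hom : ∀ {g f A B C} → Hom g B C → Hom f A B → ∃[ h ] Hom h A C
      ⊙-Hom (mkHom refl c q) (mkHom a e p) with ⟪⟫-inj₁ e | ⟪⟫-inj₂ e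
      ... | refl | refl = _ , mkHom a c (⊙-HomGE q p)

      module Embedding (j M : Class) (el : IsElementaryEmbedding j M) (trM : IsTransitiveClass M) where
        open IsElementaryEmbedding el
        𝕄 : Pred V ℓ
        𝕄 = ⟦ M ⟧
        J : V → V
        J x = proj₁ (proj₂ function x tt)
        J-graph : ∀ x → j ∋ᶜ⟨ x ⨾ J x ⟩
        J-graph x = proj₁ (proj₂ (proj₂ function x tt))
        J-uniq : ∀ {x y} → j ∋ᶜ⟨ x ⨾ y ⟩ → J x ≡ y
        J-uniq {x} h = proj₂ (proj₂ (proj₂ function x tt)) h
        J-𝕄 : ∀ x → 𝕄 (J x)
        J-𝕄 x = into x (J x) (J-graph x)

        J* : ∀ {n} → Env n → Env n
        J* {zero} _ = ∙
        J* {suc n} (γ ▹ x) = J* γ ▹ J x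
        J*-In : ∀ {n} (γ : Env n) → In 𝕄 (J* γ)
        J*-In {zero} γ = tt
        J*-In {suc n} γ = J*-In (init γ) , J-𝕄 _
        J*-pw : ∀ {n} (γ : Env n) → PW.Pointwise (λ x y → j ∋ᶜ⟨ x ⨾ y ⟩) (vec γ) (vec (J* γ))
        J*-pw {zero} γ = PW.[]
        J*-pw {suc n} γ = J-graph _ PW.∷ J*-pw (init γ)
        elemF : ∀ {n} (φ : Formula n) (γ : Env n) → (𝕍 ⊨ φ [ vec γ ]) ⇔ (𝕄 ⊨ φ [ vec (J* γ) ])
        elemF φ γ = elementary φ (vec γ) (vec (J* γ)) (J*-pw γ)

        private
          0′ : ∀ {n} → Fin (1 + n)
          0′ = zero
          1′ : ∀ {n} → Fin (2 + n)
          1′ = suc zero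
          2′ : ∀ {n} → Fin (3 + n)
          2′ = suc (suc zero)
          3′ : ∀ {n} → Fin (4 + n)
          3′ = suc (suc (suc zero))
          pairF unionF emptyF : Formula 0
          pairF = ∀ˢ (∀ˢ (∃ˢ (3∈∧ 2′ 1′)))
            where
            3∈∧ : Fin 3 → Fin 3 → Formula 3
            3∈∧ a b = (a ˢ∈ 0′) ∧ˢ (b ˢ∈ 0′) ∧ˢ ∀ˢ (0′ ˢ∈ 1′ ⇒ˢ (0′ ˢ≡ suc a) ∨ˢ (0′ ˢ≡ suc b))
          unionF = ∀ˢ (∃ˢ (∀ˢ (((0′ ˢ∈ 1′) ⇒ˢ ∃ˢ ((0′ ˢ∈ 3′) ∧ˢ (1′ ˢ∈ 0′))) ∧ˢ (∃ˢ ((0′ ˢ∈ 3′) ∧ˢ (1′ ˢ∈ 0′)) ⇒ˢ (0′ ˢ∈ 1′)))))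
          emptyF = ∃ˢ (∀ˢ (0′ ˢ∈ 1′ ⇒ˢ ⊥ˢ))

        opaque
          -- Elementarity gives M its own pairs, unions and empty set; transitivity shows that they
          -- are the real ones.
          𝕄-Good : Good 𝕄
          𝕄-Good = record
            { tr = λ {x} {y} h m → trM x y m h
            ; cl-,, = λ {x} {y} mx my →
                let (z , mz , a , b , f) = to (elemF pairF ∙) (λ x _ y _ → x ,, y , tt , ∈l , ∈r , λ w _ h → to ∈,, h) x mx y my in
                subst 𝕄 (ext (λ w h → from ∈,, (f w (trM w z mz h) h)) λ w h → g a b (to ∈,, h)) mz
            ; cl-⋃ = λ {x} mx → un x mx (to (elemF unionF ∙) (λ x _ → ⋃ x , tt , λ z _ →
                  (λ h → let (y , a , b) = to ∈⋃ h in y , tt , a , b) , (λ (y , _ , a , b) → from ∈⋃ (y , a , b))) x mx)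
            ; cl-∅ = let (e , me , f) = to (elemF emptyF ∙) (∅ , tt , λ z _ h → ⊥-elim (∉∅ h)) in
                subst 𝕄 (ext (λ w h → ⊥-elim (lower⊥ (f w (trM w e me h) h))) (λ w h → ⊥-elim (∉∅ h))) me }
            where
            un : ∀ x → 𝕄 x → 𝕄 ⊨ ∃ˢ (∀ˢ (((0′ ˢ∈ 1′) ⇒ˢ ∃ˢ ((0′ ˢ∈ 3′) ∧ˢ (1′ ˢ∈ 0′))) ∧ˢ (∃ˢ ((0′ ˢ∈ 3′) ∧ˢ (1′ ˢ∈ 0′)) ⇒ˢ (0′ ˢ∈ 1′)))) [ x ∷ [] ] → 𝕄 (⋃ x)
            un x mx (u , mu , f) = subst 𝕄 (ext
              (λ w h → let (y , _ , a , b) = proj₁ (f w (trM w u mu h)) h in from ∈⋃ (y , a , b))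
              (λ w h → let (y , a , b) = to ∈⋃ h ; my = trM y x mx a in proj₂ (f w (trM w y my b)) (y , my , a , b))) mu
            g : ∀ {x y z w} → x ∈ z → y ∈ z → w ≡ x ⊎ w ≡ y → w ∈ z
            g a b (inj₁ refl) = a
            g a b (inj₂ refl) = b
            lower⊥ : ⊥ {ℓ} → ⊥₀
            lower⊥ ()

        -- For an absolute P, truth in M is truth, so elementarity loses its relativisation.
        elem : ∀ {n} (P : Env n → Set ℓ) ⦃ d : Def abs P ⦄ γ → P γ ⇔ P (J* γ)
        elem P ⦃ d ⦄ γ = ok (any {full} d) 𝕍 allV γ (inV γ) ∙⇔ elemF (form d) γ ∙⇔ sym⇔ (ok d 𝕄 𝕄-Good (J* γ) (J*-In γ))

        elemT : ∀ {n} (t : Env n → V) ⦃ d : DefT abs t ⦄ γ → J (t γ) ≡ t (J* γ)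
        elemT t ⦃ d ⦄ γ = to (elem (λ γ → last γ ≡ t (init γ)) ⦃ graph d ⦄ (γ ▹ t γ)) refl

        -- A block of universal quantifiers in front of an absolute matrix can be moved as well, but
        -- on the side of M it reaches members of M only. This is why the applications have to place
        -- their arguments in M.
        elemΠ₂ : ∀ {n} (P : Env (2 + n) → Set ℓ) ⦃ d : Def abs P ⦄ γ → (∀ x y → P (γ ▹ x ▹ y)) → ∀ x y → 𝕄 x → 𝕄 y → P (J* γ ▹ x ▹ y)
        elemΠ₂ P ⦃ d ⦄ γ f x y mx my = from (ok d 𝕄 𝕄-Good (J* γ ▹ x ▹ y) ((J*-In γ , mx) , my))
          (to (elemF (∀ˢ (∀ˢ (form d))) γ) (λ x _ y _ → to (ok (any {full} d) 𝕍 allV (γ ▹ x ▹ y) ((inV γ , tt) , tt)) (f x y)) x mx y my)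
        elemΠ₃ : ∀ {n} (P : Env (3 + n) → Set ℓ) ⦃ d : Def abs P ⦄ γ → (∀ x y z → P (γ ▹ x ▹ y ▹ z)) →
                 ∀ x y z → 𝕄 x → 𝕄 y → 𝕄 z → P (J* γ ▹ x ▹ y ▹ z)
        elemΠ₃ P ⦃ d ⦄ γ f x y z mx my mz = from (ok d 𝕄 𝕄-Good (J* γ ▹ x ▹ y ▹ z) (((J*-In γ , mx) , my) , mz))
          (to (elemF (∀ˢ (∀ˢ (∀ˢ (form d)))) γ)
            (λ x _ y _ z _ → to (ok (any {full} d) 𝕍 allV (γ ▹ x ▹ y ▹ z) (((inV γ , tt) , tt) , tt)) (f x y z)) x mx y my z mz)

        J-∈ : ∀ {x y} → x ∈ y ⇔ J x ∈ J y
        J-∈ {x} {y} = elem (λ (∙ ▹ x ▹ y) → x ∈ y) (∙ ▹ x ▹ y)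
        J-inj : ∀ {x y} → J x ≡ J y → x ≡ y
        J-inj {x} {y} = from (elem (λ (∙ ▹ x ▹ y) → x ≡ y) (∙ ▹ x ▹ y))
        J-Ord : ∀ {x} → Ord x ⇔ Ord (J x)
        J-Ord {x} = elem (λ (∙ ▹ x) → Ord x) (∙ ▹ x)
        J-app : ∀ {f x} → J (app f x) ≡ app (J f) (J x)
        J-app {f} {x} = elemT (λ (∙ ▹ f ▹ x) → app f x) (∙ ▹ f ▹ x)
        J-Bij : ∀ {f a b} → Bij f a b ⇔ Bij (J f) (J a) (J b)
        J-Bij {f} {a} {b} = elem (λ (∙ ▹ f ▹ a ▹ b) → Bij f a b) (∙ ▹ f ▹ a ▹ b)
        J-⟪⟫ : ∀ {x y} → J ⟪ x ، y ⟫ ≡ ⟪ J x ، J y ⟫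
        J-⟪⟫ {x} {y} = elemT (λ (∙ ▹ x ▹ y) → ⟪ x ، y ⟫) (∙ ▹ x ▹ y)

        jp : Env (Class.arity j)
        jp = env (Class.parameters j)
        JP : Env (suc (Class.arity j)) → V → Set ℓ
        JP (γ ▹ x) y = 𝕍 ⊨ Class.formula j [ ⟪ x ، y ⟫ ∷ vec γ ]
        opaque
          dJP : Def full (λ γ → JP (init γ) (last γ))
          dJP = inst {P = λ γ p → 𝕍 ⊨ Class.formula j [ p ∷ vec (init (init γ)) ]}
            (wkU (wkU (formD (Class.formula j)))) (i⟪⟫ ⦃ v1 ⦄ ⦃ v0 ⦄)
            where
            wkU : ∀ {n} {P : Env (suc n) → Set ℓ} → Def full P → Def full {2 + n} (λ γ → P (init (init γ) ▹ last γ))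
            wkU {P = P} d = exch {P = λ γ x _ → P (γ ▹ x)} (wkD d)
        JP⇔ : ∀ {x y} → JP (jp ▹ x) y ⇔ (J x ≡ y)
        JP⇔ {x} {y} = mk⇔ (λ h → J-uniq (_ , from ≐⇔ refl , subst (λ ρ → 𝕍 ⊨ Class.formula j [ ⟪ x ، y ⟫ ∷ ρ ]) (vec-env _) h))
          λ { refl → let (p , e , h) = J-graph x in
                subst₂ (λ p ρ → 𝕍 ⊨ Class.formula j [ p ∷ ρ ]) (to ≐⇔ e) (sym (vec-env _)) h }
        JT : Env (Class.arity j) → V → V
        JT γ x = ι JP ⦃ dJP ⦄ (γ ▹ x)
        JT≡ : ∀ {x} → JT jp x ≡ J x
        JT≡ {x} = ι-eq JP ⦃ dJP ⦄ (from JP⇔ refl) λ z h → sym (to JP⇔ h)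
        opaque
          iJT : DefT full {suc (Class.arity j)} (λ γ → JT (init γ) (last γ))
          iJT = iι JP ⦃ dJP ⦄
        opaque
          -- By replacement, as j is a definable class; the restriction is a set and may serve as a
          -- homomorphism.
          J↾ : V → V
          J↾ a = lam JT ⦃ iJT ⦄ jp a
          J↾-Fn : ∀ {a} → Fn (J↾ a) a
          J↾-Fn = lam-Fn JT ⦃ iJT ⦄
          J↾-app : ∀ {a x} → x ∈ a → app (J↾ a) x ≡ J x
          J↾-app h = trans (lam-app JT ⦃ iJT ⦄ h) JT≡

        J-Hom : ∀ {G E} → HomGE (J↾ G) G E (J G) (J E)
        J-Hom {G} {E} = record { hom-Fn = J↾-Fn ; hom-into = λ x h → subst (_∈ J G) (sym (J↾-app h)) (to J-∈ h)
          ; hom-edge = λ x h y k e → subst (_∈ J E) (trans J-⟪⟫ (sym (cong₂ ⟪_،_⟫ (J↾-app h) (J↾-app k)))) (to J-∈ e) }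

        J-ω : J ω ≡ ω
        J-ω = isω⇒ (J ω) (to (elem IsωP (∙ ▹ ω)) ((λ z h → to ∈ω h) , ∅∈ω , λ z h → suc∈ω h))
          where
          IsωP : Env 1 → Set ℓ
          IsωP (∙ ▹ x) = (∀ z → z ∈ x → Nat z) × ∅ ∈ x × (∀ z → z ∈ x → sucV z ∈ x)
          isω⇒ : ∀ x → IsωP (∙ ▹ x) → x ≡ ω
          isω⇒ x (f , z , s) = ext (λ y h → from ∈ω (f y h)) (ω-ind (λ (∙ ▹ x) y → y ∈ x) (∙ ▹ x) z λ m _ → s m)
        J-nat : ∀ n → n ∈ ω → J n ≡ n
        J-nat n h = trans (sym JT≡) (ω-ind (λ γ n → JT γ n ≡ n) ⦃ dEq ⦃ iJT ⦄ ⦃ v0 ⦄ ⦄ jp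
          (trans JT≡ (elemT (λ (∙) → ∅) ∙))
          (λ m _ e → trans JT≡ (trans (elemT (λ (∙ ▹ x) → sucV x) (∙ ▹ m)) (cong sucV (trans (sym JT≡) e)))) n h)

        -- A least α with j α ∈ α would be undercut by j α.
        J-up : ∀ {α} → Ord α → ¬ J α ∈ α
        J-up {α} o h = let (β , b , k , min) = Ord-least (λ γ α → JT γ α ∈ α) ⦃ dMem ⦃ iJT ⦄ ⦃ v0 ⦄ ⦄ jp (α , o , subst (_∈ α) (sym JT≡) h)
                           k′ = subst (_∈ β) JT≡ k
                       in min (J β) k′ (subst (_∈ J β) (sym JT≡) (to J-∈ k′))

        -- Ordinals below κ are fixed and κ itself is moved. If κ ∈ ξ, then j κ ∈ j ξ = κ would be
        -- fixed, so j κ = κ by injectivity.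
        crit-∉ran : ∀ {κ ξ} → IsCriticalPoint κ j → J ξ ≢ κ
        crit-∉ran {κ} {ξ} (o , fix , ne) e = f (Ord-cmp (from J-Ord (subst Ord (sym e) κo)) κo)
          where
          κo = from Ord⇔ o
          neq : J κ ≢ κ
          neq e = ne (subst (λ y → j ∋ᶜ⟨ κ ⨾ y ⟩) e (J-graph κ))
          f : ξ ∈ κ ⊎ ξ ≡ κ ⊎ κ ∈ ξ → ⊥₀
          f (inj₁ h) = ∈-irrefl (subst (_∈ κ) (trans (sym (J-uniq (fix ξ h))) e) h)
          f (inj₂ (inj₁ refl)) = neq e
          f (inj₂ (inj₂ h)) = let k = subst (J κ ∈_) e (to J-∈ h) in
            ∈-irrefl (subst (_∈ κ) (J-inj (J-uniq (fix (J κ) k))) k)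
    open Embeddings

    -- Functions of Jónsson type on ω-sequences.

    module JonssonFunctions where
      -- A Jónsson-style function for ω-sequences (after Erdős–Hajnal and Galvin–Prikry): φ picks a
      -- representative of each class of eventually equal sequences, and
      -- (s, n) ↦ φ(s)(n) hits every point of X already on sequences from Y,
      -- for every Y ⊆ X equipotent with A.

      record Eqv (o s t : V) : Set ℓ where
        field
          {eqv-N} : V
          eqv-ω : eqv-N ∈ o
          eqv-≡ : ∀ k → k ∈ o → eqv-N ∈ k → app s k ≡ app t k
      open Eqv public
      -- The variable o stands for ω; left open, it keeps the notion absolute and is moved by j like
      -- the other parameters, with `J-ω` applied afterwards.
      record Hit (o S φ Y x : V) : Set ℓ where
        field
          {hit-n hit-s} : V
          hit-ω : hit-n ∈ o
          hit-S : hit-s ∈ S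
          hit-Y : ∀ k → k ∈ o → app hit-s k ∈ Y
          hit-≡ : app (app φ hit-s) hit-n ≡ x
      open Hit public
      opaque
       instance
        iEqv : ∀ {m n} {s t u : Env n → V} ⦃ _ : DefT m s ⦄ ⦃ _ : DefT m t ⦄ ⦃ _ : DefT m u ⦄ → Def m (λ γ → Eqv (s γ) (t γ) (u γ))
        iEqv ⦃ a ⦄ ⦃ b ⦄ ⦃ c ⦄ = sub3 (λ (∙ ▹ o ▹ s ▹ t) → Eqv o s t) (any (iso
          {P = λ (∙ ▹ o ▹ s ▹ t) → ∃[ N ] (N ∈ o × (∀ k → k ∈ o → N ∈ k → app s k ≡ app t k))}
          (λ γ → mk⇔ (λ (N , h , f) → record { eqv-ω = h ; eqv-≡ = f }) (λ e → eqv-N e , eqv-ω e , eqv-≡ e)) (find _))) a b c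
        iHit : ∀ {m n} {s t u v w : Env n → V} ⦃ _ : DefT m s ⦄ ⦃ _ : DefT m t ⦄ ⦃ _ : DefT m u ⦄ ⦃ _ : DefT m v ⦄ ⦃ _ : DefT m w ⦄ →
                 Def m (λ γ → Hit (s γ) (t γ) (u γ) (v γ) (w γ))
        iHit ⦃ a ⦄ ⦃ b ⦄ ⦃ c ⦄ ⦃ d ⦄ ⦃ e ⦄ = subs (λ (∙ ▹ o ▹ S ▹ φ ▹ Y ▹ x) → Hit o S φ Y x) (any (iso
          {P = λ (∙ ▹ o ▹ S ▹ φ ▹ Y ▹ x) → ∃[ n ] (n ∈ o × ∃[ s ] (s ∈ S × (∀ k → k ∈ o → app s k ∈ Y) × app (app φ s) n ≡ x))}
          (λ γ → mk⇔ (λ (n , a , s , b , c , d) → record { hit-ω = a ; hit-S = b ; hit-Y = c ; hit-≡ = d })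
                      (λ h → _ , hit-ω h , _ , hit-S h , hit-Y h , hit-≡ h)) (find _))) ([] ▸ a ▸ b ▸ c ▸ d ▸ e)

      private
        ClsP : Env 1 → V → Set ℓ
        ClsP (∙ ▹ s) t = Eqv ω s t
        opaque
          defClsP : Def full {2} (λ γ → ClsP (init γ) (last γ))
          defClsP = find _
        opaque
          cls : V → V → V
          cls S s = sep ClsP ⦃ defClsP ⦄ (∙ ▹ s) S
          ∈cls : ∀ {S s t} → t ∈ cls S s ⇔ (t ∈ S × Eqv ω s t)
          ∈cls {S} {s} = ∈sep ClsP ⦃ defClsP ⦄ (∙ ▹ s) S
          instance
           icls : ∀ {n} {s t : Env n → V} ⦃ _ : DefT full s ⦄ ⦃ _ : DefT full t ⦄ → DefT full (λ γ → cls (s γ) (t γ))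
           icls ⦃ a ⦄ ⦃ b ⦄ = subT2 cls (byMem {t = λ γ → cls (last (init γ)) (last γ)} (λ (∙ ▹ S ▹ s) t → t ∈ S × Eqv ω s t) λ γ z → ∈cls) a b
        ClsT : Env 1 → V → V
        ClsT (∙ ▹ S) s = cls S s
        PickT : V → V → V → Set ℓ
        PickT _ c y = y ∈ c
        RepT : Env 2 → V → V
        RepT (∙ ▹ f ▹ S) s = app f (cls S s)

      eqv-refl : ∀ {s} → Eqv ω s s
      eqv-refl = record { eqv-ω = ∅∈ω ; eqv-≡ = λ _ _ _ → refl }
      eqv-sym : ∀ {s t} → Eqv ω s t → Eqv ω t s
      eqv-sym e = record { eqv-ω = eqv-ω e ; eqv-≡ = λ k h l → sym (eqv-≡ e k h l) }
      eqv-trans : ∀ {s t u} → Eqv ω s t → Eqv ω t u → Eqv ω s u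
      eqv-trans {s} {t} {u} e f = g (Ord-cmp (Ord-∈ Ord-ω (eqv-ω e)) (Ord-∈ Ord-ω (eqv-ω f)))
        where
        both : ∀ N → N ∈ ω → (∀ k → k ∈ ω → N ∈ k → eqv-N e ∈ k × eqv-N f ∈ k) → Eqv ω s u
        both N h b = record { eqv-ω = h ; eqv-≡ = λ k k∈ l → let (x , y) = b k k∈ l in trans (eqv-≡ e k k∈ x) (eqv-≡ f k k∈ y) }
        g : _ → Eqv ω s u
        g (inj₁ h) = both _ (eqv-ω f) λ k k∈ l → Ord-tr (Ord-∈ Ord-ω k∈) h l , l
        g (inj₂ (inj₁ q)) = both _ (eqv-ω f) λ k k∈ l → subst (_∈ k) (sym q) l , l
        g (inj₂ (inj₂ h)) = both _ (eqv-ω e) λ k k∈ l → l , Ord-tr (Ord-∈ Ord-ω k∈) h l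

      private
       opaque
        defClsT : DefT full {2} (λ γ → ClsT (init γ) (last γ))
        defClsT = findT _
        defRepT : DefT full {3} (λ γ → RepT (init γ) (last γ))
        defRepT = findT _
      opaque
       representatives : ∀ S → ∃[ φ ] ((∀ s → s ∈ S → app φ s ∈ S × Eqv ω s (app φ s))
                                      × (∀ s → s ∈ S → ∀ t → t ∈ S → Eqv ω s t → app φ s ≡ app φ t))
       representatives S =
        let (f , F , u) = Choice.uniformize PickT (find _) ∅ (img ClsT ⦃ defClsT ⦄ (∙ ▹ S) S) λ c h →
              let (s , k , e) = to (∈img ClsT ⦃ defClsT ⦄) h in s , subst (s ∈_) (sym e) (from ∈cls (k , eqv-refl))
            val : ∀ {s} → s ∈ S → app (lam RepT ⦃ defRepT ⦄ (∙ ▹ f ▹ S) S) s ≡ app f (cls S s)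
            val = lam-app RepT ⦃ defRepT ⦄
        in lam RepT ⦃ defRepT ⦄ (∙ ▹ f ▹ S) S ,
           (λ s h → subst (λ t → t ∈ S × Eqv ω s t) (sym (val h)) (to ∈cls (u (cls S s) (from (∈img ClsT ⦃ defClsT ⦄) (s , h , refl))))) ,
           λ s h t k e → trans (val h) (trans (cong (app f) (ext
             (λ w l → let (a , b) = to ∈cls l in from ∈cls (a , eqv-trans (eqv-sym e) b))
             (λ w l → let (a , b) = to ∈cls l in from ∈cls (a , eqv-trans e b)))) (sym (val k)))

      module Jonsson (A a₀ : V) (a₀∈ : a₀ ∈ A) where
        S φ : V
        S = ω ⇛ A
        φ = proj₁ (representatives S)
        φ-rep : ∀ s → s ∈ S → app φ s ∈ S × Eqv ω s (app φ s)
        φ-rep = proj₁ (proj₂ (representatives S))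
        φ-eqv : ∀ s → s ∈ S → ∀ t → t ∈ S → Eqv ω s t → app φ s ≡ app φ t
        φ-eqv = proj₂ (proj₂ (representatives S))
        private
          LP : Env 1 → V → Set ℓ
          LP (∙ ▹ A) x = ∃[ b ] Bij b A (fst x)
          opaque
            defLP : Def full {2} (λ γ → LP (init γ) (last γ))
            defLP = find _
          D : V
          D = sep LP ⦃ defLP ⦄ (∙ ▹ A) (𝒫 A ⊗ A)
          ∈D : ∀ {X α} → ⟪ X ، α ⟫ ∈ D ⇔ (X ⊆ A × α ∈ A × ∃[ b ] Bij b A X)
          ∈D {X} {α} = mk⇔
            (λ h → let (k , b , B) = to (∈sep LP ⦃ defLP ⦄ (∙ ▹ A) (𝒫 A ⊗ A)) h ; (x , y) = to pair∈⊗ k in to ∈𝒫 x , y , b , subst (Bij b A) fst-⟪⟫ B)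
            (λ (x , y , b , B) → from (∈sep LP ⦃ defLP ⦄ (∙ ▹ A) (𝒫 A ⊗ A)) (from pair∈⊗ (from ∈𝒫 x , y) , b , subst (Bij b A) (sym fst-⟪⟫) B))
          D⇒ : ∀ {x} → x ∈ D → x ≡ ⟪ fst x ، snd x ⟫
          D⇒ h with to ∈⊗ (proj₁ (to (∈sep LP ⦃ defLP ⦄ (∙ ▹ A) (𝒫 A ⊗ A)) h))
          ... | X , _ , α , _ , refl = sym (cong₂ ⟪_،_⟫ fst-⟪⟫ snd-⟪⟫)
          T : V → V → V → Set ℓ
          T p x y = fst y ⊆ fst x × snd y ∈ fst x × ¬ Hit ω (fst p) (snd p) (fst y) (snd y)
          T* : V → V → V → V → Set ℓ
          T* X α Y β = Y ⊆ X × β ∈ X × ¬ Hit ω S φ Y β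
          T⇔ : ∀ {x y} → T ⟪ S ، φ ⟫ x y ⇔ T* (fst x) (snd x) (fst y) (snd y)
          T⇔ {x} {y} = mk⇔ (λ (a , b , c) → a , b , subst₂ (λ s f → ¬ Hit ω s f (fst y) (snd y)) fst-⟪⟫ snd-⟪⟫ c)
                           (λ (a , b , c) → a , b , subst₂ (λ s f → ¬ Hit ω s f (fst y) (snd y)) (sym fst-⟪⟫) (sym snd-⟪⟫) c)
          Goal : Set ℓ
          Goal = ∃[ X ] ∃[ b ] (X ⊆ A × Bij b A X × (∀ Y → ∀ b′ → Y ⊆ X → Bij b′ A Y → ∀ x → x ∈ X → Hit ω S φ Y x))
          GoalP : Env 3 → Set ℓ
          GoalP (∙ ▹ A ▹ S ▹ φ) = ∃[ X ] ∃[ b ] (X ⊆ A × Bij b A X × (∀ Y → ∀ b′ → Y ⊆ X → Bij b′ A Y → ∀ x → x ∈ X → Hit ω S φ Y x))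
          StepP : Env 4 → Set ℓ
          StepP (∙ ▹ A ▹ S ▹ φ ▹ X) = ∃[ Y ] ∃[ b ] (Y ⊆ X × Bij b A Y × ∃[ β ] (β ∈ X × ¬ Hit ω S φ Y β))
          step : ¬ Goal → ∀ x → x ∈ D → ∃[ y ] (y ∈ D × T ⟪ S ، φ ⟫ x y)
          step no x h =
            let (X⊆ , α∈ , b , B) = to ∈D (subst (_∈ D) (D⇒ h) h)
                (Y , b′ , s , B′ , β , β∈ , nh) = by-contra StepP (∙ ▹ A ▹ S ▹ φ ▹ fst x) λ ns →
                  no (fst x , b , X⊆ , B , λ Y b′ s B′ β β∈ →
                    by-contra (λ (∙ ▹ S ▹ φ ▹ Y ▹ β) → Hit ω S φ Y β) (∙ ▹ S ▹ φ ▹ Y ▹ β) λ nh → ns (Y , b′ , s , B′ , β , β∈ , nh))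
            in ⟪ Y ، β ⟫ , from ∈D ((λ z k → X⊆ z (s z k)) , X⊆ β β∈ , b′ , B′) ,
               from T⇔ (subst₂ (λ u v → u ⊆ fst x × v ∈ fst x × ¬ Hit ω S φ u v) (sym fst-⟪⟫) (sym snd-⟪⟫) (s , β∈ , nh))
          module Diag (s : V) (tr : ∀ n → n ∈ ω → app s n ∈ D × T ⟪ S ، φ ⟫ (app s n) (app s (sucV n))) where
            X a : V → V
            X n = fst (app s n)
            -- State n + 1 stores, next to its set, the point of X n that is not hit from this set.
            a n = snd (app s (sucV n))
            X⊆A : ∀ {n} → n ∈ ω → X n ⊆ A
            X⊆A {n} h = let k = proj₁ (tr n h) in proj₁ (to ∈D (subst (_∈ D) (D⇒ k) k))
            down : ∀ m → m ∈ ω → ∀ n → n ∈ sucV m → X m ⊆ X n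
            down = ω-ind (λ (∙ ▹ s) m → ∀ n → n ∈ sucV m → fst (app s m) ⊆ fst (app s n)) (∙ ▹ s)
              (λ n h → f n (to ∈suc h)) λ m h ih n k → g m h ih n (to ∈suc k)
              where
              f : ∀ n → n ∈ ∅ ⊎ n ≡ ∅ → X ∅ ⊆ X n
              f n (inj₁ h) = ⊥-elim (∉∅ h)
              f n (inj₂ refl) z k = k
              g : ∀ m → m ∈ ω → (∀ n → n ∈ sucV m → X m ⊆ X n) → ∀ n → n ∈ sucV m ⊎ n ≡ sucV m → X (sucV m) ⊆ X n
              g m h ih n (inj₁ k) z l = ih n k z (proj₁ (to T⇔ (proj₂ (tr m h))) z l)
              g m h ih n (inj₂ refl) z l = l
            a∈ : ∀ {n} → n ∈ ω → a n ∈ X n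
            a∈ {n} h = proj₁ (proj₂ (to T⇔ (proj₂ (tr n h))))
            AT : Env 1 → V → V
            AT (∙ ▹ s) n = snd (app s (sucV n))
            private
             opaque
              defAT : DefT full {2} (λ γ → AT (init γ) (last γ))
              defAT = findT _
            t u : V
            t = lam AT ⦃ defAT ⦄ (∙ ▹ s) ω
            t∈S : t ∈ S
            t∈S = from ∈⇛ (lam-Fn AT ⦃ defAT ⦄ , λ n h → subst (_∈ A) (sym (lam-app AT ⦃ defAT ⦄ h)) (X⊆A h _ (a∈ h)))
            u = app φ t
            N : V
            N = eqv-N (proj₂ (φ-rep t t∈S))
            N∈ : N ∈ ω
            N∈ = eqv-ω (proj₂ (φ-rep t t∈S))
            -- A sequence and its representative agree strictly beyond N, hence the successor.
            n : V
            n = sucV N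
            n∈ : n ∈ ω
            n∈ = suc∈ω N∈
            -- the sequence a, overwritten by a (n + 1) up to n
            WP : Env 2 → V → V → Set ℓ
            WP (∙ ▹ s ▹ n) k y = (n ∈ k × y ≡ snd (app s (sucV k))) ⊎ (¬ n ∈ k × y ≡ snd (app s (sucV (sucV n))))
            WQ : Env 2 → V → Set ℓ
            WQ γ q = WP γ (fst q) (snd q)
            private
             opaque
              defWQ : Def full {3} (λ γ → WQ (init γ) (last γ))
              defWQ = find _
            w : V
            w = sep WQ ⦃ defWQ ⦄ (∙ ▹ s ▹ n) (ω ⊗ A)
            ∈w : ∀ {k y} → ⟪ k ، y ⟫ ∈ w ⇔ (k ∈ ω × y ∈ A × WP (∙ ▹ s ▹ n) k y)
            ∈w {k} {y} = ∈sep WQ ⦃ defWQ ⦄ (∙ ▹ s ▹ n) (ω ⊗ A) ∙⇔ mk⇔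
              (λ (h , p) → let (i , j) = to pair∈⊗ h in i , j , subst₂ (WP (∙ ▹ s ▹ n)) fst-⟪⟫ snd-⟪⟫ p)
              (λ (i , j , p) → from pair∈⊗ (i , j) , subst₂ (WP (∙ ▹ s ▹ n)) (sym fst-⟪⟫) (sym snd-⟪⟫) p)
            w-uni : ∀ {k y z} → WP (∙ ▹ s ▹ n) k y → WP (∙ ▹ s ▹ n) k z → y ≡ z
            w-uni (inj₁ (_ , e)) (inj₁ (_ , f)) = trans e (sym f)
            w-uni (inj₂ (_ , e)) (inj₂ (_ , f)) = trans e (sym f)
            w-uni (inj₁ (h , _)) (inj₂ (no , _)) = ⊥-elim (no h)
            w-uni (inj₂ (no , _)) (inj₁ (h , _)) = ⊥-elim (no h)
            w-at : ∀ k → k ∈ ω → ∃[ y ] (⟪ k ، y ⟫ ∈ w × y ∈ X (sucV n))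
            w-at k h with lem (λ (∙ ▹ n ▹ k) → n ∈ k) (∙ ▹ n ▹ k)
            ... | inj₁ l = a k , from ∈w (h , X⊆A h _ (a∈ h) , inj₁ (l , refl)) , down k h (sucV n) (f (Ord-⊆ (Ord-suc no) (Ord-∈ Ord-ω h) (Ord-suc-⊆ (Ord-∈ Ord-ω h) l))) _ (a∈ h)
              where
              no = Ord-∈ Ord-ω n∈
              f : sucV n ∈ k ⊎ sucV n ≡ k → sucV n ∈ sucV k
              f (inj₁ h) = from ∈suc (inj₁ h)
              f (inj₂ e) = from ∈suc (inj₂ e)
            ... | inj₂ no = a (sucV n) , from ∈w (h , X⊆A (suc∈ω n∈) _ (a∈ (suc∈ω n∈)) , inj₂ (no , refl)) , a∈ (suc∈ω n∈)
            w-Fn : Fn w ω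
            w-Fn = record
              { fn-rel = λ q h → let (k , i , y , j , e) = to ∈⊗ (proj₁ (to (∈sep WQ ⦃ defWQ ⦄ (∙ ▹ s ▹ n) (ω ⊗ A)) h)) in k , i , y , e
              ; fn-tot = λ k h → let (y , i , _) = w-at k h in y , i
              ; fn-uni = λ k h y z i j → w-uni (proj₂ (proj₂ (to ∈w i))) (proj₂ (proj₂ (to ∈w j))) }
            w-X : ∀ k → k ∈ ω → app w k ∈ X (sucV n)
            w-X k h = let (y , i , j) = w-at k h in subst (_∈ X (sucV n)) (sym (app-eq w-Fn i)) j
            w∈S : w ∈ S
            w∈S = from ∈⇛ (w-Fn , λ k h → X⊆A (suc∈ω n∈) _ (w-X k h))
            w~t : Eqv ω w t
            w~t = record { eqv-ω = n∈ ; eqv-≡ = λ k h l →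
              trans (app-eq w-Fn (from ∈w (h , X⊆A h _ (a∈ h) , inj₁ (l , refl)))) (sym (lam-app AT ⦃ defAT ⦄ h)) }
            absurd : ⊥₀
            absurd = proj₂ (proj₂ (to T⇔ (proj₂ (tr n n∈)))) record { hit-ω = n∈ ; hit-S = w∈S ; hit-Y = w-X
              ; hit-≡ = trans (cong (λ f → app f n) (φ-eqv w w∈S t t∈S w~t))
                  (trans (sym (eqv-≡ (proj₂ (φ-rep t t∈S)) n n∈ ∈suc-refl)) (lam-app AT ⦃ defAT ⦄ n∈)) }
        opaque
         -- Otherwise dependent choice gives X 0 ⊇ X 1 ⊇ ... and points a n ∈ X n not hit from X (n
         -- + 1). At a suitable n, the representative of the sequence a takes the value a n. The
         -- sequence w has all its values in X (n + 1) and agrees with a beyond n, so it has the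
         -- same representative and hits a n from X (n + 1).
         jonsson : ∃[ X ] ∃[ b ] (X ⊆ A × Bij b A X × (∀ Y → ∀ b′ → Y ⊆ X → Bij b′ A Y → ∀ x → x ∈ X → Hit ω S φ Y x))
         jonsson = by-contra GoalP (∙ ▹ A ▹ S ▹ φ) λ no →
           let (s , _ , _ , tr) = DC.dc T (find _) ⟪ S ، φ ⟫ D ⟪ A ، a₀ ⟫
                 (from ∈D ((λ _ h → h) , a₀∈ , _ , idB)) (step no)
           in Diag.absurd s tr
           where
           IT : Env 0 → V → V
           IT _ x = x
           defIT : DefT full {1} (λ γ → IT (init γ) (last γ))
           defIT = findT _
           idB : Bij (lam IT ⦃ defIT ⦄ ∙ A) A A
           idB = record { bij-Inj = record { inj-Fn = lam-Fn IT ⦃ defIT ⦄ ; inj-into = λ x h → subst (_∈ A) (sym (lam-app IT ⦃ defIT ⦄ h)) h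
                            ; inj-inj = λ x h y k e → trans (sym (lam-app IT ⦃ defIT ⦄ h)) (trans e (lam-app IT ⦃ defIT ⦄ k)) }
                        ; bij-onto = λ y h → y , h , lam-app IT ⦃ defIT ⦄ h }
    open JonssonFunctions

    -- Kunen's theorem and reflection at a strong cardinal.

    module StrongTransfer where
      Good-fst : ∀ {M x y} → Good M → M ⟪ x ، y ⟫ → M x
      Good-fst g m = let (z , h , k , l) = ∈⟪⟫-comps in tr g k (tr g h m)
      Good-snd : ∀ {M x y} → Good M → M ⟪ x ، y ⟫ → M y
      Good-snd g m = let (z , h , k , l) = ∈⟪⟫-comps in tr g l (tr g h m)

      Lim-⊗ : ∀ {x a b} → Lim x → a ∈ R x → b ∈ R x → (a ⊗ b) ∈ R x
      Lim-⊗ l h k = R-super (Lim-𝒫 l (Lim-𝒫 l (cl-⋃ g (cl-,, g h k)))) λ z m → let (x , p , y , q , e) = to ∈⊗ m in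
        subst (_∈ _) (sym e) (⟪⟫-𝒫𝒫 p q)
        where g = Lim-Good l

      private
        EqT : V → V → V → Set ℓ
        EqT _ x y = y ≡ x
      opaque
       lim-above : ∀ z → ∃[ x ] (Lim x × z ∈ R x)
       lim-above z = let (x , l , h , _) = Choice.closure EqT (find _) ∅ (λ x → x , refl) z in x , l , h

      module KunenInconsistency (j M : Class) (el : IsElementaryEmbedding j M) (trM : IsTransitiveClass M) where
        open Embedding j M el trM
        private
          JonP : Env 7 → Set ℓ
          JonP (∙ ▹ X ▹ A ▹ o ▹ S ▹ φ ▹ Y ▹ b) = Y ⊆ X → Bij b A Y → ∀ x → x ∈ X → Hit o S φ Y x
          FnsP : Env 2 → Set ℓ
          FnsP (∙ ▹ S ▹ o) = ∀ s → s ∈ S → Fn s o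
          TP : Env 2 → V → Set ℓ
          TP (∙ ▹ e ▹ s) q = app e (snd q) ≡ app s (fst q)
        private
         opaque
          defTP : Def full {3} (λ γ → TP (init γ) (last γ))
          defTP = find _
        -- Move the property of X along j. The pointwise image Y of X and a bijection of A with Y
        -- lie in M, so each point of j X is hit by a sequence s from Y. Such an s is j t for some
        -- t, so the point lies in the range of j, and j X is contained in that range. But j b is a
        -- bijection of A = j A with j X; pulled back along it, κ would be in the range too.
        kunen : ∀ {A κ} → J A ≡ A → κ ∈ A → (∀ ξ → J ξ ≢ κ) →
                (∀ Y → Y ⊆ A → 𝕄 Y) → (∀ Y → Y ⊆ A ⊗ A → 𝕄 Y) → ⊥₀
        kunen {A} {κ} JA κ∈ no-ran sub₁ sub₂ = final
          where
          open Jonsson A κ κ∈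
          X b e : V
          X = proj₁ jonsson
          b = proj₁ (proj₂ jonsson)
          X⊆ : X ⊆ A
          X⊆ = proj₁ (proj₂ (proj₂ jonsson))
          B : Bij b A X
          B = proj₁ (proj₂ (proj₂ (proj₂ jonsson)))
          hitJ : ∀ Y b′ → 𝕄 Y → 𝕄 b′ → Y ⊆ J X → Bij b′ (J A) Y → ∀ x → x ∈ J X → Hit (J ω) (J S) (J φ) Y x
          hitJ = elemΠ₂ JonP (∙ ▹ X ▹ A ▹ ω ▹ S ▹ φ) (proj₂ (proj₂ (proj₂ (proj₂ jonsson))))
          e = J↾ X
          JX⊆ : J X ⊆ A
          JX⊆ = subst (J X ⊆_) JA (to (elem (λ (∙ ▹ x ▹ y) → x ⊆ y) (∙ ▹ X ▹ A)) X⊆)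
          Y c : V
          Y = e ″ X
          c = (J↾ A ⊙ b) A
          Y∋ : ∀ {z} → z ∈ X → J z ∈ Y
          Y∋ h = from ∈″ (_ , h , sym (J↾-app h))
          ∋Y : ∀ {y} → y ∈ Y → ∃[ z ] (z ∈ X × y ≡ J z)
          ∋Y h = let (z , k , q) = to ∈″ h in z , k , trans q (J↾-app k)
          b∈ : ∀ {ξ} → ξ ∈ A → app b ξ ∈ X
          b∈ h = inj-into (bij-Inj B) _ h
          c-app : ∀ {ξ} → ξ ∈ A → app c ξ ≡ J (app b ξ)
          c-app h = trans (⊙-app h) (J↾-app (X⊆ _ (b∈ h)))
          c-Bij : Bij c A Y
          c-Bij = record
            { bij-Inj = record { inj-Fn = ⊙-Fn ; inj-into = λ ξ h → subst (_∈ Y) (sym (c-app h)) (Y∋ (b∈ h))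
                ; inj-inj = λ ξ h ζ k q → inj-inj (bij-Inj B) ξ h ζ k (J-inj (trans (sym (c-app h)) (trans q (c-app k)))) }
            ; bij-onto = λ y h → let (z , k , q) = ∋Y h ; (ξ , l , r) = bij-onto B z k in
                ξ , l , trans (c-app l) (trans (cong J r) (sym q)) }
          Y⊆ : Y ⊆ J X
          Y⊆ y h = let (z , k , q) = ∋Y h in subst (_∈ J X) (sym q) (to J-∈ k)
          𝕄Y : 𝕄 Y
          𝕄Y = sub₁ Y λ y h → JX⊆ y (Y⊆ y h)
          𝕄c : 𝕄 c
          𝕄c = sub₂ c λ q h → let (ξ , k , y , r) = fn-rel (inj-Fn (bij-Inj c-Bij)) q h in
            subst (_∈ A ⊗ A) (sym r) (from pair∈⊗ (k , subst (_∈ A) (app-eq (inj-Fn (bij-Inj c-Bij)) (subst (_∈ c) r h))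
              (JX⊆ _ (Y⊆ _ (inj-into (bij-Inj c-Bij) ξ k)))))
          module _ (x : V) (H : Hit (J ω) (J S) (J φ) Y x) where
            s n t : V
            s = hit-s H
            n = hit-n H
            n∈ : n ∈ ω
            n∈ = subst (n ∈_) J-ω (hit-ω H)
            sY : ∀ k → k ∈ ω → app s k ∈ Y
            sY k h = hit-Y H k (subst (k ∈_) (sym J-ω) h)
            s-Fn : Fn s ω
            s-Fn = subst (Fn s) J-ω (to (elem FnsP (∙ ▹ S ▹ ω)) (λ s h → proj₁ (to ∈⇛ h)) s (hit-S H))
            t = sep TP ⦃ defTP ⦄ (∙ ▹ e ▹ s) (ω ⊗ X)
            ∈t : ∀ {k z} → ⟪ k ، z ⟫ ∈ t ⇔ (k ∈ ω × z ∈ X × J z ≡ app s k)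
            ∈t {k} {z} = mk⇔
              (λ h → let (p , q) = to (∈sep TP ⦃ defTP ⦄ (∙ ▹ e ▹ s) (ω ⊗ X)) h ; (i , l) = to pair∈⊗ p in
                i , l , trans (sym (J↾-app l)) (subst₂ (λ a b → app e a ≡ app s b) snd-⟪⟫ fst-⟪⟫ q))
              (λ (i , l , q) → from (∈sep TP ⦃ defTP ⦄ (∙ ▹ e ▹ s) (ω ⊗ X)) (from pair∈⊗ (i , l) ,
                subst₂ (λ a b → app e a ≡ app s b) (sym snd-⟪⟫) (sym fst-⟪⟫) (trans (J↾-app l) q)))
            t-Fn : Fn t ω
            t-Fn = record
              { fn-rel = λ q h → let (k , i , z , l , r) = to ∈⊗ (proj₁ (to (∈sep TP ⦃ defTP ⦄ (∙ ▹ e ▹ s) (ω ⊗ X)) h)) in k , i , z , r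
              ; fn-tot = λ k h → let (z , l , q) = ∋Y (sY k h) in z , from ∈t (h , l , sym q)
              ; fn-uni = λ k h y z p q → J-inj (trans (proj₂ (proj₂ (to ∈t p))) (sym (proj₂ (proj₂ (to ∈t q))))) }
            t-val : ∀ k → k ∈ ω → app t k ∈ X × J (app t k) ≡ app s k
            t-val k h = proj₂ (to ∈t (app-∈ t-Fn h))
            -- Both are functions on ω, and j fixes each k ∈ ω, so the value of `J t` at k is j (t
            -- k).
            Jt : J t ≡ s
            Jt = fn-ext (subst (Fn (J t)) J-ω (to (elem (λ (∙ ▹ t ▹ o) → Fn t o) (∙ ▹ t ▹ ω)) t-Fn)) s-Fn λ k h →
              trans (cong (app (J t)) (sym (J-nat k h))) (trans (sym J-app) (proj₂ (t-val k h)))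
            t∈S : t ∈ S
            t∈S = from ∈⇛ (t-Fn , λ k h → X⊆ _ (proj₁ (t-val k h)))
            hit-ran : ∃[ z ] (J z ≡ x)
            hit-ran = app (app φ t) n , trans J-app (trans (cong₂ app (trans J-app (cong (app (J φ)) Jt)) (J-nat n n∈)) (hit-≡ H))
          JB : Bij (J b) (J A) (J X)
          JB = to J-Bij B
          κ∈J : κ ∈ J A
          κ∈J = subst (κ ∈_) (sym JA) κ∈
          final : ⊥₀
          final =
            let x∈ = inj-into (bij-Inj JB) κ κ∈J
                (z , q) = hit-ran _ (hitJ Y c 𝕄Y 𝕄c Y⊆ (subst (λ a → Bij c a Y) (sym JA) c-Bij) _ x∈)
                z∈ = from J-∈ (subst (_∈ J X) (sym q) x∈)
                (ξ , h , r) = bij-onto B z z∈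
            in no-ran ξ (inj-inj (bij-Inj JB) (J ξ) (to J-∈ h) κ κ∈J (trans (sym J-app) (trans (cong J r) q)))

      -- If P maps to every member of the class Θ below κ, it maps to all of Θ.  Otherwise let R δ be the
      -- least level above which a bad member occurs; applying j moves the good level R δ to R (j δ), so
      -- j δ = δ, against Kunen's theorem.

      module Transfer (θ : Formula 1) (up : Upward θ) (U E : V) where
        Θ : V → Set ℓ
        Θ G = 𝕍 ⊨ θ [ G ∷ [] ]
        record Bad (U E δ : V) : Set ℓ where
          field
            {bad-G} : V
            bad-Θ : Θ bad-G
            bad-R : bad-G ∈ R δ
            bad-¬ : ¬ (∃[ h ] Hom h ⟪ U ، E ⟫ bad-G)
        open Bad
        private
          opaque
           instance
            iΘ : ∀ {n} {s : Env n → V} ⦃ _ : DefT full s ⦄ → Def full (λ γ → Θ (s γ))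
            iΘ ⦃ a ⦄ = sub1 (λ (∙ ▹ G) → Θ G) (iso (λ γ → id⇔) (formD θ)) a
          opaque
           instance
            iBad : Def full {3} (λ (∙ ▹ U ▹ E ▹ δ) → Bad U E δ)
            iBad = iso {P = λ (∙ ▹ U ▹ E ▹ δ) → ∃[ G ] (Θ G × G ∈ R δ × ¬ (∃[ h ] Hom h ⟪ U ، E ⟫ G))}
              (λ γ → mk⇔ (λ (_ , a , b , c) → record { bad-Θ = a ; bad-R = b ; bad-¬ = c }) (λ b → _ , bad-Θ b , bad-R b , bad-¬ b))
              (dEx ⦃ dAnd ⦃ iΘ ⦄ ⦃ find _ ⦄ ⦄)
          RkT : Env 0 → V → V
          RkT _ x = rk x
          -- A certificate for x ∈ V_δ: a transitive set containing x and a function on it, with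
          -- values below δ, that increases along ∈. V_δ enters only as a variable v, so the
          -- implication is absolute and can be moved by j.
          LowP : Env 5 → Set ℓ
          LowP (∙ ▹ δ ▹ v ▹ x ▹ T ▹ r) = Tr T → x ∈ T → (∀ z → z ∈ T → app r z ∈ δ) →
            (∀ z → z ∈ T → ∀ y → y ∈ z → app r y ∈ app r z) → x ∈ v
          low-rank : ∀ δ x T r → LowP (∙ ▹ δ ▹ R δ ▹ x ▹ T ▹ r)
          low-rank δ x T r t x∈ into mono = from ∈R (app r x , into x x∈ ,
            ∈-ind (λ (∙ ▹ T ▹ r) z → z ∈ T → z ⊆ R (app r z)) (∙ ▹ T ▹ r)
              (λ z ih h y k → from ∈R (app r y , mono z h y k , ih y k (trn t z h y k))) x x∈)
          HF : Def abs {4} (λ (∙ ▹ v ▹ A ▹ G ▹ h) → Hom h A G)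
          HF = find _
          goodF : Formula 2
          goodF = ∀ˢ (zero ˢ∈ suc (suc zero) ⇒ˢ ren (λ _ → zero) θ ⇒ˢ ∃ˢ (form HF))

        private
         opaque
          defRkT : DefT full {1} (λ γ → RkT (init γ) (last γ))
          defRkT = findT _
        private
         transfer′ : ∀ κ → IsStrong κ → (∀ G → Θ G → G ∈ R κ → ∃[ h ] Hom h ⟪ U ، E ⟫ G) → ∀ G → Θ G → ∃[ h ] Hom h ⟪ U ، E ⟫ G
         transfer′ κ (cκ , strong) base G₀ θ₀ = by-contra (λ (∙ ▹ U ▹ E ▹ G) → ∃[ h ] Hom h ⟪ U ، E ⟫ G) (∙ ▹ U ▹ E ▹ G₀) λ no →
           let (δ , o , b , min) = Ord-least (λ (∙ ▹ U ▹ E) δ → Bad U E δ) ⦃ iBad ⦄ (∙ ▹ U ▹ E)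
                 (sucV (rk G₀) , Ord-suc rk-Ord , record { bad-Θ = θ₀ ; bad-R = from ∈R (_ , ∈suc-refl , rk-⊆) ; bad-¬ = no })
               -- The bad graph in the least bad level is a subset of V_δ′ for some δ′ below δ, and
               -- the graphs in V_δ′ are still good. The argument runs with δ′.
               (δ′ , k , s) = to ∈R (bad-R b)
           in main δ′ (Ord-∈ o k) (bad-G b) (bad-Θ b) s (bad-¬ b) λ G t h →
                by-contra (λ (∙ ▹ U ▹ E ▹ G) → ∃[ h ] Hom h ⟪ U ، E ⟫ G) (∙ ▹ U ▹ E ▹ G) λ nh →
                  min δ′ k record { bad-Θ = t ; bad-R = h ; bad-¬ = nh }
           where
           κo : Ord κ
           κo = card-Ord (from Card⇔ cκ)
           main : ∀ δ → Ord δ → ∀ G → Θ G → G ⊆ R δ → ¬ (∃[ h ] Hom h ⟪ U ، E ⟫ G) →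
                  (∀ G → Θ G → G ∈ R δ → ∃[ h ] Hom h ⟪ U ، E ⟫ G) → ⊥₀
           main δ o G t s no good = choose (strong μ (to Card⇔ μc) κ∈μ)
             where
             upG = up (G ∷ []) t
             w Z x α μ : V
             w = proj₁ upG
             -- All that has to lie in M, in one set: the level, the bad graph, and the witness that
             -- keeps the graph in the class as seen by M.
             Z = ⟪ δ ، ⟪ G ، w ⟫ ⟫
             limZ : ∃[ x ] (Lim x × Z ∈ R x)
             limZ = lim-above Z
             x = proj₁ limZ
             xl : Lim x
             xl = proj₁ (proj₂ limZ)
             xo = lim-Ord xl
             g : Good (_∈ R x)
             g = Lim-Good xl
             Z∈ : Z ∈ R x
             Z∈ = proj₂ (proj₂ limZ)
             δ∈ : δ ∈ R x
             δ∈ = Good-fst g Z∈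
             -- The maximum of the two: μ has to exceed κ for strongness to apply, and x for V_x to
             -- be inside M.
             α = ⋃ (x ,, κ)
             αo : Ord α
             αo = ∪-Ord xo κo
             crd : ∃[ μ ] (Card μ × α ∈ μ)
             crd = card-above α αo
             μ = proj₁ crd
             μc : Card μ
             μc = proj₁ (proj₂ crd)
             ⊆α : ∀ {β} → Ord β → β ⊆ α → β ∈ μ
             ⊆α b s with Ord-⊆ b αo s
             ... | inj₁ h = Ord-tr (card-Ord μc) h (proj₂ (proj₂ crd))
             ... | inj₂ refl = proj₂ (proj₂ crd)
             κ∈μ : κ ∈ μ
             κ∈μ = ⊆α κo ⊆∪r
             x⊆μ : x ⊆ μ
             x⊆μ z h = Ord-tr (card-Ord μc) h (⊆α xo ⊆∪l)
             choose : IsStrongUpTo μ κ → ⊥₀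
             choose (j , M , el , trM , crit , v , vμ , v⊆) = cmp (Ord-cmp (to J-Ord o) o)
               where
               open Embedding j M el trM
               open KunenInconsistency j M el trM
               in𝕄 : ∀ {z} → z ∈ R x → 𝕄 z
               in𝕄 {z} h = v⊆ z (subst (z ∈_) (sym (RankInit-uniq (card-Ord μc) vμ)) (R-mono x⊆μ z h))
               κ∉ : ∀ ξ → J ξ ≢ κ
               κ∉ ξ = crit-∉ran crit
               κ∈δ : ¬ δ ∈ κ → J δ ≡ δ → κ ∈ δ
               κ∈δ no e with Ord-cmp κo o
               ... | inj₁ h = h
               ... | inj₂ (inj₁ refl) = ⊥-elim (κ∉ κ e)
               ... | inj₂ (inj₂ h) = ⊥-elim (no h)
               δ∉κ : ¬ δ ∈ κ
               δ∉κ h = no (base G t (from ∈R (δ , h , s)))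
               cmp : J δ ∈ δ ⊎ J δ ≡ δ ⊎ δ ∈ J δ → ⊥₀
               cmp (inj₁ h) = J-up o h
               -- Kunen's argument with the ordinal δ itself as A: the subsets of δ and of δ × δ
               -- already belong to V_x, hence to M.
               cmp (inj₂ (inj₁ e)) = kunen e (κ∈δ δ∉κ e) κ∉
                 (λ Y h → in𝕄 (R-super δ∈ h)) (λ Y h → in𝕄 (R-super (Lim-⊗ xl δ∈ δ∈) h))
               -- The rank of G is at most δ, hence below j δ. So G is a member of j (V_δ), and M
               -- sees every such graph of the class as good for the image of ⟪ U ، E ⟫.
               cmp (inj₂ (inj₂ h)) = no (⊙-Hom (proj₂ hom) (mkHom refl J-⟪⟫ J-Hom))
                 where
                 δ∈x : δ ∈ x
                 δ∈x = Ord-R xo o δ∈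
                 T r : V
                 T = R (sucV δ)
                 T∈ : T ∈ R x
                 T∈ = R-∈ (lim-suc xl δ δ∈x)
                 r = lam RkT ⦃ defRkT ⦄ ∙ T
                 r-val : ∀ {z} → z ∈ T → app r z ≡ rk z
                 r-val = lam-app RkT ⦃ defRkT ⦄
                 rk∈ : ∀ {z} → z ∈ T → rk z ∈ sucV δ
                 rk∈ k = let (β , l , i) = to ∈R k in rk-≤ o λ y m → R-mono (β⊆ (to ∈suc l)) y (i y m)
                   where
                   β⊆ : ∀ {β} → β ∈ δ ⊎ β ≡ δ → β ⊆ δ
                   β⊆ (inj₁ l) z m = Ord-tr o m l
                   β⊆ (inj₂ refl) z m = m
                 r∈ : r ∈ R x
                 r∈ = R-super (Lim-⊗ xl T∈ (trn (R-Tr x) _ (R-∈ (lim-suc xl _ (lim-suc xl δ δ∈x))) _ (from ∈R (_ , ∈suc-refl , R-⊆ _))))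
                   λ q m → let (z , k , e) = to (∈lam RkT ⦃ defRkT ⦄) m in subst (_∈ T ⊗ sucV δ) (sym e) (from pair∈⊗ (k , rk∈ k))
                 G∈J : G ∈ J (R δ)
                 G∈J = elemΠ₃ LowP (∙ ▹ δ ▹ R δ) (low-rank δ) G T r (in𝕄 (Good-fst g (Good-snd g Z∈))) (in𝕄 T∈) (in𝕄 r∈)
                   (R-Tr _) (from ∈R (δ , ∈suc-refl , s))
                   (λ z k → subst (_∈ J δ) (sym (r-val k)) (Ord-suc-⊆ (to J-Ord o) h _ (rk∈ k)))
                   (λ z k y l → subst₂ _∈_ (sym (r-val (trn (R-Tr _) z k y l))) (sym (r-val k)) (rk-∈ l))
                 G𝕄 : 𝕄 G
                 G𝕄 = in𝕄 (Good-fst g (Good-snd g Z∈))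
                 hom : ∃[ h ] Hom h (J ⟪ U ، E ⟫) G
                 hom = let (k , mk , K) = to (elemF goodF (∙ ▹ R δ ▹ ⟪ U ، E ⟫))
                             (λ G _ h t → let (k , K) = good G (from (ren-⊨ 𝕍 (λ _ → zero) θ (G ∷ []) _ (λ { zero → refl })) t) h in
                                k , tt , to (ok (any {full} HF) 𝕍 allV (∙ ▹ R δ ▹ ⟪ U ، E ⟫ ▹ G ▹ k) ((((tt , tt) , tt) , tt) , tt)) K)
                             G G𝕄 G∈J (to (ren-⊨ 𝕄 (λ _ → zero) θ (G ∷ []) _ (λ { zero → refl }))
                               (proj₂ upG 𝕄 𝕄-Good (in𝕄 (Good-snd g (Good-snd g Z∈))) (tt , G𝕄)))
                       in k , from (ok HF 𝕄 𝕄-Good (∙ ▹ J (R δ) ▹ J ⟪ U ، E ⟫ ▹ G ▹ k) ((((tt , J-𝕄 _) , J-𝕄 _) , G𝕄) , mk)) K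
        opaque
          transfer : ∀ κ → IsStrong κ → (∀ G → Θ G → G ∈ R κ → ∃[ h ] Hom h ⟪ U ، E ⟫ G) → ∀ G → Θ G → ∃[ h ] Hom h ⟪ U ، E ⟫ G
          transfer = transfer′
    open StrongTransfer

    -- Products and the consequences of a strong cardinal.

    module Products where
      IsGraph-⟪⟫ : ∀ {A} → IsGraph A → A ≡ ⟪ fst A ، snd A ⟫
      IsGraph-⟪⟫ (G , E , e , _) with to ≐⇔ e
      ... | refl = sym (cong₂ ⟪_،_⟫ fst-⟪⟫ snd-⟪⟫)

      private
        UP : Env 1 → V → Set ℓ
        UP (∙ ▹ S) f = ∀ A → A ∈ S → app f A ∈ fst A
        EP : Env 1 → V → Set ℓ
        EP (∙ ▹ S) p = ∀ A → A ∈ S → ⟪ app (fst p) A ، app (snd p) A ⟫ ∈ snd A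
        PrT : Env 1 → V → V
        PrT (∙ ▹ A) f = app f A

      private
       opaque
        defUP : Def full {2} (λ γ → UP (init γ) (last γ))
        defUP = find _
        defEP : Def full {2} (λ γ → EP (init γ) (last γ))
        defEP = find _
        defPrT : DefT full {2} (λ γ → PrT (init γ) (last γ))
        defPrT = findT _
      product : ∀ S → (∀ A → A ∈ S → IsGraph A) →
                ∃[ U ] ∃[ E ] (IsProduct ⟪ U ، E ⟫ S × (∀ A → A ∈ S → ∃[ h ] Hom h ⟪ U ، E ⟫ A))
      product S graphs = U , E , (U , E , from ≐⇔ refl , (λ f → mk⇔ U-fw U-bw) , λ p → mk⇔ E-fw E-bw) ,
        λ A h → lam PrT ⦃ defPrT ⦄ (∙ ▹ A) U , mkHom refl (pr h) record
          { hom-Fn = lam-Fn PrT ⦃ defPrT ⦄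
          ; hom-into = λ f k → subst (_∈ fst A) (sym (lam-app PrT ⦃ defPrT ⦄ k)) (proj₂ (to ∈U k) A h)
          ; hom-edge = λ f k g l e → subst₂ (λ x y → ⟪ x ، y ⟫ ∈ snd A) (sym (lam-app PrT ⦃ defPrT ⦄ k)) (sym (lam-app PrT ⦃ defPrT ⦄ l)) (proj₂ (proj₂ (to ∈E e)) A h) }
        where
        pr : ∀ {A} → A ∈ S → A ≡ ⟪ fst A ، snd A ⟫
        pr h = IsGraph-⟪⟫ (graphs _ h)
        U E : V
        -- The vertex set of a pair A ∈ S is a member of ⋃ ⋃ S, so the vertices lie one union
        -- deeper.
        U = sep UP ⦃ defUP ⦄ (∙ ▹ S) (S ⇛ ⋃ (⋃ (⋃ S)))
        E = sep EP ⦃ defEP ⦄ (∙ ▹ S) (U ⊗ U)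
        ∈U : ∀ {f} → f ∈ U ⇔ (Fn f S × (∀ A → A ∈ S → app f A ∈ fst A))
        ∈U {f} = mk⇔ (λ h → let (k , p) = to (∈sep UP ⦃ defUP ⦄ (∙ ▹ S) (S ⇛ ⋃ (⋃ (⋃ S)))) h in proj₁ (to ∈⇛ k) , p)
          λ (F , p) → from (∈sep UP ⦃ defUP ⦄ (∙ ▹ S) (S ⇛ ⋃ (⋃ (⋃ S)))) (from ∈⇛ (F , λ A h →
            from ∈⋃ (fst A , subst (λ B → fst B ∈ ⋃ (⋃ S)) (sym (pr h)) (subst (_∈ ⋃ (⋃ S)) (sym fst-⟪⟫)
              (let (z , i , k , _) = ∈⟪⟫-comps in from ∈⋃ (z , from ∈⋃ (A , h , subst (z ∈_) (sym (pr h)) i) , k))) , p A h)) , p)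
        ∈E : ∀ {f g} → ⟪ f ، g ⟫ ∈ E ⇔ (f ∈ U × g ∈ U × (∀ A → A ∈ S → ⟪ app f A ، app g A ⟫ ∈ snd A))
        ∈E {f} {g} = mk⇔
          (λ h → let (k , p) = to (∈sep EP ⦃ defEP ⦄ (∙ ▹ S) (U ⊗ U)) h ; (i , l) = to pair∈⊗ k in
            i , l , λ A m → subst₂ (λ x y → ⟪ app x A ، app y A ⟫ ∈ snd A) fst-⟪⟫ snd-⟪⟫ (p A m))
          (λ (i , l , p) → from (∈sep EP ⦃ defEP ⦄ (∙ ▹ S) (U ⊗ U)) (from pair∈⊗ (i , l) ,
            λ A m → subst₂ (λ x y → ⟪ app x A ، app y A ⟫ ∈ snd A) (sym fst-⟪⟫) (sym snd-⟪⟫) (p A m)))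
        U-fw : ∀ {f} → f ∈ U → IsFunctionOn f S × (∀ A G E x → A ∈ S → A ≐⟨ G ⨾ E ⟩ → f ∋⟨ A ⨾ x ⟩ → x ∈ G)
        U-fw h = let (F , p) = to ∈U h in to Fn⇔ F , λ A G E x k e l →
          subst₂ _∈_ (app-eq F (to ∋⇔ l)) (trans (cong fst (to ≐⇔ e)) fst-⟪⟫) (p A k)
        U-bw : ∀ {f} → IsFunctionOn f S × (∀ A G E x → A ∈ S → A ≐⟨ G ⨾ E ⟩ → f ∋⟨ A ⨾ x ⟩ → x ∈ G) → f ∈ U
        U-bw (F , p) = from ∈U (from Fn⇔ F , λ A h → p A (fst A) (snd A) _ h (from ≐⇔ (pr h)) (from ∋⇔ (app-∈ (from Fn⇔ F) h)))
        E-fw : ∀ {p} → p ∈ E → ∃₂ λ f g → (p ≐⟨ f ⨾ g ⟩) × f ∈ U × g ∈ U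
               × (∀ A G E x y → A ∈ S → A ≐⟨ G ⨾ E ⟩ → f ∋⟨ A ⨾ x ⟩ → g ∋⟨ A ⨾ y ⟩ → E ∋⟨ x ⨾ y ⟩)
        E-fw {p} h with to ∈⊗ (proj₁ (to (∈sep EP ⦃ defEP ⦄ (∙ ▹ S) (U ⊗ U)) h))
        ... | f , i , g , l , refl = f , g , from ≐⇔ refl , i , l , λ A G D x y k e m n →
          from ∋⇔ (subst₂ _∈_ (cong₂ ⟪_،_⟫ (app-eq (proj₁ (to ∈U i)) (to ∋⇔ m)) (app-eq (proj₁ (to ∈U l)) (to ∋⇔ n)))
            (trans (cong snd (to ≐⇔ e)) snd-⟪⟫) (proj₂ (proj₂ (to ∈E h)) A k))
        E-bw : ∀ {p} → (∃₂ λ f g → (p ≐⟨ f ⨾ g ⟩) × f ∈ U × g ∈ U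
               × (∀ A G E x y → A ∈ S → A ≐⟨ G ⨾ E ⟩ → f ∋⟨ A ⨾ x ⟩ → g ∋⟨ A ⨾ y ⟩ → E ∋⟨ x ⨾ y ⟩)) → p ∈ E
        E-bw (f , g , e , i , l , q) with to ≐⇔ e
        ... | refl = from ∈E (i , l , λ A h → to ∋⇔ (q A (fst A) (snd A) _ _ h (from ≐⇔ (pr h))
          (from ∋⇔ (app-∈ (proj₁ (to ∈U i)) h)) (from ∋⇔ (app-∈ (proj₁ (to ∈U l)) h))))

      private
        HomT : V → V → V → Set ℓ
        HomT B A h = Hom h B A
        opaque
          tup : V → V → V → V
          tup f S b = img (λ (∙ ▹ f ▹ b) A → ⟪ A ، app (app f A) b ⟫) (∙ ▹ f ▹ b) S
          ∈tup : ∀ {f S b p} → p ∈ tup f S b ⇔ (∃[ A ] (A ∈ S × p ≡ ⟪ A ، app (app f A) b ⟫))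
          ∈tup = ∈img (λ (∙ ▹ f ▹ b) A → ⟪ A ، app (app f A) b ⟫)
          instance
           itup : ∀ {n} {s t u : Env n → V} ⦃ _ : DefT full s ⦄ ⦃ _ : DefT full t ⦄ ⦃ _ : DefT full u ⦄ → DefT full (λ γ → tup (s γ) (t γ) (u γ))
           itup ⦃ a ⦄ ⦃ b ⦄ ⦃ c ⦄ = subT3 tup (byMem {t = λ γ → tup (last (init (init γ))) (last (init γ)) (last γ)}
             (λ (∙ ▹ f ▹ S ▹ b) p → ∃[ A ] (A ∈ S × p ≡ ⟪ A ، app (app f A) b ⟫)) λ γ z → ∈tup) a b c
        TupT : Env 2 → V → V
        TupT (∙ ▹ f ▹ S) b = tup f S b
        tup-val : ∀ {f S b A y} → ⟪ A ، y ⟫ ∈ tup f S b → A ∈ S × y ≡ app (app f A) b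
        tup-val h with to ∈tup h
        ... | A , k , e with ⟪⟫-inj₁ e
        ... | refl = k , ⟪⟫-inj₂ e
        tup-Fn : ∀ {f S b} → Fn (tup f S b) S
        tup-Fn = record
          { fn-rel = λ p h → let (A , k , e) = to ∈tup h in A , k , _ , e
          ; fn-tot = λ A h → _ , from ∈tup (A , h , refl)
          ; fn-uni = λ A h y z k l → trans (proj₂ (tup-val k)) (sym (proj₂ (tup-val l))) }

      private
       opaque
        defTupT : DefT full {3} (λ γ → TupT (init γ) (last γ))
        defTupT = findT _
      -- Choice picks one homomorphism into each factor; the tuple preserves edges because the
      -- product tests them coordinatewise.
      tupling : ∀ {P S B} → IsProduct P S → IsGraph B → (∀ A → A ∈ S → ∃[ h ] Hom h B A) → ∃[ h ] Hom h B P
      tupling {P} {S} {B} (U , E , eP , U⇔ , E⇔) gB homs =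
        let (f , F , u) = Choice.uniformize HomT (find _) B S homs in go f u
        where
        go : ∀ f → (∀ A → A ∈ S → Hom (app f A) B A) → ∃[ h ] Hom h B P
        go f u = lam TupT ⦃ defTupT ⦄ (∙ ▹ f ▹ S) (fst B) , mkHom (IsGraph-⟪⟫ gB) (to ≐⇔ eP) record
          { hom-Fn = lam-Fn TupT ⦃ defTupT ⦄
          ; hom-into = λ b h → subst (_∈ U) (sym (lam-app TupT ⦃ defTupT ⦄ h)) (tup∈ h)
          ; hom-edge = λ b h c k e → subst₂ (λ x y → ⟪ x ، y ⟫ ∈ E) (sym (lam-app TupT ⦃ defTupT ⦄ h)) (sym (lam-app TupT ⦃ defTupT ⦄ k))
              (from (E⇔ _) (_ , _ , from ≐⇔ refl , tup∈ h , tup∈ k , λ A G D x y A∈ q l m →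
                from ∋⇔ (subst₂ (λ x y → ⟪ x ، y ⟫ ∈ D) (sym (proj₂ (tup-val (to ∋⇔ l)))) (sym (proj₂ (tup-val (to ∋⇔ m)))) (edge A∈ (to ≐⇔ q) h k e)))) }
          where
          ge : ∀ {A G D} → A ∈ S → A ≡ ⟪ G ، D ⟫ → HomGE (app f A) (fst B) (snd B) G D
          ge {A} h e = f′ (u A h) e
            where
            f′ : ∀ {A G D k} → Hom k B A → A ≡ ⟪ G ، D ⟫ → HomGE k (fst B) (snd B) G D
            f′ {k = k} (mkHom p q r) e with ⟪⟫-inj₁ (trans (sym q) e) | ⟪⟫-inj₂ (trans (sym q) e)
            ... | refl | refl = subst₂ (λ G D → HomGE k G D _ _) (sym (trans (cong fst p) fst-⟪⟫)) (sym (trans (cong snd p) snd-⟪⟫)) r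
          edge : ∀ {A G D b c} → A ∈ S → A ≡ ⟪ G ، D ⟫ → b ∈ fst B → c ∈ fst B → ⟪ b ، c ⟫ ∈ snd B → ⟪ app (app f A) b ، app (app f A) c ⟫ ∈ D
          edge h e i l m = hom-edge (ge h e) _ i _ l m
          tup∈ : ∀ {b} → b ∈ fst B → tup f S b ∈ U
          tup∈ h = from (U⇔ _) (to Fn⇔ tup-Fn , λ A G D x A∈ q l →
            subst (_∈ G) (sym (proj₂ (tup-val (to ∋⇔ l)))) (hom-into (ge A∈ (to ≐⇔ q)) _ h))

      -- S is the part of the class inside V_κ; the projections are the homomorphisms that
      -- `transfer` asks for below κ.
      strong⇒PRP : ExistsStrong → PRP (𝚺 2)
      strong⇒PRP (κ , K) φ σ _ graphs =
        let (U , E , pr , proj) = product S λ A h → graphs A (proj₂ (to ∈S h))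
        in S , (λ A h → proj₂ (to ∈S h)) , ⟪ U ، E ⟫ , pr , λ G t →
           let (h , H) = Transfer.transfer φ (Σ₂-upward σ) U E κ K (λ G t l → proj G (from ∈S (l , t))) G t in h , to Hom⇔ H
        where
        ΘP : Env 0 → V → Set ℓ
        ΘP γ G = 𝕍 ⊨ φ [ G ∷ vec γ ]
        dΘ : Def full {1} (λ γ → ΘP (init γ) (last γ))
        dΘ = formD φ
        S : V
        S = sep ΘP ⦃ dΘ ⦄ ∙ (R κ)
        ∈S : ∀ {x} → x ∈ S ⇔ (x ∈ R κ × 𝕍 ⊨ φ [ x ∷ [] ])
        ∈S = ∈sep ΘP ⦃ dΘ ⦄ ∙ (R κ)

      ∋ᶜ⇔ : ∀ {φ α G} → (class₀ φ ∋ᶜ⟨ α ⨾ G ⟩) ⇔ (𝕍 ⊨ φ [ ⟪ α ، G ⟫ ∷ [] ])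
      ∋ᶜ⇔ {φ} = mk⇔ (λ (p , e , h) → subst (λ p → 𝕍 ⊨ φ [ p ∷ [] ]) (to ≐⇔ e) h) (λ h → _ , from ≐⇔ refl , h)

      -- Let β bound an index of each member of the range that lies in V_κ. The graph at β maps to
      -- all of these, hence by `transfer` to the whole range, and in particular to the graph at β +
      -- 1.
      strong⇒SWVP : ExistsStrong → SWVP (𝚺 2)
      strong⇒SWVP (κ , K) (φ , σ , ((rel , fun) , graphs) , homs , no-homs) =
        no-homs β (sucV β) (GG oβ) (GG oβ′) (gr oβ) (gr oβ′) ∈suc-refl (proj₁ final , to (Hom⇔ {proj₁ final} {GG oβ} {GG oβ′}) (subst (λ A → Hom (proj₁ final) A (GG oβ′)) (sym Gβ) (proj₂ final)))
        where
        F : V → V → Set ℓ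
        F α G = 𝕍 ⊨ φ [ ⟪ α ، G ⟫ ∷ [] ]
        IT : V → V → V → Set ℓ
        IT _ G α = F α G
        dIT : Def full {3} (λ γ → IT (last (init (init γ))) (last (init γ)) (last γ))
        dIT = sub1 (λ γ → 𝕍 ⊨ φ [ vec γ ]) (formD φ) (i⟪⟫ ⦃ v0 ⦄ ⦃ v1 ⦄)
        PairD : Def abs {3} (λ (∙ ▹ G ▹ α ▹ p) → p ≡ ⟪ α ، G ⟫)
        PairD = find _
        θ : Formula 1
        θ = ∃ˢ (∃ˢ (ren (λ _ → zero) φ ∧ˢ form PairD))
        θ⇔ : ∀ {G} → (𝕍 ⊨ θ [ G ∷ [] ]) ⇔ (∃[ α ] F α G)
        θ⇔ {G} = mk⇔
          (λ (α , _ , p , _ , h , e) → α , subst (λ p → 𝕍 ⊨ φ [ p ∷ [] ]) (from (ok (any {full} PairD) 𝕍 allV (∙ ▹ G ▹ α ▹ p) (((tt , tt) , tt) , tt)) e)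
                                           (from (ren-⊨ 𝕍 (λ _ → zero) φ (p ∷ []) _ (λ { zero → refl })) h))
          (λ (α , h) → α , tt , ⟪ α ، G ⟫ , tt , to (ren-⊨ 𝕍 (λ _ → zero) φ (⟪ α ، G ⟫ ∷ []) _ (λ { zero → refl })) h ,
                         to (ok (any {full} PairD) 𝕍 allV (∙ ▹ G ▹ α ▹ ⟪ α ، G ⟫) (((tt , tt) , tt) , tt)) refl)
        up : Upward θ
        up (G ∷ []) t = let (α , h) = to θ⇔ t ; (w , f) = Σ₂-upward σ (⟪ α ، G ⟫ ∷ []) h in
          ⟪ w ، ⟪ α ، G ⟫ ⟫ , λ M g m (_ , mG) → let mp = Good-snd g m ; mα = Good-fst g mp in
            α , mα , ⟪ α ، G ⟫ , mp , to (ren-⊨ M (λ _ → zero) φ (⟪ α ، G ⟫ ∷ []) _ (λ { zero → refl })) (f M g (Good-fst g m) (tt , mp)) ,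
              to (ok PairD M g (∙ ▹ G ▹ α ▹ ⟪ α ، G ⟫) (((tt , mG) , mα) , mp)) refl
        dΘ : Def full {1} (λ γ → 𝕍 ⊨ θ [ last γ ∷ [] ])
        dΘ = formD θ
        ΘP : Env 0 → V → Set ℓ
        ΘP _ G = 𝕍 ⊨ θ [ G ∷ [] ]
        D : V
        D = sep ΘP ⦃ dΘ ⦄ ∙ (R κ)
        ∈D : ∀ {x} → x ∈ D ⇔ (x ∈ R κ × 𝕍 ⊨ θ [ x ∷ [] ])
        ∈D = ∈sep ΘP ⦃ dΘ ⦄ ∙ (R κ)
        open Choice IT dIT using (bnd; bnd-Ord; bnd-∈)
        tot : ∀ G → G ∈ D → ∃[ α ] IT ∅ G α
        tot G h = to θ⇔ (proj₂ (to ∈D h))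
        β : V
        β = bnd ∅ D
        oβ : Ord β
        oβ = bnd-Ord tot
        oβ′ : Ord (sucV β)
        oβ′ = Ord-suc oβ
        GG : ∀ {α} → Ord α → V
        GG o = proj₁ (fun _ (to Ord⇔ o))
        gr : ∀ {α} (o : Ord α) → class₀ φ ∋ᶜ⟨ α ⨾ GG o ⟩
        gr o = proj₁ (proj₂ (fun _ (to Ord⇔ o)))
        Gβ : GG oβ ≡ ⟪ fst (GG oβ) ، snd (GG oβ) ⟫
        Gβ = IsGraph-⟪⟫ (graphs β _ (gr oβ))
        base : ∀ G → 𝕍 ⊨ θ [ G ∷ [] ] → G ∈ R κ → ∃[ h ] Hom h ⟪ fst (GG oβ) ، snd (GG oβ) ⟫ G
        base G t h = let (α , k , f) = bnd-∈ tot G (from ∈D (h , t))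
                         (H , p) = homs α β G (GG oβ) (from (∋ᶜ⇔ {φ}) f) (gr oβ) (inj₁ (Ord-R oβ (ordF f) k))
                     in H , subst (λ A → Hom H A G) Gβ (from Hom⇔ p)
          where
          ordF : ∀ {α} → F α G → Ord α
          ordF f = let (x , y , o , e) = rel _ f in subst Ord (sym (⟪⟫-inj₁ (to ≐⇔ e))) (from Ord⇔ o)
        final : ∃[ h ] Hom h ⟪ fst (GG oβ) ، snd (GG oβ) ⟫ (GG oβ′)
        final = Transfer.transfer θ up (fst (GG oβ)) (snd (GG oβ)) κ K base (GG oβ′) (from θ⇔ (sucV β , to (∋ᶜ⇔ {φ}) (gr oβ′)))
    open Products

   open Cardinals public hiding (iBij)
   open Embeddings public hiding (iHom)
   open JonssonFunctions public hiding (iHit)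
   open StrongTransfer public
   open Products public
  open StrongCardinals public

  module Extenders where
   private

    -- Numerals, local relations and edges.

    module Levels where
      opaque
        num : ℕ → V
        num zero = ∅
        num (suc n) = sucV (num n)
        num-0 : num 0 ≡ ∅
        num-0 = refl
        num-suc : ∀ {n} → num (suc n) ≡ sucV (num n)
        num-suc = refl
        instance
         inum : ∀ {m n k} → DefT m {n} (λ γ → num k)
         inum {k = zero} = i∅
         inum {k = suc k} = isuc ⦃ inum {k = k} ⦄
      num∈ω : ∀ k → num k ∈ ω
      num∈ω zero = subst (_∈ ω) (sym num-0) ∅∈ω
      num∈ω (suc k) = subst (_∈ ω) (sym num-suc) (suc∈ω (num∈ω k))
      num-inj : ∀ i k → num i ≡ num k → i ≡ k
      num-inj zero zero e = refl
      num-inj zero (suc k) e = ⊥-elim (suc≢∅ (trans (sym num-suc) (trans (sym e) num-0)))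
      num-inj (suc i) zero e = ⊥-elim (suc≢∅ (trans (sym num-suc) (trans e num-0)))
      num-inj (suc i) (suc k) e = cong suc (num-inj i k (suc-inj (trans (sym num-suc) (trans e num-suc))))
      num-< : ∀ i d → num i ∈ num (suc d + i)
      num-< i zero = subst (num i ∈_) (sym num-suc) ∈suc-refl
      num-< i (suc d) = subst (num i ∈_) (sym num-suc) (from ∈suc (inj₁ (num-< i d)))
      Ord-num : ∀ k → Ord (num k)
      Ord-num k = Ord-∈ Ord-ω (num∈ω k)

      -- Strict increase gives i ≤ f i. One i with i < f i would propagate the strict inequality up
      -- to M, where there is no room left. Applied to copies, this makes graph homomorphisms
      -- respect the levels.
      rigid-nat : ∀ M f → M ∈ ω → (∀ i → i ∈ sucV M → app f i ∈ sucV M) →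
                  (∀ i → sucV i ∈ sucV M → app f i ∈ app f (sucV i)) → ∀ i → i ∈ sucV M → app f i ≡ i
      rigid-nat M f M∈ into incr i i∈ = h (Ord-⊆ (oN i∈) (oN (into i i∈)) (lower i (Nω i∈) i∈))
        where
        Nω : ∀ {k} → k ∈ sucV M → k ∈ ω
        Nω h = Ord-tr Ord-ω h (suc∈ω M∈)
        oN : ∀ {k} → k ∈ sucV M → Ord k
        oN h = Ord-∈ Ord-ω (Nω h)
        oM : Ord (sucV M)
        oM = Ord-∈ Ord-ω (suc∈ω M∈)
        lower : ∀ i → i ∈ ω → i ∈ sucV M → i ⊆ app f i
        lower = ω-ind (λ (∙ ▹ f ▹ M) i → i ∈ sucV M → i ⊆ app f i) (∙ ▹ f ▹ M) (λ _ z k → ⊥-elim (∉∅ k))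
          λ m _ ih k → let m∈ = Ord-tr oM ∈suc-refl k in
            Ord-suc-⊆ (oN (into _ k)) (g (Ord-⊆ (oN m∈) (oN (into m m∈)) (ih m∈)) (oN (into _ k)) (incr m k))
          where
          g : ∀ {m a b} → m ∈ a ⊎ m ≡ a → Ord b → a ∈ b → m ∈ b
          g (inj₁ h) o k = Ord-tr o h k
          g (inj₂ refl) o k = k
        h : i ∈ app f i ⊎ i ≡ app f i → app f i ≡ i
        h (inj₂ e) = sym e
        h (inj₁ l) = ⊥-elim (top-absurd (spread M M∈ (Mi (to ∈suc i∈))))
          where
          spread : ∀ m → m ∈ ω → i ∈ sucV m → m ∈ sucV M → m ∈ app f m
          spread = ω-ind (λ (∙ ▹ f ▹ M ▹ i) m → i ∈ sucV m → m ∈ sucV M → m ∈ app f m) (∙ ▹ f ▹ M ▹ i)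
            (λ k _ → z (to ∈suc k)) λ m _ ih k m∈ → s m ih (to ∈suc k) m∈
            where
            z : i ∈ ∅ ⊎ i ≡ ∅ → ∅ ∈ app f ∅
            z (inj₁ k) = ⊥-elim (∉∅ k)
            z (inj₂ e) = subst (λ i → i ∈ app f i) e l
            s : ∀ m → (i ∈ sucV m → m ∈ sucV M → m ∈ app f m) → i ∈ sucV m ⊎ i ≡ sucV m → sucV m ∈ sucV M → sucV m ∈ app f (sucV m)
            s m ih (inj₂ e) _ = subst (λ i → i ∈ app f i) e l
            s m ih (inj₁ k) m∈ = q (Ord-⊆ (oN m∈) (oN (into m m′)) (Ord-suc-⊆ (oN (into m m′)) (ih k m′)))
              where
              m′ = Ord-tr oM ∈suc-refl m∈
              q : sucV m ∈ app f m ⊎ sucV m ≡ app f m → sucV m ∈ app f (sucV m)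
              q (inj₁ h) = Ord-tr (oN (into _ m∈)) h (incr m m∈)
              q (inj₂ e) = subst (_∈ app f (sucV m)) (sym e) (incr m m∈)
          Mi : i ∈ M ⊎ i ≡ M → i ∈ sucV M
          Mi _ = i∈
          top-absurd : (M ∈ sucV M → M ∈ app f M) → ⊥₀
          top-absurd k with to ∈suc (into M ∈suc-refl)
          ... | inj₁ h = ∈-asym (k ∈suc-refl) h
          ... | inj₂ e = ∈-irrefl (subst (M ∈_) e (k ∈suc-refl))

      -- Local relations on a universe: the structure maps below commute with their modalities.

      Pr Tri : V → Set ℓ
      Pr x = x ≡ ⟪ fst x ، snd x ⟫
      Tri x = Pr x × Pr (snd x)

      -- Relation 0 yields complements. Relations 2 and 3 tag a point in two different ways and 1
      -- allows either tag; together they yield unions, and 2 is also the diagonal. Relations 4 to 7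
      -- swap a pair, delete a coordinate of a triple, and project; they make the ultrafilters
      -- cohere. Relation 8 replaces the first coordinate by one of its members, which gives a
      -- bounded quantifier.
      rel : Fin 9 → V → V → Set ℓ
      rel zero x y = x ≡ y
      rel (suc zero) x y = y ≡ ⟪ x ، x ⟫ ⊎ y ≡ ⟪ sing x ، x ⟫
      rel (suc (suc zero)) x y = y ≡ ⟪ x ، x ⟫
      rel (suc (suc (suc zero))) x y = y ≡ ⟪ sing x ، x ⟫
      rel (suc (suc (suc (suc zero)))) x y = Pr x × y ≡ ⟪ snd x ، fst x ⟫
      rel (suc (suc (suc (suc (suc zero))))) x y = Tri x × y ≡ ⟪ fst x ، fst (snd x) ⟫
      rel (suc (suc (suc (suc (suc (suc zero)))))) x y = Tri x × y ≡ ⟪ fst x ، snd (snd x) ⟫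
      rel (suc (suc (suc (suc (suc (suc (suc zero))))))) x y = Pr x × y ≡ snd x
      rel (suc (suc (suc (suc (suc (suc (suc (suc zero)))))))) x y = Pr x × ∃[ w ] (w ∈ fst x × y ≡ ⟪ w ، snd x ⟫)

      private
        opaque
          drel : ∀ k → Def abs {2} (λ γ → rel k (last (init γ)) (last γ))
          drel zero = find _
          drel (suc zero) = find _
          drel (suc (suc zero)) = find _
          drel (suc (suc (suc zero))) = find _
          drel (suc (suc (suc (suc zero)))) = find _
          drel (suc (suc (suc (suc (suc zero))))) = find _
          drel (suc (suc (suc (suc (suc (suc zero)))))) = find _
          drel (suc (suc (suc (suc (suc (suc (suc zero))))))) = find _
          drel (suc (suc (suc (suc (suc (suc (suc (suc zero)))))))) = find _

        Some : ∀ n → (Fin n → Set ℓ) → Set ℓ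
        Some zero P = ⊥
        Some (suc n) P = P zero ⊎ Some n (λ k → P (suc k))
        some⇔ : ∀ {n} {P : Fin n → Set ℓ} → Some n P ⇔ Σ (Fin n) P
        some⇔ = mk⇔ fw (λ (k , p) → bw k p)
          where
          fw : ∀ {n} {P : Fin n → Set ℓ} → Some n P → Σ (Fin n) P
          fw {suc n} (inj₁ p) = zero , p
          fw {suc n} (inj₂ s) = let (k , p) = fw s in suc k , p
          bw : ∀ {n} {P : Fin n → Set ℓ} k → P k → Some n P
          bw zero p = inj₁ p
          bw (suc k) p = inj₂ (bw k p)
        dSome : ∀ {m j n} {P : Fin n → Env j → Set ℓ} → (∀ k → Def m (P k)) → Def m (λ γ → Some n (λ k → P k γ))
        dSome {n = zero} d = record { form = ⊥ˢ ; ok = λ M o γ i → id⇔ }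
        dSome {n = suc n} d = dOr ⦃ d zero ⦄ ⦃ dSome (λ k → d (suc k)) ⦄

      -- The offset is 2 because the step from copy 0 to copy 1 belongs to the chain. The relations
      -- occupy copies 2 to 10, and copy 11 is left for well-foundedness: twelve copies in all.
      lvl : Fin 9 → V
      lvl k = num (2 + toℕ k)
      lvl-inj : ∀ {i k} → lvl i ≡ lvl k → i ≡ k
      lvl-inj e = toℕ-injective (cong (λ n → pred (pred n)) (num-inj _ _ e))

      record Rho (j x y : V) : Set ℓ where
        constructor rho
        field
          rho-k : Fin 9
          rho-j : j ≡ lvl rho-k
          rho-rel : rel rho-k x y
      open Rho public
      rho-lvl : ∀ {k x y} → Rho (lvl k) x y ⇔ rel k x y
      rho-lvl {k} {x} {y} = mk⇔ (λ (rho i e r) → subst (λ k → rel k x y) (sym (lvl-inj e)) r) (rho k refl)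
      opaque
       instance
        iRho : ∀ {m n} {s t u : Env n → V} ⦃ _ : DefT m s ⦄ ⦃ _ : DefT m t ⦄ ⦃ _ : DefT m u ⦄ → Def m (λ γ → Rho (s γ) (t γ) (u γ))
        iRho ⦃ a ⦄ ⦃ b ⦄ ⦃ c ⦄ = sub3 (λ (∙ ▹ j ▹ x ▹ y) → Rho j x y) (any (iso
          {P = λ (∙ ▹ j ▹ x ▹ y) → Some 9 (λ k → j ≡ lvl k × rel k x y)}
          (λ (∙ ▹ j ▹ x ▹ y) → some⇔ {9} {λ k → j ≡ lvl k × rel k x y} ∙⇔ mk⇔ (λ (k , e , r) → rho k e r) (λ (rho k e r) → k , e , r))
          (dSome {P = λ k (∙ ▹ j ▹ x ▹ y) → j ≡ lvl k × rel k x y} λ k → dAnd ⦃ dEq ⦃ v2 ⦄ ⦃ inum {k = 2 + toℕ k} ⦄ ⦄ ⦃ sub2 (λ (∙ ▹ x ▹ y) → rel k x y) (drel k) v1 v0 ⦄))) a b c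

      private
        NegP : Env 2 → V → Set ℓ
        NegP (∙ ▹ j ▹ X) x = ∀ y → y ∈ X → ¬ Rho j x y
      private
       opaque
        defNegP : Def full {3} (λ γ → NegP (init γ) (last γ))
        defNegP = find _
      opaque
        -- The negated diamond of the relation coded by j. At the identity relation it is the
        -- complement, so this single operation provides complements and, combined with them,
        -- diamonds.
        neg : V → V → V → V
        neg j W X = sep NegP ⦃ defNegP ⦄ (∙ ▹ j ▹ X) W
        ∈neg : ∀ {j W X x} → x ∈ neg j W X ⇔ (x ∈ W × (∀ y → y ∈ X → ¬ Rho j x y))
        ∈neg {j} {W} {X} = ∈sep NegP ⦃ defNegP ⦄ (∙ ▹ j ▹ X) W
        instance
         ineg : ∀ {n} {s t u : Env n → V} ⦃ _ : DefT full s ⦄ ⦃ _ : DefT full t ⦄ ⦃ _ : DefT full u ⦄ → DefT full (λ γ → neg (s γ) (t γ) (u γ))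
         ineg ⦃ a ⦄ ⦃ b ⦄ ⦃ c ⦄ = isep NegP ⦃ defNegP ⦄ ([] ▸ a ▸ c) b

      -- PW is meant to be a power set, so that well-foundedness becomes a bounded statement.
      record WFr (PW X : V) : Set ℓ where
        field
          wfr : ∀ S → S ∈ PW → (∃[ x ] (x ∈ S × x ≡ x)) → ∃[ m ] (m ∈ S × (∀ x → x ∈ S → ¬ ⟪ x ، m ⟫ ∈ X))
      open WFr public
      -- Below copy 11 an edge determines Y as the negated diamond of X. At copy 11 it is a unary
      -- predicate in disguise: X is joined to its own copy if it is well-founded, and from this the
      -- well-foundedness of the ultrapower is drawn.
      record Skip (W PW j X Y : V) : Set ℓ where
        constructor skip
        field
          skp : (num 1 ∈ j × j ∈ num 11 × Y ⊆ W × (∀ x → x ∈ W → x ∈ Y ⇔ (∀ y → y ∈ X → ¬ Rho j x y)))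
                ⊎ (j ≡ num 11 × Y ≡ X × WFr PW X)
      open Skip public
      record Edge (W PW p q : V) : Set ℓ where
        constructor edge
        field
          edg : (fst q ≡ sucV (fst p) × snd q ≡ snd p) ⊎ (fst p ≡ ∅ × Skip W PW (fst q) (snd p) (snd q))
      open Edge public
      opaque
       instance
        iWFr : ∀ {m n} {s t : Env n → V} ⦃ _ : DefT m s ⦄ ⦃ _ : DefT m t ⦄ → Def m (λ γ → WFr (s γ) (t γ))
        iWFr ⦃ a ⦄ ⦃ b ⦄ = sub2 (λ (∙ ▹ P ▹ X) → WFr P X) (any (iso
          {P = λ (∙ ▹ P ▹ X) → ∀ S → S ∈ P → (∃[ x ] (x ∈ S × x ≡ x)) → ∃[ m ] (m ∈ S × (∀ x → x ∈ S → ¬ ⟪ x ، m ⟫ ∈ X))}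
          (λ γ → mk⇔ (λ f → record { wfr = f }) wfr) (find _))) a b
        iSkip : ∀ {m n} {s t u v w : Env n → V} ⦃ _ : DefT m s ⦄ ⦃ _ : DefT m t ⦄ ⦃ _ : DefT m u ⦄ ⦃ _ : DefT m v ⦄ ⦃ _ : DefT m w ⦄ →
                Def m (λ γ → Skip (s γ) (t γ) (u γ) (v γ) (w γ))
        iSkip ⦃ a ⦄ ⦃ b ⦄ ⦃ c ⦄ ⦃ d ⦄ ⦃ e ⦄ = subs (λ (∙ ▹ W ▹ P ▹ j ▹ X ▹ Y) → Skip W P j X Y) (any (iso
          {P = λ (∙ ▹ W ▹ P ▹ j ▹ X ▹ Y) → (num 1 ∈ j × j ∈ num 11 × Y ⊆ W × (∀ x → x ∈ W → x ∈ Y ⇔ (∀ y → y ∈ X → ¬ Rho j x y)))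
                ⊎ (j ≡ num 11 × Y ≡ X × WFr P X)}
          (λ γ → mk⇔ skip skp) (find _))) ([] ▸ a ▸ b ▸ c ▸ d ▸ e)
        iEdge : ∀ {m n} {s t u v : Env n → V} ⦃ _ : DefT m s ⦄ ⦃ _ : DefT m t ⦄ ⦃ _ : DefT m u ⦄ ⦃ _ : DefT m v ⦄ →
                Def m (λ γ → Edge (s γ) (t γ) (u γ) (v γ))
        iEdge ⦃ a ⦄ ⦃ b ⦄ ⦃ c ⦄ ⦃ d ⦄ = sub4 (λ (∙ ▹ W ▹ P ▹ p ▹ q) → Edge W P p q) (any (iso
          {P = λ (∙ ▹ W ▹ P ▹ p ▹ q) → (fst q ≡ sucV (fst p) × snd q ≡ snd p) ⊎ (fst p ≡ ∅ × Skip W P (fst q) (snd p) (snd q))}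
          (λ γ → mk⇔ edge edg) (find _))) a b c d
    open Levels

    -- The graph of a universe and its homomorphisms.

    module UniverseGraphs where
      num-lt : ∀ {i k} → i < k → num i ∈ num k
      num-lt {i} {suc k} (s≤s h) = subst (num i ∈_) (sym num-suc) (from ∈suc (f (m≤n⇒m<n∨m≡n h)))
        where
        f : i < k ⊎ i ≡ k → num i ∈ num k ⊎ num i ≡ num k
        f (inj₁ h) = inj₁ (num-lt h)
        f (inj₂ refl) = inj₂ refl
      ∅∈num : ∀ {k} → 0 < k → ∅ ∈ num k
      ∅∈num h = subst (_∈ num _) num-0 (num-lt h)

      record RU (W : V) : Set ℓ where
        constructor ru
        field
          {ru-λ} : V
          ru-Lim : Lim ru-λ
          ru-R : W ≡ R ru-λ
      open RU public
      opaque
       instance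
        iLim : ∀ {n} {s : Env n → V} ⦃ _ : DefT full s ⦄ → Def full (λ γ → Lim (s γ))
        iLim ⦃ a ⦄ = sub1 (λ (∙ ▹ x) → Lim x) (iso {P = λ (∙ ▹ x) → Ord x × ω ∈ x × (∀ y → y ∈ x → sucV y ∈ x)}
          (λ γ → mk⇔ (λ (a , b , c) → record { lim-Ord = a ; lim-ω = b ; lim-suc = c }) (λ l → lim-Ord l , lim-ω l , lim-suc l)) (find _)) a
        iRU : ∀ {n} {s : Env n → V} ⦃ _ : DefT full s ⦄ → Def full (λ γ → RU (s γ))
        iRU ⦃ a ⦄ = sub1 (λ (∙ ▹ W) → RU W) (iso {P = λ (∙ ▹ W) → ∃[ x ] (Lim x × W ≡ R x)}
          (λ γ → mk⇔ (λ (_ , a , b) → ru a b) (λ (ru a b) → _ , a , b)) (find _)) a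

      module _ {W} (r : RU W) where
        ru-Good : Good (_∈ W)
        ru-Good = subst (λ W → Good (_∈ W)) (sym (ru-R r)) (Lim-Good (ru-Lim r))
        ru-super : ∀ {y z} → y ∈ W → z ⊆ y → z ∈ W
        ru-super h s = subst (_ ∈_) (sym (ru-R r)) (R-super (subst (_ ∈_) (ru-R r) h) s)
        ru-𝒫 : ∀ {y} → y ∈ W → 𝒫 y ∈ W
        ru-𝒫 h = subst (_ ∈_) (sym (ru-R r)) (Lim-𝒫 (ru-Lim r) (subst (_ ∈_) (ru-R r) h))
        ru-Tr : ∀ {x y} → x ∈ y → y ∈ W → x ∈ W
        ru-Tr = tr ru-Good
        ru-⟪⟫ : ∀ {x y} → x ∈ W → y ∈ W → ⟪ x ، y ⟫ ∈ W
        ru-⟪⟫ = Good-⟪⟫ ru-Good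
        ru-fst : ∀ {x} → x ∈ W → Pr x → fst x ∈ W
        ru-fst h p = Good-fst ru-Good (subst (_∈ W) p h)
        ru-snd : ∀ {x} → x ∈ W → Pr x → snd x ∈ W
        ru-snd h p = Good-snd ru-Good (subst (_∈ W) p h)
        ru-∅ : ∅ ∈ W
        ru-∅ = cl-∅ ru-Good
        ru-ω : ω ∈ W
        ru-ω = subst (_ ∈_) (sym (ru-R r)) (from ∈R (ω , lim-ω (ru-Lim r) , R-⊆ ω))
        rel-local : ∀ k {x y} → x ∈ W → rel k x y → y ∈ W
        rel-local zero h refl = h
        rel-local (suc zero) h (inj₁ refl) = ru-⟪⟫ h h
        rel-local (suc zero) h (inj₂ refl) = ru-⟪⟫ (cl-,, ru-Good h h) h
        rel-local (suc (suc zero)) h refl = ru-⟪⟫ h h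
        rel-local (suc (suc (suc zero))) h refl = ru-⟪⟫ (cl-,, ru-Good h h) h
        rel-local (suc (suc (suc (suc zero)))) h (p , refl) = ru-⟪⟫ (ru-snd h p) (ru-fst h p)
        rel-local (suc (suc (suc (suc (suc zero))))) h ((p , q) , refl) = ru-⟪⟫ (ru-fst h p) (ru-fst (ru-snd h p) q)
        rel-local (suc (suc (suc (suc (suc (suc zero)))))) h ((p , q) , refl) = ru-⟪⟫ (ru-fst h p) (ru-snd (ru-snd h p) q)
        rel-local (suc (suc (suc (suc (suc (suc (suc zero))))))) h (p , refl) = ru-snd h p
        rel-local (suc (suc (suc (suc (suc (suc (suc (suc zero)))))))) h (p , w , k , refl) = ru-⟪⟫ (ru-Tr k (ru-fst h p)) (ru-snd h p)
        Rho-local : ∀ {j x y} → x ∈ W → Rho j x y → y ∈ W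
        Rho-local h (rho k _ s) = rel-local k h s

      RU-cmp : ∀ {W W′} → RU W → RU W′ → W ∈ W′ ⊎ W ≡ W′ ⊎ W′ ∈ W
      RU-cmp (ru l refl) (ru l′ refl) with Ord-cmp (lim-Ord l) (lim-Ord l′)
      ... | inj₁ h = inj₁ (R-∈ h)
      ... | inj₂ (inj₁ e) = inj₂ (inj₁ (cong R e))
      ... | inj₂ (inj₂ h) = inj₂ (inj₂ (R-∈ h))

      -- The graph of a universe: twelve copies of 𝒫 W; consecutive copies are
      -- joined by the identity, and the bottom copy is joined to copy k ≥ 2 by the k-th relation.

      private
        GEP : Env 2 → V → Set ℓ
        GEP (∙ ▹ W ▹ P) e = Edge W P (fst e) (snd e)
      GV : V → V
      GV P = num 12 ⊗ P
      private
       opaque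
        defGEP : Def full {3} (λ γ → GEP (init γ) (last γ))
        defGEP = find _
      opaque
        GE : V → V → V
        GE W P = sep GEP ⦃ defGEP ⦄ (∙ ▹ W ▹ P) (GV P ⊗ GV P)
        ∈GE : ∀ {W P p q} → ⟪ p ، q ⟫ ∈ GE W P ⇔ (p ∈ GV P × q ∈ GV P × Edge W P p q)
        ∈GE {W} {P} {p} {q} = mk⇔
          (λ h → let (k , e) = to (∈sep GEP ⦃ defGEP ⦄ (∙ ▹ W ▹ P) (GV P ⊗ GV P)) h ; (a , b) = to pair∈⊗ k in a , b , subst₂ (Edge W P) fst-⟪⟫ snd-⟪⟫ e)
          (λ (a , b , e) → from (∈sep GEP ⦃ defGEP ⦄ (∙ ▹ W ▹ P) (GV P ⊗ GV P)) (from pair∈⊗ (a , b) , subst₂ (Edge W P) (sym fst-⟪⟫) (sym snd-⟪⟫) e))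
        GE-pair : ∀ {W P e} → e ∈ GE W P → ∃₂ λ p q → p ∈ GV P × q ∈ GV P × e ≡ ⟪ p ، q ⟫
        GE-pair {W} {P} h = let (p , a , q , b , e) = to ∈⊗ (proj₁ (to (∈sep GEP ⦃ defGEP ⦄ (∙ ▹ W ▹ P) (GV P ⊗ GV P)) h)) in p , q , a , b , e
        private instance
         iGE : ∀ {n} {s t : Env n → V} ⦃ _ : DefT full s ⦄ ⦃ _ : DefT full t ⦄ → DefT full (λ γ → GE (s γ) (t γ))
         iGE ⦃ a ⦄ ⦃ b ⦄ = isep GEP ⦃ defGEP ⦄ ([] ▸ a ▸ b) (i⊗ ⦃ i⊗ ⦃ inum ⦄ ⦃ b ⦄ ⦄ ⦃ i⊗ ⦃ inum ⦄ ⦃ b ⦄ ⦄)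
      Γ : V → V
      Γ W = ⟪ GV (𝒫 W) ، GE W (𝒫 W) ⟫

      -- What remains of a homomorphism `Γ W → Γ W′` once the copies are stripped off; `FromGraph`
      -- and `SH⇒HomGE` translate in both directions. Only the values of h at subsets of W matter.
      record SH (W W′ h : V) : Set ℓ where
        field
          sh-into : ∀ X → X ⊆ W → app h X ⊆ W′
          sh-neg : ∀ j → num 1 ∈ j → j ∈ num 11 → ∀ X → X ⊆ W → app h (neg j W X) ≡ neg j W′ (app h X)
          sh-wf : ∀ X → X ⊆ W → WFr (𝒫 W) X → WFr (𝒫 W′) (app h X)
      open SH public
      opaque
       instance
        iSH : ∀ {n} {s t u : Env n → V} ⦃ _ : DefT full s ⦄ ⦃ _ : DefT full t ⦄ ⦃ _ : DefT full u ⦄ → Def full (λ γ → SH (s γ) (t γ) (u γ))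
        iSH ⦃ a ⦄ ⦃ b ⦄ ⦃ c ⦄ = sub3 (λ (∙ ▹ W ▹ W′ ▹ h) → SH W W′ h) (iso
          {P = λ (∙ ▹ W ▹ W′ ▹ h) → (∀ X → X ⊆ W → app h X ⊆ W′)
               × (∀ j → num 1 ∈ j → j ∈ num 11 → ∀ X → X ⊆ W → app h (neg j W X) ≡ neg j W′ (app h X))
               × (∀ X → X ⊆ W → WFr (𝒫 W) X → WFr (𝒫 W′) (app h X))}
          (λ γ → mk⇔ (λ (a , b , c) → record { sh-into = a ; sh-neg = b ; sh-wf = c }) (λ s → sh-into s , sh-neg s , sh-wf s)) (find _)) a b c

      private
        HT : Env 1 → V → V
        HT (∙ ▹ g) X = snd (app g ⟪ ∅ ، X ⟫)
        LvT : Env 2 → V → V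
        LvT (∙ ▹ g ▹ X) i = fst (app g ⟪ i ، X ⟫)
        GT : Env 1 → V → V
        GT (∙ ▹ h) v = ⟪ fst v ، app h (snd v) ⟫

      ∈GV : ∀ {P v} → v ∈ GV P → fst v ∈ num 12 × snd v ∈ P × v ≡ ⟪ fst v ، snd v ⟫
      ∈GV h with to ∈⊗ h
      ... | i , a , X , b , refl = subst (_∈ _) (sym fst-⟪⟫) a , subst (_∈ _) (sym snd-⟪⟫) b , sym (cong₂ ⟪_،_⟫ fst-⟪⟫ snd-⟪⟫)

      Edge-⟪⟫ : ∀ {W P i X j Y} → Edge W P ⟪ i ، X ⟫ ⟪ j ، Y ⟫ ⇔ ((j ≡ sucV i × Y ≡ X) ⊎ (i ≡ ∅ × Skip W P j X Y))
      Edge-⟪⟫ {W} {P} {i} {X} {j} {Y} = mk⇔ (λ e → f fst-⟪⟫ snd-⟪⟫ fst-⟪⟫ snd-⟪⟫ (edg e))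
                                             (λ e → edge (f (sym fst-⟪⟫) (sym snd-⟪⟫) (sym fst-⟪⟫) (sym snd-⟪⟫) e))
        where
        f : ∀ {i i′ X X′ j j′ Y Y′} → i ≡ i′ → X ≡ X′ → j ≡ j′ → Y ≡ Y′ →
            (j ≡ sucV i × Y ≡ X) ⊎ (i ≡ ∅ × Skip W P j X Y) → (j′ ≡ sucV i′ × Y′ ≡ X′) ⊎ (i′ ≡ ∅ × Skip W P j′ X′ Y′)
        f refl refl refl refl e = e

      num-1 : num 1 ≡ sucV ∅
      num-1 = trans num-suc (cong sucV num-0)

      private
       opaque
        defHT : DefT full {2} (λ γ → HT (init γ) (last γ))
        defHT = findT _
        defLvT : DefT full {3} (λ γ → LvT (init γ) (last γ))
        defLvT = findT _
      -- Every edge leads to a higher copy, so the chain through a fixed X is sent to a strictly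
      -- increasing sequence of twelve copies, and `rigid-nat` shows that levels are kept. Between
      -- consecutive copies there are only chain edges, since no relation is coded by 1. So the
      -- second coordinate is the same at all levels, and one map h describes g.
      module FromGraph {W W′ g : V} (H : HomGE g (GV (𝒫 W)) (GE W (𝒫 W)) (GV (𝒫 W′)) (GE W′ (𝒫 W′))) where
        h : V
        h = lam HT ⦃ defHT ⦄ (∙ ▹ g) (𝒫 W)
        h-val : ∀ {X} → X ⊆ W → app h X ≡ snd (app g ⟪ ∅ ، X ⟫)
        h-val s = lam-app HT ⦃ defHT ⦄ (from ∈𝒫 s)
        private
          v∈ : ∀ {i X} → i ∈ num 12 → X ⊆ W → ⟪ i ، X ⟫ ∈ GV (𝒫 W)
          v∈ a s = from pair∈⊗ (a , from ∈𝒫 s)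
          im : ∀ {i X} → i ∈ num 12 → X ⊆ W → _
          im a s = ∈GV (hom-into H _ (v∈ a s))
          12≡ : num 12 ≡ sucV (num 11)
          12≡ = num-suc
          nat : ∀ {i} → i ∈ num 12 → i ∈ ω
          nat a = Ord-tr Ord-ω a (num∈ω 12)
          step : ∀ {i X} → i ∈ num 12 → sucV i ∈ num 12 → X ⊆ W → Edge W′ (𝒫 W′) (app g ⟪ i ، X ⟫) (app g ⟪ sucV i ، X ⟫)
          step a b s = proj₂ (proj₂ (to ∈GE (hom-edge H _ (v∈ a s) _ (v∈ b s)
            (from ∈GE (v∈ a s , v∈ b s , from Edge-⟪⟫ (inj₁ (refl , refl)))))))
          up : ∀ {p q} → fst q ∈ num 12 → Edge W′ (𝒫 W′) p q → fst p ∈ fst q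
          up h (edge (inj₁ (e , _))) = subst (_ ∈_) (sym e) ∈suc-refl
          up h (edge (inj₂ (e , skip (inj₁ (k , _))))) = subst (_∈ _) (sym e) (Ord-tr (Ord-∈ (Ord-num 12) h) (∅∈num (s≤s z≤n)) k)
          up h (edge (inj₂ (e , skip (inj₂ (k , _))))) = subst₂ _∈_ (sym e) (sym k) (∅∈num (s≤s z≤n))
          level : ∀ {i X} → i ∈ num 12 → X ⊆ W → fst (app g ⟪ i ، X ⟫) ≡ i
          level {i} {X} a s = trans (sym (fv a)) (rigid-nat (num 11) f (num∈ω 11)
              (λ k h → subst (λ N → app f k ∈ N) 12≡ (subst (_∈ num 12) (sym (fv (N h))) (proj₁ (im (N h) s))))
              (λ k h → let b = N h ; a = Ord-tr (Ord-num 12) ∈suc-refl b in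
                 subst₂ _∈_ (sym (fv a)) (sym (fv b)) (up (proj₁ (im b s)) (step a b s))) i (subst (i ∈_) 12≡ a))
            where
            f : V
            f = lam LvT ⦃ defLvT ⦄ (∙ ▹ g ▹ X) (num 12)
            fv : ∀ {k} → k ∈ num 12 → app f k ≡ fst (app g ⟪ k ، X ⟫)
            fv = lam-app LvT ⦃ defLvT ⦄
            N : ∀ {k} → k ∈ sucV (num 11) → k ∈ num 12
            N = subst (_ ∈_) (sym 12≡)
          val : ∀ {i X} → i ∈ num 12 → X ⊆ W → app g ⟪ i ، X ⟫ ≡ ⟪ i ، snd (app g ⟪ i ، X ⟫) ⟫
          val {i} {X} a s = trans (proj₂ (proj₂ (im a s))) (cong (λ k → ⟪ k ، snd (app g ⟪ i ، X ⟫) ⟫) (level a s))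
          1∉ : ∀ {W P j X Y} → j ≡ num 1 → ¬ Skip W P j X Y
          1∉ refl (skip (inj₁ (k , _))) = ∈-irrefl k
          1∉ refl (skip (inj₂ (k , _))) with num-inj 1 11 k
          ... | ()
          same-step : ∀ {i X} → i ∈ num 12 → sucV i ∈ num 12 → X ⊆ W → snd (app g ⟪ sucV i ، X ⟫) ≡ snd (app g ⟪ i ، X ⟫)
          same-step {i} {X} a b s = f (to Edge-⟪⟫ (subst₂ (Edge W′ (𝒫 W′)) (val a s) (val b s) (step a b s)))
            where
            f : ∀ {A B} → (sucV i ≡ sucV i × B ≡ A) ⊎ (i ≡ ∅ × Skip W′ (𝒫 W′) (sucV i) A B) → B ≡ A
            f (inj₁ (_ , e)) = e
            f (inj₂ (e , k)) = ⊥-elim (1∉ (trans (cong sucV e) (sym num-1)) k)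
          same : ∀ {X} → X ⊆ W → ∀ i → i ∈ ω → i ∈ num 12 → snd (app g ⟪ i ، X ⟫) ≡ snd (app g ⟪ ∅ ، X ⟫)
          same {X} s = ω-ind (λ (∙ ▹ g ▹ X) i → i ∈ num 12 → snd (app g ⟪ i ، X ⟫) ≡ snd (app g ⟪ ∅ ، X ⟫)) (∙ ▹ g ▹ X) (λ _ → refl)
            λ m _ ih b → let a = Ord-tr (Ord-num 12) ∈suc-refl b in trans (same-step a b s) (ih a)
        g-val : ∀ {i X} → i ∈ num 12 → X ⊆ W → app g ⟪ i ، X ⟫ ≡ ⟪ i ، app h X ⟫
        g-val {i} a s = trans (val a s) (cong ⟪ i ،_⟫ (trans (same s i (nat a) a) (sym (h-val s))))
        private
          0∈ : ∅ ∈ num 12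
          0∈ = ∅∈num (s≤s z≤n)
          skips : ∀ {j X Y} → j ∈ num 12 → X ⊆ W → Y ⊆ W → Skip W (𝒫 W) j X Y → Skip W′ (𝒫 W′) j (app h X) (app h Y)
          skips {j} {X} {Y} a s t k = f (to Edge-⟪⟫ (subst₂ (Edge W′ (𝒫 W′)) (g-val 0∈ s) (g-val a t)
              (proj₂ (proj₂ (to ∈GE (hom-edge H _ (v∈ 0∈ s) _ (v∈ a t) (from ∈GE (v∈ 0∈ s , v∈ a t , from Edge-⟪⟫ (inj₂ (refl , k))))))))))
            where
            f : (j ≡ sucV ∅ × app h Y ≡ app h X) ⊎ (∅ ≡ ∅ × Skip W′ (𝒫 W′) j (app h X) (app h Y)) → Skip W′ (𝒫 W′) j (app h X) (app h Y)
            f (inj₁ (e , _)) = ⊥-elim (1∉ (trans e (sym num-1)) k)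
            f (inj₂ (_ , k)) = k
        h-SH : SH W W′ h
        h-SH = record
          { sh-into = λ X s → subst (_⊆ W′) (sym (h-val s)) (to ∈𝒫 (proj₁ (proj₂ (im 0∈ s))))
          ; sh-neg = λ j a b X s → negc a b s (skp (skips (subst (j ∈_) (sym 12≡) (from ∈suc (inj₁ b))) s (neg⊆ {j} {X})
                        (skip (inj₁ (a , b , neg⊆ {j} {X} , λ x h → mk⇔ (λ k → proj₂ (to ∈neg k)) (λ k → from ∈neg (h , k)))))))
          ; sh-wf = λ X s w → wfc (skp (skips (num-lt (s≤s (s≤s (s≤s (s≤s (s≤s (s≤s (s≤s (s≤s (s≤s (s≤s (s≤s (s≤s z≤n)))))))))))))
                        s s (skip (inj₂ (refl , refl , w))))) }
          where
          neg⊆ : ∀ {j X} → neg j W X ⊆ W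
          neg⊆ z k = proj₁ (to ∈neg k)
          negc : ∀ {j X Y Z} → num 1 ∈ j → j ∈ num 11 → X ⊆ W →
                 (num 1 ∈ j × j ∈ num 11 × Z ⊆ W′ × (∀ x → x ∈ W′ → x ∈ Z ⇔ (∀ y → y ∈ Y → ¬ Rho j x y)))
                 ⊎ (j ≡ num 11 × Z ≡ Y × WFr (𝒫 W′) Y) → Z ≡ neg j W′ Y
          negc a b s (inj₁ (_ , _ , t , c)) = ext (λ z k → from ∈neg (t z k , to (c z (t z k)) k)) (λ z k → let (l , p) = to ∈neg k in from (c z l) p)
          negc a b s (inj₂ (e , _)) = ⊥-elim (∈-irrefl (subst (_∈ num 11) e b))
          wfc : ∀ {X Y} → (num 1 ∈ num 11 × num 11 ∈ num 11 × Y ⊆ W′ × (∀ x → x ∈ W′ → x ∈ Y ⇔ (∀ y → y ∈ X → ¬ Rho (num 11) x y)))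
                 ⊎ (num 11 ≡ num 11 × Y ≡ X × WFr (𝒫 W′) X) → WFr (𝒫 W′) Y
          wfc (inj₁ (_ , b , _)) = ⊥-elim (∈-irrefl b)
          wfc (inj₂ (_ , refl , w)) = w

      private
       opaque
        defGT : DefT full {2} (λ γ → GT (init γ) (last γ))
        defGT = findT _
      SH⇒HomGE : ∀ {W W′ h} → SH W W′ h →
                 HomGE (lam GT ⦃ defGT ⦄ (∙ ▹ h) (GV (𝒫 W))) (GV (𝒫 W)) (GE W (𝒫 W)) (GV (𝒫 W′)) (GE W′ (𝒫 W′))
      SH⇒HomGE {W} {W′} {h} S = record
        { hom-Fn = lam-Fn GT ⦃ defGT ⦄
        ; hom-into = λ v k → subst (_∈ GV (𝒫 W′)) (sym (lam-app GT ⦃ defGT ⦄ k)) (in′ k)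
        ; hom-edge = λ p k q l e → subst₂ (λ a b → ⟪ a ، b ⟫ ∈ GE W′ (𝒫 W′)) (sym (lam-app GT ⦃ defGT ⦄ k)) (sym (lam-app GT ⦃ defGT ⦄ l))
            (from ∈GE (in′ k , in′ l , from Edge-⟪⟫ (f k l (edg (proj₂ (proj₂ (to ∈GE e))))))) }
        where
        sub : ∀ {v} → v ∈ GV (𝒫 W) → snd v ⊆ W
        sub k = to ∈𝒫 (proj₁ (proj₂ (∈GV k)))
        in′ : ∀ {v} → v ∈ GV (𝒫 W) → ⟪ fst v ، app h (snd v) ⟫ ∈ GV (𝒫 W′)
        in′ k = from pair∈⊗ (proj₁ (∈GV k) , from ∈𝒫 (sh-into S _ (sub k)))
        f : ∀ {p q} → p ∈ GV (𝒫 W) → q ∈ GV (𝒫 W) → (fst q ≡ sucV (fst p) × snd q ≡ snd p) ⊎ (fst p ≡ ∅ × Skip W (𝒫 W) (fst q) (snd p) (snd q)) →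
            (fst q ≡ sucV (fst p) × app h (snd q) ≡ app h (snd p)) ⊎ (fst p ≡ ∅ × Skip W′ (𝒫 W′) (fst q) (app h (snd p)) (app h (snd q)))
        f k l (inj₁ (a , b)) = inj₁ (a , cong (app h) b)
        f {p} {q} k l (inj₂ (a , skip (inj₁ (b , c , t , u)))) = inj₂ (a , skip (inj₁ (b , c , sh-into S _ (sub l) , λ x x∈ → mk⇔
          (λ m → proj₂ (to ∈neg (subst (x ∈_) eqn m))) (λ m → subst (x ∈_) (sym eqn) (from ∈neg (x∈ , m))))))
          where
          eqn : app h (snd q) ≡ neg (fst q) W′ (app h (snd p))
          eqn = trans (cong (app h) (ext (λ z m → from ∈neg (t z m , to (u z (t z m)) m)) (λ z m → let (n , o) = to ∈neg m in from (u z n) o)))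
                      (sh-neg S (fst q) b c (snd p) (sub k))
        f k l (inj₂ (a , skip (inj₂ (b , c , w)))) = inj₂ (a , skip (inj₂ (b , cong (app h) c , sh-wf S _ (sub k) w)))
      SH-val : ∀ {W h v} → v ∈ GV (𝒫 W) → app (lam GT ⦃ defGT ⦄ (∙ ▹ h) (GV (𝒫 W))) v ≡ ⟪ fst v ، app h (snd v) ⟫
      SH-val = lam-app GT ⦃ defGT ⦄

      infixl 27 _∩_
      private
        CapP : Env 1 → V → Set ℓ
        CapP (∙ ▹ y) z = z ∈ y
      private
       opaque
        defCapP : Def full {2} (λ γ → CapP (init γ) (last γ))
        defCapP = find _
      opaque
        _∩_ : V → V → V
        x ∩ y = sep CapP ⦃ defCapP ⦄ (∙ ▹ y) x
        ∈∩ : ∀ {x y z} → z ∈ x ∩ y ⇔ (z ∈ x × z ∈ y)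
        ∈∩ {x} {y} = ∈sep CapP ⦃ defCapP ⦄ (∙ ▹ y) x
        instance
         i∩ : ∀ {n} {s t : Env n → V} ⦃ _ : DefT full s ⦄ ⦃ _ : DefT full t ⦄ → DefT full (λ γ → s γ ∩ t γ)
         i∩ ⦃ a ⦄ ⦃ b ⦄ = isep CapP ⦃ defCapP ⦄ ([] ▸ b) a
      private
        ResT : Env 1 → V → V
        ResT (∙ ▹ W) X = X ∩ W
      private
       opaque
        defResT : DefT full {2} (λ γ → ResT (init γ) (last γ))
        defResT = findT _
      res : V → V → V
      res W′ W = lam ResT ⦃ defResT ⦄ (∙ ▹ W) (𝒫 W′)
      res-val : ∀ {W W′ X} → X ⊆ W′ → app (res W′ W) X ≡ X ∩ W
      res-val s = lam-app ResT ⦃ defResT ⦄ (from ∈𝒫 s)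
      -- This is where locality is used: what is related to a point of W lies in W, so cutting X
      -- down to W loses nothing.
      neg-∩ : ∀ {W W′ j X} → RU W → W ⊆ W′ → neg j W (X ∩ W) ≡ neg j W′ X ∩ W
      neg-∩ r s = ext
        (λ z h → let (a , b) = to ∈neg h in from ∈∩ (from ∈neg (s z a , λ y k l → b y (from ∈∩ (k , Rho-local r a l)) l) , a))
        (λ z h → let (a , b) = to ∈∩ h in from ∈neg (b , λ y k l → proj₂ (to ∈neg a) y (proj₁ (to ∈∩ k)) l))
      res-SH : ∀ {W W′} → RU W → W ⊆ W′ → SH W′ W (res W′ W)
      res-SH {W} {W′} r s = record
        { sh-into = λ X t → subst (_⊆ W) (sym (res-val t)) λ z h → proj₂ (to ∈∩ h)
        ; sh-neg = λ j _ _ X t → trans (res-val λ z h → proj₁ (to ∈neg h)) (trans (sym (neg-∩ r s)) (cong (neg j W) (sym (res-val t))))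
        ; sh-wf = λ X t w → subst (WFr (𝒫 W)) (sym (res-val t)) (record { wfr = λ S h ne →
            let (m , k , f) = wfr w S (from ∈𝒫 λ z l → s z (to ∈𝒫 h z l)) ne in m , k , λ x l q → f x l (proj₁ (to ∈∩ q)) }) }
    open UniverseGraphs

    -- Ultrafilters and their coherence.

    module Modalities where
      Pr-⟪⟫ : ∀ {x y} → Pr ⟪ x ، y ⟫
      Pr-⟪⟫ = sym (cong₂ ⟪_،_⟫ fst-⟪⟫ snd-⟪⟫)

      -- A structure map h : 𝒫 W → 𝒫 W′ assigns to a ∈ W′ the ultrafilter {X | a ∈ h X}, and the
      -- ultrafilters at different points cohere along the local relations.

      module Ultrafilters {W W′ h : V} (r : RU W) (r′ : RU W′) (S : SH W W′ h) where
        private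
          lo : ∀ k → num 1 ∈ lvl k
          lo k = num-lt (s≤s (s≤s z≤n))
          hi : ∀ k → lvl k ∈ num 11
          hi k = num-lt (s≤s (s≤s (toℕ<n k)))
        infix 4 _⊩_
        _⊩_ : V → V → Set ℓ
        a ⊩ X = a ∈ app h X
        ⊩-W′ : ∀ {a X} → X ⊆ W → a ⊩ X → a ∈ W′
        ⊩-W′ s e = sh-into S _ s _ e
        C : V → V
        C X = neg (lvl zero) W X
        C⊆ : ∀ {X} → C X ⊆ W
        C⊆ z e = proj₁ (to ∈neg e)
        ∈C : ∀ {X x} → x ∈ W → x ∈ C X ⇔ (¬ x ∈ X)
        ∈C {X} {x} w = mk⇔ (λ e k → proj₂ (to ∈neg e) x k (from rho-lvl refl))
          (λ no → from ∈neg (w , λ y k l → no (subst (_∈ X) (sym (to rho-lvl l)) k)))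
        ⊩neg : ∀ k {a X} → a ∈ W′ → X ⊆ W → a ⊩ neg (lvl k) W X ⇔ (∀ y → y ⊩ X → ¬ rel k a y)
        ⊩neg k {a} {X} w s = mk⇔
          (λ e y m l → proj₂ (to ∈neg (subst (a ∈_) (sh-neg S _ (lo k) (hi k) X s) e)) y m (from rho-lvl l))
          (λ f → subst (a ∈_) (sym (sh-neg S _ (lo k) (hi k) X s)) (from ∈neg (w , λ y m l → f y m (to rho-lvl l))))
        ⊩C : ∀ {a X} → a ∈ W′ → X ⊆ W → a ⊩ C X ⇔ (¬ a ⊩ X)
        ⊩C {a} {X} w s = mk⇔ (λ e k → to (⊩neg zero w s) e a k refl)
          (λ no → from (⊩neg zero w s) λ { y m refl → no m })
        dec⊩ : ∀ a X → a ⊩ X ⊎ ¬ a ⊩ X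
        dec⊩ a X = lem (λ (∙ ▹ h ▹ a ▹ X) → a ∈ app h X) (∙ ▹ h ▹ a ▹ X)
        -- Complement after `neg`. Both are preserved by h, so diamonds are.
        dia : Fin 9 → V → V
        dia k X = C (neg (lvl k) W X)
        dia⊆ : ∀ {k X} → dia k X ⊆ W
        dia⊆ = C⊆
        ∈dia : ∀ k {X x} → x ∈ W → x ∈ dia k X ⇔ (∃[ y ] (y ∈ X × rel k x y))
        ∈dia k {X} {x} w = mk⇔
          (λ e → let (y , m , l) = by-contra (λ (∙ ▹ X ▹ x ▹ j) → ∃[ y ] (y ∈ X × Rho j x y)) (∙ ▹ X ▹ x ▹ lvl k)
                       (λ no → to (∈C w) e (from ∈neg (w , λ y m l → no (y , m , l)))) in y , m , to rho-lvl l)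
          (λ (y , m , l) → from (∈C w) λ e → proj₂ (to ∈neg e) y m (from rho-lvl l))
        ⊩dia : ∀ k {a X} → a ∈ W′ → X ⊆ W → a ⊩ dia k X ⇔ (∃[ y ] (y ⊩ X × rel k a y))
        ⊩dia k {a} {X} w s = mk⇔
          (λ e → let (y , m , l) = by-contra (λ (∙ ▹ X ▹ a ▹ j) → ∃[ y ] (y ∈ X × Rho j a y)) (∙ ▹ app h X ▹ a ▹ lvl k)
                       (λ no → to (⊩C w λ z n → proj₁ (to ∈neg n)) e (from (⊩neg k w s) λ y m l → no (y , m , from rho-lvl l))) in y , m , to rho-lvl l)
          (λ (y , m , l) → from (⊩C w λ z n → proj₁ (to ∈neg n)) λ e → to (⊩neg k w s) e y m l)

        private
          ZP : Env 2 → V → Set ℓ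
          ZP (∙ ▹ X ▹ Y) z = (z ≡ ⟪ snd z ، snd z ⟫ × snd z ∈ X) ⊎ (z ≡ ⟪ sing (snd z) ، snd z ⟫ × snd z ∈ Y)
          δ σ J : Fin 9
          J = suc zero
          δ = suc (suc zero)
          σ = suc (suc (suc zero))
          sing≢ : ∀ {x} → sing x ≢ x
          sing≢ {x} e = ∈-irrefl (subst (x ∈_) e ∈l)
          opaque
            defZP : Def full {3} (λ γ → ZP (init γ) (last γ))
            defZP = find _
          module _ (X Y : V) (s : X ⊆ W) (t : Y ⊆ W) where
            opaque
              Z : V
              Z = sep ZP ⦃ defZP ⦄ (∙ ▹ X ▹ Y) W
              ∈Z : ∀ {z} → z ∈ Z ⇔ (z ∈ W × ZP (∙ ▹ X ▹ Y) z)
              ∈Z = ∈sep ZP ⦃ defZP ⦄ (∙ ▹ X ▹ Y) W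
            Z⊆ : Z ⊆ W
            Z⊆ z e = proj₁ (to ∈Z e)
            Zδ : ∀ {x} → ⟪ x ، x ⟫ ∈ Z → x ∈ X
            Zδ e with proj₂ (to ∈Z e)
            ... | inj₁ (_ , m) = subst (_∈ X) snd-⟪⟫ m
            ... | inj₂ (q , _) = ⊥-elim (sing≢ (trans (sym (⟪⟫-inj₁ q)) (⟪⟫-inj₂ q)))
            Zσ : ∀ {x} → ⟪ sing x ، x ⟫ ∈ Z → x ∈ Y
            Zσ e with proj₂ (to ∈Z e)
            ... | inj₁ (q , _) = ⊥-elim (sing≢ (trans (⟪⟫-inj₁ q) (sym (⟪⟫-inj₂ q))))
            ... | inj₂ (_ , m) = subst (_∈ Y) snd-⟪⟫ m
            Xδ : ∀ {x} → x ∈ X → ⟪ x ، x ⟫ ∈ Z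
            Xδ m = from ∈Z (ru-⟪⟫ r (s _ m) (s _ m) , inj₁ (cong₂ ⟪_،_⟫ (sym snd-⟪⟫) (sym snd-⟪⟫) , subst (_∈ X) (sym snd-⟪⟫) m))
            Yσ : ∀ {x} → x ∈ Y → ⟪ sing x ، x ⟫ ∈ Z
            Yσ m = from ∈Z (ru-⟪⟫ r (cl-,, (ru-Good r) (t _ m) (t _ m)) (t _ m) ,
              inj₂ (cong₂ ⟪_،_⟫ (cong sing (sym snd-⟪⟫)) (sym snd-⟪⟫) , subst (_∈ Y) (sym snd-⟪⟫) m))
            eδ : dia δ Z ≡ X
            eδ = ext (λ x e → let (y , m , q) = to (∈dia δ (dia⊆ x e)) e in Zδ (subst (_∈ Z) q m))
                     (λ x e → from (∈dia δ (s x e)) (_ , Xδ e , refl))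
            eσ : dia σ Z ≡ Y
            eσ = ext (λ x e → let (y , m , q) = to (∈dia σ (dia⊆ x e)) e in Zσ (subst (_∈ Z) q m))
                     (λ x e → from (∈dia σ (t x e)) (_ , Yσ e , refl))
            eJ : dia J Z ≡ X ∪ Y
            eJ = ext (λ x e → let (y , m , q) = to (∈dia J (dia⊆ x e)) e in from ∈∪ (f m q)) (λ x e → g (to ∈∪ e))
              where
              f : ∀ {x y} → y ∈ Z → rel J x y → x ∈ X ⊎ x ∈ Y
              f m (inj₁ refl) = inj₁ (Zδ m)
              f m (inj₂ refl) = inj₂ (Zσ m)
              g : ∀ {x} → x ∈ X ⊎ x ∈ Y → x ∈ dia J Z
              g (inj₁ e) = from (∈dia J (s _ e)) (_ , Xδ e , inj₁ refl)
              g (inj₂ e) = from (∈dia J (t _ e)) (_ , Yσ e , inj₂ refl)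
        ∪⊆ : ∀ {X Y} → X ⊆ W → Y ⊆ W → X ∪ Y ⊆ W
        ∪⊆ s t z e = Data.Sum.[ s z , t z ] (to ∈∪ e)
          where import Data.Sum
        -- `Z` codes the disjoint sum: ⟪ x ، x ⟫ for x ∈ X and ⟪ sing x ، x ⟫ for x ∈ Y, which
        -- differ by foundation. Its diamonds along relations 2, 3 and 1 are X, Y and X ∪ Y. As
        -- relation 1 is the union of the other two on both sides, preservation of diamonds gives
        -- preservation of unions.
        ⊩∪ : ∀ {a X Y} → a ∈ W′ → X ⊆ W → Y ⊆ W → a ⊩ X ∪ Y ⇔ (a ⊩ X ⊎ a ⊩ Y)
        ⊩∪ {a} {X} {Y} w s t = mk⇔
          (λ e → let (y , m , q) = to (⊩dia J w (Z⊆ X Y s t)) (subst (a ⊩_) (sym (eJ X Y s t)) e) in f m q)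
          (λ d → subst (a ⊩_) (eJ X Y s t) (from (⊩dia J w (Z⊆ X Y s t)) (g d)))
          where
          f : ∀ {y} → y ⊩ Z X Y s t → rel J a y → a ⊩ X ⊎ a ⊩ Y
          f m (inj₁ refl) = inj₁ (subst (a ⊩_) (eδ X Y s t) (from (⊩dia δ w (Z⊆ X Y s t)) (_ , m , refl)))
          f m (inj₂ refl) = inj₂ (subst (a ⊩_) (eσ X Y s t) (from (⊩dia σ w (Z⊆ X Y s t)) (_ , m , refl)))
          g : a ⊩ X ⊎ a ⊩ Y → ∃[ y ] (y ⊩ Z X Y s t × rel J a y)
          g (inj₁ e) = let (y , m , q) = to (⊩dia δ w (Z⊆ X Y s t)) (subst (a ⊩_) (sym (eδ X Y s t)) e) in y , m , inj₁ q
          g (inj₂ e) = let (y , m , q) = to (⊩dia σ w (Z⊆ X Y s t)) (subst (a ⊩_) (sym (eσ X Y s t)) e) in y , m , inj₂ q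
        -- Preservation of unions applied to X ∪ Y = Y.
        ⊩mono : ∀ {a X Y} → X ⊆ Y → Y ⊆ W → a ⊩ X → a ⊩ Y
        ⊩mono {a} {X} {Y} s t e = subst (a ⊩_) (ext (λ z m → f (to ∈∪ m)) (λ z m → from ∈∪ (inj₂ m)))
          (from (⊩∪ (⊩-W′ (λ z m → t z (s z m)) e) (λ z m → t z (s z m)) t) (inj₁ e))
          where
          f : ∀ {z} → z ∈ X ⊎ z ∈ Y → z ∈ Y
          f (inj₁ m) = s _ m
          f (inj₂ m) = m
        ⊮∅ : ∀ {a} → ¬ a ⊩ ∅
        ⊮∅ {a} e = to (⊩C w ∅⊆) (⊩mono (λ z k → ⊥-elim (∉∅ k)) C⊆ e) e
          where
          ∅⊆ : ∅ ⊆ W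
          ∅⊆ z k = ⊥-elim (∉∅ k)
          w : a ∈ W′
          w = ⊩-W′ ∅⊆ e
        ⊩W : ∀ {a} → a ∈ W′ → a ⊩ W
        ⊩W w = ⊩mono C⊆ (λ _ k → k) (from (⊩C w λ z k → ⊥-elim (∉∅ k)) ⊮∅)
        -- De Morgan: were the complement of X ∩ Y in the ultrafilter, the complement of X or that
        -- of Y would be.
        ⊩∩ : ∀ {a X Y} → X ⊆ W → Y ⊆ W → a ⊩ X → a ⊩ Y → a ⊩ X ∩ Y
        ⊩∩ {a} {X} {Y} s t e k = fin (dec⊩ a (X ∩ Y))
          where
          w : a ∈ W′
          w = ⊩-W′ s e
          sub : C (X ∩ Y) ⊆ C X ∪ C Y
          sub z m = from ∈∪ (g (lem (λ (∙ ▹ z ▹ X) → z ∈ X) (∙ ▹ z ▹ X)))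
            where
            g : z ∈ X ⊎ ¬ z ∈ X → z ∈ C X ⊎ z ∈ C Y
            g (inj₁ x) = inj₂ (from (∈C (C⊆ z m)) λ y → to (∈C (C⊆ z m)) m (from ∈∩ (x , y)))
            g (inj₂ n) = inj₁ (from (∈C (C⊆ z m)) n)
          split : a ⊩ C X ⊎ a ⊩ C Y → ⊥₀
          split (inj₁ q) = to (⊩C w s) q e
          split (inj₂ q) = to (⊩C w t) q k
          fin : a ⊩ X ∩ Y ⊎ ¬ a ⊩ X ∩ Y → a ⊩ X ∩ Y
          fin (inj₁ m) = m
          fin (inj₂ no) = ⊥-elim (split (to (⊩∪ w C⊆ C⊆) (⊩mono sub (∪⊆ C⊆ C⊆) (from (⊩C w (λ z m → s z (proj₁ (to ∈∩ m)))) no))))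

        -- Local maps along which the ultrafilters are pushed forward.
        record Mp (t : V → V) (D : V → Set ℓ) : Set (lsuc ℓ) where
          field
            mp-t : DefT full {1} (λ γ → t (last γ))
            mp-D : Def full {1} (λ γ → D (last γ))
            mp-W : ∀ {x} → x ∈ W → D x → t x ∈ W
            mp-W′ : ∀ {x} → x ∈ W′ → D x → t x ∈ W′
            mp-rule : ∀ {a X X′} → a ∈ W′ → D a → X ⊆ W → X′ ⊆ W → (∀ x → x ∈ W → D x → t x ∈ X → x ∈ X′) → t a ⊩ X → a ⊩ X′
        open Mp public
        -- The rule for the complements of X and X′, read contrapositively.
        mp-rule⁻ : ∀ {t D} → Mp t D → ∀ {a X X′} → a ∈ W′ → D a → X ⊆ W → X′ ⊆ W → (∀ x → x ∈ W → D x → x ∈ X′ → t x ∈ X) → a ⊩ X′ → t a ⊩ X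
        mp-rule⁻ {t} m {a} {X} {X′} w d s s′ f e with dec⊩ (t a) X
        ... | inj₁ k = k
        ... | inj₂ no = ⊥-elim (to (⊩C w s′) (mp-rule m w d C⊆ C⊆ (λ x x∈ dx k → from (∈C x∈) λ l → to (∈C (mp-W m x∈ dx)) k (f x x∈ dx l))
                          (from (⊩C (mp-W′ m w d) s) no)) e)
        private
          base : ∀ k {t D} → DefT full {1} (λ γ → t (last γ)) → Def full {1} (λ γ → D (last γ)) → (∀ {x y} → rel k x y ⇔ (D x × y ≡ t x)) → Mp t D
          base k dt dD e = record { mp-t = dt ; mp-D = dD ; mp-W = λ x∈ d → rel-local r k x∈ (from e (d , refl))
            ; mp-W′ = λ x∈ d → rel-local r′ k x∈ (from e (d , refl))
            ; mp-rule = λ {a} {X} w d s s′ f m → ⊩mono (λ x k∈ → let (y , l , q) = to (∈dia k (dia⊆ x k∈)) k∈ ; (dx , q′) = to e q in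
                  f x (dia⊆ x k∈) dx (subst (_∈ X) q′ l)) s′ (from (⊩dia k w s) (_ , m , from e (d , refl))) }
          compose : ∀ {s t D D′} → Mp s D′ → Mp t D → Mp (λ x → s (t x)) (λ x → D x × D′ (t x))
          compose {s} {t} {D} {D′} q p = record
            { mp-t = subT1 s (mp-t q) (mp-t p) ; mp-D = dAnd ⦃ mp-D p ⦄ ⦃ sub1 (λ γ → D′ (last γ)) (mp-D q) (mp-t p) ⦄
            ; mp-W = λ x∈ (d , d′) → mp-W q (mp-W p x∈ d) d′ ; mp-W′ = λ x∈ (d , d′) → mp-W′ q (mp-W′ p x∈ d) d′
            ; mp-rule = λ {a} {X} {X′} w (d , d′) c c′ f m → mp-rule p w d (λ z k → proj₁ (to (∈QS) k)) c′
                (λ x x∈ dx k → let (_ , e , l) = to (∈QS) k in f x x∈ (dx , e) l)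
                (mp-rule q (mp-W′ p w d) d′ c (λ z k → proj₁ (to (∈QS) k)) (λ y y∈ dy k → from (∈QS) (y∈ , dy , k)) m) }
            where
            QP : Env 1 → V → Set ℓ
            QP (∙ ▹ X) y = D′ y × s y ∈ X
            opaque
              iQ : Def full {2} (λ γ → QP (init γ) (last γ))
              iQ = dAnd ⦃ sub1 (λ γ → D′ (last γ)) (mp-D q) v0 ⦄ ⦃ dMem ⦃ subT1 s (mp-t q) v0 ⦄ ⦃ v1 ⦄ ⦄
            QS : V → V
            QS X = sep QP ⦃ iQ ⦄ (∙ ▹ X) W
            ∈QS : ∀ {X y} → y ∈ QS X ⇔ (y ∈ W × QP (∙ ▹ X) y)
            ∈QS {X} = ∈sep QP ⦃ iQ ⦄ (∙ ▹ X) W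
          recast : ∀ {t t′ D D′} → DefT full {1} (λ γ → t′ (last γ)) → Def full {1} (λ γ → D′ (last γ)) →
                   (∀ x → D′ x → D x × t x ≡ t′ x) → (∀ x → D x → D′ x) → Mp t D → Mp t′ D′
          recast {t} {t′} {D} {D′} dt dD e b p = record { mp-t = dt ; mp-D = dD
            ; mp-W = λ x∈ d → let (c , q) = e _ d in subst (_∈ W) q (mp-W p x∈ c)
            ; mp-W′ = λ x∈ d → let (c , q) = e _ d in subst (_∈ W′) q (mp-W′ p x∈ c)
            ; mp-rule = λ {a} {X} w d s s′ f m → let (c , q) = e _ d in mp-rule p w c s s′
                (λ x x∈ dx k → f x x∈ (b x dx) (subst (_∈ X) (proj₂ (e x (b x dx))) k)) (subst (_⊩ X) (sym q) m) }
        mpδ : Mp (λ x → ⟪ x ، x ⟫) (λ x → x ≡ x)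
        mpδ = base (suc (suc zero)) (findT _) (find _) (mk⇔ (λ q → refl , q) proj₂)
        opaque
         mp↔ : Mp (λ x → ⟪ snd x ، fst x ⟫) Pr
         mp↔ = base (suc (suc (suc (suc zero)))) (i⟪⟫ ⦃ isnd ⦄ ⦃ ifst ⦄) (find _) id⇔
        opaque
         mp01 : Mp (λ x → ⟪ fst x ، fst (snd x) ⟫) Tri
         mp01 = base (suc (suc (suc (suc (suc zero))))) (i⟪⟫ ⦃ ifst ⦄ ⦃ ifst ⦃ isnd ⦄ ⦄) (find _) id⇔
        opaque
         mp02 : Mp (λ x → ⟪ fst x ، snd (snd x) ⟫) Tri
         mp02 = base (suc (suc (suc (suc (suc (suc zero)))))) (i⟪⟫ ⦃ ifst ⦄ ⦃ isnd ⦃ isnd ⦄ ⦄) (find _) id⇔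
        opaque
         mp-snd : Mp snd Pr
         mp-snd = base (suc (suc (suc (suc (suc (suc (suc zero))))))) isnd (find _) id⇔
        opaque
         -- Obtained as the second projection after the swap.
         mp-fst : Mp fst Pr
         mp-fst = recast ifst (find _) (λ x p → (p , Pr-⟪⟫) , snd-⟪⟫) (λ x → proj₁) (compose mp-snd mp↔)

        -- Łoś for a quantifier bounded by the first coordinate.
        N : Fin 9
        N = suc (suc (suc (suc (suc (suc (suc (suc zero)))))))
        ⊩N : ∀ {a b X} → a ∈ W′ → b ∈ W′ → X ⊆ W → ⟪ a ، b ⟫ ⊩ dia N X ⇔ (∃[ c ] (c ∈ a × ⟪ c ، b ⟫ ⊩ X))
        ⊩N {a} {b} {X} u v s = ⊩dia N (ru-⟪⟫ r′ u v) s ∙⇔ mk⇔ fw bw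
          where
          fw : ∃[ y ] (y ⊩ X × rel N ⟪ a ، b ⟫ y) → ∃[ c ] (c ∈ a × ⟪ c ، b ⟫ ⊩ X)
          fw (y , m , _ , w , k , q) = w , subst (w ∈_) fst-⟪⟫ k , subst (_⊩ X) (trans q (cong ⟪ w ،_⟫ snd-⟪⟫)) m
          bw : ∃[ c ] (c ∈ a × ⟪ c ، b ⟫ ⊩ X) → ∃[ y ] (y ⊩ X × rel N ⟪ a ، b ⟫ y)
          bw (c , k , m) = ⟪ c ، b ⟫ , m , Pr-⟪⟫ {a} {b} , c , subst (c ∈_) (sym fst-⟪⟫) k , cong ⟪ c ،_⟫ (sym snd-⟪⟫)
        private
          FP EX : Env 1 → V → Set ℓ
          FP (∙ ▹ Y) z = Pr z × fst z ∈ Y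
          EX (∙ ▹ Y) u = ∃[ w ] (w ∈ u × w ∈ Y)
          opaque
            defFP : Def full {2} (λ γ → FP (init γ) (last γ))
            defFP = find _
          opaque
            FS : V → V
            FS Y = sep FP ⦃ defFP ⦄ (∙ ▹ Y) W
            ∈FS : ∀ {Y z} → z ∈ FS Y ⇔ (z ∈ W × Pr z × fst z ∈ Y)
            ∈FS {Y} = ∈sep FP ⦃ defFP ⦄ (∙ ▹ Y) W
        ⊩fst : ∀ {a b Y} → a ∈ W′ → b ∈ W′ → Y ⊆ W → ⟪ a ، b ⟫ ⊩ FS Y ⇔ a ⊩ Y
        ⊩fst {a} {b} {Y} u v s = mk⇔
          (λ e → subst (_⊩ Y) fst-⟪⟫ (mp-rule⁻ mp-fst w Pr-⟪⟫ s sub (λ x x∈ d k → proj₂ (proj₂ (to (∈FS) k))) e))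
          (λ e → mp-rule mp-fst w Pr-⟪⟫ s sub (λ x x∈ d k → from (∈FS) (x∈ , d , k)) (subst (_⊩ Y) (sym fst-⟪⟫) e))
          where
          w = ru-⟪⟫ r′ u v
          sub : FS Y ⊆ W
          sub z k = proj₁ (to (∈FS) k)
        private
         opaque
          defEX : Def full {2} (λ γ → EX (init γ) (last γ))
          defEX = find _
        opaque
          ◇ : V → V
          ◇ Y = sep EX ⦃ defEX ⦄ (∙ ▹ Y) W
          ∈◇ : ∀ {Y u} → u ∈ ◇ Y ⇔ (u ∈ W × ∃[ w ] (w ∈ u × w ∈ Y))
          ∈◇ {Y} = ∈sep EX ⦃ defEX ⦄ (∙ ▹ Y) W
        ◇⊆ : ∀ {Y} → ◇ Y ⊆ W
        ◇⊆ z k = proj₁ (to ∈◇ k)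
        private
          ◇-up : ∀ {Y x} → Y ⊆ W → x ∈ W → Pr x → fst x ∈ ◇ Y → x ∈ dia N (FS Y)
          ◇-up {Y} {x} s x∈ d k = let (_ , v , l , m) = to ∈◇ k in from (∈dia N x∈) (⟪ v ، snd x ⟫ ,
            from ∈FS (ru-⟪⟫ r (s v m) (ru-snd r x∈ d) , Pr-⟪⟫ , subst (_∈ Y) (sym fst-⟪⟫) m) , d , v , l , refl)
          ◇-down : ∀ {Y x y} → x ∈ W → y ∈ FS Y → rel N x y → fst x ∈ ◇ Y
          ◇-down {Y} x∈ k (p , v , l , e) = from ∈◇ (ru-fst r x∈ p , v , l , subst (_∈ Y) (trans (cong fst e) fst-⟪⟫) (proj₂ (proj₂ (to ∈FS k))))
          ⊩◇-N : ∀ {a Y} → a ∈ W′ → Y ⊆ W → fst ⟪ a ، ∅ ⟫ ⊩ ◇ Y ⇔ ⟪ a ، ∅ ⟫ ⊩ dia N (FS Y)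
          ⊩◇-N {a} {Y} u s = let w = ru-⟪⟫ r′ u (ru-∅ r′) in mk⇔
            (mp-rule mp-fst {X = ◇ Y} {X′ = dia N (FS Y)} w Pr-⟪⟫ (◇⊆ {Y}) (dia⊆ {N} {FS Y}) (λ x → ◇-up s))
            (mp-rule⁻ mp-fst {X = ◇ Y} {X′ = dia N (FS Y)} w Pr-⟪⟫ (◇⊆ {Y}) (dia⊆ {N} {FS Y}) λ x x∈ d k →
              let (_ , l , e) = to (∈dia N {FS Y} x∈) k in ◇-down {Y} x∈ l e)
          ⊩N-FS : ∀ {a Y} → a ∈ W′ → Y ⊆ W → ⟪ a ، ∅ ⟫ ⊩ dia N (FS Y) ⇔ (∃[ c ] (c ∈ a × c ⊩ Y))
          ⊩N-FS {a} {Y} u s = ⊩N {X = FS Y} u (ru-∅ r′) (λ z k → proj₁ (to ∈FS k)) ∙⇔ mk⇔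
            (λ (c , k , m) → c , k , to (⊩fst {Y = Y} (ru-Tr r′ k u) (ru-∅ r′) s) m)
            (λ (c , k , m) → c , k , from (⊩fst {Y = Y} (ru-Tr r′ k u) (ru-∅ r′) s) m)
        -- The relation behind `⊩N` acts on pairs, so a receives the dummy second coordinate `∅` and
        -- the set is pulled back along the first projection.
        ⊩◇ : ∀ {a Y} → a ∈ W′ → Y ⊆ W → a ⊩ ◇ Y ⇔ (∃[ c ] (c ∈ a × c ⊩ Y))
        ⊩◇ {a} {Y} u s = subst (λ b → b ⊩ ◇ Y ⇔ ⟪ a ، ∅ ⟫ ⊩ dia N (FS Y)) fst-⟪⟫ (⊩◇-N u s) ∙⇔ ⊩N-FS u s
        -- The dual of `⊩◇`, obtained for the complement of Y.
        ⊩⊆ : ∀ {a Y Z} → a ∈ W′ → Y ⊆ W → Z ⊆ W → (∀ u → u ∈ W → u ⊆ Y → u ∈ Z) → (∀ c → c ∈ a → c ⊩ Y) → a ⊩ Z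
        ⊩⊆ {a} {Y} {Z} u s t f g = ⊩mono (λ x k → f x (C⊆ x k) λ z l →
            by-contra (λ (∙ ▹ z ▹ Y) → z ∈ Y) (∙ ▹ z ▹ Y) λ no →
              to (∈C (C⊆ x k)) k (from ∈◇ (C⊆ x k , z , l , from (∈C (ru-Tr r l (C⊆ x k))) no))) t
          (from (⊩C u ◇⊆) λ e → let (c , k , m) = to (⊩◇ u C⊆) e in to (⊩C (ru-Tr r′ k u) s) m (g c k))

        -- Induction through `⊩⊆`: if a ⊆ V_γ and the members of a concentrate on V_γ, then a
        -- concentrates on the subsets of V_γ, which belong to V_β for γ below β.
        ⊩R : W′ ⊆ W → ∀ β → Ord β → β ∈ ru-λ r′ → ∀ a → a ∈ R β → a ⊩ R β
        ⊩R c = Ord-ind (λ (∙ ▹ x ▹ h) β → β ∈ x → ∀ a → a ∈ R β → a ∈ app h (R β)) (∙ ▹ ru-λ r′ ▹ h) λ β o ih k a e →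
          let (γ , l , s) = to ∈R e ; γ∈ = Ord-tr (lim-Ord (ru-Lim r′)) l k in
          ⊩⊆ (inW′ k e) (λ z m → c z (inW′ γ∈ m)) (λ z m → c z (inW′ k m)) (λ u _ t → from ∈R (γ , l , t))
             λ x m → ih γ l γ∈ x (s x m)
          where
          inW′ : ∀ {β z} → β ∈ ru-λ r′ → z ∈ R β → z ∈ W′
          inW′ k m = subst (_ ∈_) (sym (ru-R r′)) (from ∈R (_ , k , λ y l → trn (R-Tr _) _ m y l))
        ⊩W′ : W′ ⊆ W → ∀ {a} → a ∈ W′ → a ⊩ W′
        ⊩W′ c {a} e = let (β , k , s) = to ∈R (subst (a ∈_) (ru-R r′) e)
                          k′ = lim-suc (ru-Lim r′) β k
                      in ⊩mono (λ z m → subst (z ∈_) (sym (ru-R r′)) (R-mono (λ y l → Ord-tr (lim-Ord (ru-Lim r′)) l k′) z m)) c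
                           (⊩R c (sucV β) (Ord-∈ (lim-Ord (ru-Lim r′)) k′) k′ a (from ∈R (β , ∈suc-refl , s)))
    open Modalities

    -- Coordinate calculus for the extender of an endomorphism.

    module ExtenderMaps where
      private
        EqP MeP EqP₁ : Env 2 → V → Set ℓ
        EqP (∙ ▹ f ▹ g) z = Pr z × app f (fst z) ≡ app g (snd z)
        MeP (∙ ▹ f ▹ g) z = Pr z × app f (fst z) ∈ app g (snd z)
        EqP₁ (∙ ▹ f ▹ g) z = app f z ≡ app g z
        UpP : Env 1 → V → Set ℓ
        UpP (∙ ▹ n) u = n ⊆ u
      private
       opaque
        defEqP : Def full {3} (λ γ → EqP (init γ) (last γ))
        defEqP = find _
        defMeP : Def full {3} (λ γ → MeP (init γ) (last γ))
        defMeP = find _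
        defEqP₁ : Def full {3} (λ γ → EqP₁ (init γ) (last γ))
        defEqP₁ = find _
        defUpP : Def full {2} (λ γ → UpP (init γ) (last γ))
        defUpP = find _
      opaque
        EqS MeS EqS₁ : V → V → V → V
        EqS W f g = sep EqP ⦃ defEqP ⦄ (∙ ▹ f ▹ g) W
        MeS W f g = sep MeP ⦃ defMeP ⦄ (∙ ▹ f ▹ g) W
        EqS₁ W f g = sep EqP₁ ⦃ defEqP₁ ⦄ (∙ ▹ f ▹ g) W
        ∈EqS : ∀ {W f g z} → z ∈ EqS W f g ⇔ (z ∈ W × Pr z × app f (fst z) ≡ app g (snd z))
        ∈EqS {W} {f} {g} = ∈sep EqP ⦃ defEqP ⦄ (∙ ▹ f ▹ g) W
        ∈MeS : ∀ {W f g z} → z ∈ MeS W f g ⇔ (z ∈ W × Pr z × app f (fst z) ∈ app g (snd z))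
        ∈MeS {W} {f} {g} = ∈sep MeP ⦃ defMeP ⦄ (∙ ▹ f ▹ g) W
        ∈EqS₁ : ∀ {W f g z} → z ∈ EqS₁ W f g ⇔ (z ∈ W × app f z ≡ app g z)
        ∈EqS₁ {W} {f} {g} = ∈sep EqP₁ ⦃ defEqP₁ ⦄ (∙ ▹ f ▹ g) W
        instance
         iEqS : ∀ {n} {s t u : Env n → V} ⦃ _ : DefT full s ⦄ ⦃ _ : DefT full t ⦄ ⦃ _ : DefT full u ⦄ → DefT full (λ γ → EqS (s γ) (t γ) (u γ))
         iEqS ⦃ a ⦄ ⦃ b ⦄ ⦃ c ⦄ = isep EqP ⦃ defEqP ⦄ ([] ▸ b ▸ c) a
         iMeS : ∀ {n} {s t u : Env n → V} ⦃ _ : DefT full s ⦄ ⦃ _ : DefT full t ⦄ ⦃ _ : DefT full u ⦄ → DefT full (λ γ → MeS (s γ) (t γ) (u γ))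
         iMeS ⦃ a ⦄ ⦃ b ⦄ ⦃ c ⦄ = isep MeP ⦃ defMeP ⦄ ([] ▸ b ▸ c) a
        Up : V → V → V
        Up W n = sep UpP ⦃ defUpP ⦄ (∙ ▹ n) W
        ∈Up : ∀ {W n u} → u ∈ Up W n ⇔ (u ∈ W × n ⊆ u)
        ∈Up {W} {n} = ∈sep UpP ⦃ defUpP ⦄ (∙ ▹ n) W
        private instance
         iUp : ∀ {n} {s t : Env n → V} ⦃ _ : DefT full s ⦄ ⦃ _ : DefT full t ⦄ → DefT full (λ γ → Up (s γ) (t γ))
         iUp ⦃ a ⦄ ⦃ b ⦄ = isep UpP ⦃ defUpP ⦄ ([] ▸ b) a

      private
        CvP RxP F0P S0P : Env 1 → V → Set ℓ
        CvP (∙ ▹ X) z = Pr z × ⟪ snd z ، fst z ⟫ ∈ X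
        RxP (∙ ▹ X) z = Tri z × ⟪ fst z ، snd (snd z) ⟫ ∈ X
        F0P (∙ ▹ X) z = Pr z × fst z ∈ X
        S0P (∙ ▹ X) z = Pr z × snd z ∈ X

      private
       opaque
        defCvP : Def full {2} (λ γ → CvP (init γ) (last γ))
        defCvP = find _
        defRxP : Def full {2} (λ γ → RxP (init γ) (last γ))
        defRxP = find _
        defF0P : Def full {2} (λ γ → F0P (init γ) (last γ))
        defF0P = find _
        defS0P : Def full {2} (λ γ → S0P (init γ) (last γ))
        defS0P = find _
      module Extender {W h : V} (r : RU W) (S : SH W W h) where
        open Ultrafilters r r S public
        opaque
          -- Inverse images of X under the swap, under deletion of the middle of a triple, and under
          -- the two projections.
          conv rext pf ps : V → V
          conv X = sep CvP ⦃ defCvP ⦄ (∙ ▹ X) W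
          rext X = sep RxP ⦃ defRxP ⦄ (∙ ▹ X) W
          pf X = sep F0P ⦃ defF0P ⦄ (∙ ▹ X) W
          ps X = sep S0P ⦃ defS0P ⦄ (∙ ▹ X) W
          ∈conv : ∀ {X z} → z ∈ conv X ⇔ (z ∈ W × Pr z × ⟪ snd z ، fst z ⟫ ∈ X)
          ∈conv {X} = ∈sep CvP ⦃ defCvP ⦄ (∙ ▹ X) W
          ∈rext : ∀ {X z} → z ∈ rext X ⇔ (z ∈ W × Tri z × ⟪ fst z ، snd (snd z) ⟫ ∈ X)
          ∈rext {X} = ∈sep RxP ⦃ defRxP ⦄ (∙ ▹ X) W
          ∈pf : ∀ {X z} → z ∈ pf X ⇔ (z ∈ W × Pr z × fst z ∈ X)
          ∈pf {X} = ∈sep F0P ⦃ defF0P ⦄ (∙ ▹ X) W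
          ∈ps : ∀ {X z} → z ∈ ps X ⇔ (z ∈ W × Pr z × snd z ∈ X)
          ∈ps {X} = ∈sep S0P ⦃ defS0P ⦄ (∙ ▹ X) W
        conv⊆ : ∀ {X} → conv X ⊆ W
        conv⊆ z k = proj₁ (to ∈conv k)
        rext⊆ : ∀ {X} → rext X ⊆ W
        rext⊆ z k = proj₁ (to ∈rext k)
        pf⊆ : ∀ {X} → pf X ⊆ W
        pf⊆ z k = proj₁ (to ∈pf k)
        ps⊆ : ∀ {X} → ps X ⊆ W
        ps⊆ z k = proj₁ (to ∈ps k)
        opaque
          ⊩conv : ∀ {a b X} → a ∈ W → b ∈ W → X ⊆ W → ⟪ a ، b ⟫ ⊩ X → ⟪ b ، a ⟫ ⊩ conv X
          ⊩conv {a} {b} {X} u v s e = mp-rule mp↔ (ru-⟪⟫ r v u) Pr-⟪⟫ s conv⊆ (λ x x∈ d k → from ∈conv (x∈ , d , k))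
            (subst (_⊩ X) (sym (cong₂ ⟪_،_⟫ snd-⟪⟫ fst-⟪⟫)) e)
          ⊩rext : ∀ {a b c X} → a ∈ W → b ∈ W → c ∈ W → X ⊆ W → ⟪ a ، c ⟫ ⊩ X → ⟪ a ، ⟪ b ، c ⟫ ⟫ ⊩ rext X
          ⊩rext {a} {b} {c} {X} u v w s e = mp-rule mp02 (ru-⟪⟫ r u (ru-⟪⟫ r v w)) (Pr-⟪⟫ , subst Pr (sym snd-⟪⟫) Pr-⟪⟫) s rext⊆ (λ x x∈ d k → from ∈rext (x∈ , d , k))
            (subst (_⊩ X) (sym (cong₂ ⟪_،_⟫ fst-⟪⟫ (trans (cong snd snd-⟪⟫) snd-⟪⟫))) e)
          ⊩pf : ∀ {a b X} → a ∈ W → b ∈ W → X ⊆ W → a ⊩ X → ⟪ a ، b ⟫ ⊩ pf X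
          ⊩pf {a} {b} {X} u v s e = mp-rule mp-fst (ru-⟪⟫ r u v) Pr-⟪⟫ s pf⊆ (λ x x∈ d k → from ∈pf (x∈ , d , k)) (subst (_⊩ X) (sym fst-⟪⟫) e)
          ⊩ps : ∀ {a b X} → a ∈ W → b ∈ W → X ⊆ W → b ⊩ X → ⟪ a ، b ⟫ ⊩ ps X
          ⊩ps {a} {b} {X} u v s e = mp-rule mp-snd (ru-⟪⟫ r u v) Pr-⟪⟫ s ps⊆ (λ x x∈ d k → from ∈ps (x∈ , d , k)) (subst (_⊩ X) (sym snd-⟪⟫) e)
          ⊩fst⁻ : ∀ {a b X Y} → a ∈ W → b ∈ W → X ⊆ W → Y ⊆ W → (∀ x y → x ∈ W → y ∈ W → ⟪ x ، y ⟫ ∈ X → x ∈ Y) → ⟪ a ، b ⟫ ⊩ X → a ⊩ Y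
          ⊩fst⁻ {a} {b} {X} {Y} u v s t f e = subst (_⊩ Y) fst-⟪⟫ (mp-rule⁻ mp-fst (ru-⟪⟫ r u v) Pr-⟪⟫ t s
            (λ x x∈ d k → f (fst x) (snd x) (ru-fst r x∈ d) (ru-snd r x∈ d) (subst (_∈ X) d k)) e)
          ⊩snd⁻ : ∀ {a b X Y} → a ∈ W → b ∈ W → X ⊆ W → Y ⊆ W → (∀ x y → x ∈ W → y ∈ W → ⟪ x ، y ⟫ ∈ X → y ∈ Y) → ⟪ a ، b ⟫ ⊩ X → b ⊩ Y
          ⊩snd⁻ {a} {b} {X} {Y} u v s t f e = subst (_⊩ Y) snd-⟪⟫ (mp-rule⁻ mp-snd (ru-⟪⟫ r u v) Pr-⟪⟫ t s
            (λ x x∈ d k → f (fst x) (snd x) (ru-fst r x∈ d) (ru-snd r x∈ d) (subst (_∈ X) d k)) e)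
          ⊩pair : ∀ {a b X Y} → a ∈ W → b ∈ W → X ⊆ W → Y ⊆ W → (∀ x y → x ∈ W → y ∈ W → ⟪ x ، y ⟫ ∈ X → ⟪ x ، y ⟫ ∈ Y) → ⟪ a ، b ⟫ ⊩ X → ⟪ a ، b ⟫ ⊩ Y
          ⊩pair {a} {b} {X} {Y} u v s t f e = ⊩mono (λ z k → g z (to ∈∩ k)) t (⊩∩ pf⊆ s (⊩pf {b = b} u v (λ _ k → k) (⊩W u)) e)
            where
            g : ∀ z → z ∈ pf W × z ∈ X → z ∈ Y
            g z (k , l) = let (z∈ , p , _) = to ∈pf k in subst (_∈ Y) (sym p) (f _ _ (ru-fst r z∈ p) (ru-snd r z∈ p) (subst (_∈ X) p l))
          ⊩flip : ∀ {a b X Y} → a ∈ W → b ∈ W → X ⊆ W → Y ⊆ W → (∀ x y → x ∈ W → y ∈ W → ⟪ x ، y ⟫ ∈ X → ⟪ y ، x ⟫ ∈ Y) → ⟪ a ، b ⟫ ⊩ X → ⟪ b ، a ⟫ ⊩ Y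
          ⊩flip {a} {b} {X} {Y} u v s t f e = ⊩pair v u conv⊆ t (λ x y x∈ y∈ k → f y x y∈ x∈ (subst (_∈ X) (cong₂ ⟪_،_⟫ snd-⟪⟫ fst-⟪⟫) (proj₂ (proj₂ (to ∈conv k)))))
            (⊩conv u v s e)
          -- At the triple of a, b and c all three pairs are visible: X holds of the first two
          -- coordinates and Y of the last two, so Z holds of the outer ones.
          ⊩chain : ∀ {a b c X Y Z} → a ∈ W → b ∈ W → c ∈ W → X ⊆ W → Y ⊆ W → Z ⊆ W →
                   (∀ x y z → x ∈ W → y ∈ W → z ∈ W → ⟪ x ، y ⟫ ∈ X → ⟪ y ، z ⟫ ∈ Y → ⟪ x ، z ⟫ ∈ Z) →
                   ⟪ a ، b ⟫ ⊩ X → ⟪ b ، c ⟫ ⊩ Y → ⟪ a ، c ⟫ ⊩ Z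
          ⊩chain {a} {b} {c} {X} {Y} {Z} u v w s t q f e k =
            subst (_⊩ Z) (cong₂ ⟪_،_⟫ fst-⟪⟫ (trans (cong snd snd-⟪⟫) snd-⟪⟫))
              (mp-rule⁻ mp02 t∈ tri q (λ z l → ps⊆ z (proj₂ (to ∈∩ l))) step
                (⊩∩ rx⊆ ps⊆ (mp-rule mp01 t∈ tri s rx⊆ (λ x x∈ d m → from ∈rx (x∈ , d , m))
                    (subst (_⊩ X) (sym (cong₂ ⟪_،_⟫ fst-⟪⟫ (trans (cong fst snd-⟪⟫) fst-⟪⟫))) e))
                  (⊩ps u (ru-⟪⟫ r v w) t k)))
            where
            t∈ : ⟪ a ، ⟪ b ، c ⟫ ⟫ ∈ W
            t∈ = ru-⟪⟫ r u (ru-⟪⟫ r v w)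
            tri : Tri ⟪ a ، ⟪ b ، c ⟫ ⟫
            tri = Pr-⟪⟫ , subst Pr (sym snd-⟪⟫) Pr-⟪⟫
            LxP : Env 1 → V → Set ℓ
            LxP (∙ ▹ X) z = Tri z × ⟪ fst z ، fst (snd z) ⟫ ∈ X
            defLxP : Def full {2} (λ γ → LxP (init γ) (last γ))
            defLxP = find _
            rx : V
            rx = sep LxP ⦃ defLxP ⦄ (∙ ▹ X) W
            ∈rx : ∀ {z} → z ∈ rx ⇔ (z ∈ W × Tri z × ⟪ fst z ، fst (snd z) ⟫ ∈ X)
            ∈rx = ∈sep LxP ⦃ defLxP ⦄ (∙ ▹ X) W
            rx⊆ : rx ⊆ W
            rx⊆ z l = proj₁ (to ∈rx l)
            step : ∀ x → x ∈ W → Tri x → x ∈ rx ∩ ps Y → ⟪ fst x ، snd (snd x) ⟫ ∈ Z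
            step x x∈ (p , p′) l = let (m , n) = to ∈∩ l ; x₂ = ru-snd r x∈ p in
              f _ _ _ (ru-fst r x∈ p) (ru-fst r x₂ p′) (ru-snd r x₂ p′) (proj₂ (proj₂ (to ∈rx m))) (subst (_∈ Y) p′ (proj₂ (proj₂ (to ∈ps n))))
          ⊩diag⁻ : ∀ {a X Y} → a ∈ W → X ⊆ W → Y ⊆ W → (∀ x → x ∈ W → ⟪ x ، x ⟫ ∈ X → x ∈ Y) → ⟪ a ، a ⟫ ⊩ X → a ⊩ Y
          ⊩diag⁻ u s t f e = mp-rule mpδ u refl s t (λ x x∈ _ k → f x x∈ k) e
          ⊩diag : ∀ {a X Y} → a ∈ W → X ⊆ W → Y ⊆ W → (∀ x → x ∈ W → x ∈ Y → ⟪ x ، x ⟫ ∈ X) → a ⊩ Y → ⟪ a ، a ⟫ ⊩ X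
          ⊩diag u s t f e = mp-rule⁻ mpδ u refl s t (λ x x∈ _ k → f x x∈ k) e

        private
          PjfP PjsP : Env 0 → V → Set ℓ
          PjfP _ z = Pr z × Pr (fst z) × fst (fst z) ≡ snd z
          PjsP _ z = Pr z × Pr (fst z) × snd (fst z) ≡ snd z
          DlP LfP : Env 0 → V → Set ℓ
          DlP _ z = Pr z × fst z ≡ snd z
          LfP _ z = Tri z × fst z ≡ fst (snd z)
        private
         opaque
          defPjfP : Def full {1} (λ γ → PjfP (init γ) (last γ))
          defPjfP = find _
          defPjsP : Def full {1} (λ γ → PjsP (init γ) (last γ))
          defPjsP = find _
          defDlP : Def full {1} (λ γ → DlP (init γ) (last γ))
          defDlP = find _
          defLfP : Def full {1} (λ γ → LfP (init γ) (last γ))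
          defLfP = find _
        opaque
          Pjf Pjs : V
          Pjf = sep PjfP ⦃ defPjfP ⦄ ∙ W
          Pjs = sep PjsP ⦃ defPjsP ⦄ ∙ W
          private
            Dl Lf : V
            Dl = sep DlP ⦃ defDlP ⦄ ∙ W
            Lf = sep LfP ⦃ defLfP ⦄ ∙ W
          ∈Pjf : ∀ {z} → z ∈ Pjf ⇔ (z ∈ W × Pr z × Pr (fst z) × fst (fst z) ≡ snd z)
          ∈Pjf = ∈sep PjfP ⦃ defPjfP ⦄ ∙ W
          ∈Pjs : ∀ {z} → z ∈ Pjs ⇔ (z ∈ W × Pr z × Pr (fst z) × snd (fst z) ≡ snd z)
          ∈Pjs = ∈sep PjsP ⦃ defPjsP ⦄ ∙ W
          private
            ∈Dl : ∀ {z} → z ∈ Dl ⇔ (z ∈ W × Pr z × fst z ≡ snd z)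
            ∈Dl = ∈sep DlP ⦃ defDlP ⦄ ∙ W
            ∈Lf : ∀ {z} → z ∈ Lf ⇔ (z ∈ W × Tri z × fst z ≡ fst (snd z))
            ∈Lf = ∈sep LfP ⦃ defLfP ⦄ ∙ W
            ⊩Dl : ∀ {a} → a ∈ W → ⟪ a ، a ⟫ ⊩ Dl
            ⊩Dl u = ⊩diag u (λ z k → proj₁ (to ∈Dl k)) (λ _ k → k)
              (λ x x∈ _ → from ∈Dl (ru-⟪⟫ r x∈ x∈ , Pr-⟪⟫ , trans fst-⟪⟫ (sym snd-⟪⟫))) (⊩W u)
          -- The coordinates of a pair, as members of the ultrapower.
          ⊩Pjf : ∀ {a b} → a ∈ W → b ∈ W → ⟪ ⟪ a ، b ⟫ ، a ⟫ ⊩ Pjf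
          ⊩Pjf {a} {b} u v = ⊩flip u (ru-⟪⟫ r u v) (λ z k → proj₁ (to ∈Lf k)) (λ z k → proj₁ (to ∈Pjf k))
            (λ x y x∈ y∈ k → let (_ , (p , q) , e) = to ∈Lf k in from ∈Pjf (ru-⟪⟫ r y∈ x∈ , Pr-⟪⟫ , subst Pr (trans snd-⟪⟫ (sym fst-⟪⟫)) q ,
              trans (cong fst fst-⟪⟫) (trans (cong fst (sym snd-⟪⟫)) (trans (sym e) (trans fst-⟪⟫ (sym snd-⟪⟫))))))
            (mp-rule mp01 (ru-⟪⟫ r u (ru-⟪⟫ r u v)) (Pr-⟪⟫ , subst Pr (sym snd-⟪⟫) Pr-⟪⟫) (λ z k → proj₁ (to ∈Dl k)) (λ z k → proj₁ (to ∈Lf k))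
              (λ x x∈ d k → from ∈Lf (x∈ , d , trans (sym fst-⟪⟫) (trans (proj₂ (proj₂ (to ∈Dl k))) snd-⟪⟫)))
              (subst (_⊩ Dl) (sym (cong₂ ⟪_،_⟫ fst-⟪⟫ (trans (cong fst snd-⟪⟫) fst-⟪⟫))) (⊩Dl u)))
          ⊩Pjs : ∀ {a b} → a ∈ W → b ∈ W → ⟪ ⟪ a ، b ⟫ ، b ⟫ ⊩ Pjs
          ⊩Pjs {a} {b} u v = ⊩flip v (ru-⟪⟫ r u v) rext⊆ (λ z k → proj₁ (to ∈Pjs k))
            (λ x y x∈ y∈ k → let (_ , (p , q) , e) = to ∈rext k in from ∈Pjs (ru-⟪⟫ r y∈ x∈ , Pr-⟪⟫ , subst Pr (trans snd-⟪⟫ (sym fst-⟪⟫)) q ,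
              trans (cong snd fst-⟪⟫) (trans (cong snd (sym snd-⟪⟫)) (trans (sym (trans (trans (sym fst-⟪⟫) (proj₂ (proj₂ (to ∈Dl e)))) snd-⟪⟫)) (trans fst-⟪⟫ (sym snd-⟪⟫))))))
            (⊩rext v u v (λ z k → proj₁ (to ∈Dl k)) (⊩Dl v))

        private
          PnP : Env 2 → V → Set ℓ
          PnP (∙ ▹ W ▹ h) n = (∀ c → c ∈ sucV n → c ∈ app h (sing c)) × (∀ a → a ∈ W → n ⊆ a → a ∈ app h (Up W n))
        opaque
          -- The induction also shows that every a ⊇ n concentrates on supersets of n. If m is
          -- principal and m ∈ a, then by `⊩◇` the ultrafilter at a concentrates on sets containing
          -- m, which carries this to m + 1. The point m + 1 concentrates on its subsets as well, by
          -- `⊩⊆`, and is therefore principal.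
          prin : ∀ n → n ∈ ω → n ⊩ sing n
          prin n n∈ = proj₁ (ω-ind PnP (∙ ▹ W ▹ h) (base , base-up) step n n∈) n ∈suc-refl
            where
            nW : ∀ {m} → m ∈ ω → m ∈ W
            nW k = ru-Tr r k (ru-ω r)
            s⊆ : ∀ {c} → c ∈ W → sing c ⊆ W
            s⊆ w z k = subst (_∈ W) (sym (to ∈sing k)) w
            up⊆ : ∀ {m} → Up W m ⊆ W
            up⊆ z k = proj₁ (to ∈Up k)
            ∅⊆ : ∀ {x} → ∅ ⊆ x
            ∅⊆ z k = ⊥-elim (∉∅ k)
            base-up : ∀ a → a ∈ W → ∅ ⊆ a → a ⊩ Up W ∅
            base-up a a∈ _ = ⊩mono (λ z k → from ∈Up (k , ∅⊆)) up⊆ (⊩W a∈)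
            ∅⊩ : ∅ ⊩ sing ∅
            ∅⊩ = ⊩⊆ (ru-∅ r) ∅⊆ (s⊆ (ru-∅ r)) (λ u _ s → from ∈sing (ext s ∅⊆)) λ c k → ⊥-elim (∉∅ k)
            base : ∀ c → c ∈ sucV ∅ → c ⊩ sing c
            base c k = f (to ∈suc k)
              where
              f : c ∈ ∅ ⊎ c ≡ ∅ → c ⊩ sing c
              f (inj₁ k) = ⊥-elim (∉∅ k)
              f (inj₂ e) = subst (λ c → c ⊩ sing c) (sym e) ∅⊩
            step : ∀ m → m ∈ ω → PnP (∙ ▹ W ▹ h) m → PnP (∙ ▹ W ▹ h) (sucV m)
            step m m∈ (pr , up) = (λ c k → f c (to ∈suc k)) , up′
              where
              m′ : sucV m ∈ W
              m′ = nW (suc∈ω m∈)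
              up′ : ∀ a → a ∈ W → sucV m ⊆ a → a ⊩ Up W (sucV m)
              up′ a a∈ s = ⊩mono (λ z k → g z (to ∈∩ k)) up⊆ (⊩∩ up⊆ ◇⊆ (up a a∈ λ z k → s z (from ∈suc (inj₁ k)))
                  (from (⊩◇ a∈ (s⊆ (nW m∈))) (m , s m ∈suc-refl , pr m ∈suc-refl)))
                where
                g : ∀ z → z ∈ Up W m × z ∈ ◇ (sing m) → z ∈ Up W (sucV m)
                g z (k , l) = let (z∈ , t) = to ∈Up k ; (_ , w , w∈ , q) = to ∈◇ l in
                  from ∈Up (z∈ , λ x i → j t (subst (_∈ z) (to ∈sing q) w∈) (to ∈suc i))
                  where
                  j : ∀ {x} → m ⊆ z → m ∈ z → x ∈ m ⊎ x ≡ m → x ∈ z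
                  j t q (inj₁ i) = t _ i
                  j t q (inj₂ refl) = q
              last-one : sucV m ⊩ sing (sucV m)
              last-one = ⊩mono (λ z k → from ∈sing (h′ z (to ∈∩ k))) (s⊆ m′)
                (⊩∩ up⊆ (λ z k → C⊆ z k) (up′ _ m′ λ _ k → k)
                  (⊩⊆ m′ (λ z k → ru-Tr r k m′) C⊆ (λ u u∈ s → from (∈C u∈) λ k → let (_ , w , w∈ , q) = to ∈◇ k in to (∈C (ru-Tr r w∈ u∈)) q (s w w∈))
                    λ c k → ⊩mono (λ z l → subst (_∈ sucV m) (sym (to ∈sing l)) k) (λ z k → ru-Tr r k m′) (pr c k)))
                where
                h′ : ∀ z → z ∈ Up W (sucV m) × z ∈ C (◇ (C (sucV m))) → z ≡ sucV m
                h′ z (k , l) = let (z∈ , t) = to ∈Up k in ext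
                  (λ x x∈ → by-contra (λ (∙ ▹ x ▹ y) → x ∈ y) (∙ ▹ x ▹ sucV m) λ no →
                    to (∈C z∈) l (from ∈◇ (z∈ , x , x∈ , from (∈C (ru-Tr r x∈ z∈)) no))) t
              f : ∀ c → c ∈ sucV m ⊎ c ≡ sucV m → c ⊩ sing c
              f c (inj₁ k) = pr c k
              f c (inj₂ refl) = last-one
    open ExtenderMaps

    -- Well-foundedness of the ultrapower.

    module Wellfoundedness where
      -- ⟪a , f⟫ with a ∈ W and f a function on W stands for the class of f in the ultrapower by the
      -- ultrafilter at a.
      Eε Eq : V → V → V → V → Set ℓ
      Eε W h c d = ⟪ fst c ، fst d ⟫ ∈ app h (MeS W (snd c) (snd d))
      Eq W h c d = ⟪ fst c ، fst d ⟫ ∈ app h (EqS W (snd c) (snd d))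

      private
        EtP : Env 2 → V → Set ℓ
        EtP (∙ ▹ W ▹ h) p = Eε W h (fst p) (snd p)
        XvP : Env 1 → V → Set ℓ
        XvP (∙ ▹ s) z = fst (fst z) ≡ sucV (fst (snd z)) ×
          app (snd (app s (fst (fst z)))) (snd (fst z)) ∈ app (snd (app s (fst (snd z)))) (snd (snd z))
        VlT SqT : Env 1 → V → V
        VlT (∙ ▹ s) p = app (snd (app s (fst p))) (snd p)
        SqT (∙ ▹ s) n = ⟪ n ، fst (app s n) ⟫
        IdG : V → V → V → V
        IdG p c s = s
        EdT : V → V → V → Set ℓ
        EdT E x y = ⟪ y ، x ⟫ ∈ E
        MinP : Env 2 → Set ℓ
        MinP (∙ ▹ S ▹ E) = ∃[ m ] (m ∈ S × (∀ x → x ∈ S → ¬ ⟪ x ، m ⟫ ∈ E))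
        BlP : Env 3 → Set ℓ
        BlP (∙ ▹ S ▹ E ▹ m) = ∃[ x ] (x ∈ S × ⟪ x ، m ⟫ ∈ E)
        CutT : Env 2 → V → V
        CutT (∙ ▹ k ▹ T) y = ⋃ (sing (app k y) ∩ T)
        DisP : Env 2 → V → Set ℓ
        DisP (∙ ▹ g ▹ g′) c = ¬ app g c ≡ app g′ c
      opaque
        -- Representing functions with values in a set T form a set, on which recursion along the
        -- membership of the ultrapower is available.
        DT : V → V → V
        DT W T = W ⊗ (W ⇛ T)
        ∈DT : ∀ {W T c} → c ∈ DT W T ⇔ (Pr c × fst c ∈ W × Fn (snd c) W × (∀ x → x ∈ W → app (snd c) x ∈ T))
        ∈DT {W} {T} {c} = mk⇔ fw (λ (p , a , F , t) → subst (_∈ W ⊗ (W ⇛ T)) (sym p) (from pair∈⊗ (a , from ∈⇛ (F , t))))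
          where
          fw : c ∈ W ⊗ (W ⇛ T) → Pr c × fst c ∈ W × Fn (snd c) W × (∀ x → x ∈ W → app (snd c) x ∈ T)
          fw e with to ∈⊗ e
          ... | a , a∈ , f , f∈ , refl = Pr-⟪⟫ , subst (_∈ W) (sym fst-⟪⟫) a∈ , subst (λ f → Fn f W × (∀ x → x ∈ W → app f x ∈ T)) (sym snd-⟪⟫) (to ∈⇛ f∈)
        instance
         iDT : ∀ {n} {s t : Env n → V} ⦃ _ : DefT full s ⦄ ⦃ _ : DefT full t ⦄ → DefT full (λ γ → DT (s γ) (t γ))
         iDT ⦃ a ⦄ ⦃ b ⦄ = i⊗ ⦃ a ⦄ ⦃ i⇛ ⦃ a ⦄ ⦃ b ⦄ ⦄
      private
       opaque
        defEtP : Def full {3} (λ γ → EtP (init γ) (last γ))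
        defEtP = find _
        defXvP : Def full {2} (λ γ → XvP (init γ) (last γ))
        defXvP = find _
        defVlT : DefT full {2} (λ γ → VlT (init γ) (last γ))
        defVlT = findT _
        defSqT : DefT full {2} (λ γ → SqT (init γ) (last γ))
        defSqT = findT _
        defCutT : DefT full {3} (λ γ → CutT (init γ) (last γ))
        defCutT = findT _
      opaque
        ET : V → V → V → V
        ET W h T = sep EtP ⦃ defEtP ⦄ (∙ ▹ W ▹ h) (DT W T ⊗ DT W T)
        ∈ET : ∀ {W h T c d} → ⟪ c ، d ⟫ ∈ ET W h T ⇔ (c ∈ DT W T × d ∈ DT W T × Eε W h c d)
        ∈ET {W} {h} {T} {c} {d} = mk⇔
          (λ e → let (k , m) = to (∈sep EtP ⦃ defEtP ⦄ (∙ ▹ W ▹ h) (DT W T ⊗ DT W T)) e ; (a , b) = to pair∈⊗ k in a , b , subst₂ (Eε W h) fst-⟪⟫ snd-⟪⟫ m)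
          (λ (a , b , m) → from (∈sep EtP ⦃ defEtP ⦄ (∙ ▹ W ▹ h) (DT W T ⊗ DT W T)) (from pair∈⊗ (a , b) , subst₂ (Eε W h) (sym fst-⟪⟫) (sym snd-⟪⟫) m))
        instance
         iET : ∀ {n} {s t u : Env n → V} ⦃ _ : DefT full s ⦄ ⦃ _ : DefT full t ⦄ ⦃ _ : DefT full u ⦄ → DefT full (λ γ → ET (s γ) (t γ) (u γ))
         iET ⦃ a ⦄ ⦃ b ⦄ ⦃ c ⦄ = isep EtP ⦃ defEtP ⦄ ([] ▸ a ▸ b) (i⊗ ⦃ iDT ⦃ a ⦄ ⦃ c ⦄ ⦄ ⦃ iDT ⦃ a ⦄ ⦃ c ⦄ ⦄)
        -- For a sequence of objects ⟪ a n ، f n ⟫, the pairs of ⟪ n + 1 ، x ⟫ and ⟪ n ، y ⟫ with f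
        -- (n + 1) x ∈ f n y. The tags merge countably many relations into one subset of W, to which
        -- `sh-wf` applies.
        Xv : V → V → V
        Xv W s = sep XvP ⦃ defXvP ⦄ (∙ ▹ s) W
        ∈Xv : ∀ {W s z} → z ∈ Xv W s ⇔ (z ∈ W × XvP (∙ ▹ s) z)
        ∈Xv {W} {s} = ∈sep XvP ⦃ defXvP ⦄ (∙ ▹ s) W
        vals seq : V → V → V
        vals s S = img VlT ⦃ defVlT ⦄ (∙ ▹ s) S
        ∈vals : ∀ {s S y} → y ∈ vals s S ⇔ (∃[ p ] (p ∈ S × y ≡ VlT (∙ ▹ s) p))
        ∈vals = ∈img VlT ⦃ defVlT ⦄
        seq s o = img SqT ⦃ defSqT ⦄ (∙ ▹ s) o
        ∈seq : ∀ {s o y} → y ∈ seq s o ⇔ (∃[ n ] (n ∈ o × y ≡ ⟪ n ، fst (app s n) ⟫))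
        ∈seq = ∈img SqT ⦃ defSqT ⦄
        -- The value of k where it belongs to T, and `∅` elsewhere: intersecting its singleton with
        -- T and taking the union avoids a definition by cases.
        cut : V → V → V → V
        cut k T W = lam CutT ⦃ defCutT ⦄ (∙ ▹ k ▹ T) W
        cut-Fn : ∀ {k T W} → Fn (cut k T W) W
        cut-Fn = lam-Fn CutT ⦃ defCutT ⦄
        cut-in : ∀ {k T W y} → y ∈ W → app k y ∈ T → app (cut k T W) y ≡ app k y
        cut-in {k} {T} h t = trans (lam-app CutT ⦃ defCutT ⦄ h) (trans (cong ⋃ (ext (λ z m → proj₁ (to ∈∩ m))
          (λ z m → from ∈∩ (m , subst (_∈ T) (sym (to ∈sing m)) t)))) ⋃-sing)
        cut-T : ∀ {k T W y} → ∅ ∈ T → y ∈ W → app (cut k T W) y ∈ T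
        cut-T {k} {T} {W} {y} e h with lem (λ (∙ ▹ k ▹ y ▹ T) → app k y ∈ T) (∙ ▹ k ▹ y ▹ T)
        ... | inj₁ t = subst (_∈ T) (sym (cut-in h t)) t
        ... | inj₂ no = subst (_∈ T) (sym (trans (lam-app CutT ⦃ defCutT ⦄ h) (ext (λ z m → let (w , i , _) = to ∈⋃ m ; (a , b) = to ∈∩ i in
                           ⊥-elim (no (subst (_∈ T) (to ∈sing a) b))) (λ z m → ⊥-elim (∉∅ m))))) e

      opaque
        -- Along the relation the values of the functions descend in ∈, so a point with an ∈-minimal
        -- value is minimal.
        WFr-Xv : ∀ W s → WFr (𝒫 W) (Xv W s)
        WFr-Xv W s = record { wfr = λ S _ (x₀ , h , _) →
          let (v , v∈ , min) = foundation (vals s S) (_ , from ∈vals (x₀ , h , refl))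
              (m , m∈ , q) = to ∈vals v∈
          in m , m∈ , λ x x∈ k → min _ (subst (VlT (∙ ▹ s) x ∈_) (sym q)
               (subst₂ (λ a b → VlT (∙ ▹ s) a ∈ VlT (∙ ▹ s) b) fst-⟪⟫ snd-⟪⟫ (proj₂ (proj₂ (to ∈Xv k))))) (from ∈vals (x , x∈ , refl)) }

      private
       opaque
        defDisP : Def full {3} (λ γ → DisP (init γ) (last γ))
        defDisP = find _
      module Collapse {W h : V} (r : RU W) (S : SH W W h) where
        open Extender r S public

        EqS⊆ : ∀ {f g} → EqS W f g ⊆ W
        EqS⊆ z k = proj₁ (to ∈EqS k)
        MeS⊆ : ∀ {f g} → MeS W f g ⊆ W
        MeS⊆ z k = proj₁ (to ∈MeS k)
        ⟪⟫∈EqS : ∀ {f g x y} → x ∈ W → y ∈ W → ⟪ x ، y ⟫ ∈ EqS W f g ⇔ (app f x ≡ app g y)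
        ⟪⟫∈EqS {f} {g} u v = mk⇔ (λ e → subst₂ (λ a b → app f a ≡ app g b) fst-⟪⟫ snd-⟪⟫ (proj₂ (proj₂ (to ∈EqS e))))
          (λ e → from ∈EqS (ru-⟪⟫ r u v , Pr-⟪⟫ , subst₂ (λ a b → app f a ≡ app g b) (sym fst-⟪⟫) (sym snd-⟪⟫) e))
        ⟪⟫∈MeS : ∀ {f g x y} → x ∈ W → y ∈ W → ⟪ x ، y ⟫ ∈ MeS W f g ⇔ (app f x ∈ app g y)
        ⟪⟫∈MeS {f} {g} u v = mk⇔ (λ e → subst₂ (λ a b → app f a ∈ app g b) fst-⟪⟫ snd-⟪⟫ (proj₂ (proj₂ (to ∈MeS e))))
          (λ e → from ∈MeS (ru-⟪⟫ r u v , Pr-⟪⟫ , subst₂ (λ a b → app f a ∈ app g b) (sym fst-⟪⟫) (sym snd-⟪⟫) e))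

        opaque
          -- For a descending sequence of objects, the points ⟪ n ، a n ⟫ would descend in the image
          -- of `Xv W s` under h, which is well-founded since `Xv W s` is. The tags survive the
          -- passage because natural numbers are principal.
          E-WF : ∀ T → WF (DT W T) (ET W h T)
          E-WF T D D⊆ (c₀ , c₀∈) = by-contra MinP (∙ ▹ D ▹ ET W h T) λ no →
            let (s , _ , _ , tr) = DC.dc EdT (find _) (ET W h T) D c₀ c₀∈ λ x x∈ →
                  by-contra BlP (∙ ▹ D ▹ ET W h T ▹ x) λ nb → no (x , x∈ , λ y y∈ k → nb (y , y∈ , k))
            in absurd s tr
            where
            absurd : ∀ s → (∀ n → n ∈ ω → app s n ∈ D × ⟪ app s (sucV n) ، app s n ⟫ ∈ ET W h T) → ⊥₀
            absurd s tr = let (m , m∈ , min) = wfr (sh-wf S (Xv W s) Xv⊆ (WFr-Xv W s)) (seq s ω) (from ∈𝒫 seq⊆) (_ , from ∈seq (∅ , ∅∈ω , refl) , refl)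
                              (n , n∈ , q) = to ∈seq m∈
                          in min _ (from ∈seq (sucV n , suc∈ω n∈ , refl)) (subst (λ m → ⟪ ⟪ sucV n ، aa (sucV n) ⟫ ، m ⟫ ⊩ Xv W s) (sym q) (descent n n∈))
              where
              aa : V → V
              aa n = fst (app s n)
              aW : ∀ {n} → n ∈ ω → aa n ∈ W
              aW k = proj₁ (proj₂ (to ∈DT (D⊆ _ (proj₁ (tr _ k)))))
              nW : ∀ {n} → n ∈ ω → n ∈ W
              nW k = ru-Tr r k (ru-ω r)
              seq⊆ : seq s ω ⊆ W
              seq⊆ z k = let (n , n∈ , q) = to ∈seq k in subst (_∈ W) (sym q) (ru-⟪⟫ r (nW n∈) (aW n∈))
              Xv⊆ : Xv W s ⊆ W
              Xv⊆ z k = proj₁ (to ∈Xv k)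
              s⊆ : ∀ {c} → c ∈ W → sing c ⊆ W
              s⊆ w z k = subst (_∈ W) (sym (to ∈sing k)) w
              descent : ∀ n → n ∈ ω → ⟪ ⟪ sucV n ، aa (sucV n) ⟫ ، ⟪ n ، aa n ⟫ ⟫ ⊩ Xv W s
              -- `rext` inserts a tag before the second coordinate and `conv` swaps; two rounds
              -- attach the tags m and n to the two seeds.
              descent n n∈ = ⊩mono (λ z k → let (k₁ , k₂) = to ∈∩ k ; (k₂ , k₃) = to ∈∩ k₂ in g z k₁ k₂ k₃) Xv⊆
                (⊩∩ rext⊆ (λ z k → pf⊆ z (proj₁ (to ∈∩ k)))
                  (⊩rext u n′ b∈ conv⊆ (⊩conv b∈ u rext⊆ (⊩rext b∈ m′ a∈ conv⊆ (⊩conv a∈ b∈ MeS⊆ (proj₂ (proj₂ (to ∈ET (proj₂ (tr n n∈)))))))))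
                  (⊩∩ pf⊆ ps⊆ (⊩pf u v pf⊆ (⊩pf m′ a∈ (s⊆ m′) (prin m (suc∈ω n∈)))) (⊩ps u v pf⊆ (⊩pf n′ b∈ (s⊆ n′) (prin n n∈)))))
                where
                m Y : V
                m = sucV n
                Y = MeS W (snd (app s m)) (snd (app s n))
                m′ : m ∈ W
                m′ = nW (suc∈ω n∈)
                n′ : n ∈ W
                n′ = nW n∈
                a∈ : aa m ∈ W
                a∈ = aW (suc∈ω n∈)
                b∈ : aa n ∈ W
                b∈ = aW n∈
                u : ⟪ m ، aa m ⟫ ∈ W
                u = ru-⟪⟫ r m′ a∈
                v : ⟪ n ، aa n ⟫ ∈ W
                v = ru-⟪⟫ r n′ b∈
                cv : ∀ {X x y} → ⟪ x ، y ⟫ ∈ conv X → ⟪ y ، x ⟫ ∈ X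
                cv {X} k = subst (_∈ X) (cong₂ ⟪_،_⟫ snd-⟪⟫ fst-⟪⟫) (proj₂ (proj₂ (to ∈conv k)))
                rx : ∀ {X x y} → ⟪ x ، y ⟫ ∈ rext X → ⟪ x ، snd y ⟫ ∈ X
                rx {X} k = subst (_∈ X) (cong₂ ⟪_،_⟫ fst-⟪⟫ (cong snd snd-⟪⟫)) (proj₂ (proj₂ (to ∈rext k)))
                g : ∀ z → z ∈ rext (conv (rext (conv Y))) → z ∈ pf (pf (sing m)) → z ∈ ps (pf (sing n)) → z ∈ Xv W s
                g z k₁ k₂ k₃ = from ∈Xv (rext⊆ z k₁ , trans fm (cong sucV (sym fn)) ,
                  subst₂ (λ a b → app (snd (app s a)) (snd (fst z)) ∈ app (snd (app s b)) (snd (snd z))) (sym fm) (sym fn)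
                    (subst₂ (λ a b → app (snd (app s m)) a ∈ app (snd (app s n)) b) fst-⟪⟫ snd-⟪⟫ (proj₂ (proj₂ (to ∈MeS y∈)))))
                  where
                  fm : fst (fst z) ≡ m
                  fm = to ∈sing (proj₂ (proj₂ (to ∈pf (proj₂ (proj₂ (to ∈pf k₂))))))
                  fn : fst (snd z) ≡ n
                  fn = to ∈sing (proj₂ (proj₂ (to ∈pf (proj₂ (proj₂ (to ∈ps k₃))))))
                  y∈ : ⟪ snd (fst z) ، snd (snd z) ⟫ ∈ Y
                  y∈ = cv (rx (cv (rx (subst (_∈ rext (conv (rext (conv Y)))) (proj₁ (proj₂ (to ∈pf k₂))) k₁))))

        Obj : V → Set ℓ
        Obj c = Pr c × fst c ∈ W × Fn (snd c) W
        DT-Obj : ∀ {T c} → c ∈ DT W T → Obj c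
        DT-Obj k = let (p , a , F , _) = to ∈DT k in p , a , F
        opaque
          Eq-sym : ∀ {c d} → Obj c → Obj d → Eq W h c d → Eq W h d c
          Eq-sym (_ , u , _) (_ , v , _) e = ⊩flip u v EqS⊆ EqS⊆ (λ x y x∈ y∈ k → from (⟪⟫∈EqS y∈ x∈) (sym (to (⟪⟫∈EqS x∈ y∈) k))) e
          Eq-ε : ∀ {c d e} → Obj c → Obj d → Obj e → Eq W h c d → Eε W h d e → Eε W h c e
          Eq-ε (_ , u , _) (_ , v , _) (_ , w , _) e k = ⊩chain u v w EqS⊆ MeS⊆ MeS⊆
            (λ x y z x∈ y∈ z∈ a b → from (⟪⟫∈MeS x∈ z∈) (subst (_∈ _) (sym (to (⟪⟫∈EqS x∈ y∈) a)) (to (⟪⟫∈MeS y∈ z∈) b))) e k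
          ε-Eq : ∀ {c d e} → Obj c → Obj d → Obj e → Eε W h c d → Eq W h d e → Eε W h c e
          ε-Eq (_ , u , _) (_ , v , _) (_ , w , _) e k = ⊩chain u v w MeS⊆ EqS⊆ MeS⊆
            (λ x y z x∈ y∈ z∈ a b → from (⟪⟫∈MeS x∈ z∈) (subst (_ ∈_) (to (⟪⟫∈EqS y∈ z∈) b) (to (⟪⟫∈MeS x∈ y∈) a))) e k
          Eq-refl : ∀ {c} → Obj c → Eq W h c c
          Eq-refl (_ , u , _) = ⊩diag u EqS⊆ (λ _ k → k) (λ x x∈ _ → from (⟪⟫∈EqS x∈ x∈) refl) (⊩W u)

        Sol : V → V → Set ℓ
        Sol T g = ∀ c → c ∈ DT W T → app g c ≡ g ″ pre (DT W T) (ET W h T) c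
        ∈sol : ∀ {T g c} → Sol T g → c ∈ DT W T → ∀ {y} → y ∈ app g c ⇔ (∃[ d ] (d ∈ DT W T × Eε W h d c × y ≡ app g d))
        ∈sol {T} {g} {c} s k {y} = mk⇔
          (λ e → let (d , l , q) = to ∈″ (subst (y ∈_) (s c k) e) ; (a , b) = to ∈pre l in d , a , proj₂ (proj₂ (to ∈ET b)) , q)
          (λ (d , a , b , q) → subst (y ∈_) (sym (s c k)) (from ∈″ (d , from ∈pre (a , from ∈ET (a , k , b)) , q)))
        opaque
          sol-ex : ∀ T → ∃[ g ] Sol T g
          sol-ex T = let (g , _ , q) = WfRec.wf-rec IdG ∅ (DT W T) (ET W h T) (E-WF T) in g , q
          sol-Eq : ∀ {T g c d} → Sol T g → c ∈ DT W T → d ∈ DT W T → Eq W h c d → app g c ≡ app g d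
          sol-Eq {T} {g} {c} {d} s k l e = ext
            (λ y m → let (x , a , b , q) = to (∈sol s k) m in from (∈sol s l) (x , a , ε-Eq (DT-Obj a) (DT-Obj k) (DT-Obj l) b e , q))
            (λ y m → let (x , a , b , q) = to (∈sol s l) m in from (∈sol s k) (x , a , ε-Eq (DT-Obj a) (DT-Obj l) (DT-Obj k) b (Eq-sym (DT-Obj k) (DT-Obj l) e) , q))
          -- Enlarging T adds no new members. If the function of m has values in the transitive set
          -- T, then an object below m has values in T almost everywhere, and truncating it by `cut`
          -- does not change its class. The default of `cut` is why ∅ ∈ T is assumed.
          sol-agree : ∀ {T T′ g g′} → Tr T → ∅ ∈ T → T ⊆ T′ → Sol T g → Sol T′ g′ → ∀ c → c ∈ DT W T → app g c ≡ app g′ c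
          sol-agree {T} {T′} {g} {g′} t e s G G′ c k = by-contra (λ (∙ ▹ g ▹ c ▹ g′) → app g c ≡ app g′ c) (∙ ▹ g ▹ c ▹ g′) λ no →
            let (m , m∈ , min) = E-WF T (sep DisP ⦃ defDisP ⦄ (∙ ▹ g ▹ g′) (DT W T)) (λ z l → proj₁ (to ∈D l)) (c , from ∈D (k , no))
                (mT , nm) = to ∈D m∈
            in nm (step m mT λ d l b → by-contra (λ (∙ ▹ g ▹ c ▹ g′) → app g c ≡ app g′ c) (∙ ▹ g ▹ d ▹ g′) λ nd →
                 min d (from ∈D (l , nd)) (from ∈ET (l , mT , b)))
            where
            ∈D : ∀ {x} → x ∈ sep DisP ⦃ defDisP ⦄ (∙ ▹ g ▹ g′) (DT W T) ⇔ (x ∈ DT W T × ¬ app g x ≡ app g′ x)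
            ∈D = ∈sep DisP ⦃ defDisP ⦄ (∙ ▹ g ▹ g′) (DT W T)
            big : ∀ {d} → d ∈ DT W T → d ∈ DT W T′
            big l = let (p , a , F , i) = to ∈DT l in from ∈DT (p , a , F , λ x x∈ → s _ (i x x∈))
            step : ∀ m → m ∈ DT W T → (∀ d → d ∈ DT W T → Eε W h d m → app g d ≡ app g′ d) → app g m ≡ app g′ m
            step m mT ih = ext
              (λ y l → let (d , a , b , q) = to (∈sol G mT) l in from (∈sol G′ (big mT)) (d , big a , b , trans q (ih d a b)))
              (λ y l → let (d , a , b , q) = to (∈sol G′ (big mT)) l
                           (p , d∈ , F , _) = to ∈DT a
                           d′ = ⟪ fst d ، cut (snd d) T W ⟫
                           d′∈ : d′ ∈ DT W T
                           d′∈ = from ∈DT (Pr-⟪⟫ , subst (_∈ W) (sym fst-⟪⟫) d∈ , subst (λ f → Fn f W × (∀ x → x ∈ W → app f x ∈ T)) (sym snd-⟪⟫) (cut-Fn , λ x → cut-T e))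
                           eq′ : Eq W h d d′
                           eq′ = subst₂ (λ a f → ⟪ fst d ، a ⟫ ⊩ EqS W (snd d) f) (sym fst-⟪⟫) (sym snd-⟪⟫) (same d∈ (proj₁ (proj₂ (to ∈DT mT))) b (proj₂ (proj₂ (proj₂ (to ∈DT mT)))))
                           b′ = Eq-ε (DT-Obj d′∈) (DT-Obj a) (DT-Obj mT) (Eq-sym (DT-Obj a) (DT-Obj d′∈) eq′) b
                       in from (∈sol G mT) (d′ , d′∈ , b′ , trans q (trans (sol-Eq G′ a (big d′∈) eq′) (sym (ih d′ d′∈ b′)))))
              where
              same : ∀ {d} → fst d ∈ W → fst m ∈ W → Eε W h d m → (∀ x → x ∈ W → app (snd m) x ∈ T) →
                     ⟪ fst d ، fst d ⟫ ⊩ EqS W (snd d) (cut (snd d) T W)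
              same {d} u v b i = ⊩diag u EqS⊆ (λ z l → proj₁ (to ∈EqS₁ l)) (λ x x∈ l → from (⟪⟫∈EqS x∈ x∈) (proj₂ (to ∈EqS₁ l)))
                (⊩fst⁻ u v MeS⊆ (λ z l → proj₁ (to ∈EqS₁ l)) (λ x y x∈ y∈ l → from ∈EqS₁ (x∈ ,
                  sym (cut-in x∈ (trn t _ (i y y∈) _ (to (⟪⟫∈MeS x∈ y∈) l))))) b)
    open Wellfoundedness

    -- Transitive collapse and extensionality.

    module TransitiveCollapse where
      record PiV (W h c y : V) : Set ℓ where
        constructor piv
        field
          {pv-T pv-g} : V
          pv-Tr : Tr pv-T
          pv-∅ : ∅ ∈ pv-T
          pv-sol : ∀ c → c ∈ DT W pv-T → app pv-g c ≡ pv-g ″ pre (DT W pv-T) (ET W h pv-T) c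
          pv-∈ : c ∈ DT W pv-T
          pv-val : y ≡ app pv-g c
      open PiV
      private
        PvP : Env 3 → V → Set ℓ
        PvP (∙ ▹ W ▹ h ▹ c) y = PiV W h c y
        opaque
         instance
          iPiV : ∀ {n} {s t u v : Env n → V} ⦃ _ : DefT full s ⦄ ⦃ _ : DefT full t ⦄ ⦃ _ : DefT full u ⦄ ⦃ _ : DefT full v ⦄ →
                 Def full (λ γ → PiV (s γ) (t γ) (u γ) (v γ))
          iPiV ⦃ a ⦄ ⦃ b ⦄ ⦃ c ⦄ ⦃ d ⦄ = sub4 (λ (∙ ▹ W ▹ h ▹ c ▹ y) → PiV W h c y) (iso
            {P = λ (∙ ▹ W ▹ h ▹ c ▹ y) → ∃[ T ] ∃[ g ] (Tr T × ∅ ∈ T × (∀ c → c ∈ DT W T → app g c ≡ g ″ pre (DT W T) (ET W h T) c) × c ∈ DT W T × y ≡ app g c)}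
            (λ γ → mk⇔ (λ (_ , _ , a , b , c , d , e) → piv a b c d e) (λ (piv a b c d e) → _ , _ , a , b , c , d , e)) (find _)) a b c d
      private
       opaque
        defPvP : Def full {4} (λ γ → PvP (init γ) (last γ))
        defPvP = find _
      -- The transitive collapse of the ultrapower, by recursion on Eε restricted to functions into a
      -- transitive set T; the value does not depend on T.
      opaque
        π : V → V → V → V
        π W h c = ι PvP ⦃ defPvP ⦄ (∙ ▹ W ▹ h ▹ c)
        π-eq′ : ∀ {W h c y} → PiV W h c y → (∀ z → PiV W h c z → z ≡ y) → π W h c ≡ y
        π-eq′ = ι-eq PvP ⦃ defPvP ⦄
        instance
         iπ : ∀ {n} {s t u : Env n → V} ⦃ _ : DefT full s ⦄ ⦃ _ : DefT full t ⦄ ⦃ _ : DefT full u ⦄ → DefT full (λ γ → π (s γ) (t γ) (u γ))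
         iπ ⦃ a ⦄ ⦃ b ⦄ ⦃ c ⦄ = subT3 π (iι PvP ⦃ defPvP ⦄) a b c
      private
        DfP : Env 2 → V → Set ℓ
        DfP (∙ ▹ f ▹ g) z = ∃[ u ] (u ∈ app f (fst z) × ¬ u ∈ app g (snd z))
        DfT : V → V → V → Set ℓ
        DfT p x y = y ∈ app (fst p) (fst x) × ¬ y ∈ app (snd p) (snd x)
        ApT FsT FfT : Env 1 → V → V
        ApT (∙ ▹ f) x = app f x
        FsT (∙ ▹ f) x = app f (snd x)
        FfT (∙ ▹ f) x = app f (fst x)
        IdnT : Env 0 → V → V
        IdnT _ x = x
        ExtP : Env 2 → V → Set ℓ
        ExtP (∙ ▹ W ▹ h) v = ∀ c → ∀ d → c ≡ ⟪ fst c ، snd c ⟫ → fst c ∈ W → Fn (snd c) W → d ≡ ⟪ fst d ، snd d ⟫ → fst d ∈ W → Fn (snd d) W →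
          π W h c ≡ v → π W h d ≡ v → ⟪ fst c ، fst d ⟫ ∈ app h (EqS W (snd c) (snd d))
      private
       opaque
        defDfP : Def full {3} (λ γ → DfP (init γ) (last γ))
        defDfP = find _
        defApT : DefT full {2} (λ γ → ApT (init γ) (last γ))
        defApT = findT _
        defFsT : DefT full {2} (λ γ → FsT (init γ) (last γ))
        defFsT = findT _
        defFfT : DefT full {2} (λ γ → FfT (init γ) (last γ))
        defFfT = findT _
        defIdnT : DefT full {1} (λ γ → IdnT (init γ) (last γ))
        defIdnT = findT _
      private
       opaque
        defExtP : Def full {3} (λ γ → ExtP (init γ) (last γ))
        defExtP = find _
      opaque
        Dif : V → V → V → V
        Dif W f g = sep DfP ⦃ defDfP ⦄ (∙ ▹ f ▹ g) W
        ∈Dif : ∀ {W f g z} → z ∈ Dif W f g ⇔ (z ∈ W × ∃[ u ] (u ∈ app f (fst z) × ¬ u ∈ app g (snd z)))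
        ∈Dif {W} {f} {g} = ∈sep DfP ⦃ defDfP ⦄ (∙ ▹ f ▹ g) W
        fn ∘s ∘f : V → V → V
        fn W f = lam ApT ⦃ defApT ⦄ (∙ ▹ f) W
        ∘s W f = lam FsT ⦃ defFsT ⦄ (∙ ▹ f) W
        ∘f W f = lam FfT ⦃ defFfT ⦄ (∙ ▹ f) W
        fn-Fn : ∀ {W f} → Fn (fn W f) W
        fn-Fn = lam-Fn ApT ⦃ defApT ⦄
        fn-app : ∀ {W f x} → x ∈ W → app (fn W f) x ≡ app f x
        fn-app = lam-app ApT ⦃ defApT ⦄
        ∘s-Fn : ∀ {W f} → Fn (∘s W f) W
        ∘s-Fn = lam-Fn FsT ⦃ defFsT ⦄
        ∘s-app : ∀ {W f x} → x ∈ W → app (∘s W f) x ≡ app f (snd x)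
        ∘s-app = lam-app FsT ⦃ defFsT ⦄
        ∘f-Fn : ∀ {W f} → Fn (∘f W f) W
        ∘f-Fn = lam-Fn FfT ⦃ defFfT ⦄
        ∘f-app : ∀ {W f x} → x ∈ W → app (∘f W f) x ≡ app f (fst x)
        ∘f-app = lam-app FfT ⦃ defFfT ⦄
        idn : V → V
        idn W = lam IdnT ⦃ defIdnT ⦄ ∙ W
        idn-Fn : ∀ {W} → Fn (idn W) W
        idn-Fn = lam-Fn IdnT ⦃ defIdnT ⦄
        idn-app : ∀ {W x} → x ∈ W → app (idn W) x ≡ x
        idn-app = lam-app IdnT ⦃ defIdnT ⦄
        idn-mem : ∀ {W p} → p ∈ idn W ⇔ (∃[ x ] (x ∈ W × p ≡ ⟪ x ، x ⟫))
        idn-mem = ∈lam IdnT ⦃ defIdnT ⦄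

      module Ultrapower {W h : V} (r : RU W) (S : SH W W h) where
        open Collapse r S public
        obj : ∀ {a f} → a ∈ W → Fn f W → Obj ⟪ a ، f ⟫
        obj u F = Pr-⟪⟫ , subst (_∈ W) (sym fst-⟪⟫) u , subst (λ f → Fn f W) (sym snd-⟪⟫) F

        private
          dn : ∀ {T x y} → Tr T → ⟪ x ، y ⟫ ∈ T → x ∈ T × y ∈ T
          dn t k = let (z , m , l , n) = ∈⟪⟫-comps in trn t _ (trn t _ k _ m) _ l , trn t _ (trn t _ k _ m) _ n
          T+ : V → V
          T+ p = R (sucV (rk p))
          p∈T+ : ∀ {p} → p ∈ T+ p
          p∈T+ = from ∈R (_ , ∈suc-refl , rk-⊆)
          ∅∈T+ : ∀ {p} → ∅ ∈ T+ p
          ∅∈T+ = from ∈R (_ , ∈suc-refl , λ z k → ⊥-elim (∉∅ k))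
          obj-DT : ∀ {T c} → Tr T → c ∈ T → Obj c → c ∈ DT W T
          obj-DT {T} {c} t e (p , u , F) = from ∈DT (p , u , F , λ x x∈ →
            proj₂ (dn t (trn t _ (proj₂ (dn t (subst (_∈ T) p e))) _ (app-∈ F x∈))))
        opaque
          π-sol : ∀ {T g c} → Tr T → ∅ ∈ T → Sol T g → c ∈ DT W T → π W h c ≡ app g c
          π-sol {T} {g} {c} t e s k = π-eq′ (piv t e s k refl) λ { z (piv {T′} {g′} t′ e′ s′ k′ q) →
            let (G , G-sol) = sol-ex (⋃ (T ,, T′))
            in trans q (trans (sol-agree t′ e′ ⊆∪r s′ G-sol c k′) (sym (sol-agree t e ⊆∪l s G-sol c k))) }
          π-mem : ∀ {c y} → Obj c → y ∈ π W h c ⇔ (∃[ d ] (Obj d × Eε W h d c × y ≡ π W h d))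
          π-mem {c} {y} o = mk⇔
            (λ k → let T = T+ c ; (g , s) = sol-ex T ; c∈ = obj-DT (R-Tr _) p∈T+ o
                       (d , d∈ , e , q) = to (∈sol s c∈) (subst (y ∈_) (π-sol (R-Tr _) ∅∈T+ s c∈) k)
                   in d , DT-Obj d∈ , e , trans q (sym (π-sol (R-Tr _) ∅∈T+ s d∈)))
            (λ (d , o′ , e , q) → let T = T+ ⟪ c ، d ⟫ ; (g , s) = sol-ex T ; (c∈T , d∈T) = dn (R-Tr _) p∈T+
                                      c∈ = obj-DT (R-Tr _) c∈T o ; d∈ = obj-DT (R-Tr _) d∈T o′
                   in subst (y ∈_) (sym (π-sol (R-Tr _) ∅∈T+ s c∈)) (from (∈sol s c∈) (d , d∈ , e , trans q (π-sol (R-Tr _) ∅∈T+ s d∈))))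
          Eq⇒π : ∀ {c d} → Obj c → Obj d → Eq W h c d → π W h c ≡ π W h d
          Eq⇒π o o′ e = ext
            (λ y k → let (x , ox , m , q) = to (π-mem o) k in from (π-mem o′) (x , ox , ε-Eq ox o o′ m e , q))
            (λ y k → let (x , ox , m , q) = to (π-mem o′) k in from (π-mem o) (x , ox , ε-Eq ox o′ o m (Eq-sym o o′ e) , q))

        private
          Dif⊆ : ∀ {f g} → Dif W f g ⊆ W
          Dif⊆ z k = proj₁ (to ∈Dif k)
          Pjf⊆ : Pjf ⊆ W
          Pjf⊆ z k = proj₁ (to ∈Pjf k)
          Pjs⊆ : Pjs ⊆ W
          Pjs⊆ z k = proj₁ (to ∈Pjs k)
          Ext : V → Set ℓ
          Ext v = ∀ c d → Obj c → Obj d → π W h c ≡ v → π W h d ≡ v → Eq W h c d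
          -- Suppose f x ⊄ g y for almost all pairs, and let k choose an element of the difference.
          -- The object with the seed ⟪ a ، b ⟫ and the function k is below ⟪ a ، f ⟫, so its
          -- collapse is also the collapse of some d below ⟪ b ، g ⟫. By the induction hypothesis d
          -- is equal to it in the ultrapower, so k x y ∈ g y almost everywhere, which is absurd.
          half : ∀ {a b f g} → a ∈ W → b ∈ W → Fn f W → Fn g W → (∀ y → y ∈ π W h ⟪ a ، f ⟫ → Ext y) →
                 π W h ⟪ a ، f ⟫ ≡ π W h ⟪ b ، g ⟫ → ¬ ⟪ a ، b ⟫ ⊩ Dif W f g
          half {a} {b} {f} {g} u v F G ih e k =
            let (k₀ , _ , ch) = Choice.uniformize DfT (find _) ⟪ f ، g ⟫ (Dif W f g) λ x x∈ →
                  let (_ , y , p , q) = to ∈Dif x∈ in y , subst (λ f → y ∈ app f (fst x)) (sym fst-⟪⟫) p , λ m → q (subst (λ g → y ∈ app g (snd x)) snd-⟪⟫ m)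
            in go k₀ λ x x∈ → let (p , q) = ch x x∈ in subst (λ f → app k₀ x ∈ app f (fst x)) fst-⟪⟫ p , λ m → q (subst (λ g → app k₀ x ∈ app g (snd x)) (sym snd-⟪⟫) m)
            where
            w : ⟪ a ، b ⟫ ∈ W
            w = ru-⟪⟫ r u v
            go : ∀ k₀ → (∀ x → x ∈ Dif W f g → app k₀ x ∈ app f (fst x) × ¬ app k₀ x ∈ app g (snd x)) → ⊥₀
            go k₀ ch = let (d , od , m , q) = to (π-mem (obj v G)) (subst (π W h E ∈_) e πE) in
                no-d (Eq-ε oE od (obj v G) (ih (π W h E) πE E d oE od refl (sym q)) m)
              where
              E k′ : V
              k′ = fn W k₀
              E = ⟪ ⟪ a ، b ⟫ ، k′ ⟫
              oE : Obj E
              oE = obj w fn-Fn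
              Eεc : Eε W h E ⟪ a ، f ⟫
              Eεc = subst₂ (λ x y → ⟪ x ، y ⟫ ⊩ MeS W (snd E) (snd ⟪ a ، f ⟫)) (sym fst-⟪⟫) (sym fst-⟪⟫)
                (subst₂ (λ x y → ⟪ ⟪ a ، b ⟫ ، a ⟫ ⊩ MeS W x y) (sym snd-⟪⟫) (sym snd-⟪⟫)
                  (⊩pair w u (λ z k → Pjf⊆ z (proj₁ (to ∈∩ k))) MeS⊆
                    (λ x y x∈ y∈ l → let (m , n) = to ∈∩ l ; (_ , _ , _ , q) = to ∈Pjf m
                                         x∈D = subst (_∈ Dif W f g) fst-⟪⟫ (proj₂ (proj₂ (to ∈pf n)))
                       in from (⟪⟫∈MeS x∈ y∈) (subst₂ (λ p s → p ∈ app f s) (sym (fn-app x∈)) (trans (cong fst (sym fst-⟪⟫)) (trans q snd-⟪⟫)) (proj₁ (ch x x∈D))))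
                    (⊩∩ Pjf⊆ pf⊆ (⊩Pjf u v) (⊩pf w u Dif⊆ k))))
              πE : π W h E ∈ π W h ⟪ a ، f ⟫
              πE = from (π-mem (obj u F)) (E , oE , Eεc , refl)
              no-d : ¬ Eε W h E ⟪ b ، g ⟫
              no-d m = ⊮∅ (⊩pair w v (λ z l → MeS⊆ z (proj₁ (to ∈∩ l))) (λ z l → ⊥-elim (∉∅ l))
                (λ x y x∈ y∈ l → let (m₁ , l₂) = to ∈∩ l ; (m₂ , m₃) = to ∈∩ l₂ ; (_ , _ , _ , q) = to ∈Pjs m₂
                                     x∈D = subst (_∈ Dif W f g) fst-⟪⟫ (proj₂ (proj₂ (to ∈pf m₃)))
                   in ⊥-elim (proj₂ (ch x x∈D) (subst₂ (λ p s → p ∈ app g s) (fn-app x∈) (sym (trans (cong snd (sym fst-⟪⟫)) (trans q snd-⟪⟫))) (to (⟪⟫∈MeS x∈ y∈) m₁))))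
                (⊩∩ MeS⊆ (λ z l → Pjs⊆ z (proj₁ (to ∈∩ l)))
                  (subst₂ (λ x y → ⟪ ⟪ a ، b ⟫ ، b ⟫ ⊩ MeS W x y) snd-⟪⟫ snd-⟪⟫ (subst₂ (λ x y → ⟪ x ، y ⟫ ⊩ MeS W (snd E) (snd ⟪ b ، g ⟫)) fst-⟪⟫ fst-⟪⟫ m))
                  (⊩∩ Pjs⊆ pf⊆ (⊩Pjs u v) (⊩pf w v Dif⊆ k))))
          -- If the two functions are not equal almost everywhere, one of the two inclusions fails
          -- almost everywhere, by the ultrafilter property for unions; `half` excludes both.
          ext-step : ∀ v → (∀ y → y ∈ v → Ext y) → Ext v
          ext-step v ih c d (p , u , F) (p′ , u′ , G) q q′ = by-contra (λ (∙ ▹ W ▹ h ▹ c ▹ d) → Eq W h c d) (∙ ▹ W ▹ h ▹ c ▹ d) λ no →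
            split (to (⊩∪ (ru-⟪⟫ r u u′) Dif⊆ (λ z k → proj₁ (to ∈conv k)))
              (⊩mono cover (∪⊆ Dif⊆ (λ z k → proj₁ (to ∈conv k))) (⊩∩ pf⊆ C⊆ (⊩pf u u′ (λ _ k → k) (⊩W u)) (from (⊩C (ru-⟪⟫ r u u′) EqS⊆) no))))
            where
            f g : V
            f = snd c
            g = snd d
            cover : pf W ∩ C (EqS W f g) ⊆ Dif W f g ∪ conv (Dif W g f)
            cover z k = let (m , n) = to ∈∩ k ; (z∈ , pz , _) = to ∈pf m in
              from ∈∪ (by-contra (λ (∙ ▹ z ▹ A ▹ B) → z ∈ A ⊎ z ∈ B) (∙ ▹ z ▹ Dif W f g ▹ conv (Dif W g f)) λ nz →
                to (∈C z∈) n (from ∈EqS (z∈ , pz , ext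
                  (λ y l → by-contra (λ (∙ ▹ y ▹ A) → y ∈ A) (∙ ▹ y ▹ app g (snd z)) λ ny → nz (inj₁ (from ∈Dif (z∈ , y , l , ny))))
                  (λ y l → by-contra (λ (∙ ▹ y ▹ A) → y ∈ A) (∙ ▹ y ▹ app f (fst z)) λ ny → nz (inj₂ (from ∈conv (z∈ , pz ,
                    from ∈Dif (ru-⟪⟫ r (ru-snd r z∈ pz) (ru-fst r z∈ pz) , y , subst (λ t → y ∈ app g t) (sym fst-⟪⟫) l , λ t → ny (subst (λ s → y ∈ app f s) snd-⟪⟫ t)))))))))
            eπ : π W h ⟪ fst c ، f ⟫ ≡ v
            eπ = trans (cong (π W h) (sym p)) q
            eπ′ : π W h ⟪ fst d ، g ⟫ ≡ v
            eπ′ = trans (cong (π W h) (sym p′)) q′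
            split : ⟪ fst c ، fst d ⟫ ⊩ Dif W f g ⊎ ⟪ fst c ، fst d ⟫ ⊩ conv (Dif W g f) → ⊥₀
            split (inj₁ k) = half u u′ F G (λ y l → ih y (subst (y ∈_) eπ l)) (trans eπ (sym eπ′)) k
            split (inj₂ k) = half u′ u G F (λ y l → ih y (subst (y ∈_) eπ′ l)) (trans eπ′ (sym eπ))
              (⊩flip u u′ conv⊆ Dif⊆ (λ x y x∈ y∈ l → subst (_∈ Dif W g f) (cong₂ ⟪_،_⟫ snd-⟪⟫ fst-⟪⟫) (proj₂ (proj₂ (to ∈conv l)))) k)
        opaque
          π⇒Eq : ∀ {c d} → Obj c → Obj d → π W h c ≡ π W h d → Eq W h c d
          π⇒Eq {c} {d} (p , u , F) (p′ , u′ , G) e = ∈-ind ExtP ⦃ defExtP ⦄ (∙ ▹ W ▹ h)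
            (λ v ih c d p u F p′ u′ G q q′ → ext-step v (λ y k c d (p , u , F) (p′ , u′ , G) → ih y k c d p u F p′ u′ G) c d (p , u , F) (p′ , u′ , G) q q′)
            (π W h d) c d p u F p′ u′ G e refl
          π-∈ : ∀ {c d} → Obj c → Obj d → π W h c ∈ π W h d ⇔ Eε W h c d
          π-∈ {c} {d} o o′ = mk⇔
            (λ k → let (x , ox , m , q) = to (π-mem o′) k in Eq-ε o ox o′ (π⇒Eq o ox q) m)
            (λ m → from (π-mem o′) (c , o , m , refl))
          π-≡ : ∀ {c d} → Obj c → Obj d → π W h c ≡ π W h d ⇔ Eq W h c d
          π-≡ o o′ = mk⇔ (π⇒Eq o o′) (Eq⇒π o o′)
    open TransitiveCollapse

   open Levels public hiding (iRho; ineg; iWFr; iSkip)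
   open UniverseGraphs public hiding (iLim; i∩)
   open Modalities public
   open ExtenderMaps public hiding (iEqS; iMeS)
   open Wellfoundedness public hiding (iDT; iET)
   open TransitiveCollapse public
  open Extenders public

  module UltrapowerEmbeddings where
   private

    -- Łoś's theorem.

    module FundamentalTheorem where
      idTs : ∀ {m n} → Ts m n n (λ γ → γ)
      idTs {n = zero} = []
      idTs {n = suc n} = wkTs idTs ▸ v0

      ev : ∀ {n} → Env n → V → Env n
      ev {zero} _ x = ∙
      ev {suc n} (γ ▹ f) x = ev γ x ▹ app f x
      evTs : ∀ {m n k} {f : Env n → Env k} {t : Env n → V} → Ts m n k f → DefT m t → Ts m n k (λ γ → ev (f γ) (t γ))
      evTs [] b = []
      evTs (ts ▸ a) b = evTs ts b ▸ iapp ⦃ a ⦄ ⦃ b ⦄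
      evD : ∀ {n} (φ : Formula n) → Def full {suc n} (λ γ → 𝕍 ⊨ φ [ vec (ev (init γ) (last γ)) ])
      evD φ = subs (λ γ → 𝕍 ⊨ φ [ vec γ ]) (formD φ) (evTs (wkTs idTs) v0)
      private
        -- The selection principle takes a single parameter, so an environment is packed into one
        -- set.
        code : ∀ {n} → Env n → V
        code {zero} _ = ∅
        code {suc n} (γ ▹ x) = ⟪ code γ ، x ⟫
        uncode : ∀ {n} → V → Env n
        uncode {zero} _ = ∙
        uncode {suc n} p = uncode (fst p) ▹ snd p
        uncode-code : ∀ {n} (γ : Env n) → uncode (code γ) ≡ γ
        uncode-code {zero} γ = refl
        uncode-code {suc n} (γ ▹ x) = cong₂ _▹_ (trans (cong uncode fst-⟪⟫) (uncode-code γ)) snd-⟪⟫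
        uncodeTs : ∀ {m n k} {t : Env n → V} → DefT m t → Ts m n k (λ γ → uncode {k} (t γ))
        uncodeTs {k = zero} a = []
        uncodeTs {k = suc k} {t} a = uncodeTs {k = k} {t = λ γ → fst (t γ)} (ifst ⦃ a ⦄) ▸ isnd ⦃ a ⦄
        LsP : ∀ {n} → Formula n → Env n → V → Set ℓ
        LsP φ γ x = 𝕍 ⊨ φ [ vec (ev γ x) ]
        ChT : ∀ {n} → Formula (suc n) → V → V → V → Set ℓ
        ChT φ p x y = 𝕍 ⊨ φ [ vec (ev (uncode p) x ▹ y) ]
      opaque
        LS : ∀ {n} → V → Formula n → Env n → V
        LS W φ γ = sep (LsP φ) ⦃ evD φ ⦄ γ W
        ∈LS : ∀ {W n} {φ : Formula n} {γ x} → x ∈ LS W φ γ ⇔ (x ∈ W × (𝕍 ⊨ φ [ vec (ev γ x) ]))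
        ∈LS {W} {φ = φ} {γ} = ∈sep (LsP φ) ⦃ evD φ ⦄ γ W
        skolem : ∀ {n} W (φ : Formula (suc n)) (γ : Env n) →
                 ∃[ f ] (Fn f W × (∀ x → x ∈ W → 𝕍 ⊨ ∃ˢ φ [ vec (ev γ x) ] → 𝕍 ⊨ φ [ vec (ev (γ ▹ f) x) ]))
        skolem {n} W φ γ = let (k , _ , ch) = Choice.uniformize (ChT φ) d (code γ) (LS W (∃ˢ φ) γ) (λ x x∈ →
                                 let (y , _ , p) = proj₂ (to (∈LS {W} {φ = ∃ˢ φ}) x∈) in y , subst (λ γ → 𝕍 ⊨ φ [ y ∷ vec (ev γ x) ]) (sym (uncode-code γ)) p)
                           in fn W k , fn-Fn , λ x x∈ p → subst₂ (λ y γ → 𝕍 ⊨ φ [ y ∷ vec (ev γ x) ]) (sym (fn-app x∈)) (uncode-code γ) (ch x (from (∈LS {φ = ∃ˢ φ}) (x∈ , p)))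
          where
          d : Def full {3} (λ γ → ChT φ (last (init (init γ))) (last (init γ)) (last γ))
          d = subs (λ γ → 𝕍 ⊨ φ [ vec γ ]) (formD φ) (evTs (uncodeTs v2) v1 ▸ v0)

      module Łoś {W h : V} (r : RU W) (S : SH W W h) where
        open Ultrapower r S public
        𝕄₀ : Pred V ℓ
        𝕄₀ y = ∃[ c ] (Obj c × y ≡ π W h c)
        AllFn : ∀ {n} → Env n → Set ℓ
        AllFn = In (λ f → Fn f W)
        piE : ∀ {n} → V → Env n → Env n
        piE {zero} a _ = ∙
        piE {suc n} a (γ ▹ f) = piE a γ ▹ π W h ⟪ a ، f ⟫
        private
          sh : ∀ {n} → Env n → Env n
          sh {zero} _ = ∙
          sh {suc n} (γ ▹ f) = sh γ ▹ ∘s W f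
          sh-Fn : ∀ {n} (γ : Env n) → AllFn (sh γ)
          sh-Fn {zero} γ = tt
          sh-Fn {suc n} γ = sh-Fn (init γ) , ∘s-Fn
          ev-sh : ∀ {n} (γ : Env n) {z} → z ∈ W → ev (sh γ) z ≡ ev γ (snd z)
          ev-sh {zero} γ z∈ = refl
          ev-sh {suc n} γ z∈ = cong₂ _▹_ (ev-sh (init γ) z∈) (∘s-app z∈)
          Pj⊆ : Pjs ⊆ W
          Pj⊆ z k = proj₁ (to ∈Pjs k)
        private
          cast : ∀ (F : V → V → V) {a a′ b b′ f f′ g g′} → a ≡ a′ → b ≡ b′ → f ≡ f′ → g ≡ g′ → ⟪ a ، b ⟫ ⊩ F f g → ⟪ a′ ، b′ ⟫ ⊩ F f′ g′
          cast F refl refl refl refl k = k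
        obj-Eq : ∀ {a b f g} → Eq W h ⟪ a ، f ⟫ ⟪ b ، g ⟫ ⇔ ⟪ a ، b ⟫ ⊩ EqS W f g
        obj-Eq = mk⇔ (cast (EqS W) fst-⟪⟫ fst-⟪⟫ snd-⟪⟫ snd-⟪⟫) (cast (EqS W) (sym fst-⟪⟫) (sym fst-⟪⟫) (sym snd-⟪⟫) (sym snd-⟪⟫))
        obj-Eε : ∀ {a b f g} → Eε W h ⟪ a ، f ⟫ ⟪ b ، g ⟫ ⇔ ⟪ a ، b ⟫ ⊩ MeS W f g
        obj-Eε = mk⇔ (cast (MeS W) fst-⟪⟫ fst-⟪⟫ snd-⟪⟫ snd-⟪⟫) (cast (MeS W) (sym fst-⟪⟫) (sym fst-⟪⟫) (sym snd-⟪⟫) (sym snd-⟪⟫))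
        LS⊆ : ∀ {n} {φ : Formula n} {γ} → LS W φ γ ⊆ W
        LS⊆ {φ = φ} z k = proj₁ (to (∈LS {φ = φ}) k)
        private
          shift-s : ∀ {a b f} → a ∈ W → b ∈ W → Fn f W → π W h ⟪ ⟪ b ، a ⟫ ، ∘s W f ⟫ ≡ π W h ⟪ a ، f ⟫
          shift-s {a} {b} {f} u v F = Eq⇒π (obj (ru-⟪⟫ r v u) ∘s-Fn) (obj u F) (from obj-Eq
            (⊩pair (ru-⟪⟫ r v u) u Pj⊆ EqS⊆ (λ x y x∈ y∈ k → let (_ , _ , _ , q) = to ∈Pjs k in
              from (⟪⟫∈EqS x∈ y∈) (trans (∘s-app x∈) (cong (app f) (trans (cong snd (sym fst-⟪⟫)) (trans q snd-⟪⟫))))) (⊩Pjs v u)))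
          shift-f : ∀ {a b g} → a ∈ W → b ∈ W → Fn g W → π W h ⟪ ⟪ b ، a ⟫ ، ∘f W g ⟫ ≡ π W h ⟪ b ، g ⟫
          shift-f {a} {b} {g} u v F = Eq⇒π (obj (ru-⟪⟫ r v u) ∘f-Fn) (obj v F) (from obj-Eq
            (⊩pair (ru-⟪⟫ r v u) v (λ z k → proj₁ (to ∈Pjf k)) EqS⊆ (λ x y x∈ y∈ k → let (_ , _ , _ , q) = to ∈Pjf k in
              from (⟪⟫∈EqS x∈ y∈) (trans (∘f-app x∈) (cong (app g) (trans (cong fst (sym fst-⟪⟫)) (trans q snd-⟪⟫))))) (⊩Pjf v u)))
          shift : ∀ {n a b} (γ : Env n) → AllFn γ → a ∈ W → b ∈ W → piE ⟪ b ، a ⟫ (sh γ) ≡ piE a γ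
          shift {zero} γ _ u v = refl
          shift {suc n} γ (F , f) u v = cong₂ _▹_ (shift (init γ) F u v) (shift-s u v f)
          look-pi : ∀ {n a} (γ : Env n) i → lookup (vec (piE a γ)) i ≡ π W h ⟪ a ، lookup (vec γ) i ⟫
          look-pi {suc n} γ zero = refl
          look-pi {suc n} γ (suc i) = look-pi (init γ) i
          look-ev : ∀ {n x} (γ : Env n) i → lookup (vec (ev γ x)) i ≡ app (lookup (vec γ) i) x
          look-ev {suc n} γ zero = refl
          look-ev {suc n} γ (suc i) = look-ev (init γ) i
          look-Fn : ∀ {n} (γ : Env n) → AllFn γ → ∀ i → Fn (lookup (vec γ) i) W
          look-Fn {suc n} γ (F , f) zero = f
          look-Fn {suc n} γ (F , f) (suc i) = look-Fn (init γ) F i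
        mutual
          -- All parameters share the seed a. An object brought in by a quantifier has a seed b of
          -- its own, so both sides are moved to the pair of b and a, the old functions being
          -- composed with the second projection and the new one with the first (`at-pair`).
          łoś : ∀ {n} (φ : Formula n) {a} → a ∈ W → ∀ γ → AllFn γ → (𝕄₀ ⊨ φ [ vec (piE a γ) ]) ⇔ a ⊩ LS W φ γ
          łoś (i ˢ∈ k) {a} u γ F = subst₂ (λ x y → (x ∈ y) ⇔ a ⊩ LS W (i ˢ∈ k) γ) (sym (look-pi γ i)) (sym (look-pi γ k))
            (π-∈ (obj u (look-Fn γ F i)) (obj u (look-Fn γ F k)) ∙⇔ obj-Eε ∙⇔ mk⇔
              (⊩diag⁻ u MeS⊆ LS⊆ λ x x∈ m → from ∈LS (x∈ , subst₂ _∈_ (sym (look-ev γ i)) (sym (look-ev γ k)) (to (⟪⟫∈MeS x∈ x∈) m)))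
              (⊩diag u MeS⊆ LS⊆ λ x x∈ m → from (⟪⟫∈MeS x∈ x∈) (subst₂ _∈_ (look-ev γ i) (look-ev γ k) (proj₂ (to ∈LS m)))))
          łoś (i ˢ≡ k) {a} u γ F = subst₂ (λ x y → (x ≡ y) ⇔ a ⊩ LS W (i ˢ≡ k) γ) (sym (look-pi γ i)) (sym (look-pi γ k))
            (π-≡ (obj u (look-Fn γ F i)) (obj u (look-Fn γ F k)) ∙⇔ obj-Eq ∙⇔ mk⇔
              (⊩diag⁻ u EqS⊆ LS⊆ λ x x∈ m → from ∈LS (x∈ , subst₂ _≡_ (sym (look-ev γ i)) (sym (look-ev γ k)) (to (⟪⟫∈EqS x∈ x∈) m)))
              (⊩diag u EqS⊆ LS⊆ λ x x∈ m → from (⟪⟫∈EqS x∈ x∈) (subst₂ _≡_ (look-ev γ i) (look-ev γ k) (proj₂ (to ∈LS m)))))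
          łoś ⊥ˢ u γ F = mk⇔ (λ ()) (λ k → ⊥-elim (⊮∅ (⊩mono (λ z m → no (proj₂ (to (∈LS {φ = ⊥ˢ}) m))) (λ z m → ⊥-elim (∉∅ m)) k)))
            where
            no : ∀ {A : Set ℓ} → ⊥ {ℓ} → A
            no ()
          łoś (φ ∧ˢ ψ) u γ F = ×⇔ (łoś φ u γ F) (łoś ψ u γ F) ∙⇔ mk⇔
            (λ (k , l) → ⊩mono (λ z m → let (p , q) = to ∈∩ m ; (z∈ , p) = to (∈LS {φ = φ}) p in from (∈LS {φ = φ ∧ˢ ψ}) (z∈ , p , proj₂ (to (∈LS {φ = ψ}) q))) LS⊆ (⊩∩ LS⊆ LS⊆ k l))
            (λ k → ⊩mono (λ z m → let (z∈ , p , q) = to (∈LS {φ = φ ∧ˢ ψ}) m in from (∈LS {φ = φ}) (z∈ , p)) LS⊆ k ,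
                   ⊩mono (λ z m → let (z∈ , p , q) = to (∈LS {φ = φ ∧ˢ ψ}) m in from (∈LS {φ = ψ}) (z∈ , q)) LS⊆ k)
          łoś (φ ∨ˢ ψ) u γ F = ⊎⇔ (łoś φ u γ F) (łoś ψ u γ F) ∙⇔ sym⇔ (⊩∪ u LS⊆ LS⊆) ∙⇔ mk⇔
            (⊩mono (λ z m → f (to ∈∪ m)) LS⊆)
            (⊩mono (λ z m → let (z∈ , p) = to (∈LS {φ = φ ∨ˢ ψ}) m in from ∈∪ (g z∈ p)) (∪⊆ LS⊆ LS⊆))
            where
            f : ∀ {z} → z ∈ LS W φ γ ⊎ z ∈ LS W ψ γ → z ∈ LS W (φ ∨ˢ ψ) γ
            f (inj₁ m) = let (z∈ , p) = to (∈LS {φ = φ}) m in from (∈LS {φ = φ ∨ˢ ψ}) (z∈ , inj₁ p)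
            f (inj₂ m) = let (z∈ , p) = to (∈LS {φ = ψ}) m in from (∈LS {φ = φ ∨ˢ ψ}) (z∈ , inj₂ p)
            g : ∀ {z} → z ∈ W → (𝕍 ⊨ φ [ vec (ev γ z) ]) ⊎ (𝕍 ⊨ ψ [ vec (ev γ z) ]) → z ∈ LS W φ γ ⊎ z ∈ LS W ψ γ
            g z∈ (inj₁ p) = inj₁ (from (∈LS {φ = φ}) (z∈ , p))
            g z∈ (inj₂ p) = inj₂ (from (∈LS {φ = ψ}) (z∈ , p))
          łoś (φ ⇒ˢ ψ) {a} u γ F = →⇔ (łoś φ u γ F) (łoś ψ u γ F) ∙⇔ mk⇔
            (λ k → f k (dec⊩ a (LS W φ γ)))
            (λ k l → ⊩mono (λ z m → let (p , q) = to ∈∩ m ; (z∈ , p) = to (∈LS {φ = φ ⇒ˢ ψ}) p in from (∈LS {φ = ψ}) (z∈ , p (proj₂ (to (∈LS {φ = φ}) q)))) LS⊆ (⊩∩ LS⊆ LS⊆ k l))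
            where
            f : (a ⊩ LS W φ γ → a ⊩ LS W ψ γ) → a ⊩ LS W φ γ ⊎ ¬ a ⊩ LS W φ γ → a ⊩ LS W (φ ⇒ˢ ψ) γ
            f k (inj₁ l) = ⊩mono (λ z m → let (z∈ , p) = to (∈LS {φ = ψ}) m in from (∈LS {φ = φ ⇒ˢ ψ}) (z∈ , λ _ → p)) LS⊆ (k l)
            f k (inj₂ n) = ⊩mono (λ z m → from (∈LS {φ = φ ⇒ˢ ψ}) (C⊆ z m , λ p → ⊥-elim (to (∈C (C⊆ z m)) m (from (∈LS {φ = φ}) (C⊆ z m , p))))) LS⊆
              (from (⊩C u LS⊆) n)
          łoś (∀ˢ φ) {a} u γ F = mk⇔ (λ k → f k (dec⊩ a (LS W (∀ˢ φ) γ)))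
            (λ { k y ((_ , o , refl)) → łoś-all φ u γ F k o })
            where
            f : 𝕄₀ ⊨ ∀ˢ φ [ vec (piE a γ) ] → a ⊩ LS W (∀ˢ φ) γ ⊎ ¬ a ⊩ LS W (∀ˢ φ) γ → a ⊩ LS W (∀ˢ φ) γ
            f k (inj₁ l) = l
            -- A Skolem function g for ¬ φ supplies a counterexample wherever the universal
            -- statement fails; the object with seed a and function g then contradicts k.
            f k (inj₂ n) = let (g , G , q) = skolem W (φ ⇒ˢ ⊥ˢ) γ in
              ⊥-elim (⊮∅ (⊩mono (λ z m → let (m , l) = to ∈∩ m ; (z∈ , p) = to (∈LS {φ = φ} {γ = γ ▹ g}) m in
                  ⊥-elim (to (∈C z∈) l (from (∈LS {φ = ∀ˢ φ}) (z∈ , λ y _ → by-contra (λ δ → 𝕍 ⊨ φ [ vec δ ]) ⦃ formD φ ⦄ (ev γ z ▹ y) λ np →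
                    lower⊥ (q z z∈ (y , tt , λ p → ⊥-elim (np p)) p)))))
                (λ z m → ⊥-elim (∉∅ m))
                (⊩∩ LS⊆ C⊆ (to (łoś φ u (γ ▹ g) (F , G)) (k _ (_ , obj u G , refl))) (from (⊩C u LS⊆) n))))
              where
              lower⊥ : ⊥ {ℓ} → ⊥₀
              lower⊥ ()
          łoś (∃ˢ φ) {a} u γ F = mk⇔
            (λ { (y , (_ , o , refl) , p) → łoś-ex φ u γ F o p })
            (λ k → let (g , G , q) = skolem W φ γ in _ , (_ , obj u G , refl) , from (łoś φ u (γ ▹ g) (F , G))
              (⊩mono (λ z m → let (z∈ , p) = to (∈LS {φ = ∃ˢ φ}) m in from (∈LS {φ = φ}) (z∈ , q z z∈ p)) LS⊆ k))
          private
            at-pair : ∀ {n} (φ : Formula (suc n)) {a c} → a ∈ W → (γ : Env n) → AllFn γ → Obj c →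
                      (𝕄₀ ⊨ φ [ π W h c ∷ vec (piE a γ) ]) ⇔ ⟪ fst c ، a ⟫ ⊩ LS W φ (sh γ ▹ ∘f W (snd c))
            at-pair φ {a} {c} u γ F (p , v , G) = subst₂ (λ y δ → (𝕄₀ ⊨ φ [ y ∷ vec δ ]) ⇔ ⟪ fst c ، a ⟫ ⊩ LS W φ (sh γ ▹ ∘f W (snd c)))
              (trans (shift-f u v G) (cong (π W h) (sym p))) (shift γ F u v) (łoś φ (ru-⟪⟫ r v u) (sh γ ▹ ∘f W (snd c)) (sh-Fn γ , ∘f-Fn))
            łoś-all : ∀ {n} (φ : Formula (suc n)) {a c} → a ∈ W → (γ : Env n) → AllFn γ → a ⊩ LS W (∀ˢ φ) γ → Obj c → 𝕄₀ ⊨ φ [ π W h c ∷ vec (piE a γ) ]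
            łoś-all φ {a} {c} u γ F k o@(_ , v , _) = from (at-pair φ u γ F o)
              (⊩pair v u ps⊆ LS⊆ (λ x y x∈ y∈ m → let (z∈ , _ , l) = to ∈ps m in from (∈LS {φ = φ})
                  (z∈ , subst₂ (λ p δ → 𝕍 ⊨ φ [ p ∷ vec δ ]) (sym (∘f-app z∈)) (sym (ev-sh γ z∈)) (proj₂ (to (∈LS {φ = ∀ˢ φ}) l) _ tt)))
                (⊩ps v u LS⊆ k))
            łoś-ex : ∀ {n} (φ : Formula (suc n)) {a c} → a ∈ W → (γ : Env n) → AllFn γ → Obj c → 𝕄₀ ⊨ φ [ π W h c ∷ vec (piE a γ) ] → a ⊩ LS W (∃ˢ φ) γ
            łoś-ex φ {a} {c} u γ F o@(_ , v , _) p = ⊩snd⁻ v u LS⊆ LS⊆ (λ x y x∈ y∈ m → let (z∈ , q) = to (∈LS {φ = φ}) m in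
                from (∈LS {φ = ∃ˢ φ}) (y∈ , _ , tt , subst (λ δ → 𝕍 ⊨ φ [ app (∘f W (snd c)) ⟪ x ، y ⟫ ∷ vec δ ]) (trans (ev-sh γ z∈) (cong (ev γ) snd-⟪⟫)) q))
              (to (at-pair φ u γ F o) p)
    open FundamentalTheorem

    -- The elementary embedding into the ultrapower.

    module UltrapowerEmbedding where
      ⊨-cong : ∀ {M N : Pred V ℓ} → (∀ x → M x ⇔ N x) → ∀ {n} (φ : Formula n) ρ → (M ⊨ φ [ ρ ]) ⇔ (N ⊨ φ [ ρ ])
      ⊨-cong e (x ˢ∈ y) ρ = id⇔
      ⊨-cong e (x ˢ≡ y) ρ = id⇔
      ⊨-cong e ⊥ˢ ρ = id⇔
      ⊨-cong e (φ ∧ˢ ψ) ρ = ×⇔ (⊨-cong e φ ρ) (⊨-cong e ψ ρ)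
      ⊨-cong e (φ ∨ˢ ψ) ρ = ⊎⇔ (⊨-cong e φ ρ) (⊨-cong e ψ ρ)
      ⊨-cong e (φ ⇒ˢ ψ) ρ = →⇔ (⊨-cong e φ ρ) (⊨-cong e ψ ρ)
      ⊨-cong e (∀ˢ φ) ρ = Π⇔ λ x → →⇔ (e x) (⊨-cong e φ (x ∷ ρ))
      ⊨-cong e (∃ˢ φ) ρ = Σ⇔ λ x → ×⇔ (e x) (⊨-cong e φ (x ∷ ρ))

      module _ {n} (P : Env n → V → Set ℓ) ⦃ d : Def full {suc n} (λ γ → P (init γ) (last γ)) ⦄ where
        class : Env n → Class
        class γ = record { formula = form d ; parameters = vec γ }
        class⇔ : ∀ {γ x} → ⟦ class γ ⟧ x ⇔ P γ x
        class⇔ {γ} {x} = sym⇔ (ok𝕍 (λ γ → P (init γ) (last γ)) (γ ▹ x))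

      private
        CstT : Env 1 → V → V
        CstT (∙ ▹ x) _ = x
      private
       opaque
        defCstT : DefT full {2} (λ γ → CstT (init γ) (last γ))
        defCstT = findT _
      opaque
        cst : V → V → V
        cst W x = lam CstT ⦃ defCstT ⦄ (∙ ▹ x) W
        cst-Fn : ∀ {W x} → Fn (cst W x) W
        cst-Fn = lam-Fn CstT ⦃ defCstT ⦄
        cst-app : ∀ {W x y} → y ∈ W → app (cst W x) y ≡ x
        cst-app = lam-app CstT ⦃ defCstT ⦄
        instance
         icst : ∀ {n} {s t : Env n → V} ⦃ _ : DefT full s ⦄ ⦃ _ : DefT full t ⦄ → DefT full (λ γ → cst (s γ) (t γ))
         icst ⦃ a ⦄ ⦃ b ⦄ = subT2 cst (byMem {t = λ γ → cst (last (init γ)) (last γ)} (λ (∙ ▹ W ▹ x) p → ∃[ y ] (y ∈ W × p ≡ ⟪ y ، x ⟫)) λ γ z → ∈lam CstT ⦃ defCstT ⦄) a b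
         iidn : ∀ {n} {s : Env n → V} ⦃ _ : DefT full s ⦄ → DefT full (λ γ → idn (s γ))
         iidn ⦃ a ⦄ = subT1 idn (byMem {t = λ γ → idn (last γ)} (λ (∙ ▹ W) p → ∃[ y ] (y ∈ W × p ≡ ⟪ y ، y ⟫)) λ γ z → idn-mem) a

      private
        IdP MP jP : Env 2 → V → Set ℓ
        IdP (∙ ▹ W ▹ h) a = a ∈ W → π W h ⟪ a ، idn W ⟫ ≡ a
        MP (∙ ▹ W ▹ h) y = ∃[ c ] ((c ≡ ⟪ fst c ، snd c ⟫ × fst c ∈ W × Fn (snd c) W) × y ≡ π W h c)
        jP (∙ ▹ W ▹ h) p = ∃[ x ] (p ≡ ⟪ x ، π W h ⟪ ∅ ، cst W x ⟫ ⟫)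
        opaque
          dMP : Def full {3} (λ γ → MP (init γ) (last γ))
          dMP = find _
          djP : Def full {3} (λ γ → jP (init γ) (last γ))
          djP = find _

      module Target {W h : V} (r : RU W) (S : SH W W h) where
        open Łoś r S public
        private
          oid : ∀ {a} → a ∈ W → Obj ⟪ a ، idn W ⟫
          oid u = obj u idn-Fn
        opaque
          -- By the bounded quantifier `⊩N`, an object below ⟪ a ، idn W ⟫ equals ⟪ c ، idn W ⟫ for
          -- some c ∈ a, so ∈-induction applies. This puts W inside the target.
          π-id : ∀ a → a ∈ W → π W h ⟪ a ، idn W ⟫ ≡ a
          π-id = ∈-ind IdP (∙ ▹ W ▹ h) λ a ih u → ext
            (λ z k → let (d , o@(p , v , G) , e , q) = to (π-mem (oid u)) k
                         (c , c∈ , l) = to (⊩N u v EqS⊆) (⊩flip v u MeS⊆ dia⊆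
                           (λ x y x∈ y∈ m → let m = subst (app (snd d) x ∈_) (idn-app y∈) (to (⟪⟫∈MeS x∈ y∈) m) in
                              from (∈dia N (ru-⟪⟫ r y∈ x∈)) (⟪ app (snd d) x ، x ⟫ ,
                                from (⟪⟫∈EqS (ru-Tr r m y∈) x∈) (idn-app (ru-Tr r m y∈)) , Pr-⟪⟫ , _ , subst (_ ∈_) (sym fst-⟪⟫) m , cong ⟪ _ ،_⟫ (sym snd-⟪⟫)))
                           (to obj-Eε (subst (λ d → Eε W h d ⟪ a ، idn W ⟫) p e)))
                         c∈W = ru-Tr r c∈ u
                     in subst (_∈ a) (trans (sym (ih c c∈ c∈W)) (trans (Eq⇒π (oid c∈W) (obj v G) (from obj-Eq l)) (trans (cong (π W h) (sym p)) (sym q)))) c∈)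
            (λ y k → let v = ru-Tr r k u in from (π-mem (oid u)) (⟪ y ، idn W ⟫ , oid v ,
              from obj-Eε (⊩flip u v dia⊆ MeS⊆
                (λ x z x∈ z∈ m → let (q , l , _ , w , w∈ , e) = to (∈dia N (ru-⟪⟫ r x∈ z∈)) m
                                     w∈x = subst (w ∈_) fst-⟪⟫ w∈ ; w∈W = ru-Tr r w∈x x∈
                                     wz = to (⟪⟫∈EqS w∈W z∈) (subst (_∈ EqS W (idn W) (idn W)) (trans e (cong ⟪ w ،_⟫ snd-⟪⟫)) l)
                                 in from (⟪⟫∈MeS z∈ x∈) (subst₂ _∈_ (trans (sym (idn-app w∈W)) wz) (sym (idn-app x∈)) w∈x))
                (from (⊩N u v EqS⊆) (y , k , to obj-Eq (Eq-refl (oid v))))) , sym (ih y k v)))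
        K : V → V
        K x = π W h ⟪ ∅ ، cst W x ⟫
        opaque
          -- Both sides compare the constant function a with the identity at the seed a; they agree
          -- almost everywhere iff the ultrafilter at a is principal.
          K-fix : ∀ {a} → a ∈ W → K a ≡ a ⇔ a ⊩ sing a
          K-fix {a} u = mk⇔ (λ e → trans e (sym (π-id a u))) (λ e → trans e (π-id a u)) ∙⇔ π-≡ (obj (ru-∅ r) cst-Fn) (oid u) ∙⇔ obj-Eq ∙⇔ mk⇔
            (⊩snd⁻ (ru-∅ r) u EqS⊆ s⊆ λ x y x∈ y∈ m → from ∈sing (sym (trans (sym (cst-app x∈)) (trans (to (⟪⟫∈EqS x∈ y∈) m) (idn-app y∈)))))
            (λ m → ⊩pair (ru-∅ r) u ps⊆ EqS⊆ (λ x y x∈ y∈ k → from (⟪⟫∈EqS x∈ y∈) (trans (cst-app x∈) (trans (sym (to ∈sing (proj₂ (proj₂ (to ∈ps k)))))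
                (trans snd-⟪⟫ (sym (idn-app y∈)))))) (⊩ps (ru-∅ r) u s⊆ m))
            where
            s⊆ : sing a ⊆ W
            s⊆ z k = subst (_∈ W) (sym (to ∈sing k)) u
        𝐌 𝐣 : Class
        𝐌 = class MP ⦃ dMP ⦄ (∙ ▹ W ▹ h)
        𝐣 = class jP ⦃ djP ⦄ (∙ ▹ W ▹ h)
        𝐌⇔ : ∀ {y} → ⟦ 𝐌 ⟧ y ⇔ 𝕄₀ y
        𝐌⇔ = class⇔ MP ⦃ dMP ⦄
        𝐣⇔ : ∀ {x y} → 𝐣 ∋ᶜ⟨ x ⨾ y ⟩ ⇔ (y ≡ K x)
        𝐣⇔ {x} {y} = mk⇔
          (λ (p , e , k) → f (subst (jP (∙ ▹ W ▹ h)) (to ≐⇔ e) (to (class⇔ jP ⦃ djP ⦄) k)))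
          (λ { refl → _ , from ≐⇔ refl , from (class⇔ jP ⦃ djP ⦄) (x , refl) })
          where
          f : jP (∙ ▹ W ▹ h) ⟪ x ، y ⟫ → y ≡ K x
          f (x′ , e) with ⟪⟫-inj₁ e
          ... | refl = ⟪⟫-inj₂ e
        trM : IsTransitiveClass 𝐌
        trM x y m k with to 𝐌⇔ m
        ... | c , o , refl = let (d , o′ , _ , q) = to (π-mem o) k in from 𝐌⇔ (d , o′ , q)
        W⊆𝐌 : ∀ {a} → a ∈ W → ⟦ 𝐌 ⟧ a
        W⊆𝐌 {a} u = from 𝐌⇔ (_ , oid u , sym (π-id a u))
        private
          csts : ∀ {n} → Vec V n → Env n
          csts [] = ∙
          csts (x ∷ xs) = csts xs ▹ cst W x
          csts-Fn : ∀ {n} (xs : Vec V n) → AllFn (csts xs)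
          csts-Fn [] = tt
          csts-Fn (x ∷ xs) = csts-Fn xs , cst-Fn
          csts-ev : ∀ {n} (xs : Vec V n) {x} → x ∈ W → vec (ev (csts xs) x) ≡ xs
          csts-ev [] k = refl
          csts-ev (x ∷ xs) k = cong₂ _∷_ (cst-app k) (csts-ev xs k)
          csts-pi : ∀ {n} {xs ys : Vec V n} → PW.Pointwise (λ x y → 𝐣 ∋ᶜ⟨ x ⨾ y ⟩) xs ys → ys ≡ vec (piE ∅ (csts xs))
          csts-pi PW.[] = refl
          csts-pi (e PW.∷ es) = cong₂ _∷_ (to 𝐣⇔ e) (csts-pi es)
        elementary-𝐣 : IsElementaryEmbedding 𝐣 𝐌
        elementary-𝐣 = record
          { function = (λ p k → let (x , e) = to (class⇔ jP ⦃ djP ⦄) k in x , K x , tt , from ≐⇔ e)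
                     , λ x _ → K x , from 𝐣⇔ refl , λ m → sym (to 𝐣⇔ m)
          ; into = λ x y m → from 𝐌⇔ (_ , obj (ru-∅ r) cst-Fn , to 𝐣⇔ m)
          -- For constant functions the set in Łoś's theorem is W or `∅`, according to the truth of
          -- φ.
          ; elementary = λ φ xs ys pw → mk⇔
              (λ p → ⊩mono (λ z k → from (∈LS {φ = φ}) (k , subst (𝕍 ⊨ φ [_]) (sym (csts-ev xs k)) p)) LS⊆ (⊩W (ru-∅ r)))
              (λ k → subst (𝕍 ⊨ φ [_]) (vec-env xs) (by-contra (λ γ → 𝕍 ⊨ φ [ vec γ ]) ⦃ formD φ ⦄ (env xs) λ no →
                 ⊮∅ (⊩mono (λ z m → let (z∈ , p) = to (∈LS {φ = φ}) m in
                   ⊥-elim (no (subst (𝕍 ⊨ φ [_]) (trans (csts-ev xs z∈) (sym (vec-env xs))) p))) (λ z m → ⊥-elim (∉∅ m)) k)))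
              ∙⇔ sym⇔ (łoś φ (ru-∅ r) (csts xs) (csts-Fn xs)) ∙⇔ ⊨-cong (λ y → sym⇔ 𝐌⇔) φ _
              ∙⇔ mk⇔ (subst (⟦ 𝐌 ⟧ ⊨ φ [_]) (sym (csts-pi pw))) (subst (⟦ 𝐌 ⟧ ⊨ φ [_]) (csts-pi pw)) }
        open Embedding 𝐣 𝐌 elementary-𝐣 trM public using (J; J-uniq; J-∈; J-app; J-Bij; elem)
        J≡ : ∀ {x} → J x ≡ K x
        J≡ = J-uniq (from 𝐣⇔ refl)
    open UltrapowerEmbedding

    -- Critical points of the ultrapower embedding.

    module CriticalPoints where
      -- By `K-fix`, fixed points are principal seeds. In these terms being critical is a statement
      -- about sets, to which `lem` and closure arguments apply, whereas an embedding is a class.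
      record Crit (W κ : V) : Set ℓ where
        constructor crit
        field
          {cr-h} : V
          cr-SH : SH W W cr-h
          cr-Ord : Ord κ
          cr-∈ : κ ∈ W
          cr-fix : ∀ α → α ∈ κ → α ∈ app cr-h (sing α)
          cr-mov : ¬ κ ∈ app cr-h (sing κ)
      open Crit public
      opaque
       instance
        iCrit : ∀ {n} {s t : Env n → V} ⦃ _ : DefT full s ⦄ ⦃ _ : DefT full t ⦄ → Def full (λ γ → Crit (s γ) (t γ))
        iCrit ⦃ a ⦄ ⦃ b ⦄ = sub2 (λ (∙ ▹ W ▹ κ) → Crit W κ) (iso
          {P = λ (∙ ▹ W ▹ κ) → ∃[ h ] (SH W W h × Ord κ × κ ∈ W × (∀ α → α ∈ κ → α ∈ app h (sing α)) × ¬ κ ∈ app h (sing κ))}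
          (λ γ → mk⇔ (λ (_ , a , b , c , d , e) → crit a b c d e) (λ (crit a b c d e) → _ , a , b , c , d , e)) (find _)) a b

      private
        RkT : Env 0 → V → V
        RkT _ x = rk x
        RkfP : Env 4 → Set ℓ
        RkfP (∙ ▹ T ▹ f ▹ a ▹ γ) = Tr T × a ∈ T × (∀ x → x ∈ T → Ord (app f x)) × (∀ y → y ∈ T → ∀ x → x ∈ y → app f x ∈ app f y) × app f a ≡ γ
        RkiP : Env 2 → V → Set ℓ
        RkiP (∙ ▹ T ▹ f) x = x ∈ T → x ⊆ R (app f x)
        FxP : Env 3 → V → Set ℓ
        FxP (∙ ▹ λ′ ▹ W ▹ h) γ = γ ∈ λ′ → ∀ a → a ⊆ R γ → π W h ⟪ ∅ ، cst W a ⟫ ≡ a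
        MvP : Env 3 → V → Set ℓ
        MvP (∙ ▹ λ′ ▹ W ▹ h) γ = γ ∈ λ′ × ¬ π W h ⟪ ∅ ، cst W γ ⟫ ≡ γ
        UnP : Env 2 → Set ℓ
        UnP (∙ ▹ W ▹ h) = ∃[ a ] (a ∈ W × ¬ a ∈ app h (sing a))
        UmP : Env 3 → Set ℓ
        UmP (∙ ▹ λ′ ▹ W ▹ h) = ∃[ γ ] (Ord γ × γ ∈ λ′ × ¬ π W h ⟪ ∅ ، cst W γ ⟫ ≡ γ)
        opaque
          dFxP : Def full {4} (λ γ → FxP (init γ) (last γ))
          dFxP = find _
          dMvP : Def full {4} (λ γ → MvP (init γ) (last γ))
          dMvP = find _
          dUnP : Def full UnP
          dUnP = find _
          dUmP : Def full UmP
          dUmP = find _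
          dRkfP : Def abs RkfP
          dRkfP = find _
          dRkiP : Def full {3} (λ γ → RkiP (init γ) (last γ))
          dRkiP = find _
        rk-unique-bound : ∀ {T f a γ} → RkfP (∙ ▹ T ▹ f ▹ a ▹ γ) → a ⊆ R γ
        rk-unique-bound {T} {f} {a} {γ} (t , a∈ , _ , inc , e) = subst (λ γ → a ⊆ R γ) e
          (∈-ind RkiP ⦃ dRkiP ⦄ (∙ ▹ T ▹ f) (λ x ih x∈ z k → from ∈R (app f z , inc x x∈ z k , ih z k (trn t _ x∈ _ k))) a a∈)

      private
       opaque
        defRkT : DefT full {1} (λ γ → RkT (init γ) (last γ))
        defRkT = findT _
      module CriticalPoint {W h : V} (r : RU W) (S : SH W W h) where
        open Target r S
        private
          Λ : V
          Λ = ru-λ r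
          oΛ : Ord Λ
          oΛ = lim-Ord (ru-Lim r)
          Λ⊆W : ∀ {α} → α ∈ Λ → α ∈ W
          Λ⊆W k = subst (_ ∈_) (sym (ru-R r)) (R-⊆ Λ _ k)
          s⊆ : ∀ {a} → a ∈ W → sing a ⊆ W
          s⊆ u z k = subst (_∈ W) (sym (to ∈sing k)) u
        -- Ranks below the first moved ordinal are absolute, so nothing of such a rank is moved.
        opaque
          fixes-all : (∀ γ → γ ∈ Λ → K γ ≡ γ) → ∀ a → a ∈ W → K a ≡ a
          fixes-all fx a u = let (γ , γ∈ , s) = to ∈R (subst (a ∈_) (ru-R r) u) in
            Ord-ind FxP ⦃ dFxP ⦄ (∙ ▹ Λ ▹ W ▹ h) step γ (Ord-∈ oΛ γ∈) γ∈ a s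
            where
            step : ∀ γ → Ord γ → (∀ δ → δ ∈ γ → FxP (∙ ▹ Λ ▹ W ▹ h) δ) → FxP (∙ ▹ Λ ▹ W ▹ h) γ
            step γ o ih γ∈ a s = trans (sym J≡) (ext (λ x k → back x k (fixed (bound x k))) λ x k → subst (_∈ J a) (trans J≡ (fixed (s x k))) (to J-∈ k))
              where
              fixed : ∀ {x} → x ∈ R γ → K x ≡ x
              fixed k = let (δ , δ∈ , t) = to ∈R k in ih δ δ∈ (Ord-tr oΛ δ∈ γ∈) _ t
              back : ∀ x → x ∈ J a → K x ≡ x → x ∈ a
              back x k e = from J-∈ (subst (_∈ J a) (sym (trans J≡ e)) k)
              T f : V
              T = R (sucV (rk a))
              f = lam RkT ⦃ defRkT ⦄ ∙ T
              a∈T : a ∈ T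
              a∈T = from ∈R (_ , ∈suc-refl , rk-⊆)
              -- An absolute certificate for the rank of a. Its image under j certifies the bound j
              -- (rk a) = rk a for the members of j a.
              ranks : RkfP (∙ ▹ T ▹ f ▹ a ▹ rk a)
              ranks = R-Tr _ , a∈T , (λ x k → subst Ord (sym (lam-app RkT ⦃ defRkT ⦄ k)) rk-Ord)
                    , (λ y k x l → subst₂ _∈_ (sym (lam-app RkT ⦃ defRkT ⦄ (trn (R-Tr _) _ k _ l))) (sym (lam-app RkT ⦃ defRkT ⦄ k)) (rk-∈ l)) , lam-app RkT ⦃ defRkT ⦄ a∈T
              rkγ : rk a ∈ γ ⊎ rk a ≡ γ → rk a ∈ Λ × rk a ⊆ γ
              rkγ (inj₁ k) = Ord-tr oΛ k γ∈ , λ z l → Ord-tr o l k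
              rkγ (inj₂ e) = subst (_∈ Λ) (sym e) γ∈ , subst (rk a ⊆_) e λ _ k → k
              rka : rk a ∈ Λ × rk a ⊆ γ
              rka = rkγ (to ∈suc (rk-≤ o s))
              bound : ∀ x → x ∈ J a → x ∈ R γ
              bound x k = R-mono (proj₂ rka) x (rk-unique-bound {J T} {J f}
                (subst (λ δ → RkfP (∙ ▹ J T ▹ J f ▹ J a ▹ δ)) (trans J≡ (fx _ (proj₁ rka))) (to (elem RkfP ⦃ dRkfP ⦄ (∙ ▹ T ▹ f ▹ a ▹ rk a)) ranks)) x k)

          -- If every ordinal below the height of W is fixed, so is all of W; then each ultrafilter
          -- is principal and h is the identity. Hence some ordinal moves, and the least one is
          -- critical.
          nontrivial⇒Crit : (∃[ X ] (X ⊆ W × ¬ app h X ≡ X)) → ∃[ κ ] Crit W κ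
          nontrivial⇒Crit (X , X⊆ , ne) =
            let (γ , o , γ∈ , m) = by-contra UmP ⦃ dUmP ⦄ (∙ ▹ Λ ▹ W ▹ h) λ no → ne (identity λ a u → to (K-fix u)
                  (fixes-all (λ γ γ∈ → by-contra (λ (∙ ▹ W ▹ h ▹ γ) → π W h ⟪ ∅ ، cst W γ ⟫ ≡ γ) (∙ ▹ W ▹ h ▹ γ) λ nf → no (γ , Ord-∈ oΛ γ∈ , γ∈ , nf)) a u))
                (κ , oκ , (κ∈ , mv) , min) = Ord-least MvP ⦃ dMvP ⦄ (∙ ▹ Λ ▹ W ▹ h) (γ , o , γ∈ , m)
            in κ , crit S oκ (Λ⊆W κ∈)
                 (λ α α∈ → let α∈Λ = Ord-tr oΛ α∈ κ∈ in to (K-fix (Λ⊆W α∈Λ))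
                   (by-contra (λ (∙ ▹ W ▹ h ▹ γ) → π W h ⟪ ∅ ، cst W γ ⟫ ≡ γ) (∙ ▹ W ▹ h ▹ α) λ nf → min α α∈ (α∈Λ , nf)))
                 (λ k → mv (from (K-fix (Λ⊆W κ∈)) k))
            where
            identity : (∀ a → a ∈ W → a ⊩ sing a) → app h X ≡ X
            identity f = ext
              (λ a k → by-contra (λ (∙ ▹ a ▹ X) → a ∈ X) (∙ ▹ a ▹ X) λ na → let u = ⊩-W′ X⊆ k in
                 to (⊩C u X⊆) (⊩mono (λ z m → subst (_∈ C X) (sym (to ∈sing m)) (from (∈C u) na)) C⊆ (f a u)) k)
              (λ a k → ⊩mono (λ z m → subst (_∈ X) (sym (to ∈sing m)) k) X⊆ (f a (X⊆ a k)))

      Crit-RU : ∀ {W κ} → RU W → (c : Crit W κ) → ∀ {μ} → Ord μ → R μ ⊆ W → IsStrongUpTo μ κ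
      Crit-RU {W} {κ} r c {μ} oμ s = 𝐣 , 𝐌 , elementary-𝐣 , trM ,
          (to Ord⇔ (cr-Ord c) , (λ α k → from 𝐣⇔ (sym (from (K-fix (ru-Tr r k (cr-∈ c))) (cr-fix c α k)))) ,
            λ m → cr-mov c (to (K-fix (cr-∈ c)) (sym (to 𝐣⇔ m)))) ,
          R μ , RankInit oμ , λ x k → W⊆𝐌 (s x k)
        where
        open Target r (cr-SH c)

      -- A bijection from α ∈ κ onto κ is moved to a bijection from α onto j κ with the same values,
      -- which would give j κ = κ.
      Crit-Card : ∀ {W κ} → RU W → Crit W κ → IsCardinal κ
      Crit-Card {W} {κ} r c = to Ord⇔ (cr-Ord c) , λ α α∈ (f , F) → absurd α α∈ f (⇒Bij F)
        where
        open Target r (cr-SH c)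
        fixed : ∀ {α} → α ∈ κ → J α ≡ α
        fixed k = trans J≡ (from (K-fix (ru-Tr r k (cr-∈ c))) (cr-fix c _ k))
        κ⊆ : κ ⊆ J κ
        κ⊆ x k = subst (_∈ J κ) (fixed k) (to J-∈ k)
        absurd : ∀ α → α ∈ κ → ∀ f → Bij f α κ → ⊥₀
        absurd α α∈ f B = cr-mov c (to (K-fix (cr-∈ c)) (trans (sym J≡) (ext
            (λ y k → let (x , x∈ , e) = bij-onto JB y k
                         xκ = Ord-tr (cr-Ord c) x∈ α∈
                     in subst (_∈ κ) (trans (trans (trans (sym (fixed (inj-into (bij-Inj B) x x∈))) J-app) (cong (app (J f)) (fixed xκ))) e)
                          (inj-into (bij-Inj B) x x∈)) κ⊆)))
          where
          JB : Bij (J f) α (J κ)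
          JB = subst (λ a → Bij (J f) a (J κ)) (fixed α∈) (to J-Bij B)
    open CriticalPoints

   open FundamentalTheorem public
   open UltrapowerEmbedding public hiding (icst; iidn)
   open CriticalPoints public
  open UltrapowerEmbeddings public

  -- Rigid universes and the homomorphisms between their graphs.

  module Rigidity where
    record Rig (W : V) : Set ℓ where
      constructor rig
      field
        rig-RU : RU W
        rig-id : ∀ h → SH W W h → ∀ X → X ⊆ W → app h X ≡ X
    open Rig public
    opaque
     instance
      iRig : ∀ {n} {s : Env n → V} ⦃ _ : DefT full s ⦄ → Def full (λ γ → Rig (s γ))
      iRig ⦃ a ⦄ = sub1 (λ (∙ ▹ W) → Rig W) (iso {P = λ (∙ ▹ W) → RU W × (∀ h → SH W W h → ∀ X → X ⊆ W → app h X ≡ X)}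
        (λ γ → mk⇔ (λ (a , b) → rig a b) (λ (rig a b) → a , b)) (find _)) a

    neg⊆ : ∀ {j W X} → neg j W X ⊆ W
    neg⊆ z k = proj₁ (to ∈neg k)
    ⊙-SH : ∀ {W W′ W″ g f} → SH W′ W″ g → SH W W′ f → SH W W″ ((g ⊙ f) (𝒫 W))
    ⊙-SH {W} {W′} {W″} {g} {f} G F = record
      { sh-into = λ X s → subst (_⊆ W″) (sym (val s)) (sh-into G _ (sh-into F X s))
      ; sh-neg = λ j a b X s → trans (val neg⊆) (trans (cong (app g) (sh-neg F j a b X s)) (trans (sh-neg G j a b _ (sh-into F X s)) (cong (neg j W″) (sym (val s)))))
      ; sh-wf = λ X s w → subst (WFr (𝒫 W″)) (sym (val s)) (sh-wf G _ (sh-into F X s) (sh-wf F X s w)) }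
      where
      val : ∀ {X} → X ⊆ W → app ((g ⊙ f) (𝒫 W)) X ≡ app g (app f X)
      val s = ⊙-app (from ∈𝒫 s)
    ∩-sub : ∀ {X W} → X ⊆ W → X ∩ W ≡ X
    ∩-sub s = ext (λ z k → proj₁ (to ∈∩ k)) (λ z k → from ∈∩ (k , s z k))
    ∩-sup : ∀ {X W} → W ⊆ X → X ∩ W ≡ W
    ∩-sup s = ext (λ z k → proj₂ (to ∈∩ k)) (λ z k → from ∈∩ (s z k , k))

    HomΓ : V → V → V → Set ℓ
    HomΓ g W W′ = HomGE g (GV (𝒫 W)) (GE W (𝒫 W)) (GV (𝒫 W′)) (GE W′ (𝒫 W′))
    Hom-Γ : ∀ {g W W′} → Hom g (Γ W) (Γ W′) → HomΓ g W W′
    Hom-Γ {g} (mkHom e e′ H) = cast (sym (⟪⟫-inj₁ e)) (sym (⟪⟫-inj₂ e)) (sym (⟪⟫-inj₁ e′)) (sym (⟪⟫-inj₂ e′)) H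
      where
      cast : ∀ {A B C D A′ B′ C′ D′} → A ≡ A′ → B ≡ B′ → C ≡ C′ → D ≡ D′ → HomGE g A B C D → HomGE g A′ B′ C′ D′
      cast refl refl refl refl H = H

    RU-⊆ : ∀ {W W′} → RU W′ → W ∈ W′ → W ⊆ W′
    RU-⊆ r k z l = ru-Tr r l k

    module _ {W W′ : V} (d : Rig W) (d′ : Rig W′) where
      private
        r = rig-RU d
        r′ = rig-RU d′
      restriction : W ⊆ W′ → ∃[ g ] Hom g (Γ W′) (Γ W)
      restriction s = _ , mkHom refl refl (SH⇒HomGE (res-SH r s))
      -- Composed with the restriction, a homomorphism Γ W → Γ W′ would make it injective; but it identifies W and W′.
      no-hom : W ∈ W′ → ∀ {g} → ¬ Hom g (Γ W) (Γ W′)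
      no-hom k {g} H = ∈-irrefl (subst (W ∈_) (sym W≡W′) k)
        where
        open FromGraph (Hom-Γ H)
        s = RU-⊆ r′ k
        id′ : ∀ {X} → X ⊆ W′ → app h (X ∩ W) ≡ X
        id′ t = trans (trans (cong (app h) (sym (res-val t))) (sym (⊙-app (from ∈𝒫 t)))) (rig-id d′ _ (⊙-SH h-SH (res-SH r s)) _ t)
        W≡W′ : W ≡ W′
        W≡W′ = trans (sym (id′ s)) (trans (cong (app h) (trans (∩-sub λ _ m → m) (sym (∩-sup s)))) (id′ λ _ m → m))

      module _ (s : W ⊆ W′) {h : V} (S : SH W′ W h) where
        private
          open Ultrafilters r′ r S
          hW : app h W ≡ W
          hW = ext (sh-into S W s) (λ a k → ⊩W′ s k)
          h∩ : ∀ {X} → X ⊆ W′ → app h (X ∩ W) ≡ app h X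
          h∩ {X} t = ext (λ a k → ⊩mono (λ z m → proj₁ (to ∈∩ m)) t k)
            (λ a k → ⊩∩ t s k (subst (a ∈_) (sym hW) (⊩-W′ t k)))
          sw : ∀ {X} → X ⊆ W → X ⊆ W′
          sw t z k = s z (t z k)
          -- X relates points of W only: a set disjoint from W consists of minimal points, and
          -- otherwise its trace on W has a minimal point.
          wf-up : ∀ {X} → X ⊆ W → WFr (𝒫 W) X → WFr (𝒫 W′) X
          wf-up {X} t w = record { wfr = λ T T∈ (x , x∈ , _) → f T x x∈ (lem (λ (∙ ▹ T ▹ W) → ∃[ y ] (y ∈ T × y ∈ W)) (∙ ▹ T ▹ W)) }
            where
            dn : ∀ {x m} → ⟪ x ، m ⟫ ∈ X → x ∈ W × m ∈ W
            dn k = Good-fst (ru-Good r) (t _ k) , Good-snd (ru-Good r) (t _ k)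
            f : ∀ T x → x ∈ T → (∃[ y ] (y ∈ T × y ∈ W)) ⊎ ¬ (∃[ y ] (y ∈ T × y ∈ W)) → ∃[ m ] (m ∈ T × (∀ x → x ∈ T → ¬ ⟪ x ، m ⟫ ∈ X))
            f T x x∈ (inj₂ no) = x , x∈ , λ y y∈ k → no (x , x∈ , proj₂ (dn k))
            f T x x∈ (inj₁ (y , y∈ , yW)) = let (m , m∈ , min) = wfr w (T ∩ W) (from ∈𝒫 λ z k → proj₂ (to ∈∩ k)) (y , from ∈∩ (y∈ , yW) , refl) in
              m , proj₁ (to ∈∩ m∈) , λ z z∈ k → min z (from ∈∩ (z∈ , proj₁ (dn k))) k
          S↾ : SH W W h
          S↾ = record
            { sh-into = λ X t → sh-into S X (sw t)
            ; sh-neg = λ j a b X t → trans (cong (app h) (trans (cong (neg j W) (sym (∩-sub t))) (neg-∩ r s))) (trans (h∩ neg⊆) (sh-neg S j a b X (sw t)))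
            ; sh-wf = λ X t w → sh-wf S X (sw t) (wf-up t w) }
        -- Seeds in W concentrate on W by `⊩W′`, so h X depends only on X ∩ W. On subsets of W, h is
        -- an endomorphism, because well-foundedness on W passes to W′; rigidity of W makes it the
        -- identity.
        SH-unique : ∀ {X} → X ⊆ W′ → app h X ≡ X ∩ W
        SH-unique t = trans (sym (h∩ t)) (rig-id d h S↾ _ λ z k → proj₂ (to ∈∩ k))

      hom-unique : W ⊆ W′ → ∀ {g g′} → Hom g (Γ W′) (Γ W) → Hom g′ (Γ W′) (Γ W) → g ≡ g′
      hom-unique s H H′ = fn-ext (hom-Fn (Hom-Γ H)) (hom-Fn (Hom-Γ H′)) λ v k → trans (val H k) (sym (val H′ k))
        where
        val : ∀ {g v} → Hom g (Γ W′) (Γ W) → v ∈ GV (𝒫 W′) → app g v ≡ ⟪ fst v ، snd v ∩ W ⟫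
        val {g} H k = let (a , b , e) = ∈GV k ; t = to ∈𝒫 b in
          trans (cong (app g) e) (trans (g-val (Hom-Γ H) a t) (cong ⟪ _ ،_⟫ (SH-unique s (h-SH (Hom-Γ H)) t)))
          where open FromGraph

    IsGraph-Γ : ∀ {W} → IsGraph (Γ W)
    IsGraph-Γ {W} = _ , _ , from ≐⇔ refl , (_ , from pair∈⊗ (∅∈num (s≤s z≤n) , from ∈𝒫 (λ _ k → k))) ,
      λ p k → let (a , b , a∈ , b∈ , e) = GE-pair k in a , b , a∈ , b∈ , from ≐⇔ e

    -- ⟪ ∅ ، W ⟫ is a vertex, so a transitive set containing the graph contains W.
    Γ∉ : ∀ {W U} → RU U → Γ W ∈ U → W ∈ U
    Γ∉ r k = Good-snd (ru-Good r) (ru-Tr r (from pair∈⊗ (∅∈num (s≤s z≤n) , from ∈𝒫 (λ _ k → k))) (Good-fst (ru-Good r) k))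

    private
      -- The existence of a strong cardinal involves classes and cannot be decided by `lem`. This
      -- sentence about sets can, and it implies the former.
      StP : Env 0 → Set ℓ
      StP _ = ∃[ κ ] (∀ x → ∃[ W ] (RU W × x ∈ W × Crit W κ))
      AvT : V → V → V → Set ℓ
      AvT _ κ x = ∀ W → RU W → x ∈ W → ¬ Crit W κ


      opaque
        dStP : Def full StP
        dStP = find _
        dAvT : Def full {3} (λ γ → AvT (last (init (init γ))) (last (init γ)) (last γ))
        dAvT = find _



    opaque
      -- Without strong cardinals, every κ is avoided as a critical point from some rank on, and a
      -- closure point of these ranks is rigid.
      dichotomy : ExistsStrong ⊎ (∀ z → ∃[ W ] (Rig W × z ∈ W))
      dichotomy = f (lem StP ⦃ dStP ⦄ ∙)
        where
        f : StP ∙ ⊎ ¬ StP ∙ → ExistsStrong ⊎ (∀ z → ∃[ W ] (Rig W × z ∈ W))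
        f (inj₁ (κ , q)) = inj₁ (κ , (let (W , r , _ , c) = q ∅ in Crit-Card r c) ,
          λ μ μC _ → let (W , r , k , c) = q (R μ) in Crit-RU r c (card-Ord (from Card⇔ μC)) (RU-⊆ r k))
        f (inj₂ no) = inj₂ λ z → let (x , l , z∈ , cl) = Choice.closure AvT dAvT ∅ avoid z in R x , rig (ru l refl) (rigid x l cl) , z∈
          where
          avoid : ∀ κ → ∃[ x ] AvT ∅ κ x
          avoid κ = by-contra (λ (∙ ▹ κ) → ∃[ x ] (∀ W → RU W → x ∈ W → ¬ Crit W κ)) (∙ ▹ κ) λ nx → no (κ , λ x →
            by-contra (λ (∙ ▹ κ ▹ x) → ∃[ W ] (RU W × x ∈ W × Crit W κ)) (∙ ▹ κ ▹ x) λ nW → nx (x , λ W r k c → nW (W , r , k , c)))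
          rigid : ∀ x → Lim x → (∀ κ → κ ∈ R x → ∃[ y ] (y ∈ R x × AvT ∅ κ y)) → ∀ h → SH (R x) (R x) h → ∀ X → X ⊆ R x → app h X ≡ X
          rigid x l cl h S X s = by-contra (λ (∙ ▹ h ▹ X) → app h X ≡ X) (∙ ▹ h ▹ X) λ ne →
            let (κ , c) = CriticalPoint.nontrivial⇒Crit (ru l refl) S (X , s , ne)
                (y , y∈ , q) = cl κ (cr-∈ c)
            in q (R x) (ru l refl) y∈ c
  open Rigidity public

  -- Π₁ definitions through good sets.

  module Reflection where
    -- With every quantifier bounded by u the formula is Δ₀, so asking it of all good u costs a
    -- single universal quantifier.
    relativise : ∀ {m n} → Fin m → (Fin n → Fin m) → Formula n → Formula m
    relativise u r (x ˢ∈ y) = r x ˢ∈ r y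
    relativise u r (x ˢ≡ y) = r x ˢ≡ r y
    relativise u r ⊥ˢ = ⊥ˢ
    relativise u r (φ ∧ˢ ψ) = relativise u r φ ∧ˢ relativise u r ψ
    relativise u r (φ ∨ˢ ψ) = relativise u r φ ∨ˢ relativise u r ψ
    relativise u r (φ ⇒ˢ ψ) = relativise u r φ ⇒ˢ relativise u r ψ
    relativise u r (∀ˢ φ) = ∀∈ˢ u (relativise (suc u) (lift r) φ)
    relativise u r (∃ˢ φ) = ∃∈ˢ u (relativise (suc u) (lift r) φ)

    relativise-Δ₀ : ∀ {m n} (u : Fin m) (r : Fin n → Fin m) φ → IsΔ₀ (relativise u r φ)
    relativise-Δ₀ u r (x ˢ∈ y) = mem
    relativise-Δ₀ u r (x ˢ≡ y) = eq
    relativise-Δ₀ u r ⊥ˢ = bot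
    relativise-Δ₀ u r (φ ∧ˢ ψ) = and (relativise-Δ₀ u r φ) (relativise-Δ₀ u r ψ)
    relativise-Δ₀ u r (φ ∨ˢ ψ) = or (relativise-Δ₀ u r φ) (relativise-Δ₀ u r ψ)
    relativise-Δ₀ u r (φ ⇒ˢ ψ) = imp (relativise-Δ₀ u r φ) (relativise-Δ₀ u r ψ)
    relativise-Δ₀ u r (∀ˢ φ) = all (relativise-Δ₀ (suc u) (lift r) φ)
    relativise-Δ₀ u r (∃ˢ φ) = ex (relativise-Δ₀ (suc u) (lift r) φ)

    relativise-⊨ : ∀ {m n} (u : Fin m) (r : Fin n → Fin m) φ (ρ : Vec V n) (σ : Vec V m) → (∀ i → lookup ρ i ≡ lookup σ (r i)) →
                   ((_∈ lookup σ u) ⊨ φ [ ρ ]) ⇔ (𝕍 ⊨ relativise u r φ [ σ ])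
    relativise-⊨ u r (x ˢ∈ y) ρ σ e rewrite e x | e y = id⇔
    relativise-⊨ u r (x ˢ≡ y) ρ σ e rewrite e x | e y = id⇔
    relativise-⊨ u r ⊥ˢ ρ σ e = id⇔
    relativise-⊨ u r (φ ∧ˢ ψ) ρ σ e = ×⇔ (relativise-⊨ u r φ ρ σ e) (relativise-⊨ u r ψ ρ σ e)
    relativise-⊨ u r (φ ∨ˢ ψ) ρ σ e = ⊎⇔ (relativise-⊨ u r φ ρ σ e) (relativise-⊨ u r ψ ρ σ e)
    relativise-⊨ u r (φ ⇒ˢ ψ) ρ σ e = →⇔ (relativise-⊨ u r φ ρ σ e) (relativise-⊨ u r ψ ρ σ e)
    relativise-⊨ u r (∀ˢ φ) ρ σ e = Π⇔ λ x → →⇔ id⇔ (relativise-⊨ (suc u) (lift r) φ (x ∷ ρ) (x ∷ σ) (ren-⊨-lift r ρ σ e x))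
      ∙⇔ mk⇔ (λ f _ → f) (λ f → f tt)
    relativise-⊨ u r (∃ˢ φ) ρ σ e = Σ⇔ λ x → ×⇔ id⇔ (relativise-⊨ (suc u) (lift r) φ (x ∷ ρ) (x ∷ σ) (ren-⊨-lift r ρ σ e x))
      ∙⇔ mk⇔ (λ p → tt , p) proj₂

    private
      module _ {m} (u : Fin m) where
        transF pairF unionF emptyF : Formula m
        transF = ∀∈ˢ u (∀∈ˢ zero (zero ˢ∈ suc (suc u)))
        pairF = ∀∈ˢ u (∀∈ˢ (suc u) (∃∈ˢ (suc (suc u)) (suc zero ˢ∈ zero ∧ˢ suc (suc zero) ˢ∈ zero ∧ˢ
          ∀∈ˢ zero (zero ˢ≡ suc (suc (suc zero)) ∨ˢ zero ˢ≡ suc (suc zero)))))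
        unionF = ∀∈ˢ u (∃∈ˢ (suc u) (∀∈ˢ zero (∃∈ˢ (suc (suc zero)) (suc zero ˢ∈ zero)) ∧ˢ ∀∈ˢ (suc zero) (∀∈ˢ zero (zero ˢ∈ suc (suc zero)))))
        emptyF = ∃∈ˢ u (∀∈ˢ zero ⊥ˢ)
        GoodF : Formula m
        GoodF = transF ∧ˢ pairF ∧ˢ unionF ∧ˢ emptyF
        GoodF-Δ₀ : IsΔ₀ GoodF
        GoodF-Δ₀ = and (all (all mem)) (and (all (all (ex (and mem (and mem (all (or eq eq))))))) (and (all (ex (and (all (ex mem)) (all (all mem))))) (ex (all bot))))
      lower⊥ : ⊥ {ℓ} → ⊥₀
      lower⊥ ()
      GoodF-⊨ : ∀ {u : V} {m} {ρ : Vec V m} → (𝕍 ⊨ GoodF zero [ u ∷ ρ ]) ⇔ Good (_∈ u)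
      GoodF-⊨ {u} = mk⇔
        (λ (t , p , un , (e , _ , e∈ , em)) → record
          { tr = λ h k → t _ tt k _ tt h
          ; cl-,, = λ {x} {y} h k → let (z , _ , z∈ , a , b , c) = p _ tt h _ tt k in
              subst (_∈ u) (ext (λ w l → from ∈,, (c w tt l)) (λ w l → pr b a (to ∈,, l))) z∈
          ; cl-⋃ = λ h → let (z , _ , z∈ , a , b) = un _ tt h in
              subst (_∈ u) (ext (λ w l → let (v , _ , p) = a w tt l in from ∈⋃ (v , p)) (λ w l → let (v , p , q) = to ∈⋃ l in b v tt p w tt q)) z∈
          ; cl-∅ = subst (_∈ u) (ext (λ w l → ⊥-elim (lower⊥ (em w tt l))) (λ w l → ⊥-elim (∉∅ l))) e∈ })
        (λ g → (λ x _ h y _ k → tr g k h)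
          , (λ x _ h y _ k → x ,, y , tt , cl-,, g h k , ∈r , ∈l , λ w _ l → to ∈,, l)
          , (λ x _ h → ⋃ x , tt , cl-⋃ g h , (λ w _ l → let (v , p , q) = to ∈⋃ l in v , tt , p , q) , λ v _ p w _ q → from ∈⋃ (v , p , q))
          , (∅ , tt , cl-∅ g , λ w _ l → ⊥-elim (∉∅ l)))
        where
        pr : ∀ {x y z w} → x ∈ z → y ∈ z → w ≡ x ⊎ w ≡ y → w ∈ z
        pr a b (inj₁ refl) = a
        pr a b (inj₂ refl) = b

    opaque
      -- An absolute matrix holds at p for all values of the universal variables iff it does so in every good set containing p.
      Π₁-formula : (Q : Env 3 → Set ℓ) ⦃ _ : Def abs Q ⦄ → ∃[ φ ] (IsΠ 1 φ × (∀ p → (𝕍 ⊨ φ [ p ∷ [] ]) ⇔ (∀ x y → Q (∙ ▹ p ▹ x ▹ y))))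
      Π₁-formula Q ⦃ d ⦄ = ∀ˢ (GoodF zero ⇒ˢ (suc zero ˢ∈ zero) ⇒ˢ relativise zero suc χ)
        , all (Σ⇒Π (Δ₀⇒Σ₀ (imp (GoodF-Δ₀ zero) (imp mem (relativise-Δ₀ zero suc χ)))))
        , λ p → mk⇔
            (λ f x y → let (l , L , k) = lim-above ⟪ p ، ⟪ x ، y ⟫ ⟫ ; g = Lim-Good L ; p∈ = Good-fst g k ; q∈ = Good-snd g k ; x∈ = Good-fst g q∈ ; y∈ = Good-snd g q∈ in
              from (ok d (_∈ R l) g (∙ ▹ p ▹ x ▹ y) (((tt , p∈) , x∈) , y∈))
                (from (relativise-⊨ zero suc χ (p ∷ []) (R l ∷ p ∷ []) (λ { zero → refl })) (f (R l) tt (from (GoodF-⊨ {ρ = p ∷ []}) g) p∈) x x∈ y y∈))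
            (λ f u _ g p∈ → to (relativise-⊨ zero suc χ (p ∷ []) (u ∷ p ∷ []) (λ { zero → refl }))
              (λ x x∈ y y∈ → to (ok d (_∈ u) (to (GoodF-⊨ {ρ = p ∷ []}) g) (∙ ▹ p ▹ x ▹ y) (((tt , p∈) , x∈) , y∈)) (f x y)))
        where
        χ : Formula 1
        χ = ∀ˢ (∀ˢ (form d))
  open Reflection public

  -- Absolute descriptions of graphs of rigid universes.

  module Codes where
    -- Being the graph of a rigid universe is absolute up to one universally quantified set y, which
    -- ranges over the subsets of W and over the endomorphisms.

    record GraphOf (P G E : V) : Set ℓ where
      field
        go-G : ∀ v → v ∈ G → Pr v × fst v ∈ num 12 × snd v ∈ P
        go-G′ : ∀ i → i ∈ num 12 → ∀ X → X ∈ P → ⟪ i ، X ⟫ ∈ G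
        go-E : ∀ e → e ∈ E → Pr e × fst e ∈ G × snd e ∈ G × Edge (⋃ P) P (fst e) (snd e)
        go-E′ : ∀ a → a ∈ G → ∀ b → b ∈ G → Edge (⋃ P) P a b → ⟪ a ، b ⟫ ∈ E
    open GraphOf public
    -- With P in the role of 𝒫 W, this says W = V_l through the sequence f of the earlier levels.
    -- Quantifiers over subsets are bounded by P, and ω ∈ l is expressed by a set of finite ordinals
    -- that contains ∅ and is closed under successor.
    record LevelsAt (P l f : V) : Set ℓ where
      field
        lv-Ord : Ord l
        lv-ω : ∃[ n ] (n ∈ l × ∅ ∈ n × (∀ z → z ∈ n → Nat z × sucV z ∈ n))
        lv-suc : ∀ z → z ∈ l → sucV z ∈ l
        lv-Fn : Fn f l
        lv-P : ∀ β → β ∈ l → app f β ∈ P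
        lv-f : ∀ β → β ∈ l → ∀ z → z ∈ app f β → ∃[ γ ] (γ ∈ β × z ⊆ app f γ)
        lv-f′ : ∀ β → β ∈ l → ∀ γ → γ ∈ β → ∀ z → z ∈ P → z ⊆ app f γ → z ∈ app f β
        lv-W : ∀ z → z ∈ ⋃ P → ∃[ γ ] (γ ∈ l × z ⊆ app f γ)
        lv-W′ : ∀ γ → γ ∈ l → ∀ z → z ∈ P → z ⊆ app f γ → z ∈ ⋃ P
    open LevelsAt public
    opaque
     private instance
      iGraphOf : ∀ {m n} {s t u : Env n → V} ⦃ _ : DefT m s ⦄ ⦃ _ : DefT m t ⦄ ⦃ _ : DefT m u ⦄ → Def m (λ γ → GraphOf (s γ) (t γ) (u γ))
      iGraphOf ⦃ a ⦄ ⦃ b ⦄ ⦃ c ⦄ = sub3 (λ (∙ ▹ P ▹ G ▹ E) → GraphOf P G E) (any (iso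
        {P = λ (∙ ▹ P ▹ G ▹ E) → (∀ v → v ∈ G → Pr v × fst v ∈ num 12 × snd v ∈ P)
          × (∀ i → i ∈ num 12 → ∀ X → X ∈ P → ⟪ i ، X ⟫ ∈ G)
          × (∀ e → e ∈ E → Pr e × fst e ∈ G × snd e ∈ G × Edge (⋃ P) P (fst e) (snd e))
          × (∀ a → a ∈ G → ∀ b → b ∈ G → Edge (⋃ P) P a b → ⟪ a ، b ⟫ ∈ E)}
        (λ γ → mk⇔ (λ (a , b , c , d) → record { go-G = a ; go-G′ = b ; go-E = c ; go-E′ = d }) (λ g → go-G g , go-G′ g , go-E g , go-E′ g)) (find _))) a b c
      iLevelsAt : ∀ {m n} {s t u : Env n → V} ⦃ _ : DefT m s ⦄ ⦃ _ : DefT m t ⦄ ⦃ _ : DefT m u ⦄ → Def m (λ γ → LevelsAt (s γ) (t γ) (u γ))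
      iLevelsAt ⦃ a ⦄ ⦃ b ⦄ ⦃ c ⦄ = sub3 (λ (∙ ▹ P ▹ l ▹ f) → LevelsAt P l f) (any (iso
        {P = λ (∙ ▹ P ▹ l ▹ f) → (Ord l × (∃[ n ] (n ∈ l × ∅ ∈ n × (∀ z → z ∈ n → Nat z × sucV z ∈ n)))
          × (∀ z → z ∈ l → sucV z ∈ l) × Fn f l × (∀ β → β ∈ l → app f β ∈ P))
          × ((∀ β → β ∈ l → ∀ z → z ∈ app f β → ∃[ γ ] (γ ∈ β × (∀ w → w ∈ z → w ∈ app f γ)))
          × (∀ β → β ∈ l → ∀ γ → γ ∈ β → ∀ z → z ∈ P → (∀ w → w ∈ z → w ∈ app f γ) → z ∈ app f β))
          × (∀ z → z ∈ ⋃ P → ∃[ γ ] (γ ∈ l × (∀ w → w ∈ z → w ∈ app f γ)))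
          × (∀ γ → γ ∈ l → ∀ z → z ∈ P → (∀ w → w ∈ z → w ∈ app f γ) → z ∈ ⋃ P)}
        (λ γ → mk⇔ (λ ((a , b , c , d , e) , (f , g) , h , i) → record
            { lv-Ord = a ; lv-ω = b ; lv-suc = c ; lv-Fn = d ; lv-P = e ; lv-f = f ; lv-f′ = g ; lv-W = h ; lv-W′ = i })
          (λ l → (lv-Ord l , lv-ω l , lv-suc l , lv-Fn l , lv-P l) , (lv-f l , lv-f′ l) , lv-W l , lv-W′ l))
        (dAnd ⦃ find _ ⦄ ⦃ dAnd ⦃ find _ ⦄ ⦃ find _ ⦄ ⦄))) a b c
    -- 𝒫 W is not an absolute operation of W, but W = ⋃ P is one of P; so P is the variable from
    -- which everything is described.
    record RigidAt (P G E y : V) : Set ℓ where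
      field
        ra-graph : GraphOf P G E
        ra-levels : ∃[ l ] (l ∈ P × ∃[ f ] (f ∈ P × LevelsAt P l f))
        ra-power : y ⊆ ⋃ P → y ∈ P
        ra-rigid : HomGE y G E G E → ∀ v → v ∈ G → app y v ≡ v
    open RigidAt public
    opaque
     instance
      iRigidAt : ∀ {m n} {s t u v : Env n → V} ⦃ _ : DefT m s ⦄ ⦃ _ : DefT m t ⦄ ⦃ _ : DefT m u ⦄ ⦃ _ : DefT m v ⦄ → Def m (λ γ → RigidAt (s γ) (t γ) (u γ) (v γ))
      iRigidAt ⦃ a ⦄ ⦃ b ⦄ ⦃ c ⦄ ⦃ d ⦄ = sub4 (λ (∙ ▹ P ▹ G ▹ E ▹ y) → RigidAt P G E y) (any (iso
        {P = λ (∙ ▹ P ▹ G ▹ E ▹ y) → GraphOf P G E × (∃[ l ] (l ∈ P × ∃[ f ] (f ∈ P × LevelsAt P l f)))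
          × ((∀ z → z ∈ y → z ∈ ⋃ P) → y ∈ P) × (HomGE y G E G E → ∀ v → v ∈ G → app y v ≡ v)}
        (λ γ → mk⇔ (λ (a , b , c , d) → record { ra-graph = a ; ra-levels = b ; ra-power = c ; ra-rigid = d })
          (λ g → ra-graph g , ra-levels g , ra-power g , ra-rigid g)) (find _))) a b c d

    ⋃-𝒫 : ∀ {W} → ⋃ (𝒫 W) ≡ W
    ⋃-𝒫 = ext (λ z k → let (y , a , b) = to ∈⋃ k in to ∈𝒫 a z b) (λ z k → from ∈⋃ (_ , from ∈𝒫 (λ _ l → l) , k))

    private
      RT′ : Env 0 → V → V
      RT′ _ x = R x
      LvP : Env 2 → V → Set ℓ
      LvP (∙ ▹ l ▹ f) β = β ∈ l → app f β ≡ R β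

    module _ {P l f : V} (L : LevelsAt P l f) (pow : ∀ z → z ⊆ ⋃ P → z ∈ P) where
      private
        sub : ∀ {β z} → β ∈ l → z ⊆ app f β → z ∈ P
        sub k s = pow _ λ w m → from ∈⋃ (_ , lv-P L _ k , s w m)
      opaque
        lv-R : ∀ β → β ∈ l → app f β ≡ R β
        lv-R β k = Ord-ind LvP (∙ ▹ l ▹ f) (λ β _ ih k → let k′ = λ {γ} (m : γ ∈ β) → Ord-tr (lv-Ord L) m k in ext
            (λ z m → let (γ , γ∈ , s) = lv-f L β k z m in from ∈R (γ , γ∈ , subst (z ⊆_) (ih γ γ∈ (k′ γ∈)) s))
            (λ z m → let (γ , γ∈ , s) = to ∈R m ; s′ = subst (z ⊆_) (sym (ih γ γ∈ (k′ γ∈))) s in lv-f′ L β k γ γ∈ z (sub (k′ γ∈) s′) s′))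
          β (Ord-∈ (lv-Ord L) k) k
        lv-RU : RU (⋃ P)
        lv-RU = ru {ru-λ = l} (record { lim-Ord = lv-Ord L ; lim-ω = ω∈ (lv-ω L) ; lim-suc = lv-suc L }) (ext
            (λ z m → let (γ , γ∈ , s) = lv-W L z m in from ∈R (γ , γ∈ , subst (z ⊆_) (lv-R γ γ∈) s))
            (λ z m → let (γ , γ∈ , s) = to ∈R m ; s′ = subst (z ⊆_) (sym (lv-R γ γ∈)) s in lv-W′ L γ γ∈ z (sub γ∈ s′) s′))
          where
          ω∈ : ∃[ n ] (n ∈ l × ∅ ∈ n × (∀ z → z ∈ n → Nat z × sucV z ∈ n)) → ω ∈ l
          ω∈ (n , k , z , s) = subst (_∈ l) (ext (λ m h → from ∈ω (proj₁ (s m h)))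
            (ω-ind (λ (∙ ▹ n) m → m ∈ n) (∙ ▹ n) z λ m _ h → proj₂ (s m h))) k

    private
     opaque
      defRT′ : DefT full {1} (λ γ → RT′ (init γ) (last γ))
      defRT′ = findT _
    -- The height of W and the sequence of its levels are subsets of W, so both existential
    -- quantifiers in `RigidAt` can be bounded by P.
    LevelsAt-RU : ∀ {W} (r : RU W) → ∃[ l ] (l ∈ 𝒫 W × ∃[ f ] (f ∈ 𝒫 W × LevelsAt (𝒫 W) l f))
    LevelsAt-RU {W} r@(ru {l} L refl) = l , from ∈𝒫 (R-⊆ l) , f , from ∈𝒫 f⊆ , record
      { lv-Ord = lim-Ord L ; lv-ω = ω , lim-ω L , ∅∈ω , (λ z k → to ∈ω k , suc∈ω k) ; lv-suc = lim-suc L ; lv-Fn = lam-Fn RT′ ⦃ defRT′ ⦄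
      ; lv-P = λ β k → from ∈𝒫 (subst (_⊆ R l) (sym (val k)) (R-mono λ γ m → Ord-tr (lim-Ord L) m k))
      ; lv-f = λ β k z m → let (γ , γ∈ , s) = to ∈R (subst (z ∈_) (val k) m) in γ , γ∈ , subst (z ⊆_) (sym (val (Ord-tr (lim-Ord L) γ∈ k))) s
      ; lv-f′ = λ β k γ γ∈ z _ s → subst (z ∈_) (sym (val k)) (from ∈R (γ , γ∈ , subst (z ⊆_) (val (Ord-tr (lim-Ord L) γ∈ k)) s))
      ; lv-W = λ z m → let (γ , γ∈ , s) = to ∈R (subst (z ∈_) ⋃-𝒫 m) in γ , γ∈ , subst (z ⊆_) (sym (val γ∈)) s
      ; lv-W′ = λ γ γ∈ z _ s → subst (z ∈_) (sym ⋃-𝒫) (from ∈R (γ , γ∈ , subst (z ⊆_) (val γ∈) s)) }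
      where
      f : V
      f = lam RT′ ⦃ defRT′ ⦄ ∙ l
      val : ∀ {β} → β ∈ l → app f β ≡ R β
      val = lam-app RT′ ⦃ defRT′ ⦄
      f⊆ : f ⊆ R l
      f⊆ p m = let (β , k , e) = to (∈lam RT′ ⦃ defRT′ ⦄) m in subst (_∈ R l) (sym e) (ru-⟪⟫ r (R-⊆ l _ k) (R-∈ k))

    GraphOf-Γ : ∀ {W} → GraphOf (𝒫 W) (GV (𝒫 W)) (GE W (𝒫 W))
    GraphOf-Γ {W} = record
      { go-G = λ v k → let (a , b , e) = ∈GV k in e , a , b
      ; go-G′ = λ i a X b → from pair∈⊗ (a , b)
      ; go-E = λ e k → let (p , q , _ , _ , x) = GE-pair k in f x k
      ; go-E′ = λ a k b l e → from ∈GE (k , l , subst (λ W → Edge W (𝒫 _) a b) ⋃-𝒫 e) }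
      where
      f : ∀ {e p q} → e ≡ ⟪ p ، q ⟫ → e ∈ GE W (𝒫 W) → Pr e × fst e ∈ GV (𝒫 W) × snd e ∈ GV (𝒫 W) × Edge (⋃ (𝒫 W)) (𝒫 W) (fst e) (snd e)
      f refl k = let (a , b , c) = to ∈GE k in Pr-⟪⟫ , subst (_∈ GV (𝒫 W)) (sym fst-⟪⟫) a , subst (_∈ GV (𝒫 W)) (sym snd-⟪⟫) b ,
        subst₂ (Edge (⋃ (𝒫 W)) (𝒫 W)) (sym fst-⟪⟫) (sym snd-⟪⟫) (subst (λ W → Edge W (𝒫 _) _ _) (sym ⋃-𝒫) c)
    ⇒Γ : ∀ {P G E} → GraphOf P G E → G ≡ GV P × E ≡ GE (⋃ P) P
    ⇒Γ {P} {G} {E} g = eG , ext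
        (λ e k → let (p , a , b , c) = go-E g e k in subst (_∈ GE (⋃ P) P) (sym p) (from ∈GE (subst (_ ∈_) eG a , subst (_ ∈_) eG b , c)))
        (λ e k → let (p , q , _ , _ , x) = GE-pair k in f x k)
      where
      eG : G ≡ GV P
      eG = ext (λ v k → let (p , a , b) = go-G g v k in subst (_∈ GV P) (sym p) (from pair∈⊗ (a , b)))
               (λ v k → let (a , b , e) = ∈GV k in subst (_∈ G) (sym e) (go-G′ g _ a _ b))
      f : ∀ {e p q} → e ≡ ⟪ p ، q ⟫ → e ∈ GE (⋃ P) P → e ∈ E
      f refl k = let (a , b , c) = to ∈GE k in go-E′ g _ (subst (_ ∈_) (sym eG) a) _ (subst (_ ∈_) (sym eG) b) c

    Rig⇒ : ∀ {W} → Rig W → ∀ y → RigidAt (𝒫 W) (GV (𝒫 W)) (GE W (𝒫 W)) y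
    Rig⇒ {W} d y = record
      { ra-graph = GraphOf-Γ ; ra-levels = LevelsAt-RU (rig-RU d)
      ; ra-power = λ s → from ∈𝒫 (subst (y ⊆_) ⋃-𝒫 s)
      ; ra-rigid = λ H v k → let (a , b , e) = ∈GV k in
          trans (cong (app y) e) (trans (FromGraph.g-val H a (to ∈𝒫 b)) (trans (cong ⟪ fst v ،_⟫ (rig-id d _ (FromGraph.h-SH H) _ (to ∈𝒫 b))) (sym e))) }

    -- Subsets of W test that P is the power set, and subsets of G ⊗ G test rigidity. As only these
    -- are asked for, y may be confined to any larger universe.
    ⇒Rig : ∀ {P G E} → (∀ y → y ⊆ ⋃ P ⊎ y ⊆ G ⊗ G → RigidAt P G E y) → Rig (⋃ P) × P ≡ 𝒫 (⋃ P) × ⟪ G ، E ⟫ ≡ Γ (⋃ P)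
    ⇒Rig {P} {G} {E} f = rig (let (_ , _ , _ , _ , L) = ra-levels at∅ in lv-RU L pow) rigid , eP ,
        cong₂ ⟪_،_⟫ (trans eG (cong GV eP)) (trans eE (cong (GE (⋃ P)) eP))
      where
      at∅ : RigidAt P G E ∅
      at∅ = f ∅ (inj₁ λ z k → ⊥-elim (∉∅ k))
      pow : ∀ z → z ⊆ ⋃ P → z ∈ P
      pow z s = ra-power (f z (inj₁ s)) s
      eP : P ≡ 𝒫 (⋃ P)
      eP = ext (λ z k → from ∈𝒫 λ w l → from ∈⋃ (z , k , l)) (λ z k → pow z (to ∈𝒫 k))
      eG = proj₁ (⇒Γ (ra-graph at∅))
      eE = proj₂ (⇒Γ (ra-graph at∅))
      HG : ∀ {h} → SH (⋃ P) (⋃ P) h → ∃[ g ] (HomGE g G E G E × (∀ X → X ⊆ ⋃ P → app g ⟪ ∅ ، X ⟫ ≡ ⟪ ∅ ، app h X ⟫))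
      HG {h} S = _ , cast (sym (trans eG (cong GV eP))) (sym (trans eE (cong (GE (⋃ P)) eP))) (SH⇒HomGE S) , λ X s →
        trans (SH-val (from pair∈⊗ (∅∈num (s≤s z≤n) , from ∈𝒫 s))) (cong₂ ⟪_،_⟫ fst-⟪⟫ (cong (app h) snd-⟪⟫))
        where
        cast : ∀ {g A B A′ B′} → A ≡ A′ → B ≡ B′ → HomGE g A B A B → HomGE g A′ B′ A′ B′
        cast refl refl H = H
      hom-⊆ : ∀ {g} → HomGE g G E G E → g ⊆ G ⊗ G
      hom-⊆ {g} H p k = let (x , x∈ , y , e) = fn-rel (hom-Fn H) p k in subst (_∈ G ⊗ G) (sym e)
        (from pair∈⊗ (x∈ , subst (_∈ G) (app-eq (hom-Fn H) (subst (_∈ g) e k)) (hom-into H x x∈)))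
      rigid : ∀ h → SH (⋃ P) (⋃ P) h → ∀ X → X ⊆ ⋃ P → app h X ≡ X
      rigid h S X s = let (g , H , v) = HG S in ⟪⟫-inj₂ (trans (sym (v X s)) (ra-rigid (f g (inj₂ (hom-⊆ H))) H _
        (subst (⟪ ∅ ، X ⟫ ∈_) (sym eG) (from pair∈⊗ (∅∈num (s≤s z≤n) , pow X s)))))
  open Codes public

  -- Enumeration of the rigid universes.

  module Sequences where
    private
      RiP : Env 2 → Set ℓ
      RiP (∙ ▹ W ▹ U) = ∃[ P ] (P ∈ W × ∃[ G ] (G ∈ W × ∃[ E ] (E ∈ W × ⋃ P ≡ U × (∀ y → y ∈ W → RigidAt P G E y))))
    -- Rigidity of U as seen from a universe W above it; bounded by W, it can occur in an absolute
    -- matrix.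
    record RigIn (W U : V) : Set ℓ where
      constructor rigIn
      field
        ri : RiP (∙ ▹ W ▹ U)
    open RigIn public
    opaque
     private instance
      iRigIn : ∀ {m n} {s t : Env n → V} ⦃ _ : DefT m s ⦄ ⦃ _ : DefT m t ⦄ → Def m (λ γ → RigIn (s γ) (t γ))
      iRigIn ⦃ a ⦄ ⦃ b ⦄ = sub2 (λ (∙ ▹ W ▹ U) → RigIn W U) (any (iso {P = RiP} (λ γ → mk⇔ rigIn ri) (find _))) a b

    RU-⊗ : ∀ {W a b} → RU W → a ∈ W → b ∈ W → a ⊗ b ∈ W
    RU-⊗ (ru l refl) h k = Lim-⊗ l h k

    -- The height of W is a limit, so W contains the power set of U, the graph, and every subset of
    -- U and of the squared vertex set: all that `⇒Rig` tests.
    RigIn⇔ : ∀ {W U} → RU W → U ∈ W → RigIn W U ⇔ Rig U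
    RigIn⇔ {W} {U} r u = mk⇔
      (λ (rigIn (P , P∈ , G , G∈ , E , E∈ , e , f)) → subst Rig e (proj₁ (⇒Rig λ { y (inj₁ s) → f y (ru-super r (cl-⋃ (ru-Good r) P∈) s)
                                                                         ; y (inj₂ s) → f y (ru-super r (RU-⊗ r G∈ G∈) s) })))
      (λ d → rigIn (𝒫 U , ru-𝒫 r u , GV (𝒫 U) , g , GE U (𝒫 U) , ru-super r (RU-⊗ r g g) (λ e k → let (p , q , a , b , x) = GE-pair k in
                subst (_∈ GV (𝒫 U) ⊗ GV (𝒫 U)) (sym x) (from pair∈⊗ (a , b))) , ⋃-𝒫 , λ y _ → Rig⇒ d y))
      where
      g : GV (𝒫 U) ∈ W
      g = RU-⊗ r (ru-Tr r (num∈ω 12) (ru-ω r)) (ru-𝒫 r u)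

    -- α is the order type of the rigid universes in W.

    record Index (W D f α : V) : Set ℓ where
      field
        ix-D : ∀ U → U ∈ D → U ∈ W × RigIn W U
        ix-D′ : ∀ U → U ∈ W → RigIn W U → U ∈ D
        ix-Fn : Fn f D
        ix-f : ∀ U → U ∈ D → ∀ z → z ∈ app f U → ∃[ U′ ] (U′ ∈ D × U′ ∈ U × z ≡ app f U′)
        ix-f′ : ∀ U → U ∈ D → ∀ U′ → U′ ∈ D → U′ ∈ U → app f U′ ∈ app f U
        ix-α : ∀ z → z ∈ α → ∃[ U ] (U ∈ D × z ≡ app f U)
        ix-α′ : ∀ U → U ∈ D → app f U ∈ α
    open Index public
    opaque
     instance
      iIndex : ∀ {m n} {s t u v : Env n → V} ⦃ _ : DefT m s ⦄ ⦃ _ : DefT m t ⦄ ⦃ _ : DefT m u ⦄ ⦃ _ : DefT m v ⦄ → Def m (λ γ → Index (s γ) (t γ) (u γ) (v γ))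
      iIndex ⦃ a ⦄ ⦃ b ⦄ ⦃ c ⦄ ⦃ d ⦄ = sub4 (λ (∙ ▹ W ▹ D ▹ f ▹ α) → Index W D f α) (any (iso
        {P = λ (∙ ▹ W ▹ D ▹ f ▹ α) → (∀ U → U ∈ D → U ∈ W × RigIn W U) × (∀ U → U ∈ W → RigIn W U → U ∈ D) × Fn f D
          × (∀ U → U ∈ D → ∀ z → z ∈ app f U → ∃[ U′ ] (U′ ∈ D × U′ ∈ U × z ≡ app f U′))
          × (∀ U → U ∈ D → ∀ U′ → U′ ∈ D → U′ ∈ U → app f U′ ∈ app f U)
          × (∀ z → z ∈ α → ∃[ U ] (U ∈ D × z ≡ app f U))
          × (∀ U → U ∈ D → app f U ∈ α)}
        (λ γ → mk⇔ (λ (a , b , c , d , e , f , g) → record { ix-D = a ; ix-D′ = b ; ix-Fn = c ; ix-f = d ; ix-f′ = e ; ix-α = f ; ix-α′ = g })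
          (λ i → ix-D i , ix-D′ i , ix-Fn i , ix-f i , ix-f′ i , ix-α i , ix-α′ i)) (find _))) a b c d

    private
      RgP : Env 0 → V → Set ℓ
      RgP _ U = Rig U
      VsP OrP : Env 2 → V → Set ℓ
      VsP (∙ ▹ D ▹ f) U = U ∈ D → app f U ⊆ U
      OrP (∙ ▹ D ▹ f) U = U ∈ D → Ord (app f U)
      AgP : Env 3 → V → Set ℓ
      AgP (∙ ▹ D ▹ f ▹ f′) U = U ∈ D → app f U ≡ app f′ U
      IdG : V → V → V → V
      IdG p c s = s

    module _ {W D f α : V} (r : RU W) (i : Index W D f α) where
      ix-Rig : ∀ {U} → U ∈ D → U ∈ W × Rig U
      ix-Rig {U} k = let (u , d) = ix-D i U k in u , to (RigIn⇔ r u) d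
      ix-in : ∀ {U} → U ∈ W → Rig U → U ∈ D
      ix-in u d = ix-D′ i _ u (from (RigIn⇔ r u) d)
      -- Keeps the indices inside W, so that f is a subset of W and the quantifier over f can be
      -- bounded by the power set.
      ix-val : ∀ U → U ∈ D → app f U ⊆ U
      ix-val = ∈-ind VsP (∙ ▹ D ▹ f) λ U ih k z m → let (U′ , k′ , u , e) = ix-f i U k z m in
        subst (_∈ U) (sym e) (ru-super (rig-RU (proj₂ (ix-Rig k))) u (ih U′ u k′))
      ix-f∈ : f ∈ 𝒫 W
      ix-f∈ = from ∈𝒫 λ p k → let (U , k′ , y , e) = fn-rel (ix-Fn i) p k ; u = proj₁ (ix-Rig k′) in
        subst (_∈ W) (sym e) (ru-⟪⟫ r u (subst (_∈ W) (app-eq (ix-Fn i) (subst (_∈ f) e k)) (ru-super r u (ix-val U k′))))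
      ix-ord : ∀ U → U ∈ D → Ord (app f U)
      ix-ord = ∈-ind OrP (∙ ▹ D ▹ f) λ U ih k → record
        { ordTr = record { trn = λ y m z l → let (U′ , k′ , u , e) = ix-f i U k y m ; (U″ , k″ , u′ , e′) = ix-f i U′ k′ z (subst (z ∈_) e l) in
            subst (_∈ app f U) (sym e′) (ix-f′ i U k U″ k″ (ru-Tr (rig-RU (proj₂ (ix-Rig k))) u′ u)) }
        ; ordTr′ = λ y m → let (U′ , k′ , u , e) = ix-f i U k y m in subst Tr (sym e) (ordTr (ih U′ u k′)) }
      ix-Ord : Ord α
      ix-Ord = record
        { ordTr = record { trn = λ y m z l → let (U , k , e) = ix-α i y m ; (U′ , k′ , u , e′) = ix-f i U k z (subst (z ∈_) e l) in
            subst (_∈ α) (sym e′) (ix-α′ i U′ k′) }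
        ; ordTr′ = λ y m → let (U , k , e) = ix-α i y m in subst Tr (sym e) (ordTr (ix-ord U k)) }

    module _ {W D f α W′ D′ f′ α′ : V} (r : RU W) (r′ : RU W′) (s : W ⊆ W′) (i : Index W D f α) (i′ : Index W′ D′ f′ α′) where
      ix-⊆ : ∀ {U} → U ∈ D → U ∈ D′
      ix-⊆ k = let (u , d) = ix-Rig r i k in ix-in r′ i′ (s _ u) d
      ix-agree : ∀ U → U ∈ D → app f U ≡ app f′ U
      ix-agree = ∈-ind AgP (∙ ▹ D ▹ f ▹ f′) λ U ih k → ext
        (λ z m → let (U′ , k′ , u , e) = ix-f i U k z m in
          subst (_∈ app f′ U) (sym (trans e (ih U′ u k′))) (ix-f′ i′ U (ix-⊆ k) U′ (ix-⊆ k′) u))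
        (λ z m → let (U′ , k′ , u , e) = ix-f i′ U (ix-⊆ k) z m
                     k″ = ix-in r i (ru-Tr r u (proj₁ (ix-Rig r i k))) (proj₂ (ix-Rig r′ i′ k′))
                 in subst (_∈ app f U) (trans (ih U′ u k″) (sym e)) (ix-f′ i U k U′ k″ u))

    ix-uniq : ∀ {W D f α D′ f′ α′} → RU W → Index W D f α → Index W D′ f′ α′ → α ≡ α′
    ix-uniq {W} r i i′ = ext (half i i′) (half i′ i)
      where
      half : ∀ {D f α D′ f′ α′} → Index W D f α → Index W D′ f′ α′ → ∀ z → z ∈ α → z ∈ α′
      half {α′ = α′} i i′ z m = let (U , k , e) = ix-α i z m in
        subst (_∈ α′) (sym (trans e (ix-agree r r (λ _ k → k) i i′ U k))) (ix-α′ i′ U (ix-⊆ r r (λ _ k → k) i i′ k))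
    -- The rigid universes in W are the predecessors of W among those in W′, so W′ already computes
    -- the index of W.
    ix-seg : ∀ {W D f α W′ D′ f′ α′} → RU W → RU W′ → W ∈ D′ → Index W D f α → Index W′ D′ f′ α′ → α ≡ app f′ W
    ix-seg {W} {D} {f} {α} {W′} {D′} {f′} {α′} r r′ w i i′ = ext
      (λ z m → let (U , k , e) = ix-α i z m in subst (_∈ app f′ W) (sym (trans e (ix-agree r r′ s i i′ U k)))
        (ix-f′ i′ W w U (ix-⊆ r r′ s i i′ k) (proj₁ (ix-Rig r i k))))
      (λ z m → let (U , k , u , e) = ix-f i′ W w z m ; k′ = ix-in r i u (proj₂ (ix-Rig r′ i′ k)) in
        subst (_∈ α) (trans (ix-agree r r′ s i i′ U k′) (sym e)) (ix-α′ i U k′))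
      where
      s : W ⊆ W′
      s = RU-⊆ r′ (proj₁ (ix-Rig r′ i′ w))

    private
     opaque
      defRgP : Def full {1} (λ γ → RgP (init γ) (last γ))
      defRgP = find _
    opaque
      ix-exists : ∀ W → RU W → ∃[ D ] ∃[ f ] ∃[ α ] Index W D f α
      ix-exists W r = D , f , f ″ D , record
        { ix-D = λ U k → let (u , d) = to ∈D k in u , from (RigIn⇔ r u) d
        ; ix-D′ = λ U u d → from ∈D (u , to (RigIn⇔ r u) d)
        ; ix-Fn = proj₁ (proj₂ rec)
        ; ix-f = λ U k z m → let (U′ , l , e) = to ∈″ (subst (z ∈_) (eqn U k) m) ; (k′ , p) = to ∈pre l in U′ , k′ , proj₂ (proj₂ (to ⟪⟫∈On p)) , e
        ; ix-f′ = λ U k U′ k′ u → subst (app f U′ ∈_) (sym (eqn U k)) (from ∈″ (U′ , from ∈pre (k′ , from ⟪⟫∈On (k′ , k , u)) , refl))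
        ; ix-α = λ z m → to ∈″ m
        ; ix-α′ = λ U k → from ∈″ (U , k , refl) }
        where
        D : V
        D = sep RgP ⦃ defRgP ⦄ ∙ W
        ∈D : ∀ {U} → U ∈ D ⇔ (U ∈ W × Rig U)
        ∈D = ∈sep RgP ⦃ defRgP ⦄ ∙ W
        rec : ∃[ f ] (Fn f D × (∀ c → c ∈ D → app f c ≡ f ″ pre D (∈On D) c))
        rec = WfRec.wf-rec IdG ∅ D (∈On D) (∈On-WF D)
        f : V
        f = proj₁ rec
        eqn : ∀ U → U ∈ D → app f U ≡ f ″ pre D (∈On D) U
        eqn = proj₂ (proj₂ rec)

    record Ix (W α : V) : Set ℓ where
      constructor ix
      field
        {ix-DD ix-ff} : V
        ix-rig : Rig W
        ix-ix : Index W ix-DD ix-ff α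
    open Ix public
    opaque
     instance
      iIx : ∀ {n} {s t : Env n → V} ⦃ _ : DefT full s ⦄ ⦃ _ : DefT full t ⦄ → Def full (λ γ → Ix (s γ) (t γ))
      iIx ⦃ a ⦄ ⦃ b ⦄ = sub2 (λ (∙ ▹ W ▹ α) → Ix W α) (iso {P = λ (∙ ▹ W ▹ α) → Rig W × ∃[ D ] ∃[ f ] Index W D f α}
        (λ γ → mk⇔ (λ (a , _ , _ , b) → ix a b) (λ (ix a b) → a , _ , _ , b)) (find _)) a b

    Ix-Ord : ∀ {W α} → Ix W α → Ord α
    Ix-Ord (ix d i) = ix-Ord (rig-RU d) i
    Ix-mono : ∀ {W α W′ α′} → Ix W α → Ix W′ α′ → W ∈ W′ → α ∈ α′
    Ix-mono {α′ = α′} (ix d i) (ix d′ i′) k = let w = ix-in (rig-RU d′) i′ k d in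
      subst (_∈ α′) (sym (ix-seg (rig-RU d) (rig-RU d′) w i i′)) (ix-α′ i′ _ w)
    Ix-uniq : ∀ {W α α′} → Ix W α → Ix W α′ → α ≡ α′
    Ix-uniq (ix d i) (ix _ i′) = ix-uniq (rig-RU d) i i′
    Ix-refl : ∀ {W α W′ α′} → Ix W α → Ix W′ α′ → α ∈ α′ → W ∈ W′
    Ix-refl {W} {α} {W′} {α′} p q k = f (RU-cmp (rig-RU (ix-rig p)) (rig-RU (ix-rig q)))
      where
      f : W ∈ W′ ⊎ W ≡ W′ ⊎ W′ ∈ W → W ∈ W′
      f (inj₁ h) = h
      f (inj₂ (inj₁ refl)) = ⊥-elim (∈-irrefl (subst (_∈ α′) (Ix-uniq p q) k))
      f (inj₂ (inj₂ h)) = ⊥-elim (∈-asym k (Ix-mono q p h))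
    Ix-inj : ∀ {W α W′} → Ix W α → Ix W′ α → W ≡ W′
    Ix-inj {W} {α} {W′} p q = f (RU-cmp (rig-RU (ix-rig p)) (rig-RU (ix-rig q)))
      where
      f : W ∈ W′ ⊎ W ≡ W′ ⊎ W′ ∈ W → W ≡ W′
      f (inj₁ h) = ⊥-elim (∈-irrefl (Ix-mono p q h))
      f (inj₂ (inj₁ e)) = e
      f (inj₂ (inj₂ h)) = ⊥-elim (∈-irrefl (Ix-mono q p h))

    private
      SuP : Env 1 → Set ℓ
      SuP (∙ ▹ α) = ∃[ W ] Ix W α
      SuT : V → V → V → Set ℓ
      SuT _ β W = (∃[ U ] Ix U β) → Ix W β
      opaque
        dSuT : Def full {3} (λ γ → SuT (last (init (init γ))) (last (init γ)) (last γ))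
        dSuT = find _
    private
     opaque
      defSuP : Def full SuP
      defSuP = find _
    opaque
      -- If α is no index, all indices are below α, as a larger one would pass through α. Collection
      -- then bounds the universes with an index below α, but some rigid universe lies above the
      -- bound.
      Ix-onto : (∀ z → ∃[ W ] (Rig W × z ∈ W)) → ∀ α → Ord α → ∃[ W ] Ix W α
      Ix-onto unb α o = by-contra SuP ⦃ defSuP ⦄ (∙ ▹ α) λ no →
        let (W , d , k) = unb (R (Choice.bnd SuT dSuT ∅ α))
            (D , f , β , i) = ix-exists W (rig-RU d)
            β∈ = below no d i (Ord-cmp (ix-Ord (rig-RU d) i) o)
            (U , U∈ , q) = Choice.bnd-∈ SuT dSuT total β β∈
            U≡W = Ix-inj (q (W , ix d i)) (ix d i)
        in ∈-asym k (subst (_∈ R (Choice.bnd SuT dSuT ∅ α)) U≡W U∈)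
        where
        total : ∀ β → β ∈ α → ∃[ W ] SuT ∅ β W
        total β _ = f (lem SuP ⦃ defSuP ⦄ (∙ ▹ β))
          where
          f : SuP (∙ ▹ β) ⊎ ¬ SuP (∙ ▹ β) → ∃[ W ] SuT ∅ β W
          f (inj₁ (U , p)) = U , λ _ → p
          f (inj₂ n) = ∅ , λ m → ⊥-elim (n m)
        below : ¬ (∃[ W ] Ix W α) → ∀ {W D f β} → Rig W → Index W D f β → β ∈ α ⊎ β ≡ α ⊎ α ∈ β → β ∈ α
        below no d i (inj₁ h) = h
        below no d i (inj₂ (inj₁ refl)) = ⊥-elim (no (_ , ix d i))
        below no d i (inj₂ (inj₂ h)) = let (U , k , e) = ix-α i α h ; (u , d′) = ix-Rig (rig-RU d) i k ; (_ , _ , β , i′) = ix-exists U (rig-RU d′) in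
          ⊥-elim (no (U , subst (Ix U) (trans (ix-seg (rig-RU d′) (rig-RU d) k i′ i) (sym e)) (ix d′ i′)))
  open Sequences public

  -- The Π₁ class, the Π₁ sequence and the equivalences.

  module Conclusion where
    private
      -- This determines P from the vertices. As a premise under a universal quantifier over P it
      -- replaces an existential quantifier, which would spoil the Π₁ form.
      Pro : V → V → Set ℓ
      Pro P G = (∀ X → X ∈ P → ∃[ v ] (v ∈ G × X ≡ snd v)) × (∀ v → v ∈ G → snd v ∈ P)
      SndT : Env 0 → V → V
      SndT _ v = snd v
      GrP IxP : Env 3 → Set ℓ
      GrP (∙ ▹ A ▹ P ▹ y) = Pr A × (Pro P (fst A) → RigidAt P (fst A) (snd A) y)
      IxP (∙ ▹ p ▹ P ▹ y) = (Pr p × Pr (snd p)) × (Pro P (fst (snd p)) → RigidAt P (fst (snd p)) (snd (snd p)) y ×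
        (∃[ D ] (D ∈ P × ∃[ f ] (f ∈ P × Index (⋃ P) D f (fst p)))))
      opaque
        dGrP : Def abs GrP
        dGrP = find _
        dIxP : Def abs IxP
        dIxP = find _
      opaque
        defSndT : DefT full {1} (λ γ → SndT (init γ) (last γ))
        defSndT = findT _
      snds : V → V
      snds G = img SndT ⦃ defSndT ⦄ ∙ G
      Pro-snds : ∀ {G} → Pro (snds G) G
      Pro-snds = (λ X k → to (∈img SndT ⦃ defSndT ⦄) k) , λ v k → from (∈img SndT ⦃ defSndT ⦄) (v , k , refl)
      Pro-GV : ∀ {P P′ G} → G ≡ GV P′ → Pro P G → P ≡ P′
      Pro-GV {P} {P′} refl (f , g) = ext
        (λ X k → let (v , l , e) = f X k in subst (_∈ P′) (sym e) (proj₁ (proj₂ (∈GV l))))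
        (λ X k → subst (_∈ P) snd-⟪⟫ (g _ (from pair∈⊗ (∅∈num (s≤s z≤n) , k))))
      Γ-rigid : ∀ {W P G E} → Rig W → ⟪ G ، E ⟫ ≡ Γ W → Pro P G → ∀ y → RigidAt P G E y
      Γ-rigid {W} {P} d e p y = f (Pro-GV (⟪⟫-inj₁ e) p) (⟪⟫-inj₁ e) (⟪⟫-inj₂ e)
        where
        f : ∀ {G E} → P ≡ 𝒫 W → G ≡ GV (𝒫 W) → E ≡ GE W (𝒫 W) → RigidAt P G E y
        f refl refl refl = Rig⇒ d y

    Γ-class : ∃[ φ ] (IsΠ 1 φ × (∀ A → (𝕍 ⊨ φ [ A ∷ [] ]) ⇔ (∃[ W ] (Rig W × A ≡ Γ W))))
    Γ-class = let (φ , π , e) = Π₁-formula GrP ⦃ dGrP ⦄ in φ , π , λ A → e A ∙⇔ mk⇔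
      (λ f → let p = proj₁ (f ∅ ∅) ; (d , _ , q) = ⇒Rig (λ y _ → proj₂ (f (snds (fst A)) y) Pro-snds) in _ , d , trans p q)
      (λ { (W , d , refl) P y → Pr-⟪⟫ , λ p → Γ-rigid d (sym Pr-⟪⟫) p y })

    Γ-sequence : ∃[ φ ] (IsΠ 1 φ × (∀ p → (𝕍 ⊨ φ [ p ∷ [] ]) ⇔ (∃[ α ] ∃[ W ] (Ix W α × p ≡ ⟪ α ، Γ W ⟫))))
    Γ-sequence = let (φ , π , e) = Π₁-formula IxP ⦃ dIxP ⦄ in φ , π , λ p → e p ∙⇔ mk⇔
      decode
      (λ { (α , W , ix {D} {f} d i , refl) P y →
          let r = rig-RU d
              e : ⟪ fst (snd ⟪ α ، Γ W ⟫) ، snd (snd ⟪ α ، Γ W ⟫) ⟫ ≡ Γ W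
              e = trans (cong₂ ⟪_،_⟫ (cong fst snd-⟪⟫) (cong snd snd-⟪⟫)) (sym Pr-⟪⟫)
          in (Pr-⟪⟫ , subst Pr (sym snd-⟪⟫) Pr-⟪⟫) , λ p → Γ-rigid d e p y ,
               sequel D f (Pro-GV (⟪⟫-inj₁ e) p) (sym fst-⟪⟫) r i })
      where
      decode : ∀ {p} → (∀ P y → IxP (∙ ▹ p ▹ P ▹ y)) → ∃[ α ] ∃[ W ] (Ix W α × p ≡ ⟪ α ، Γ W ⟫)
      decode {p} f =
        let (pp , pp′) = proj₁ (f ∅ ∅)
            P = snds (fst (snd p))
            (d , _ , q) = ⇒Rig (λ y _ → proj₁ (proj₂ (f P y) Pro-snds))
            (D , _ , g , _ , i) = proj₂ (proj₂ (f P ∅) Pro-snds)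
        in fst p , ⋃ P , ix d i , trans pp (cong ⟪ fst p ،_⟫ (trans pp′ q))
      sequel : ∀ {W P α a} D f → P ≡ 𝒫 W → α ≡ a → RU W → Index W D f α → ∃[ D ] (D ∈ P × ∃[ f ] (f ∈ P × Index (⋃ P) D f a))
      sequel D f refl refl r i = D , from ∈𝒫 (λ U k → proj₁ (ix-Rig r i k)) , f , ix-f∈ r i , subst (λ W → Index W D f _) (sym ⋃-𝒫) i

    -- Given S, take rigid W and W′ with S ∈ W ∈ W′. Restrictions map the graph of W to each member
    -- of S, hence to the product, and the product maps to the graph of W′; the composite
    -- contradicts `no-hom`.
    PRP⇒strong : PRP (𝚷 1) → ExistsStrong
    PRP⇒strong prp = f dichotomy
      where
      f : ExistsStrong ⊎ (∀ z → ∃[ W ] (Rig W × z ∈ W)) → ExistsStrong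
      f (inj₁ s) = s
      f (inj₂ unb) = let (φ , π , e) = Γ-class
                         graphs = λ G g → subst IsGraph (sym (proj₂ (proj₂ (to (e G) g)))) IsGraph-Γ
                     in ⊥-elim (absurd φ e (prp φ π
                       -- The class is proper: a rigid W containing the set of all these graphs
                       -- would contain its own graph, hence itself.
                       (λ (x , q) → let (W , d , k) = unb x in
                          ∈-irrefl (Γ∉ (rig-RU d) (ru-Tr (rig-RU d) (from (q _) (from (e _) (W , d , refl))) k))) graphs))
        where
        absurd : ∀ φ → (∀ A → (𝕍 ⊨ φ [ A ∷ [] ]) ⇔ (∃[ W ] (Rig W × A ≡ Γ W))) →
                 ¬ (∃[ S ] (∀ A → A ∈ S → ⟦ class₀ φ ⟧ A) × (∃[ P ] IsProduct P S × (∀ G → ⟦ class₀ φ ⟧ G → ∃[ h ] IsHom h P G)))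
        absurd φ e (S , sub , P , pr , out) =
          let (W , d , S∈) = unb S
              (W′ , d′ , W∈) = unb W
              (g , H) = tupling pr (IsGraph-Γ {W}) λ A k → let (U , u , q) = to (e A) (sub A k) in
                subst (λ A → ∃[ h ] Hom h (Γ W) A) (sym q) (restriction u d (RU-⊆ (rig-RU d)
                  (Γ∉ (rig-RU d) (subst (_∈ W) q (ru-Tr (rig-RU d) k S∈)))))
              (g′ , H′) = out (Γ W′) (from (e _) (W′ , d′ , refl))
          in no-hom d d′ W∈ (proj₂ (⊙-Hom (from (Hom⇔ {g′} {P} {Γ W′}) H′) H))

    WVP⇒strong : WVP (𝚷 1) → ExistsStrong
    WVP⇒strong wvp = f dichotomy
      where
      f : ExistsStrong ⊎ (∀ z → ∃[ W ] (Rig W × z ∈ W)) → ExistsStrong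
      f (inj₁ s) = s
      f (inj₂ unb) = let (φ , π , e) = Γ-sequence in ⊥-elim (wvp (φ , π , sequence φ e))
        where
        module _ (φ : Formula 1) (e : ∀ p → (𝕍 ⊨ φ [ p ∷ [] ]) ⇔ (∃[ α ] ∃[ W ] (Ix W α × p ≡ ⟪ α ، Γ W ⟫))) where
          at : ∀ {α G} → class₀ φ ∋ᶜ⟨ α ⨾ G ⟩ → ∃[ W ] (Ix W α × G ≡ Γ W)
          at {α} {G} k = g (to (e _) (to (∋ᶜ⇔ {φ}) k))
            where
            g : ∃[ β ] ∃[ W ] (Ix W β × ⟪ α ، G ⟫ ≡ ⟪ β ، Γ W ⟫) → ∃[ W ] (Ix W α × G ≡ Γ W)
            g (β , W , i , q) = W , subst (Ix W) (sym (⟪⟫-inj₁ q)) i , ⟪⟫-inj₂ q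
          ⊆-of : ∀ {W W′ α β} → Ix W α → Ix W′ β → α ≼ β → W ⊆ W′
          ⊆-of i i′ (inj₁ k) = RU-⊆ (rig-RU (ix-rig i′)) (Ix-refl i i′ k)
          ⊆-of {W} i i′ (inj₂ refl) = subst (W ⊆_) (Ix-inj i i′) λ _ k → k
          unique : ∀ {W W′ A B} → Rig W → Rig W′ → W ⊆ W′ → A ≡ Γ W → B ≡ Γ W′ → ∃! _≡_ λ h → IsHom h B A
          unique {W} {W′} d d′ s refl refl = let (g , H) = restriction d d′ s in
            g , to (Hom⇔ {g} {Γ W′} {Γ W}) H , λ {g′} K → hom-unique d d′ s H (from (Hom⇔ {g′} {Γ W′} {Γ W}) K)
          none : ∀ {W W′ A B} → Rig W → Rig W′ → W ∈ W′ → A ≡ Γ W → B ≡ Γ W′ → ¬ (∃[ h ] IsHom h A B)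
          none {W} {W′} d d′ k refl refl (g , K) = no-hom d d′ k (from (Hom⇔ {g} {Γ W} {Γ W′}) K)
          sequence : IsGraphSequence (class₀ φ)
            × (∀ α β A B → class₀ φ ∋ᶜ⟨ α ⨾ A ⟩ → class₀ φ ∋ᶜ⟨ β ⨾ B ⟩ → α ≼ β → ∃! _≡_ λ h → IsHom h B A)
            × (∀ α β A B → class₀ φ ∋ᶜ⟨ α ⨾ A ⟩ → class₀ φ ∋ᶜ⟨ β ⨾ B ⟩ → α ∈ β → ¬ (∃[ h ] IsHom h A B))
          sequence =
            (((λ p k → let (α , W , i , q) = to (e p) k in α , Γ W , to Ord⇔ (Ix-Ord i) , from ≐⇔ q)
             , (λ α o → let (W , i) = Ix-onto unb α (from Ord⇔ o) in Γ W , from (∋ᶜ⇔ {φ}) (from (e _) (α , W , i , refl)) ,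
                  λ k → let (W′ , i′ , q) = at k in trans (cong Γ (Ix-inj i i′)) (sym q)))
            , (λ α G k → let (W , _ , q) = at k in subst IsGraph (sym q) IsGraph-Γ))
            , (λ α β A B k l m → let (W , i , q) = at k ; (W′ , i′ , q′) = at l in
                 unique (ix-rig i) (ix-rig i′) (⊆-of i i′ m) q q′)
            , (λ α β A B k l m → let (W , i , q) = at k ; (W′ , i′ , q′) = at l in
                 none (ix-rig i) (ix-rig i′) (Ix-refl i i′ m) q q′)

    PRP-Π⊆Σ : PRP (𝚺 2) → PRP (𝚷 1)
    PRP-Π⊆Σ p φ π = p φ (Π⇒Σ π)
    SWVP-Π⊆Σ : SWVP (𝚺 2) → SWVP (𝚷 1)
    SWVP-Π⊆Σ p (φ , π , q) = p (φ , Π⇒Σ π , q)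
    WVP-Π⊆Σ : WVP (𝚺 2) → WVP (𝚷 1)
    WVP-Π⊆Σ p (φ , π , q) = p (φ , Π⇒Σ π , q)
    SWVP⇒WVP : ∀ {C} → SWVP C → WVP C
    SWVP⇒WVP p (φ , σ , s , u , n) = p (φ , σ , s , (λ α β A B k l m → let (h , H , _) = u α β A B k l m in h , H) , n)

    equivalence : TFAE (ExistsStrong ∷ PRP (𝚺 2) ∷ PRP (𝚷 1) ∷ SWVP (𝚺 2) ∷ SWVP (𝚷 1) ∷ WVP (𝚺 2) ∷ WVP (𝚷 1) ∷ [])
    equivalence i k p = from-strong k (to-strong i p)
      where
      Ps = ExistsStrong ∷ PRP (𝚺 2) ∷ PRP (𝚷 1) ∷ SWVP (𝚺 2) ∷ SWVP (𝚷 1) ∷ WVP (𝚺 2) ∷ WVP (𝚷 1) ∷ []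
      to-strong : ∀ i → lookup Ps i → ExistsStrong
      to-strong zero p = p
      to-strong (suc zero) p = PRP⇒strong (PRP-Π⊆Σ p)
      to-strong (suc (suc zero)) p = PRP⇒strong p
      to-strong (suc (suc (suc zero))) p = WVP⇒strong (SWVP⇒WVP {𝚷 1} (SWVP-Π⊆Σ p))
      to-strong (suc (suc (suc (suc zero)))) p = WVP⇒strong (SWVP⇒WVP {𝚷 1} p)
      to-strong (suc (suc (suc (suc (suc zero))))) p = WVP⇒strong (WVP-Π⊆Σ p)
      to-strong (suc (suc (suc (suc (suc (suc zero)))))) p = WVP⇒strong p
      from-strong : ∀ k → ExistsStrong → lookup Ps k
      from-strong zero s = s
      from-strong (suc zero) s = strong⇒PRP s
      from-strong (suc (suc zero)) s = PRP-Π⊆Σ (strong⇒PRP s)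
      from-strong (suc (suc (suc zero))) s = strong⇒SWVP s
      from-strong (suc (suc (suc (suc zero)))) s = SWVP-Π⊆Σ (strong⇒SWVP s)
      from-strong (suc (suc (suc (suc (suc zero))))) s = SWVP⇒WVP {𝚺 2} (strong⇒SWVP s)
      from-strong (suc (suc (suc (suc (suc (suc zero)))))) s = SWVP⇒WVP {𝚷 1} (SWVP-Π⊆Σ (strong⇒SWVP s))
  open Conclusion public

theorem5p1 : ∀ {ℓ} (V : Set ℓ) (_∈_ : V → V → Set ℓ) →
  let open SetTheory V _∈_ in
  IsZFC →
  TFAE (ExistsStrong
      ∷ PRP (𝚺 2)
      ∷ PRP (𝚷 1)
      ∷ SWVP (𝚺 2)
      ∷ SWVP (𝚷 1)
      ∷ WVP (𝚺 2)
      ∷ WVP (𝚷 1)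
      ∷ [])
theorem5p1 V _∈_ zfc = ZFC.equivalence V _∈_ zfc
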